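{- For $m\ge1$ let $F_m(t)=\sum_{r\ge0}b(m^r)t^r$ and $F^*_m(t)=\sum_{r\ge0}b^*(m^r)t^r$, where $b(m^r)$ (resp. $b^*(m^r)$) is the number of alternating (resp. reverse alternating) permutations in $\mathfrak S_{mr}$ of cycle type $\langle m^r\rangle$ (all cycles of length $m$). Then, umbrally: (a) If $m=2^kh$ with $k\ge1$, $h\ge3$, $h$ odd, then $F_m(t)=F^*_m(t)=\left(\frac{1+t}{1-t}\right)^{\frac1{2m}\sum_{d\mid h}\mu(d)E^{m/d}}$. (b) If $m=2^k$ with $k\ge2$, then $F_m(t)=F^*_m(t)=\left(\frac{1+t}{1-t}\right)^{\frac1{2m}(E^m-1)}$. (c) $F_2(t)=\left(\frac{1+t}{1-t}\right)^{(E^2+1)/4}$ and $F_2^*(t)=\frac{F_2(t)}{1+t}$.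
   Context: A permutation $a_1\cdots a_n$ is alternating if $a_1>a_2<a_3>\cdots$ and reverse alternating if $a_1<a_2>a_3<\cdots$. $\mu$ is the Möbius function. Euler numbers $E_n$: $\sum_{n\ge0}E_nx^n/n!=\sec x+\tan x$. An expression $\left(\frac{1+t}{1-t}\right)^{g(E)}$ means $\exp\!\left(g(E)\log\frac{1+t}{1-t}\right)$, expanded as a formal power series in $t$ with coefficients polynomials in an indeterminate $E$; umbral evaluation then expands each coefficient in powers of $E$ and, as the last step, replaces each $E^k$ by $E_k$. -}

module Defs where

open import Data.Bool using (Bool; true; false; _∧_; _∨_; not; if_then_else_)
open import Data.Nat as ℕ using (ℕ; zero; suc; _∸_; _≡ᵇ_; _<ᵇ_; _!; _^_)
open import Data.Nat.Properties using (_!≢0)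
open import Data.Nat.Divisibility using (_∣?_)
open import Data.Nat.Primality using (prime?)
open import Data.Integer as ℤ using (ℤ; +_)
open import Data.Rational as ℚ using (ℚ; 0ℚ; 1ℚ)
open import Data.List using (List; []; _∷_; [_]; map; foldr; concatMap; upTo; zipWith; replicate; _++_)
open import Data.Vec as Vec using (Vec; lookup)
open import Data.Fin as Fin using (Fin; toℕ)
open import Relation.Nullary.Decidable using (⌊_⌋)

count : {A : Set} → (A → Bool) → List A → ℕ
count p = foldr (λ x n → if p x then suc n else n) 0

all : {A : Set} → (A → Bool) → List A → Bool
all p = foldr (λ x acc → p x ∧ acc) true

sumℚ : List ℚ → ℚ
sumℚ = foldr ℚ._+_ 0ℚ

ℕ→ℚ : ℕ → ℚ
ℕ→ℚ n = + n ℚ./ 1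

ℤ→ℚ : ℤ → ℚ
ℤ→ℚ z = z ℚ./ 1

-- 1/n (with the harmless convention 1/0 = 0; only used for n ≥ 1)
recip : ℕ → ℚ
recip zero    = 0ℚ
recip (suc n) = + 1 ℚ./ suc n

sgn : ℕ → ℚ
sgn zero    = 1ℚ
sgn (suc n) = ℚ.- sgn n

-- Permutations of {0,…,N-1} in one-line notation: a word v = a₁⋯a_N
-- (σ(i) = lookup v i) that is injective.

allFinL : (N : ℕ) → List (Fin N)
allFinL N = Data.List.allFin N
  where import Data.List

allWords : (N k : ℕ) → List (Vec (Fin N) k)
allWords N zero    = Vec.[] ∷ []
allWords N (suc k) = concatMap (λ x → map (x Vec.∷_) (allWords N k)) (allFinL N)

_==_ : {N : ℕ} → Fin N → Fin N → Bool
i == j = toℕ i ≡ᵇ toℕ j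

isPermutation : {N : ℕ} → Vec (Fin N) N → Bool
isPermutation {N} v =
  all (λ i → all (λ j → (i == j) ∨ not (lookup v i == lookup v j)) (allFinL N)) (allFinL N)

iter : {N : ℕ} → Vec (Fin N) N → ℕ → Fin N → Fin N
iter v zero    i = i
iter v (suc k) i = lookup v (iter v k i)

allCyclesOfLength : (m : ℕ) → {N : ℕ} → Vec (Fin N) N → Bool
allCyclesOfLength m {N} v =
  all (λ i → (iter v m i == i) ∧ all (λ j → (j ≡ᵇ 0) ∨ not (iter v j i == i)) (upTo m))
      (allFinL N)

zigzag : Bool → List ℕ → Bool
zigzag d (x ∷ y ∷ rest) = (if d then y <ᵇ x else x <ᵇ y) ∧ zigzag (not d) (y ∷ rest)
zigzag d _              = true

isAlternating : {N : ℕ} → Vec (Fin N) N → Bool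
isAlternating v = zigzag true (map toℕ (Vec.toList v))

isReverseAlternating : {N : ℕ} → Vec (Fin N) N → Bool
isReverseAlternating v = zigzag false (map toℕ (Vec.toList v))

b : ℕ → ℕ → ℕ
b m r = count (λ v → isPermutation v ∧ isAlternating v ∧ allCyclesOfLength m v)
              (allWords (m ℕ.* r) (m ℕ.* r))

b* : ℕ → ℕ → ℕ
b* m r = count (λ v → isPermutation v ∧ isReverseAlternating v ∧ allCyclesOfLength m v)
               (allWords (m ℕ.* r) (m ℕ.* r))

Series : Set
Series = ℕ → ℚ

oneS : Series
oneS zero    = 1ℚ
oneS (suc _) = 0ℚ

_⋆_ : Series → Series → Series
(a ⋆ c) n = sumℚ (map (λ k → a k ℚ.* c (n ∸ k)) (upTo (suc n)))

powS : Series → ℕ → Series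
powS a zero    = oneS
powS a (suc j) = a ⋆ powS a j

-- multiplicative inverse of a series with constant term 1:
-- b₀ = 1, b_{n} = - Σ_{k=1}^{n} a_k b_{n-k}.
-- invRev a n = [b_n, …, b_0]
invRev : Series → ℕ → List ℚ
invRev a zero    = 1ℚ ∷ []
invRev a (suc n) =
  ℚ.- sumℚ (zipWith ℚ._*_ (map (λ i → a (suc i)) (upTo (suc n))) (invRev a n)) ∷ invRev a n

headℚ : List ℚ → ℚ
headℚ []      = 0ℚ
headℚ (x ∷ _) = x

invSeries1 : Series → Series
invSeries1 a n = headℚ (invRev a n)

onePlusT : Series
onePlusT zero          = 1ℚ
onePlusT (suc zero)    = 1ℚ
onePlusT (suc (suc _)) = 0ℚ

log1p : Series
log1p zero    = 0ℚ
log1p (suc n) = sgn n ℚ.* recip (suc n)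

-- log((1+t)/(1-t)) = log(1+t) - log(1-t)
logRatio : Series
logRatio n = log1p n ℚ.- (sgn n ℚ.* log1p n)

cosS : Series
cosS n = cosAux n
  where
  cosAux : ℕ → ℚ
  cosAux zero          = 1ℚ
  cosAux (suc zero)    = 0ℚ
  cosAux (suc (suc k)) = ℚ.- (cosAux k ℚ.* recip (suc k ℕ.* suc (suc k)))

sinS : Series
sinS n = sinAux n
  where
  sinAux : ℕ → ℚ
  sinAux zero          = 0ℚ
  sinAux (suc zero)    = 1ℚ
  sinAux (suc (suc k)) = ℚ.- (sinAux k ℚ.* recip (suc k ℕ.* suc (suc k)))

secS : Series
secS = invSeries1 cosS

tanS : Series
tanS = sinS ⋆ secS

EulerNum : ℕ → ℚ
EulerNum n = ℕ→ℚ (n !) ℚ.* (secS n ℚ.+ tanS n)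

-- Polynomials in the indeterminate E with ℚ coefficients
-- (list of coefficients, index k = coefficient of E^k)

Poly : Set
Poly = List ℚ

_+ₚ_ : Poly → Poly → Poly
[]      +ₚ q       = q
(a ∷ p) +ₚ []      = a ∷ p
(a ∷ p) +ₚ (c ∷ q) = (a ℚ.+ c) ∷ (p +ₚ q)

scaleₚ : ℚ → Poly → Poly
scaleₚ c = map (c ℚ.*_)

_*ₚ_ : Poly → Poly → Poly
[]      *ₚ q = []
(a ∷ p) *ₚ q = scaleₚ a q +ₚ (0ℚ ∷ (p *ₚ q))

constₚ : ℚ → Poly
constₚ c = [ c ]

Epow : ℕ → Poly
Epow k = replicate k 0ℚ ++ [ 1ℚ ]

_^ₚ_ : Poly → ℕ → Poly
p ^ₚ zero  = constₚ 1ℚ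
p ^ₚ suc j = p *ₚ (p ^ₚ j)

sumₚ : List Poly → Poly
sumₚ = foldr _+ₚ_ []

umbral : Poly → ℚ
umbral = go 0
  where
  go : ℕ → Poly → ℚ
  go k []       = 0ℚ
  go k (c ∷ cs) = (c ℚ.* EulerNum k) ℚ.+ go (suc k) cs

-- coefficient of t^r in ((1+t)/(1-t))^{g(E)} = exp(g(E) · log((1+t)/(1-t)))
-- = Σ_{j≥0} (g(E) · log((1+t)/(1-t)))^j / j!   (only j ≤ r contribute,
-- as log((1+t)/(1-t)) has zero constant term), a polynomial in E
powerCoeff : Poly → ℕ → Poly
powerCoeff g r =
  sumₚ (map (λ j → scaleₚ ((+ 1 ℚ./ (j !)) {{j !≢0}} ℚ.* powS logRatio j r) (g ^ₚ j))
            (upTo (suc r)))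

umbralPower : Poly → Series
umbralPower g r = umbral (powerCoeff g r)

ω : ℕ → ℕ
ω n = count (λ p → ⌊ prime? p ⌋ ∧ ⌊ p ∣? n ⌋) (upTo (suc n))

squarefree : ℕ → Bool
squarefree n = all (λ p → not (⌊ prime? p ⌋ ∧ ⌊ (p ℕ.* p) ∣? n ⌋)) (upTo (suc n))

μ : ℕ → ℤ
μ n = if squarefree n then (if ωEven (ω n) then + 1 else ℤ.- (+ 1)) else + 0
  where
  ωEven : ℕ → Bool
  ωEven zero          = true
  ωEven (suc zero)    = false
  ωEven (suc (suc k)) = ωEven k

gA : ℕ → ℕ → Poly
gA m h = scaleₚ (recip (2 ℕ.* m))
  (sumₚ (map (λ e → if ⌊ suc e ∣? h ⌋
                      then scaleₚ (ℤ→ℚ (μ (suc e))) (Epow (m ℕ./ suc e))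
                      else [])
             (upTo h)))

gB : ℕ → Poly
gB m = scaleₚ (recip (2 ℕ.* m)) (Epow m +ₚ constₚ (ℚ.- 1ℚ))

gC : Poly
gC = scaleₚ (recip 4) (Epow 2 +ₚ constₚ 1ℚ)

{-# OPTIONS --safe #-}

-- A permutation σ with all cycles of length m, together with a weakly
-- increasing filling f of its positions by letters such that σ is ascending on
-- every letter, amounts to a multiset of r primitive necklaces of length m
-- (Gessel–Reutenauer).  Give each letter a weight ±1.  The weighted number of
-- such multisets depends only on the sum X of the weights and the number of
-- letters; its generating function is a power of (1+t)/(1−t) times (1−t)^(−c),
-- where c is the number of necklaces.  Averaging over the signs of l letters
-- keeps the fillings in which each of these letters occurs an even number of
-- times; as functionals of the one-line word of σ they are the l-th convolution
-- power of Cos, the indicator of ascending words of even length.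
-- All quantities are polynomials in l, so they may be compared at l = −1: there
-- the convolution power becomes Cos⁻¹, which is, up to sign, the indicator of
-- reverse alternating words, and the moments of X become those of sech, that
-- is, the Euler numbers up to sign; c becomes 0, except that c = 1 for m = 2 in
-- the reverse alternating case.  Two extra letters of fixed weights 1 and
-- −1, placed first and last, turn reverse alternating into alternating.
module Submission where

-- Signs make the necklace count computable because the power sum of degree `d` of the weights is X
-- for odd `d` and the number of letters for even `d`. No alphabet has -1 letters, so each side must
-- be known as a polynomial in l before l = -1 makes sense. Both sides obey a recursion in l by an
-- operator with unit leading term (convolution with `Cos`, product with cosh), so one difference in
-- l lowers the length of the word or the degree of the moment. The recursion has to hold from l =
-- -1 on, hence families are indexed by l + 1. The number of letters becomes -1, or 1 with the two
-- fixed letters, and Möbius sums at these two values collapse. The leftover signs stem from cosh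
-- taking the place of cos; for even m they are the r-th power of one sign, which is absorbed
-- because log((1+t)/(1-t)) is odd in t. At l = -1 there is no number X any more, only its moments.
-- This is exactly the umbral convention: powers of the exponent are formed first, acting on moment
-- sequences by shifts, and are evaluated last.

-- Finite sums and products, and their invariance under bijections of lists.

module FiniteSums where

  open import Defs
  open import Data.Bool using (Bool; true; false; _∧_)
  open import Data.Empty using (⊥-elim)
  open import Data.Nat as ℕ using (ℕ; zero; suc; _∸_; z≤n; s≤s)
  open import Data.Nat.Coprimality using (sym; 1-coprimeTo)
  import Data.Integer as ℤ
  import Data.Integer.Properties as ℤₚ
  open import Data.Rational as ℚ using (ℚ; 0ℚ; 1ℚ; mkℚ; _+_; _*_; -_)
  open import Data.Rational.Properties
  open import Data.List using (List; []; _∷_; map; foldr; concatMap; upTo; applyUpTo; _++_; filterᵇ; length)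
  open import Data.List.Properties using (map-∘; map-cong)
  open import Data.List.Membership.Propositional using (_∈_)
  open import Data.List.Membership.Propositional.Properties using (∈-∃++)
  open import Data.List.Relation.Unary.Any using (here; there)
  open import Data.List.Relation.Unary.All as All using (All)
  open import Data.List.Relation.Unary.AllPairs using (_∷_)
  open import Data.List.Relation.Unary.Unique.Propositional using (Unique)
  open import Data.List.Relation.Binary.Permutation.Propositional as Perm using (_↭_; ↭-refl; ↭-sym; ↭-trans; prep)
  import Data.List.Relation.Binary.Permutation.Propositional.Properties as Permₚ
  open import Data.Product using (∃; _×_; _,_)
  open import Function using (_∘_; id)
  open import Relation.Nullary.Decidable using (dec⇒maybe)
  open import Relation.Binary.PropositionalEquality as ≡ using (_≡_; _≢_; refl; cong; cong₂; trans; module ≡-Reasoning)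
  open import Tactic.RingSolver.Core.AlmostCommutativeRing using (AlmostCommutativeRing; fromCommutativeRing)
  open import Tactic.RingSolver using (solve-∀)
  open ≡-Reasoning

  ℚ-ring : AlmostCommutativeRing _ _
  ℚ-ring = fromCommutativeRing +-*-commutativeRing (λ x → dec⇒maybe (0ℚ ≟ x))

  private variable
    A B : Set

  ∑ : List A → (A → ℚ) → ℚ
  ∑ xs f = sumℚ (map f xs)

  ∏ : List A → (A → ℚ) → ℚ
  ∏ xs f = foldr _*_ 1ℚ (map f xs)

  ∑< : ℕ → (ℕ → ℚ) → ℚ
  ∑< n = ∑ (upTo n)

  ∏< : ℕ → (ℕ → ℚ) → ℚ
  ∏< n = ∏ (upTo n)

  ⟦_⟧ : Bool → ℚ
  ⟦ true ⟧ = 1ℚ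
  ⟦ false ⟧ = 0ℚ

  ∑-cong∈ : (xs : List A) {f g : A → ℚ} → (∀ {x} → x ∈ xs → f x ≡ g x) → ∑ xs f ≡ ∑ xs g
  ∑-cong∈ [] e = refl
  ∑-cong∈ (x ∷ xs) e = cong₂ _+_ (e (here refl)) (∑-cong∈ xs (e ∘ there))

  ∑-cong : (xs : List A) {f g : A → ℚ} → (∀ x → f x ≡ g x) → ∑ xs f ≡ ∑ xs g
  ∑-cong xs e = ∑-cong∈ xs (λ {x} _ → e x)

  ∏-cong : (xs : List A) {f g : A → ℚ} → (∀ x → f x ≡ g x) → ∏ xs f ≡ ∏ xs g
  ∏-cong xs e = cong (foldr _*_ 1ℚ) (map-cong e xs)

  ∑-++ : (xs ys : List A) (f : A → ℚ) → ∑ (xs ++ ys) f ≡ ∑ xs f + ∑ ys f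
  ∑-++ [] ys f = ≡.sym (+-identityˡ _)
  ∑-++ (x ∷ xs) ys f = trans (cong (f x +_) (∑-++ xs ys f)) (≡.sym (+-assoc (f x) _ _))

  ∑-map : (xs : List A) (h : A → B) (f : B → ℚ) → ∑ (map h xs) f ≡ ∑ xs (f ∘ h)
  ∑-map xs h f = cong sumℚ (≡.sym (map-∘ xs))

  ∏-map : (xs : List A) (h : A → B) (f : B → ℚ) → ∏ (map h xs) f ≡ ∏ xs (f ∘ h)
  ∏-map xs h f = cong (foldr _*_ 1ℚ) (≡.sym (map-∘ xs))

  ∑-concatMap : (xs : List A) (h : A → List B) (f : B → ℚ) →
    ∑ (concatMap h xs) f ≡ ∑ xs (λ x → ∑ (h x) f)
  ∑-concatMap [] h f = refl
  ∑-concatMap (x ∷ xs) h f = trans (∑-++ (h x) (concatMap h xs) f) (cong (∑ (h x) f +_) (∑-concatMap xs h f))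

  +-exchange : ∀ a b c d → (a + b) + (c + d) ≡ (a + c) + (b + d)
  +-exchange = solve-∀ ℚ-ring

  ∑-+ : (xs : List A) (f g : A → ℚ) → ∑ xs (λ x → f x + g x) ≡ ∑ xs f + ∑ xs g
  ∑-+ [] f g = refl
  ∑-+ (x ∷ xs) f g = trans (cong ((f x + g x) +_) (∑-+ xs f g)) (+-exchange (f x) (g x) _ _)

  ∑-*ˡ : (xs : List A) (c : ℚ) (f : A → ℚ) → ∑ xs (λ x → c * f x) ≡ c * ∑ xs f
  ∑-*ˡ [] c f = ≡.sym (*-zeroʳ c)
  ∑-*ˡ (x ∷ xs) c f = trans (cong (c * f x +_) (∑-*ˡ xs c f)) (≡.sym (*-distribˡ-+ c (f x) _))

  ∑-*ʳ : (xs : List A) (c : ℚ) (f : A → ℚ) → ∑ xs (λ x → f x * c) ≡ ∑ xs f * c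
  ∑-*ʳ xs c f = trans (∑-cong xs (λ x → *-comm (f x) c)) (trans (∑-*ˡ xs c f) (*-comm c _))

  ∑-neg : (xs : List A) (f : A → ℚ) → ∑ xs (λ x → - f x) ≡ - ∑ xs f
  ∑-neg [] f = refl
  ∑-neg (x ∷ xs) f = trans (cong (- f x +_) (∑-neg xs f)) (≡.sym (neg-distrib-+ (f x) _))

  ∑-zero : (xs : List A) {f : A → ℚ} → (∀ {x} → x ∈ xs → f x ≡ 0ℚ) → ∑ xs f ≡ 0ℚ
  ∑-zero [] e = refl
  ∑-zero (x ∷ xs) e = trans (cong₂ _+_ (e (here refl)) (∑-zero xs (e ∘ there))) (+-identityˡ 0ℚ)

  ∑-swap : (xs : List A) (ys : List B) (f : A → B → ℚ) →
    ∑ xs (λ x → ∑ ys (f x)) ≡ ∑ ys (λ y → ∑ xs (λ x → f x y))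
  ∑-swap [] ys f = ≡.sym (∑-zero ys (λ _ → refl))
  ∑-swap (x ∷ xs) ys f = trans (cong (∑ ys (f x) +_) (∑-swap xs ys f)) (≡.sym (∑-+ ys (f x) _))

  ∑-filterᵇ : (p : A → Bool) (xs : List A) (f : A → ℚ) → ∑ (filterᵇ p xs) f ≡ ∑ xs (λ x → ⟦ p x ⟧ * f x)
  ∑-filterᵇ p [] f = refl
  ∑-filterᵇ p (x ∷ xs) f with p x
  ... | true = cong₂ _+_ (≡.sym (*-identityˡ (f x))) (∑-filterᵇ p xs f)
  ... | false = trans (∑-filterᵇ p xs f)
    (trans (≡.sym (+-identityˡ _)) (cong (_+ _) (≡.sym (*-zeroˡ (f x)))))

  ⟦∧⟧ : ∀ x y → ⟦ x ∧ y ⟧ ≡ ⟦ x ⟧ * ⟦ y ⟧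
  ⟦∧⟧ true y = ≡.sym (*-identityˡ _)
  ⟦∧⟧ false y = ≡.sym (*-zeroˡ ⟦ y ⟧)

  guard : ∀ p {x y} → (p ≡ true → x ≡ y) → ⟦ p ⟧ * x ≡ ⟦ p ⟧ * y
  guard true e = cong (1ℚ *_) (e refl)
  guard false {x} {y} e = trans (*-zeroˡ x) (≡.sym (*-zeroˡ y))

  map-upTo-suc : (n : ℕ) (f : ℕ → ℚ) (g : ℕ → ℕ) → map f (applyUpTo (suc ∘ g) n) ≡ map (f ∘ suc) (applyUpTo g n)
  map-upTo-suc zero f g = refl
  map-upTo-suc (suc n) f g = cong (f (suc (g 0)) ∷_) (map-upTo-suc n f (g ∘ suc))

  ∑<-suc : ∀ n f → ∑< (suc n) f ≡ f 0 + ∑< n (f ∘ suc)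
  ∑<-suc n f = cong (λ z → f 0 + sumℚ z) (map-upTo-suc n f id)

  ∏<-suc : ∀ n f → ∏< (suc n) f ≡ f 0 * ∏< n (f ∘ suc)
  ∏<-suc n f = cong (λ z → f 0 * foldr _*_ 1ℚ z) (map-upTo-suc n f id)

  ∑<-cong : ∀ n {f g} → (∀ k → k ℕ.< n → f k ≡ g k) → ∑< n f ≡ ∑< n g
  ∑<-cong zero e = refl
  ∑<-cong (suc n) {f} {g} e = trans (∑<-suc n f) (trans
    (cong₂ _+_ (e 0 (s≤s z≤n)) (∑<-cong n (λ k k< → e (suc k) (s≤s k<)))) (≡.sym (∑<-suc n g)))

  ∑<-last : ∀ n f → ∑< (suc n) f ≡ ∑< n f + f n
  ∑<-last zero f = trans (+-identityʳ (f 0)) (≡.sym (+-identityˡ (f 0)))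
  ∑<-last (suc n) f = begin
    ∑< (suc (suc n)) f                  ≡⟨ ∑<-suc (suc n) f ⟩
    f 0 + ∑< (suc n) (f ∘ suc)          ≡⟨ cong (f 0 +_) (∑<-last n (f ∘ suc)) ⟩
    f 0 + (∑< n (f ∘ suc) + f (suc n))  ≡⟨ +-assoc (f 0) _ _ ⟨
    f 0 + ∑< n (f ∘ suc) + f (suc n)    ≡⟨ cong (_+ f (suc n)) (∑<-suc n f) ⟨
    ∑< (suc n) f + f (suc n)            ∎

  ∏<-last : ∀ n f → ∏< (suc n) f ≡ ∏< n f * f n
  ∏<-last zero f = trans (*-identityʳ (f 0)) (≡.sym (*-identityˡ (f 0)))
  ∏<-last (suc n) f = begin
    ∏< (suc (suc n)) f                  ≡⟨ ∏<-suc (suc n) f ⟩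
    f 0 * ∏< (suc n) (f ∘ suc)          ≡⟨ cong (f 0 *_) (∏<-last n (f ∘ suc)) ⟩
    f 0 * (∏< n (f ∘ suc) * f (suc n))  ≡⟨ *-assoc (f 0) _ _ ⟨
    f 0 * ∏< n (f ∘ suc) * f (suc n)    ≡⟨ cong (_* f (suc n)) (∏<-suc n f) ⟨
    ∏< (suc n) f * f (suc n)            ∎

  ∑<-zero : ∀ n {f} → (∀ k → k ℕ.< n → f k ≡ 0ℚ) → ∑< n f ≡ 0ℚ
  ∑<-zero n e = trans (∑<-cong n e) (∑-zero (upTo n) (λ _ → refl))

  ∑<-reverse : ∀ n f → ∑< (suc n) f ≡ ∑< (suc n) (λ k → f (n ∸ k))
  ∑<-reverse zero f = refl
  ∑<-reverse (suc n) f = begin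
    ∑< (suc (suc n)) f                              ≡⟨ ∑<-last (suc n) f ⟩
    ∑< (suc n) f + f (suc n)                        ≡⟨ cong (_+ f (suc n)) (∑<-reverse n f) ⟩
    ∑< (suc n) (λ k → f (n ∸ k)) + f (suc n)        ≡⟨ +-comm _ (f (suc n)) ⟩
    f (suc n) + ∑< (suc n) (λ k → f (n ∸ k))        ≡⟨ ∑<-suc (suc n) (λ k → f (suc n ∸ k)) ⟨
    ∑< (suc (suc n)) (λ k → f (suc n ∸ k))          ∎

  -- `_/ 1` passes through gcd normalisation and is stuck on a variable numerator; in the explicit
  -- `mkℚ` form rational sums and products compute.
  ℕ→ℚ-mk : ∀ n → ℕ→ℚ n ≡ mkℚ (ℤ.+ n) 0 (sym (1-coprimeTo n))
  ℕ→ℚ-mk n = ↥p/↧p≡p (mkℚ (ℤ.+ n) 0 (sym (1-coprimeTo n)))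

  ℕ→ℚ-+ : ∀ a c → ℕ→ℚ (a ℕ.+ c) ≡ ℕ→ℚ a + ℕ→ℚ c
  ℕ→ℚ-+ a c rewrite ℕ→ℚ-mk a | ℕ→ℚ-mk c =
    cong (ℚ._/ 1) (≡.sym (cong₂ ℤ._+_ (ℤₚ.*-identityʳ (ℤ.+ a)) (ℤₚ.*-identityʳ (ℤ.+ c))))

  ℕ→ℚ-* : ∀ a c → ℕ→ℚ (a ℕ.* c) ≡ ℕ→ℚ a * ℕ→ℚ c
  ℕ→ℚ-* a c rewrite ℕ→ℚ-mk a | ℕ→ℚ-mk c = cong (ℚ._/ 1) (ℤₚ.pos-* a c)

  ℕ→ℚ-suc : ∀ n → ℕ→ℚ (suc n) ≡ 1ℚ + ℕ→ℚ n
  ℕ→ℚ-suc n = ℕ→ℚ-+ 1 n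

  recip-inverse : ∀ n → ℕ→ℚ (suc n) * recip (suc n) ≡ 1ℚ
  recip-inverse n = begin
    ℕ→ℚ (suc n) * recip (suc n) ≡⟨ cong₂ _*_ (ℕ→ℚ-mk (suc n)) (↥p/↧p≡p (mkℚ (ℤ.+ 1) n (1-coprimeTo (suc n)))) ⟩
    q * ℚ.1/ q                  ≡⟨ *-inverseʳ q ⟩
    1ℚ                          ∎
    where q = mkℚ (ℤ.+ suc n) 0 (sym (1-coprimeTo (suc n)))

  count-∑ : (p : A → Bool) (xs : List A) → ℕ→ℚ (count p xs) ≡ ∑ xs (λ x → ⟦ p x ⟧)
  count-∑ p [] = refl
  count-∑ p (x ∷ xs) with p x
  ... | true = trans (ℕ→ℚ-suc (count p xs)) (cong (1ℚ +_) (count-∑ p xs))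
  ... | false = trans (count-∑ p xs) (≡.sym (+-identityˡ _))

  ∑-one : (xs : List A) → ∑ xs (λ _ → 1ℚ) ≡ ℕ→ℚ (length xs)
  ∑-one [] = refl
  ∑-one (x ∷ xs) = trans (cong (1ℚ +_) (∑-one xs)) (≡.sym (ℕ→ℚ-suc (length xs)))

  -- A bijection given as a relation: existence is asked in each direction and uniqueness only for
  -- members, so no inverse map has to be defined outside the lists.
  record Matching (xs : List A) (ys : List B) : Set₁ where
    field
      R       : A → B → Set
      total   : ∀ {x} → x ∈ xs → ∃ λ y → y ∈ ys × R x y
      onto    : ∀ {y} → y ∈ ys → ∃ λ x → x ∈ xs × R x y
      det     : ∀ {x y y′} → x ∈ xs → y ∈ ys → y′ ∈ ys → R x y → R x y′ → y ≡ y′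
      inj     : ∀ {x x′ y} → x ∈ xs → x′ ∈ xs → y ∈ ys → R x y → R x′ y → x ≡ x′

  ∈-↭-tail : {x y : A} {xs ys : List A} → ys ↭ y ∷ xs → x ∈ ys → x ≢ y → x ∈ xs
  ∈-↭-tail p x∈ x≢y with Permₚ.∈-resp-↭ p x∈
  ... | here x≡y = ⊥-elim (x≢y x≡y)
  ... | there x∈′ = x∈′

  Unique-resp-↭ : {xs ys : List A} → xs ↭ ys → Unique xs → Unique ys
  Unique-resp-↭ Perm.refl u = u
  Unique-resp-↭ (Perm.prep x p) (x∉ ∷ u) = Permₚ.All-resp-↭ p x∉ ∷ Unique-resp-↭ p u
  Unique-resp-↭ (Perm.swap x y p) ((x≢y All.∷ x∉) ∷ (y∉ ∷ u)) =
    (x≢y ∘ ≡.sym All.∷ Permₚ.All-resp-↭ p y∉) ∷ (Permₚ.All-resp-↭ p x∉ ∷ Unique-resp-↭ p u)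
  Unique-resp-↭ (Perm.trans p q) u = Unique-resp-↭ q (Unique-resp-↭ p u)

  -- Pair the head of `xs` with its partner, delete the partner from `ys`, and restrict the relation
  -- to what remains.
  matching-↭ : (xs : List A) (ys : List B) → Unique xs → Unique ys → (M : Matching xs ys) →
    {C : Set} (f : A → C) (g : B → C) → (∀ {x y} → x ∈ xs → y ∈ ys → Matching.R M x y → f x ≡ g y) →
    map f xs ↭ map g ys
  matching-↭ [] [] _ _ M f g e = ↭-refl
  matching-↭ [] (y ∷ ys) _ _ M f g e with Matching.onto M (here refl)
  ... | _ , () , _
  matching-↭ {A = A} {B} (x ∷ xs) ys (x∉ ∷ u) uy M f g e with Matching.total M (here refl)
  ... | y , y∈ , Rxy with ∈-∃++ y∈
  ... | ps , qs , refl = ↭-trans (Perm.↭-reflexive (cong (_∷ map f xs) (e (here refl) y∈ Rxy)))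
          (↭-trans (prep (g y) (matching-↭ xs (ps ++ qs) u u′ M′ f g e′)) (↭-sym (Permₚ.map⁺ g perm)))
    where
    open Matching M
    perm : ps ++ y ∷ qs ↭ y ∷ (ps ++ qs)
    perm = Permₚ.shift y ps qs
    uy′ : Unique (y ∷ (ps ++ qs))
    uy′ = Unique-resp-↭ perm uy
    u′ : Unique (ps ++ qs)
    u′ with uy′
    ... | _ ∷ q = q
    y∉ : ∀ {z} → z ∈ ps ++ qs → y ≢ z
    y∉ z∈ with uy′
    ... | q ∷ _ = All.lookup q z∈
    widen : ∀ {z} → z ∈ ps ++ qs → z ∈ ps ++ y ∷ qs
    widen z∈ = Permₚ.∈-resp-↭ (↭-sym perm) (there z∈)
    e′ : ∀ {a c} → a ∈ xs → c ∈ ps ++ qs → R a c → f a ≡ g c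
    e′ a∈ c∈ = e (there a∈) (widen c∈)
    M′ : Matching xs (ps ++ qs)
    M′ .Matching.R = R
    M′ .Matching.total {a} a∈ with total (there a∈)
    ... | c , c∈ , Rac = c , ∈-↭-tail perm c∈ c≢y , Rac
      where
      c≢y : c ≢ y
      c≢y refl = All.lookup x∉ a∈ (inj (here refl) (there a∈) y∈ Rxy Rac)
    M′ .Matching.onto {c} c∈ with onto (widen c∈)
    ... | a , here refl , Rac = ⊥-elim (y∉ c∈ (det (here refl) y∈ (widen c∈) Rxy Rac))
    ... | a , there a∈ , Rac = a , a∈ , Rac
    M′ .Matching.det a∈ c∈ d∈ = det (there a∈) (widen c∈) (widen d∈)
    M′ .Matching.inj a∈ b∈ c∈ = inj (there a∈) (there b∈) (widen c∈)

  sumℚ-↭ : {xs ys : List ℚ} → xs ↭ ys → sumℚ xs ≡ sumℚ ys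
  sumℚ-↭ Perm.refl = refl
  sumℚ-↭ (Perm.prep x p) = cong (x +_) (sumℚ-↭ p)
  sumℚ-↭ (Perm.swap {xs} {ys} x y p) = trans (cong (λ z → x + (y + z)) (sumℚ-↭ p)) (left-comm x y (sumℚ ys))
    where
    left-comm : ∀ a b c → a + (b + c) ≡ b + (a + c)
    left-comm = solve-∀ ℚ-ring
  sumℚ-↭ (Perm.trans p q) = trans (sumℚ-↭ p) (sumℚ-↭ q)

  productℚ-↭ : {xs ys : List ℚ} → xs ↭ ys → foldr _*_ 1ℚ xs ≡ foldr _*_ 1ℚ ys
  productℚ-↭ Perm.refl = refl
  productℚ-↭ (Perm.prep x p) = cong (x *_) (productℚ-↭ p)
  productℚ-↭ (Perm.swap {xs} {ys} x y p) =
    trans (cong (λ z → x * (y * z)) (productℚ-↭ p)) (left-comm x y (foldr _*_ 1ℚ ys))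
    where
    left-comm : ∀ a b c → a * (b * c) ≡ b * (a * c)
    left-comm = solve-∀ ℚ-ring
  productℚ-↭ (Perm.trans p q) = trans (productℚ-↭ p) (productℚ-↭ q)

  ∑-matching : (xs : List A) (ys : List B) → Unique xs → Unique ys → (M : Matching xs ys) →
    (f : A → ℚ) (g : B → ℚ) → (∀ {x y} → x ∈ xs → y ∈ ys → Matching.R M x y → f x ≡ g y) →
    ∑ xs f ≡ ∑ ys g
  ∑-matching xs ys ux uy M f g e = sumℚ-↭ (matching-↭ xs ys ux uy M f g e)

-- Polynomial sequences and the convolution algebra of functionals on words.

module Words where

  open FiniteSums
  open import Defs
  open import Data.Bool using (Bool; true; false; _∧_; not; if_then_else_)
  open import Data.Nat as ℕ using (ℕ; zero; suc; z≤n; s≤s; _<ᵇ_)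
  import Data.Nat.Properties as ℕₚ
  open import Data.Rational as ℚ using (ℚ; 0ℚ; 1ℚ; ½; _+_; _*_; -_; _-_)
  open import Data.Rational.Properties
  open import Data.List using (List; []; _∷_; length; _++_; [_])
  open import Data.Product using (∃; _,_)
  open import Function using (_∘_)
  open import Relation.Binary.PropositionalEquality as ≡ using (_≡_; refl; sym; cong; cong₂; trans; module ≡-Reasoning)
  open import Tactic.RingSolver using (solve-∀)
  open ≡-Reasoning

  pow : ℚ → ℕ → ℚ
  pow x zero    = 1ℚ
  pow x (suc n) = x * pow x n

  pow-one : ∀ n → pow 1ℚ n ≡ 1ℚ
  pow-one zero = refl
  pow-one (suc n) = trans (*-identityˡ _) (pow-one n)

  pow-minus-one : ∀ n → pow (- 1ℚ) n ≡ sgn n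
  pow-minus-one zero = refl
  pow-minus-one (suc n) = trans (cong (- 1ℚ *_) (pow-minus-one n)) (lem (sgn n))
    where
    lem : ∀ a → - 1ℚ * a ≡ - a
    lem = solve-∀ ℚ-ring

  ⟦not⟧ : ∀ p → ⟦ not p ⟧ ≡ 1ℚ - ⟦ p ⟧
  ⟦not⟧ true = refl
  ⟦not⟧ false = refl

  -- Polynomial functions of an index

  Δ : (ℕ → ℚ) → ℕ → ℚ
  Δ U i = U (suc i) - U i

  -- Encoded by vanishing of the `D`-th difference: no coefficients have to be exhibited, and a
  -- recursion in the index yields polynomiality through `isPoly-Δ`.
  PolyDeg< : ℕ → (ℕ → ℚ) → Set
  PolyDeg< zero    U = ∀ i → U i ≡ 0ℚ
  PolyDeg< (suc D) U = PolyDeg< D (Δ U)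

  IsPoly : (ℕ → ℚ) → Set
  IsPoly U = ∃ λ D → PolyDeg< D U

  Δ-cong : ∀ {U V} → (∀ i → U i ≡ V i) → ∀ i → Δ U i ≡ Δ V i
  Δ-cong e i = cong₂ _-_ (e (suc i)) (e i)

  PolyDeg<-cong : ∀ D {U V} → (∀ i → U i ≡ V i) → PolyDeg< D U → PolyDeg< D V
  PolyDeg<-cong zero e p i = trans (sym (e i)) (p i)
  PolyDeg<-cong (suc D) e p = PolyDeg<-cong D (Δ-cong e) p

  PolyDeg<-zero : ∀ D {U} → (∀ i → U i ≡ 0ℚ) → PolyDeg< D U
  PolyDeg<-zero zero e = e
  PolyDeg<-zero (suc D) {U} e = PolyDeg<-zero D (λ i → cong₂ _-_ (e (suc i)) (e i))

  PolyDeg<-suc : ∀ D {U} → PolyDeg< D U → PolyDeg< (suc D) U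
  PolyDeg<-suc zero p = PolyDeg<-zero 1 p
  PolyDeg<-suc (suc D) p = PolyDeg<-suc D p

  PolyDeg<-shift : ∀ D {U} → PolyDeg< D U → PolyDeg< D (U ∘ suc)
  PolyDeg<-shift zero p i = p (suc i)
  PolyDeg<-shift (suc D) p = PolyDeg<-shift D p

  PolyDeg<-+ : ∀ D {U V} → PolyDeg< D U → PolyDeg< D V → PolyDeg< D (λ i → U i + V i)
  PolyDeg<-+ zero p q i = cong₂ _+_ (p i) (q i)
  PolyDeg<-+ (suc D) {U} {V} p q = PolyDeg<-cong D (λ i → lem (U (suc i)) (U i) (V (suc i)) (V i)) (PolyDeg<-+ D p q)
    where
    lem : ∀ a b c d → (a - b) + (c - d) ≡ (a + c) - (b + d)
    lem = solve-∀ ℚ-ring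

  -- Discrete Leibniz rule: Δ(UV) i = ΔU i · V (i+1) + U i · ΔV i.
  PolyDeg<-* : ∀ D E {U V} → PolyDeg< D U → PolyDeg< E V → PolyDeg< (D ℕ.+ E) (λ i → U i * V i)
  PolyDeg<-* zero E {U} {V} p q = PolyDeg<-zero E (λ i → trans (cong (_* V i) (p i)) (*-zeroˡ (V i)))
  PolyDeg<-* (suc D) zero {U} {V} p q =
    PolyDeg<-zero (suc D ℕ.+ 0) {λ i → U i * V i} (λ i → trans (cong (U i *_) (q i)) (*-zeroʳ (U i)))
  PolyDeg<-* (suc D) (suc E) {U} {V} p q =
    PolyDeg<-cong (D ℕ.+ suc E) (λ i → lem (U (suc i)) (U i) (V (suc i)) (V i))
      (PolyDeg<-+ (D ℕ.+ suc E)
        (PolyDeg<-* D (suc E) {Δ U} {V ∘ suc} p (PolyDeg<-shift E q))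
        (≡.subst (λ z → PolyDeg< z (λ i → U i * Δ V i)) (sym (ℕₚ.+-suc D E))
          (PolyDeg<-* (suc D) E {U} {Δ V} p q)))
    where
    lem : ∀ a b c d → (a - b) * c + b * (c - d) ≡ a * c - b * d
    lem = solve-∀ ℚ-ring

  PolyDeg<-lift : ∀ E {D U} → PolyDeg< D U → PolyDeg< (E ℕ.+ D) U
  PolyDeg<-lift zero p = p
  PolyDeg<-lift (suc E) {D} p = PolyDeg<-suc (E ℕ.+ D) (PolyDeg<-lift E p)

  isPoly-cong : ∀ {U V} → (∀ i → U i ≡ V i) → IsPoly U → IsPoly V
  isPoly-cong e (D , p) = D , PolyDeg<-cong D e p

  isPoly-Δ : ∀ {U} → IsPoly (Δ U) → IsPoly U
  isPoly-Δ (D , p) = suc D , p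

  isPoly-const : ∀ c → IsPoly (λ _ → c)
  isPoly-const c = 1 , λ i → +-inverseʳ c

  isPoly-+ : ∀ {U V} → IsPoly U → IsPoly V → IsPoly (λ i → U i + V i)
  isPoly-+ {U} {V} (D , p) (E , q) = D ℕ.+ E ,
    PolyDeg<-+ (D ℕ.+ E) (≡.subst (λ z → PolyDeg< z U) (ℕₚ.+-comm E D) (PolyDeg<-lift E p)) (PolyDeg<-lift D q)

  isPoly-* : ∀ {U V} → IsPoly U → IsPoly V → IsPoly (λ i → U i * V i)
  isPoly-* (D , p) (E , q) = D ℕ.+ E , PolyDeg<-* D E p q

  isPoly-∑ : {A : Set} (xs : List A) {U : A → ℕ → ℚ} → (∀ x → IsPoly (U x)) → IsPoly (λ i → ∑ xs (λ x → U x i))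
  isPoly-∑ [] p = isPoly-const 0ℚ
  isPoly-∑ (x ∷ xs) p = isPoly-+ (p x) (isPoly-∑ xs p)

  isPoly-pow : ∀ {U} n → IsPoly U → IsPoly (λ i → pow (U i) n)
  isPoly-pow zero p = isPoly-const 1ℚ
  isPoly-pow (suc n) p = isPoly-* p (isPoly-pow n p)

  a-b≡0⇒a≡b : ∀ a b → a - b ≡ 0ℚ → a ≡ b
  a-b≡0⇒a≡b a b e = trans (lem a b) (trans (cong (_+ b) e) (+-identityˡ b))
    where
    lem : ∀ x y → x ≡ (x - y) + y
    lem = solve-∀ ℚ-ring

  -- Extrapolation one step back: `Δ U` vanishes at positive indices too, so by induction also at 0,
  -- and then U 0 = U 1.
  vanish-at-0 : ∀ D {U} → PolyDeg< D U → (∀ i → U (suc i) ≡ 0ℚ) → U 0 ≡ 0ℚ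
  vanish-at-0 zero p e = p 0
  vanish-at-0 (suc D) {U} p e = trans (sym (a-b≡0⇒a≡b (U 1) (U 0) Δ0)) (e 0)
    where
    Δ0 : Δ U 0 ≡ 0ℚ
    Δ0 = vanish-at-0 D p (λ i → cong₂ _-_ (e (suc i)) (e i))

  agree-at-0 : ∀ {U V} → IsPoly U → IsPoly V → (∀ i → U (suc i) ≡ V (suc i)) → U 0 ≡ V 0
  agree-at-0 {U} {V} p q e with isPoly-+ p (isPoly-* (isPoly-const (- 1ℚ)) q)
  ... | D , s = a-b≡0⇒a≡b (U 0) (V 0)
    (trans (sym (lem (U 0) (V 0))) (vanish-at-0 D s (λ i →
      trans (cong (λ z → U (suc i) + - 1ℚ * z) (sym (e i))) (lem′ (U (suc i))))))
    where
    lem : ∀ a b → a + - 1ℚ * b ≡ a - b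
    lem = solve-∀ ℚ-ring
    lem′ : ∀ a → a + - 1ℚ * a ≡ 0ℚ
    lem′ = solve-∀ ℚ-ring

  -- Functionals on words

  Functional : Set
  Functional = List ℕ → ℚ

  -- Convolution dual to deconcatenation: Σ φ(u) ψ(v) over w = uv.
  conv : Functional → Functional → Functional
  conv φ ψ []      = φ [] * ψ []
  conv φ ψ (x ∷ w) = φ [] * ψ (x ∷ w) + conv (φ ∘ (x ∷_)) ψ w

  conv-cong : ∀ {φ φ′ ψ ψ′} → (∀ w → φ w ≡ φ′ w) → (∀ w → ψ w ≡ ψ′ w) → ∀ w → conv φ ψ w ≡ conv φ′ ψ′ w
  conv-cong p q [] = cong₂ _*_ (p []) (q [])
  conv-cong p q (x ∷ w) = cong₂ _+_ (cong₂ _*_ (p []) (q (x ∷ w))) (conv-cong (p ∘ (x ∷_)) q w)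

  conv-linearˡ : ∀ φ φ′ ψ a c w → conv (λ u → a * φ u + c * φ′ u) ψ w ≡ a * conv φ ψ w + c * conv φ′ ψ w
  conv-linearˡ φ φ′ ψ a c [] = lem a c (φ []) (φ′ []) (ψ [])
    where
    lem : ∀ a c x y z → (a * x + c * y) * z ≡ a * (x * z) + c * (y * z)
    lem = solve-∀ ℚ-ring
  conv-linearˡ φ φ′ ψ a c (x ∷ w) =
    trans (cong ((a * φ [] + c * φ′ []) * ψ (x ∷ w) +_) (conv-linearˡ (φ ∘ (x ∷_)) (φ′ ∘ (x ∷_)) ψ a c w)) (lem a c (φ []) (φ′ []) (ψ (x ∷ w)) _ _)
    where
    lem : ∀ a c x y z s t → (a * x + c * y) * z + (a * s + c * t) ≡ a * (x * z + s) + c * (y * z + t)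
    lem = solve-∀ ℚ-ring

  conv-linearʳ : ∀ φ ψ ψ′ a c w → conv φ (λ u → a * ψ u + c * ψ′ u) w ≡ a * conv φ ψ w + c * conv φ ψ′ w
  conv-linearʳ φ ψ ψ′ a c [] = lem a c (φ []) (ψ []) (ψ′ [])
    where
    lem : ∀ a c z x y → z * (a * x + c * y) ≡ a * (z * x) + c * (z * y)
    lem = solve-∀ ℚ-ring
  conv-linearʳ φ ψ ψ′ a c (x ∷ w) =
    trans (cong (φ [] * (a * ψ (x ∷ w) + c * ψ′ (x ∷ w)) +_) (conv-linearʳ (φ ∘ (x ∷_)) ψ ψ′ a c w)) (lem a c (φ []) (ψ (x ∷ w)) (ψ′ (x ∷ w)) _ _)
    where
    lem : ∀ a c z x y s t → z * (a * x + c * y) + (a * s + c * t) ≡ a * (z * x + s) + c * (z * y + t)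
    lem = solve-∀ ℚ-ring

  conv-scaleˡ : ∀ φ ψ a w → conv (λ u → a * φ u) ψ w ≡ a * conv φ ψ w
  conv-scaleˡ φ ψ a w = trans (conv-cong (λ u → lem a (φ u)) (λ _ → refl) w)
    (trans (conv-linearˡ φ φ ψ a 0ℚ w) (sym (lem a (conv φ ψ w))))
    where
    lem : ∀ a x → a * x ≡ a * x + 0ℚ * x
    lem = solve-∀ ℚ-ring

  -- Only values on words no longer than `w` enter; this is what the induction on length in
  -- `isPoly-conv-power` can supply.
  isPoly-conv : ∀ φ (V : ℕ → Functional) w → (∀ v → length v ℕ.≤ length w → IsPoly (λ i → V i v)) →
    IsPoly (λ i → conv φ (V i) w)
  isPoly-conv φ V [] p = isPoly-* (isPoly-const (φ [])) (p [] z≤n)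
  isPoly-conv φ V (x ∷ w) p = isPoly-+ (isPoly-* (isPoly-const (φ [])) (p (x ∷ w) ℕₚ.≤-refl))
    (isPoly-conv (φ ∘ (x ∷_)) V w (λ v v≤ → p v (ℕₚ.m≤n⇒m≤1+n v≤)))

  δ : Functional
  δ []      = 1ℚ
  δ (_ ∷ _) = 0ℚ

  conv-δ : ∀ φ w → conv φ δ w ≡ φ w
  conv-δ φ [] = *-identityʳ (φ [])
  conv-δ φ (x ∷ w) = trans (cong₂ _+_ (*-zeroʳ (φ [])) (conv-δ (φ ∘ (x ∷_)) w)) (+-identityˡ _)

  ascending : List ℕ → Bool
  ascending (x ∷ y ∷ w) = (x <ᵇ y) ∧ ascending (y ∷ w)
  ascending _           = true

  -- Descents are weak, so that conv-Cos-Zig needs no distinctness of the letters.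
  zigzag≥ : Bool → List ℕ → Bool
  zigzag≥ d (x ∷ y ∷ w) = (if d then not (x <ᵇ y) else (x <ᵇ y)) ∧ zigzag≥ (not d) (y ∷ w)
  zigzag≥ d _           = true

  evenℚ oddℚ : ℕ → ℚ
  evenℚ zero          = 1ℚ
  evenℚ (suc zero)    = 0ℚ
  evenℚ (suc (suc n)) = evenℚ n
  oddℚ zero          = 0ℚ
  oddℚ (suc zero)    = 1ℚ
  oddℚ (suc (suc n)) = oddℚ n

  even+odd : ∀ n → evenℚ n + oddℚ n ≡ 1ℚ
  even+odd zero = refl
  even+odd (suc zero) = refl
  even+odd (suc (suc n)) = even+odd n

  even-odd : ∀ n → evenℚ n - oddℚ n ≡ sgn n
  even-odd zero = refl
  even-odd (suc zero) = refl
  even-odd (suc (suc n)) = trans (even-odd n) (lem (sgn n))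
    where
    lem : ∀ a → a ≡ - (- a)
    lem = solve-∀ ℚ-ring

  -- What a single letter of weight `y` contributes when it fills the whole word.
  Hom : ℚ → Functional
  Hom y w = ⟦ ascending w ⟧ * pow y (length w)

  -- Even and odd part of the indicator of ascending words, so analogues of cosh and sinh;
  -- alternating signs enter only with `quarter`.
  Cos Sin : Functional
  Cos w = ⟦ ascending w ⟧ * evenℚ (length w)
  Sin w = ⟦ ascending w ⟧ * oddℚ (length w)

  -- a, c, -a, -c, a, …
  quarter : ℚ → ℚ → ℕ → ℚ
  quarter a c zero          = a
  quarter a c (suc zero)    = c
  quarter a c (suc (suc n)) = - quarter a c n

  Zig : ℚ → ℚ → Functional
  Zig a c w = quarter a c (length w) * ⟦ zigzag≥ false w ⟧

  -- An ascending prefix that ends in `x` so far is prolonged by an even number of letters. Moving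
  -- the cut by two letters flips the sign of `quarter`, so on words with x < z the cut at once
  -- cancels against the later ones. What survives descends at `x` or is ascending throughout.
  conv-Cos-tail : ∀ a c x w → conv (λ u → ⟦ ascending (x ∷ u) ⟧ * evenℚ (length u)) (Zig a c) w
    ≡ quarter a c (length w) * ⟦ zigzag≥ true (x ∷ w) ⟧ + c * (⟦ ascending (x ∷ w) ⟧ * oddℚ (length w))
  conv-Cos-tail a c x [] = lem a c
    where
    lem : ∀ a c → (1ℚ * 1ℚ) * (a * 1ℚ) ≡ a * 1ℚ + c * (1ℚ * 0ℚ)
    lem = solve-∀ ℚ-ring
  conv-Cos-tail a c x (z ∷ []) = begin
    (1ℚ * 1ℚ) * (c * 1ℚ) + (⟦ (x <ᵇ z) ∧ true ⟧ * 0ℚ) * (a * 1ℚ)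
      ≡⟨ cong (λ q → (1ℚ * 1ℚ) * (c * 1ℚ) + (q * 0ℚ) * (a * 1ℚ)) (⟦∧⟧ (x <ᵇ z) true) ⟩
    (1ℚ * 1ℚ) * (c * 1ℚ) + ((⟦ x <ᵇ z ⟧ * 1ℚ) * 0ℚ) * (a * 1ℚ)
      ≡⟨ lem a c ⟦ x <ᵇ z ⟧ ⟩
    c * ((1ℚ - ⟦ x <ᵇ z ⟧) * 1ℚ) + c * ((⟦ x <ᵇ z ⟧ * 1ℚ) * 1ℚ)
      ≡⟨ cong₂ (λ p q → c * p + c * (q * 1ℚ)) (trans (cong (_* 1ℚ) (sym (⟦not⟧ (x <ᵇ z)))) (sym (⟦∧⟧ (not (x <ᵇ z)) true)))
          (sym (⟦∧⟧ (x <ᵇ z) true)) ⟩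
    c * ⟦ not (x <ᵇ z) ∧ true ⟧ + c * (⟦ (x <ᵇ z) ∧ true ⟧ * 1ℚ) ∎
    where
    lem : ∀ a c p → (1ℚ * 1ℚ) * (c * 1ℚ) + ((p * 1ℚ) * 0ℚ) * (a * 1ℚ) ≡ c * ((1ℚ - p) * 1ℚ) + c * ((p * 1ℚ) * 1ℚ)
    lem = solve-∀ ℚ-ring
  conv-Cos-tail a c x (z ∷ t ∷ w) = begin
    (1ℚ * 1ℚ) * Zig a c (z ∷ t ∷ w) + ((⟦ (x <ᵇ z) ∧ true ⟧ * 0ℚ) * Zig a c (t ∷ w) + conv φ (Zig a c) w)
      ≡⟨ cong₂ (λ p q → (1ℚ * 1ℚ) * (- τ * p) + ((⟦ (x <ᵇ z) ∧ true ⟧ * 0ℚ) * Zig a c (t ∷ w) + q)) (⟦∧⟧ (z <ᵇ t) _) tail ⟩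
    (1ℚ * 1ℚ) * (- τ * (Q * Y)) + ((⟦ (x <ᵇ z) ∧ true ⟧ * 0ℚ) * Zig a c (t ∷ w) + (P * Q) * (τ * Y + c * (W * o)))
      ≡⟨ lem c τ P Q Y W o ⟦ (x <ᵇ z) ∧ true ⟧ (Zig a c (t ∷ w)) ⟩
    - τ * ((1ℚ - P) * (Q * Y)) + c * ((P * (Q * W)) * o)
      ≡⟨ cong₂ (λ p q → - τ * p + c * (q * o))
           (trans (cong₂ _*_ (sym (⟦not⟧ (x <ᵇ z))) (sym (⟦∧⟧ (z <ᵇ t) _))) (sym (⟦∧⟧ (not (x <ᵇ z)) _)))
           (trans (cong (P *_) (sym (⟦∧⟧ (z <ᵇ t) _))) (sym (⟦∧⟧ (x <ᵇ z) _))) ⟩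
    - τ * ⟦ zigzag≥ true (x ∷ z ∷ t ∷ w) ⟧ + c * (⟦ ascending (x ∷ z ∷ t ∷ w) ⟧ * o) ∎
    where
    τ = quarter a c (length w)
    o = oddℚ (length w)
    P = ⟦ x <ᵇ z ⟧
    Q = ⟦ z <ᵇ t ⟧
    Y = ⟦ zigzag≥ true (t ∷ w) ⟧
    W = ⟦ ascending (t ∷ w) ⟧
    φ : Functional
    φ u = ⟦ (x <ᵇ z) ∧ ((z <ᵇ t) ∧ ascending (t ∷ u)) ⟧ * evenℚ (length u)
    φ-scaled : ∀ u → φ u ≡ (P * Q) * (⟦ ascending (t ∷ u) ⟧ * evenℚ (length u))
    φ-scaled u = trans (cong (_* evenℚ (length u)) (trans (⟦∧⟧ (x <ᵇ z) _) (cong (P *_) (⟦∧⟧ (z <ᵇ t) _)))) (assoc P Q _ _)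
      where
      assoc : ∀ p q r s → (p * (q * r)) * s ≡ (p * q) * (r * s)
      assoc = solve-∀ ℚ-ring
    tail : conv φ (Zig a c) w ≡ (P * Q) * (τ * Y + c * (W * o))
    tail = trans (conv-cong φ-scaled (λ _ → refl) w)
      (trans (conv-scaleˡ _ (Zig a c) (P * Q) w) (cong ((P * Q) *_) (conv-Cos-tail a c t w)))
    lem : ∀ c τ p q y w o s r → (1ℚ * 1ℚ) * (- τ * (q * y)) + ((s * 0ℚ) * r + (p * q) * (τ * y + c * (w * o)))
      ≡ - τ * ((1ℚ - p) * (q * y)) + c * ((p * (q * w)) * o)
    lem = solve-∀ ℚ-ring

  -- In the convolution algebra, Zig a c = Cos⁻¹ (a + c Sin).
  conv-Cos-Zig : ∀ a c w → conv Cos (Zig a c) w ≡ a * δ w + c * Sin w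
  conv-Cos-Zig a c [] = lem a c
    where
    lem : ∀ a c → (1ℚ * 1ℚ) * (a * 1ℚ) ≡ a * 1ℚ + c * (1ℚ * 0ℚ)
    lem = solve-∀ ℚ-ring
  conv-Cos-Zig a c (x ∷ []) = lem a c
    where
    lem : ∀ a c → (1ℚ * 1ℚ) * (c * 1ℚ) + (1ℚ * 0ℚ) * (a * 1ℚ) ≡ a * 0ℚ + c * (1ℚ * 1ℚ)
    lem = solve-∀ ℚ-ring
  conv-Cos-Zig a c (x ∷ y ∷ w) = begin
    (1ℚ * 1ℚ) * Zig a c (x ∷ y ∷ w) + ((1ℚ * 0ℚ) * Zig a c (y ∷ w) + conv φ (Zig a c) w)
      ≡⟨ cong₂ (λ p q → (1ℚ * 1ℚ) * (- τ * p) + ((1ℚ * 0ℚ) * Zig a c (y ∷ w) + q)) (⟦∧⟧ (x <ᵇ y) _) tail ⟩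
    (1ℚ * 1ℚ) * (- τ * (P * Y)) + ((1ℚ * 0ℚ) * Zig a c (y ∷ w) + P * (τ * Y + c * (W * o)))
      ≡⟨ lem a c τ P Y W o (Zig a c (y ∷ w)) ⟩
    a * 0ℚ + c * ((P * W) * o)
      ≡⟨ cong (λ p → a * 0ℚ + c * (p * o)) (sym (⟦∧⟧ (x <ᵇ y) _)) ⟩
    a * 0ℚ + c * Sin (x ∷ y ∷ w) ∎
    where
    τ = quarter a c (length w)
    o = oddℚ (length w)
    P = ⟦ x <ᵇ y ⟧
    Y = ⟦ zigzag≥ true (y ∷ w) ⟧
    W = ⟦ ascending (y ∷ w) ⟧
    φ : Functional
    φ u = ⟦ (x <ᵇ y) ∧ ascending (y ∷ u) ⟧ * evenℚ (length u)
    φ-scaled : ∀ u → φ u ≡ P * (⟦ ascending (y ∷ u) ⟧ * evenℚ (length u))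
    φ-scaled u = trans (cong (_* evenℚ (length u)) (⟦∧⟧ (x <ᵇ y) _)) (*-assoc P _ _)
    tail : conv φ (Zig a c) w ≡ P * (τ * Y + c * (W * o))
    tail = trans (conv-cong φ-scaled (λ _ → refl) w)
      (trans (conv-scaleˡ _ (Zig a c) P w) (cong (P *_) (conv-Cos-tail a c y w)))
    lem : ∀ a c τ p y w o s → (1ℚ * 1ℚ) * (- τ * (p * y)) + ((1ℚ * 0ℚ) * s + p * (τ * y + c * (w * o)))
      ≡ a * 0ℚ + c * ((p * w) * o)
    lem = solve-∀ ℚ-ring

  -- The cancellation of `conv-Cos-tail`, now with prefixes of every length: `Zig 0ℚ 1ℚ` vanishes on
  -- words of even length, so for a tail of odd length every second cut drops out.
  conv-ascending-tail : ∀ x y w → oddℚ (length (y ∷ w)) ≡ 1ℚ →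
    conv (λ u → ⟦ ascending (x ∷ u) ⟧) (Zig 0ℚ 1ℚ) (y ∷ w)
      ≡ ⟦ ascending (x ∷ y ∷ w) ⟧ + quarter 0ℚ 1ℚ (length (y ∷ w)) * ⟦ zigzag≥ true (x ∷ y ∷ w) ⟧
  conv-ascending-tail x z [] odd = begin
    1ℚ * (1ℚ * 1ℚ) + ⟦ (x <ᵇ z) ∧ true ⟧ * (0ℚ * 1ℚ)
      ≡⟨ lem ⟦ (x <ᵇ z) ∧ true ⟧ ⟦ x <ᵇ z ⟧ ⟩
    ⟦ x <ᵇ z ⟧ * 1ℚ + 1ℚ * ((1ℚ - ⟦ x <ᵇ z ⟧) * 1ℚ)
      ≡⟨ cong₂ (λ p q → p + 1ℚ * q) (sym (⟦∧⟧ (x <ᵇ z) true))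
          (trans (cong (_* 1ℚ) (sym (⟦not⟧ (x <ᵇ z)))) (sym (⟦∧⟧ (not (x <ᵇ z)) true))) ⟩
    ⟦ (x <ᵇ z) ∧ true ⟧ + 1ℚ * ⟦ not (x <ᵇ z) ∧ true ⟧ ∎
    where
    lem : ∀ s p → 1ℚ * (1ℚ * 1ℚ) + s * (0ℚ * 1ℚ) ≡ p * 1ℚ + 1ℚ * ((1ℚ - p) * 1ℚ)
    lem = solve-∀ ℚ-ring
  conv-ascending-tail x z (t ∷ y ∷ w) odd = begin
    1ℚ * Zig 0ℚ 1ℚ (z ∷ t ∷ y ∷ w) + (⟦ (x <ᵇ z) ∧ true ⟧ * Zig 0ℚ 1ℚ (t ∷ y ∷ w) + conv φ (Zig 0ℚ 1ℚ) (y ∷ w))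
      ≡⟨ cong₂ (λ p q → 1ℚ * (- τ * p) + (⟦ (x <ᵇ z) ∧ true ⟧ * Zig 0ℚ 1ℚ (t ∷ y ∷ w) + q)) (⟦∧⟧ (z <ᵇ t) _) tail ⟩
    1ℚ * (- τ * (Q * Y)) + (⟦ (x <ᵇ z) ∧ true ⟧ * Zig 0ℚ 1ℚ (t ∷ y ∷ w) + (P * Q) * (W + τ * Y))
      ≡⟨ cong (λ s → 1ℚ * (- τ * (Q * Y)) + (⟦ (x <ᵇ z) ∧ true ⟧ * s + (P * Q) * (W + τ * Y))) zig0 ⟩
    1ℚ * (- τ * (Q * Y)) + (⟦ (x <ᵇ z) ∧ true ⟧ * 0ℚ + (P * Q) * (W + τ * Y))
      ≡⟨ lem τ P Q Y W ⟦ (x <ᵇ z) ∧ true ⟧ ⟩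
    P * (Q * W) + - τ * ((1ℚ - P) * (Q * Y))
      ≡⟨ cong₂ (λ p q → p + - τ * q)
           (trans (cong (P *_) (sym (⟦∧⟧ (z <ᵇ t) _))) (sym (⟦∧⟧ (x <ᵇ z) _)))
           (trans (cong₂ _*_ (sym (⟦not⟧ (x <ᵇ z))) (sym (⟦∧⟧ (z <ᵇ t) _))) (sym (⟦∧⟧ (not (x <ᵇ z)) _))) ⟩
    ⟦ ascending (x ∷ z ∷ t ∷ y ∷ w) ⟧ + - τ * ⟦ zigzag≥ true (x ∷ z ∷ t ∷ y ∷ w) ⟧ ∎
    where
    τ = quarter 0ℚ 1ℚ (length (y ∷ w))
    P = ⟦ x <ᵇ z ⟧
    Q = ⟦ z <ᵇ t ⟧
    Y = ⟦ zigzag≥ true (t ∷ y ∷ w) ⟧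
    W = ⟦ ascending (t ∷ y ∷ w) ⟧
    quarter-odd : ∀ n → oddℚ (suc n) ≡ 1ℚ → quarter 0ℚ 1ℚ n ≡ 0ℚ
    quarter-odd zero o = refl
    quarter-odd (suc zero) ()
    quarter-odd (suc (suc n)) o = cong -_ (quarter-odd n o)
    zig0 : Zig 0ℚ 1ℚ (t ∷ y ∷ w) ≡ 0ℚ
    zig0 = trans (cong (_* ⟦ zigzag≥ false (t ∷ y ∷ w) ⟧) (cong -_ (quarter-odd (length w) odd)))
      (*-zeroˡ ⟦ zigzag≥ false (t ∷ y ∷ w) ⟧)
    φ : Functional
    φ u = ⟦ (x <ᵇ z) ∧ ((z <ᵇ t) ∧ ascending (t ∷ u)) ⟧
    φ-scaled : ∀ u → φ u ≡ (P * Q) * ⟦ ascending (t ∷ u) ⟧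
    φ-scaled u = trans (⟦∧⟧ (x <ᵇ z) _) (trans (cong (P *_) (⟦∧⟧ (z <ᵇ t) _)) (sym (*-assoc P Q _)))
    tail : conv φ (Zig 0ℚ 1ℚ) (y ∷ w) ≡ (P * Q) * (W + τ * Y)
    tail = trans (conv-cong φ-scaled (λ _ → refl) (y ∷ w))
      (trans (conv-scaleˡ (λ u → ⟦ ascending (t ∷ u) ⟧) (Zig 0ℚ 1ℚ) (P * Q) (y ∷ w)) (cong ((P * Q) *_) (conv-ascending-tail t y w odd)))
    lem : ∀ τ p q y w s → 1ℚ * (- τ * (q * y)) + (s * 0ℚ + (p * q) * (w + τ * y))
      ≡ p * (q * w) + - τ * ((1ℚ - p) * (q * y))
    lem = solve-∀ ℚ-ring

  Hom-one : ∀ w → Hom 1ℚ w ≡ ⟦ ascending w ⟧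
  Hom-one w = trans (cong (⟦ ascending w ⟧ *_) (pow-one (length w))) (*-identityʳ ⟦ ascending w ⟧)

  Hom-minus-one : ∀ w → Hom (- 1ℚ) w ≡ Cos w - Sin w
  Hom-minus-one w = trans (cong (⟦ ascending w ⟧ *_) (trans (pow-minus-one (length w)) (sym (even-odd (length w)))))
    (lem ⟦ ascending w ⟧ (evenℚ (length w)) (oddℚ (length w)))
    where
    lem : ∀ a e o → a * (e - o) ≡ a * e - a * o
    lem = solve-∀ ℚ-ring

  Cos-average : ∀ w → ½ * Hom 1ℚ w + ½ * Hom (- 1ℚ) w ≡ Cos w
  Cos-average w = begin
    ½ * Hom 1ℚ w + ½ * Hom (- 1ℚ) w
      ≡⟨ cong₂ (λ p q → ½ * p + ½ * q)
           (trans (Hom-one w) (trans (sym (*-identityʳ a)) (cong (a *_) (sym (even+odd (length w)))))) (Hom-minus-one w) ⟩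
    ½ * (a * (e + o)) + ½ * (a * e - a * o)
      ≡⟨ lem a e o ⟩
    a * e ∎
    where
    a = ⟦ ascending w ⟧
    e = evenℚ (length w)
    o = oddℚ (length w)
    lem : ∀ a e o → ½ * (a * (e + o)) + ½ * (a * e - a * o) ≡ a * e
    lem = solve-∀ ℚ-ring

  -- Cos⁻¹ (Cos − Sin)
  Zag : Functional
  Zag w = 1ℚ * δ w + - 1ℚ * Zig 0ℚ 1ℚ w

  conv-Cos-Zag : ∀ w → conv Cos Zag w ≡ Hom (- 1ℚ) w
  conv-Cos-Zag w = begin
    conv Cos Zag w                                          ≡⟨ conv-linearʳ Cos δ (Zig 0ℚ 1ℚ) 1ℚ (- 1ℚ) w ⟩
    1ℚ * conv Cos δ w + - 1ℚ * conv Cos (Zig 0ℚ 1ℚ) w       ≡⟨ cong₂ (λ p q → 1ℚ * p + - 1ℚ * q) (conv-δ Cos w) (conv-Cos-Zig 0ℚ 1ℚ w) ⟩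
    1ℚ * Cos w + - 1ℚ * (0ℚ * δ w + 1ℚ * Sin w)             ≡⟨ lem (Cos w) (Sin w) (δ w) ⟩
    Cos w - Sin w                                           ≡⟨ Hom-minus-one w ⟨
    Hom (- 1ℚ) w ∎
    where
    lem : ∀ c s d → 1ℚ * c + - 1ℚ * (0ℚ * d + 1ℚ * s) ≡ c - s
    lem = solve-∀ ℚ-ring

  -- Real part of i^n; up to factorials, the coefficients of cos.
  ρ : ℕ → ℚ
  ρ = quarter 1ℚ 0ℚ

  -- The commutative model is (cosh + sinh)(1 - sinh/cosh) = 1/cosh. In the noncommutative algebra
  -- the same product, on words of even length, starts the zigzag with a descent instead of an
  -- ascent.
  conv-Hom-Zag : ∀ w → evenℚ (length w) ≡ 1ℚ → conv (Hom 1ℚ) Zag w ≡ ρ (length w) * ⟦ zigzag≥ true w ⟧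
  conv-Hom-Zag [] _ = refl
  conv-Hom-Zag (x ∷ []) ()
  conv-Hom-Zag (x ∷ y ∷ w) even = begin
    conv (Hom 1ℚ) Zag xyw
      ≡⟨ conv-cong {ψ = Zag} Hom-one (λ _ → refl) xyw ⟩
    conv asc Zag xyw
      ≡⟨ conv-linearʳ asc δ (Zig 0ℚ 1ℚ) 1ℚ (- 1ℚ) xyw ⟩
    1ℚ * conv asc δ xyw + - 1ℚ * conv asc (Zig 0ℚ 1ℚ) xyw
      -- The cut before the first letter evaluates `Zig 0ℚ 1ℚ` on a word of even length, which gives
      -- zero.
      ≡⟨ cong₂ (λ p q → 1ℚ * p + - 1ℚ * (1ℚ * (q * z) + conv (asc ∘ (x ∷_)) (Zig 0ℚ 1ℚ) (y ∷ w)))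
          (conv-δ asc xyw) (cong -_ (quarter-even (length w) even)) ⟩
    1ℚ * asc xyw + - 1ℚ * (1ℚ * (0ℚ * z) + conv (asc ∘ (x ∷_)) (Zig 0ℚ 1ℚ) (y ∷ w))
      ≡⟨ cong (λ q → 1ℚ * asc xyw + - 1ℚ * (1ℚ * (0ℚ * z) + q)) (conv-ascending-tail x y w (odd-suc (length w) even)) ⟩
    1ℚ * asc xyw + - 1ℚ * (1ℚ * (0ℚ * z) + (asc xyw + quarter 0ℚ 1ℚ (suc (length w)) * z′))
      ≡⟨ cong (λ q → 1ℚ * asc xyw + - 1ℚ * (1ℚ * (0ℚ * z) + (asc xyw + q * z′))) (quarter-suc (length w)) ⟩
    1ℚ * asc xyw + - 1ℚ * (1ℚ * (0ℚ * z) + (asc xyw + ρ (length w) * z′))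
      ≡⟨ lem (asc xyw) z (ρ (length w)) z′ ⟩
    - ρ (length w) * z′ ∎
    where
    xyw = x ∷ y ∷ w
    asc : Functional
    asc u = ⟦ ascending u ⟧
    z = ⟦ zigzag≥ false xyw ⟧
    z′ = ⟦ zigzag≥ true xyw ⟧
    quarter-even : ∀ n → evenℚ n ≡ 1ℚ → quarter 0ℚ 1ℚ n ≡ 0ℚ
    quarter-even zero e = refl
    quarter-even (suc zero) ()
    quarter-even (suc (suc n)) e = cong -_ (quarter-even n e)
    quarter-suc : ∀ n → quarter 0ℚ 1ℚ (suc n) ≡ ρ n
    quarter-suc zero = refl
    quarter-suc (suc zero) = refl
    quarter-suc (suc (suc n)) = cong -_ (quarter-suc n)
    odd-suc : ∀ n → evenℚ n ≡ 1ℚ → oddℚ (suc n) ≡ 1ℚ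
    odd-suc zero e = refl
    odd-suc (suc zero) ()
    odd-suc (suc (suc n)) e = odd-suc n e
    lem : ∀ a z r y → 1ℚ * a + - 1ℚ * (1ℚ * (0ℚ * z) + (a + r * y)) ≡ - r * y
    lem = solve-∀ ℚ-ring

  -- conv-power K (suc l) = Cos^l ∗ (Cos ∗ K); index 0 plays the role of l = -1.
  conv-power : Functional → ℕ → Functional
  conv-power K zero    = K
  conv-power K (suc i) = conv Cos (conv-power K i)

  -- `Cos` is 1 on the empty word, so one difference in `i` leaves only values on shorter words;
  -- induction on the length bound `n`.
  isPoly-conv-power : ∀ K w → IsPoly (λ i → conv-power K i w)
  isPoly-conv-power K w = bounded (length w) w ℕₚ.≤-refl
    where
    lem : ∀ a b → (1ℚ * 1ℚ) * a + b - a ≡ b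
    lem = solve-∀ ℚ-ring
    lem₀ : ∀ a → (1ℚ * 1ℚ) * a - a ≡ 0ℚ
    lem₀ = solve-∀ ℚ-ring
    bounded : ∀ n w → length w ℕ.≤ n → IsPoly (λ i → conv-power K i w)
    bounded n [] _ = isPoly-Δ (isPoly-cong (λ i → sym (lem₀ (conv-power K i []))) (isPoly-const 0ℚ))
    bounded (suc n) (x ∷ w) (s≤s w≤n) = isPoly-Δ (isPoly-cong (λ i → sym (lem (conv-power K i (x ∷ w)) _))
      (isPoly-conv (Cos ∘ (x ∷_)) (conv-power K) w (λ v v≤ → bounded n v (ℕₚ.≤-trans v≤ w≤n))))

  -- Expectation over `l` independent uniform signs.
  mean : ℕ → (List ℚ → ℚ) → ℚ
  mean zero    F = F []
  mean (suc l) F = ½ * mean l (F ∘ (1ℚ ∷_)) + ½ * mean l (F ∘ (- 1ℚ ∷_))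

  mean-cong : ∀ l {F G} → (∀ ys → F ys ≡ G ys) → mean l F ≡ mean l G
  mean-cong zero e = e []
  mean-cong (suc l) e = cong₂ (λ p q → ½ * p + ½ * q) (mean-cong l (e ∘ (1ℚ ∷_))) (mean-cong l (e ∘ (- 1ℚ ∷_)))

  mean-+ : ∀ l F G → mean l (λ ys → F ys + G ys) ≡ mean l F + mean l G
  mean-+ zero F G = refl
  mean-+ (suc l) F G = trans (cong₂ (λ p q → ½ * p + ½ * q) (mean-+ l (F ∘ (1ℚ ∷_)) (G ∘ (1ℚ ∷_))) (mean-+ l (F ∘ (- 1ℚ ∷_)) (G ∘ (- 1ℚ ∷_))))
    (lem ½ (mean l (F ∘ (1ℚ ∷_))) (mean l (G ∘ (1ℚ ∷_))) (mean l (F ∘ (- 1ℚ ∷_))) (mean l (G ∘ (- 1ℚ ∷_))))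
    where
    lem : ∀ h a b c d → h * (a + b) + h * (c + d) ≡ (h * a + h * c) + (h * b + h * d)
    lem = solve-∀ ℚ-ring

  mean-*ˡ : ∀ l c F → mean l (λ ys → c * F ys) ≡ c * mean l F
  mean-*ˡ zero c F = refl
  mean-*ˡ (suc l) c F = trans (cong₂ (λ p q → ½ * p + ½ * q) (mean-*ˡ l c (F ∘ (1ℚ ∷_))) (mean-*ˡ l c (F ∘ (- 1ℚ ∷_))))
    (lem ½ c (mean l (F ∘ (1ℚ ∷_))) (mean l (F ∘ (- 1ℚ ∷_))))
    where
    lem : ∀ h c a b → h * (c * a) + h * (c * b) ≡ c * (h * a + h * b)
    lem = solve-∀ ℚ-ring

  mean-∑ : {A : Set} (l : ℕ) (xs : List A) (F : A → List ℚ → ℚ) →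
    mean l (λ ys → ∑ xs (λ x → F x ys)) ≡ ∑ xs (λ x → mean l (F x))
  mean-∑ l [] F = mean-zero l
    where
    mean-zero : ∀ l → mean l (λ _ → 0ℚ) ≡ 0ℚ
    mean-zero zero = refl
    mean-zero (suc l) = cong (λ p → ½ * p + ½ * p) (mean-zero l)
  mean-∑ l (x ∷ xs) F = trans (mean-+ l (F x) _) (cong (mean l (F x) +_) (mean-∑ l xs F))

  mean-conv : ∀ l φ (Ψ : List ℚ → Functional) w →
    mean l (λ ys → conv φ (Ψ ys) w) ≡ conv φ (λ v → mean l (λ ys → Ψ ys v)) w
  mean-conv l φ Ψ [] = mean-*ˡ l (φ []) (λ ys → Ψ ys [])
  mean-conv l φ Ψ (x ∷ w) = trans (mean-+ l (λ ys → φ [] * Ψ ys (x ∷ w)) _)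
    (cong₂ _+_ (mean-*ˡ l (φ []) (λ ys → Ψ ys (x ∷ w))) (mean-conv l (φ ∘ (x ∷_)) Ψ w))

  -- Σ over the fillings of w by the letters (weighted by ys) that are weakly
  -- increasing, with w ascending on each letter.
  fillings : List ℚ → Functional
  fillings []       = δ
  fillings (y ∷ ys) = conv (Hom y) (fillings ys)

  -- The letters `zs` keep their weights. By hypothesis `K` is the inverse of `Cos` times their
  -- fillings, that is, the member of the family at l = -1.
  mean-fillings : ∀ K zs → (∀ w → conv Cos K w ≡ fillings zs w) → ∀ l w →
    mean l (λ ys → fillings (ys ++ zs) w) ≡ conv-power K (suc l) w
  mean-fillings K zs e zero w = sym (e w)
  mean-fillings K zs e (suc l) w = begin
    ½ * mean l (λ ys → conv (Hom 1ℚ) (F ys) w) + ½ * mean l (λ ys → conv (Hom (- 1ℚ)) (F ys) w)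
      ≡⟨ cong₂ (λ p q → ½ * p + ½ * q) (half 1ℚ) (half (- 1ℚ)) ⟩
    ½ * conv (Hom 1ℚ) (conv-power K (suc l)) w + ½ * conv (Hom (- 1ℚ)) (conv-power K (suc l)) w
      ≡⟨ conv-linearˡ (Hom 1ℚ) (Hom (- 1ℚ)) (conv-power K (suc l)) ½ ½ w ⟨
    conv (λ u → ½ * Hom 1ℚ u + ½ * Hom (- 1ℚ) u) (conv-power K (suc l)) w
      ≡⟨ conv-cong Cos-average (λ _ → refl) w ⟩
    conv Cos (conv-power K (suc l)) w ∎
    where
    F : List ℚ → Functional
    F ys = fillings (ys ++ zs)
    half : ∀ y → mean l (λ ys → conv (Hom y) (F ys) w) ≡ conv (Hom y) (conv-power K (suc l)) w
    half y = trans (mean-conv l (Hom y) F w) (conv-cong (λ _ → refl) (mean-fillings K zs e l) w)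

-- Convolution products as sums over words of letters.

module Fillings where

  open FiniteSums
  open Words
  open import Defs
  open import Data.Bool using (Bool; true; _∧_; _∨_)
  open import Data.Nat as ℕ using (ℕ; zero; suc; _<ᵇ_; _≡ᵇ_)
  open import Data.Fin using (Fin; zero; suc; toℕ)
  open import Data.Rational as ℚ using (ℚ; 0ℚ; 1ℚ; _+_; _*_; -_; _-_)
  open import Data.Rational.Properties
  open import Data.List as List using (List; []; _∷_; length; allFin)
  open import Data.List.Properties using (map-tabulate)
  open import Data.Vec using (Vec; []; _∷_; toList)
  open import Function using (_∘_; id)
  open import Relation.Binary.PropositionalEquality as ≡ using (_≡_; refl; sym; cong; cong₂; trans; module ≡-Reasoning)
  open import Tactic.RingSolver using (solve-∀)
  open ≡-Reasoning

  ∑-allFin-suc : ∀ n (g : Fin (suc n) → ℚ) → ∑ (allFin (suc n)) g ≡ g zero + ∑ (allFin n) (g ∘ suc)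
  ∑-allFin-suc n g = cong (λ z → g zero + sumℚ z) (trans (map-tabulate suc g) (sym (map-tabulate id (g ∘ suc))))

  ∑-allWords-suc : ∀ L n (g : Vec (Fin L) (suc n) → ℚ) →
    ∑ (allWords L (suc n)) g ≡ ∑ (allFin L) (λ c → ∑ (allWords L n) (λ f → g (c ∷ f)))
  ∑-allWords-suc L n g = trans (∑-concatMap (allFin L) _ g) (∑-cong (allFin L) (λ c → ∑-map (allWords L n) (c ∷_) g))

  lexStep : {L : ℕ} → Fin L → ℕ → Fin L → ℕ → Bool
  lexStep c x d y = (toℕ c <ᵇ toℕ d) ∨ ((toℕ c ≡ᵇ toℕ d) ∧ (x <ᵇ y))

  -- Lexicographic increase of (letter, value) states both conditions on a filling at once: letters
  -- weakly increase, and the word ascends within each letter.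
  lexInc : {L n : ℕ} → Vec (Fin L) n → Vec ℕ n → Bool
  lexInc (c ∷ d ∷ f) (x ∷ y ∷ w) = lexStep c x d y ∧ lexInc (d ∷ f) (y ∷ w)
  lexInc _           _           = true

  weight : {L n : ℕ} → (Fin L → ℚ) → Vec (Fin L) n → ℚ
  weight z []      = 1ℚ
  weight z (c ∷ f) = z c * weight z f

  lexSum : (ys : List ℚ) {n : ℕ} → Vec ℕ n → ℚ
  lexSum ys {n} w = ∑ (allWords (length ys) n) (λ f → ⟦ lexInc f w ⟧ * weight (List.lookup ys) f)

  -- The position before `w` has value `x` and is already filled by `c`, whose weight is left out.
  lexSumFrom : (ys : List ℚ) {n : ℕ} → Fin (length ys) → ℕ → Vec ℕ n → ℚ
  lexSumFrom ys {n} c x w = ∑ (allWords (length ys) n) (λ f → ⟦ lexInc (c ∷ f) (x ∷ w) ⟧ * weight (List.lookup ys) f)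

  private
    pull : ∀ s p q r → s * p * (q * r) ≡ (s * q) * (p * r)
    pull = solve-∀ ℚ-ring

  lexSum-∷ : ∀ ys {n} x (w : Vec ℕ n) →
    lexSum ys (x ∷ w) ≡ ∑ (allFin (length ys)) (λ c → List.lookup ys c * lexSumFrom ys c x w)
  lexSum-∷ ys {n} x w = trans (∑-allWords-suc (length ys) n _)
    (∑-cong (allFin (length ys)) (λ c → trans
      (∑-cong (allWords (length ys) n) (λ f → lem ⟦ lexInc (c ∷ f) (x ∷ w) ⟧ (List.lookup ys c) (weight (List.lookup ys) f)))
      (∑-*ˡ (allWords (length ys) n) (List.lookup ys c) _)))
    where
    lem : ∀ a b c → a * (b * c) ≡ b * (a * c)
    lem = solve-∀ ℚ-ring

  lexSumFrom-∷ : ∀ ys {n} c x y (w : Vec ℕ n) → lexSumFrom ys c x (y ∷ w) ≡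
    ∑ (allFin (length ys)) (λ d → (⟦ lexStep c x d y ⟧ * List.lookup ys d) * lexSumFrom ys d y w)
  lexSumFrom-∷ ys {n} c x y w = trans (∑-allWords-suc (length ys) n _)
    (∑-cong (allFin (length ys)) (λ d → trans
      (∑-cong (allWords (length ys) n) (λ f → trans
        (cong (_* (List.lookup ys d * weight (List.lookup ys) f)) (⟦∧⟧ (lexStep c x d y) (lexInc (d ∷ f) (y ∷ w))))
        (pull ⟦ lexStep c x d y ⟧ ⟦ lexInc (d ∷ f) (y ∷ w) ⟧ (List.lookup ys d) (weight (List.lookup ys) f))))
      (∑-*ˡ (allWords (length ys) n) (⟦ lexStep c x d y ⟧ * List.lookup ys d) _)))

  -- Letters never decrease, so after a larger letter the least one cannot return: its term carries
  -- the factor 0.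
  lexSumFrom-suc : ∀ z ys {n} c x (w : Vec ℕ n) → lexSumFrom (z ∷ ys) (suc c) x w ≡ lexSumFrom ys c x w
  lexSumFrom-suc z ys c x [] = refl
  lexSumFrom-suc z ys c x (y ∷ w) = begin
    lexSumFrom (z ∷ ys) (suc c) x (y ∷ w)
      ≡⟨ lexSumFrom-∷ (z ∷ ys) (suc c) x y w ⟩
    ∑ (allFin (suc (length ys))) (λ d → (⟦ lexStep (suc c) x d y ⟧ * List.lookup (z ∷ ys) d) * lexSumFrom (z ∷ ys) d y w)
      ≡⟨ ∑-allFin-suc (length ys) (λ d → (⟦ lexStep (suc c) x d y ⟧ * List.lookup (z ∷ ys) d) * lexSumFrom (z ∷ ys) d y w) ⟩
    (0ℚ * z) * lexSumFrom (z ∷ ys) zero y w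
      + ∑ (allFin (length ys)) (λ d → (⟦ lexStep c x d y ⟧ * List.lookup ys d) * lexSumFrom (z ∷ ys) (suc d) y w)
      ≡⟨ cong₂ _+_ (lem z (lexSumFrom (z ∷ ys) zero y w))
           (∑-cong (allFin (length ys)) (λ d → cong ((⟦ lexStep c x d y ⟧ * List.lookup ys d) *_) (lexSumFrom-suc z ys d y w))) ⟩
    0ℚ + ∑ (allFin (length ys)) (λ d → (⟦ lexStep c x d y ⟧ * List.lookup ys d) * lexSumFrom ys d y w)
      ≡⟨ +-identityˡ _ ⟩
    ∑ (allFin (length ys)) (λ d → (⟦ lexStep c x d y ⟧ * List.lookup ys d) * lexSumFrom ys d y w)
      ≡⟨ lexSumFrom-∷ ys c x y w ⟨
    lexSumFrom ys c x (y ∷ w) ∎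
    where
    lem : ∀ z s → (0ℚ * z) * s ≡ 0ℚ
    lem = solve-∀ ℚ-ring

  lexSum-rest : ∀ z ys {n} x (w : Vec ℕ n) →
    ∑ (allFin (length ys)) (λ d → List.lookup ys d * lexSumFrom (z ∷ ys) (suc d) x w) ≡ lexSum ys (x ∷ w)
  lexSum-rest z ys x w = trans
    (∑-cong (allFin (length ys)) (λ d → cong (List.lookup ys d *_) (lexSumFrom-suc z ys d x w)))
    (sym (lexSum-∷ ys x w))

  -- The least letter is in use at `x`. Either it ends there and the other letters fill the rest, or
  -- it continues, which requires an ascent; these are the two terms of `conv`.
  fillings-tail : ∀ z ys → (∀ {n} (w : Vec ℕ n) → fillings ys (toList w) ≡ lexSum ys w) → ∀ {n} x (w : Vec ℕ n) →
    conv (Hom z ∘ (x ∷_)) (fillings ys) (toList w) ≡ z * lexSumFrom (z ∷ ys) zero x w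
  fillings-tail z ys e x [] = trans (cong ((1ℚ * (z * 1ℚ)) *_) (e [])) (lem z)
    where
    lem : ∀ z → (1ℚ * (z * 1ℚ)) * (1ℚ * 1ℚ + 0ℚ) ≡ z * (1ℚ * 1ℚ + 0ℚ)
    lem = solve-∀ ℚ-ring
  fillings-tail z ys e x (y ∷ w) = begin
    (1ℚ * (z * 1ℚ)) * fillings ys (y ∷ toList w) + conv φ (fillings ys) (toList w)
      ≡⟨ cong₂ (λ p q → (1ℚ * (z * 1ℚ)) * p + q) (e (y ∷ w)) tail ⟩
    (1ℚ * (z * 1ℚ)) * lexSum ys (y ∷ w) + (P * z) * (z * lexSumFrom (z ∷ ys) zero y w)
      ≡⟨ lem z P (lexSum ys (y ∷ w)) (lexSumFrom (z ∷ ys) zero y w) ⟩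
    z * ((P * z) * lexSumFrom (z ∷ ys) zero y w + lexSum ys (y ∷ w))
      ≡⟨ cong (z *_) (sym unfold) ⟩
    z * lexSumFrom (z ∷ ys) zero x (y ∷ w) ∎
    where
    P = ⟦ x <ᵇ y ⟧
    φ : Functional
    φ = Hom z ∘ (x ∷_) ∘ (y ∷_)
    φ-scaled : ∀ u → φ u ≡ (P * z) * Hom z (y ∷ u)
    φ-scaled u = trans (cong (_* (z * (z * pow z (length u)))) (⟦∧⟧ (x <ᵇ y) (ascending (y ∷ u))))
      (pull′ P ⟦ ascending (y ∷ u) ⟧ z (pow z (length u)))
      where
      pull′ : ∀ p a z q → (p * a) * (z * (z * q)) ≡ (p * z) * (a * (z * q))
      pull′ = solve-∀ ℚ-ring
    tail : conv φ (fillings ys) (toList w) ≡ (P * z) * (z * lexSumFrom (z ∷ ys) zero y w)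
    tail = trans (conv-cong {φ = φ} {ψ = fillings ys} φ-scaled (λ _ → refl) (toList w))
      (trans (conv-scaleˡ (Hom z ∘ (y ∷_)) (fillings ys) (P * z) (toList w)) (cong ((P * z) *_) (fillings-tail z ys e y w)))
    unfold : lexSumFrom (z ∷ ys) zero x (y ∷ w) ≡ (P * z) * lexSumFrom (z ∷ ys) zero y w + lexSum ys (y ∷ w)
    unfold = begin
      lexSumFrom (z ∷ ys) zero x (y ∷ w)
        ≡⟨ lexSumFrom-∷ (z ∷ ys) zero x y w ⟩
      ∑ (allFin (suc (length ys))) (λ d → (⟦ lexStep zero x d y ⟧ * List.lookup (z ∷ ys) d) * lexSumFrom (z ∷ ys) d y w)
        ≡⟨ ∑-allFin-suc (length ys) (λ d → (⟦ lexStep zero x d y ⟧ * List.lookup (z ∷ ys) d) * lexSumFrom (z ∷ ys) d y w) ⟩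
      (P * z) * lexSumFrom (z ∷ ys) zero y w
        + ∑ (allFin (length ys)) (λ d → (1ℚ * List.lookup ys d) * lexSumFrom (z ∷ ys) (suc d) y w)
        ≡⟨ cong ((P * z) * lexSumFrom (z ∷ ys) zero y w +_) (trans
             (∑-cong (allFin (length ys)) (λ d → cong (_* lexSumFrom (z ∷ ys) (suc d) y w) (*-identityˡ (List.lookup ys d))))
             (lexSum-rest z ys y w)) ⟩
      (P * z) * lexSumFrom (z ∷ ys) zero y w + lexSum ys (y ∷ w) ∎
    lem : ∀ z p s t → (1ℚ * (z * 1ℚ)) * s + (p * z) * (z * t) ≡ z * ((p * z) * t + s)
    lem = solve-∀ ℚ-ring

  -- The cut made by `conv` is the end of the block of the least letter; recursion over the
  -- alphabet.
  fillings-lexSum : ∀ ys {n} (w : Vec ℕ n) → fillings ys (toList w) ≡ lexSum ys w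
  fillings-lexSum [] [] = refl
  fillings-lexSum [] (x ∷ w) = refl
  fillings-lexSum (z ∷ ys) [] = trans (cong ((1ℚ * 1ℚ) *_) (fillings-lexSum ys [])) refl
  fillings-lexSum (z ∷ ys) (x ∷ w) = begin
    (1ℚ * 1ℚ) * fillings ys (x ∷ toList w) + conv (Hom z ∘ (x ∷_)) (fillings ys) (toList w)
      ≡⟨ cong₂ (λ p q → (1ℚ * 1ℚ) * p + q) (fillings-lexSum ys (x ∷ w)) (fillings-tail z ys (fillings-lexSum ys) x w) ⟩
    (1ℚ * 1ℚ) * lexSum ys (x ∷ w) + z * lexSumFrom (z ∷ ys) zero x w
      ≡⟨ lem (lexSum ys (x ∷ w)) (z * lexSumFrom (z ∷ ys) zero x w) ⟩
    z * lexSumFrom (z ∷ ys) zero x w + lexSum ys (x ∷ w)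
      ≡⟨ cong (z * lexSumFrom (z ∷ ys) zero x w +_) (lexSum-rest z ys x w) ⟨
    z * lexSumFrom (z ∷ ys) zero x w + ∑ (allFin (length ys)) (λ d → List.lookup ys d * lexSumFrom (z ∷ ys) (suc d) x w)
      ≡⟨ ∑-allFin-suc (length ys) (λ d → List.lookup (z ∷ ys) d * lexSumFrom (z ∷ ys) d x w) ⟨
    ∑ (allFin (suc (length ys))) (λ d → List.lookup (z ∷ ys) d * lexSumFrom (z ∷ ys) d x w)
      ≡⟨ lexSum-∷ (z ∷ ys) x w ⟨
    lexSum (z ∷ ys) (x ∷ w) ∎
    where
    lem : ∀ a b → (1ℚ * 1ℚ) * a + b ≡ b + a
    lem = solve-∀ ℚ-ring

-- Periodic sequences, numeric codes for lexicographic order, and Lyndon words.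

module Periodic where

  open FiniteSums
  open import Defs
  open import Data.Bool using (Bool; true; false; _∧_; _∨_; not; T)
  open import Data.Bool.Properties using (T-∧)
  open import Data.Empty using (⊥-elim)
  open import Data.Unit using (tt)
  open import Data.Nat
  open import Data.Nat.Properties
  open import Data.Nat.DivMod
  open import Data.Fin using (Fin; toℕ; zero; suc)
  open import Data.Fin.Properties using (toℕ<n; toℕ-injective; toℕ-fromℕ<)
  open import Data.List using (List; []; _∷_)
  open import Data.List.Membership.Propositional using (_∈_)
  open import Data.List.Relation.Unary.Any using (here; there)
  open import Data.Vec using (Vec; []; _∷_; lookup; tabulate)
  open import Data.Vec.Properties using (lookup∘tabulate; tabulate∘lookup; tabulate-cong)
  open import Data.Product using (∃; _×_; _,_)
  open import Data.Sum using (inj₁; inj₂)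
  open import Function using (_∘_; Equivalence)
  open import Relation.Nullary using (¬_; yes; no)
  open import Relation.Binary.PropositionalEquality

  T-not⁻ : ∀ {p} → T (not p) → ¬ T p
  T-not⁻ {false} _ ()

  T-not⁺ : ∀ {p} → ¬ T p → T (not p)
  T-not⁺ {true} n = ⊥-elim (n tt)
  T-not⁺ {false} n = tt

  all⁻ : {A : Set} {p : A → Bool} (xs : List A) → T (all p xs) → ∀ {x} → x ∈ xs → T (p x)
  all⁻ {p = p} (x ∷ xs) t x∈ with Equivalence.to (T-∧ {p x}) t
  all⁻ (x ∷ xs) t (here refl) | a , b = a
  all⁻ (x ∷ xs) t (there x∈) | a , b = all⁻ xs b x∈

  all⁺ : {A : Set} {p : A → Bool} (xs : List A) → (∀ {x} → x ∈ xs → T (p x)) → T (all p xs)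
  all⁺ [] h = tt
  all⁺ {p = p} (x ∷ xs) h = Equivalence.from (T-∧ {p x}) (h (here refl) , all⁺ xs (h ∘ there))

  Periodic : {A : Set} → ℕ → (ℕ → A) → Set
  Periodic m g = ∀ k → g (m + k) ≡ g k

  shift : {A : Set} → ℕ → (ℕ → A) → ℕ → A
  shift k g t = g (k + t)

  shift-periodic : {A : Set} {m : ℕ} {g : ℕ → A} → Periodic m g → ∀ k → Periodic m (shift k g)
  shift-periodic {m = m} {g} p k t = trans (cong g lem) (p (k + t))
    where
    lem : k + (m + t) ≡ m + (k + t)
    lem = trans (sym (+-assoc k m t)) (trans (cong (_+ t) (+-comm k m)) (+-assoc m k t))

  periodic-* : {A : Set} {m : ℕ} {g : ℕ → A} → Periodic m g → ∀ q k → g (q * m + k) ≡ g k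
  periodic-* p zero k = refl
  periodic-* {m = m} {g} p (suc q) k = trans (cong g (+-assoc m (q * m) k)) (trans (p (q * m + k)) (periodic-* p q k))

  periodic-% : {A : Set} {m : ℕ} .{{_ : NonZero m}} {g : ℕ → A} → Periodic m g → ∀ k → g (k % m) ≡ g k
  periodic-% {m = m} {g} p k = trans (sym (periodic-* p (k / m) (k % m)))
    (cong g (trans (+-comm (k / m * m) (k % m)) (sym (m≡m%n+[m/n]*n k m))))

  periodic-shift-% : {A : Set} {m : ℕ} .{{_ : NonZero m}} {g : ℕ → A} → Periodic m g → ∀ k t → g (k % m + t) ≡ g (k + t)
  periodic-shift-% {m = m} {g} p k t = begin
    g (k % m + t)                     ≡⟨ periodic-% p (k % m + t) ⟨
    g ((k % m + t) % m)               ≡⟨ cong g (%-distribˡ-+ (k % m) t m) ⟩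
    g ((k % m % m + t % m) % m)       ≡⟨ cong (λ z → g ((z + t % m) % m)) (m%n%n≡m%n k m) ⟩
    g ((k % m + t % m) % m)           ≡⟨ cong g (%-distribˡ-+ k t m) ⟨
    g ((k + t) % m)                   ≡⟨ periodic-% p (k + t) ⟩
    g (k + t)                         ∎
    where open ≡-Reasoning

  module _ {A : Set} {n : ℕ} .{{_ : NonZero n}} where

    -- A word is read as a periodic sequence, so that rotating it is `shift` and modular indices
    -- stay out of later statements.
    at : Vec A n → ℕ → A
    at w k = lookup w (k mod n)

    at-periodic : ∀ w → Periodic n (at w)
    at-periodic w k = cong (lookup w) (toℕ-injective (trans (toℕ-fromℕ< _)
      (trans (trans (cong (_% n) (+-comm n k)) ([m+n]%n≡m%n k n)) (sym (toℕ-fromℕ< _)))))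

    at-toℕ : ∀ w i → at w (toℕ i) ≡ lookup w i
    at-toℕ w i = cong (lookup w) (toℕ-injective (trans (toℕ-fromℕ< _) (m<n⇒m%n≡m (toℕ<n i))))

    word : (ℕ → A) → Vec A n
    word g = tabulate (g ∘ toℕ)

    at-word : ∀ {g} → Periodic n g → ∀ k → at (word g) k ≡ g k
    at-word {g} p k = trans (lookup∘tabulate (g ∘ toℕ) (k mod n)) (trans (cong g (toℕ-fromℕ< _)) (periodic-% p k))

    at-injective : ∀ w w′ → (∀ k → at w k ≡ at w′ k) → w ≡ w′
    at-injective w w′ e = trans (sym (tabulate∘lookup w)) (trans
      (tabulate-cong (λ i → trans (sym (at-toℕ w i)) (trans (e (toℕ i)) (at-toℕ w′ i)))) (tabulate∘lookup w′))

  module Code {L : ℕ} where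

    -- The first `n` letters as a numeral in base `L`, leading digit first: lexicographic comparison
    -- becomes the order of ℕ.
    code : ℕ → (ℕ → Fin L) → ℕ
    code zero    g = 0
    code (suc n) g = toℕ (g 0) * L ^ n + code n (g ∘ suc)

    code-cong : ∀ n {g h} → (∀ k → g k ≡ h k) → code n g ≡ code n h
    code-cong zero e = refl
    code-cong (suc n) e = cong₂ (λ a c → toℕ a * L ^ n + c) (e 0) (code-cong n (e ∘ suc))

    digit-< : ∀ {a c x B} → a < c → x < B → a * B + x < c * B
    digit-< {a} {c} {x} {B} a<c x<B = begin-strict
      a * B + x <⟨ +-monoʳ-< (a * B) x<B ⟩
      a * B + B ≡⟨ +-comm (a * B) B ⟩
      suc a * B ≤⟨ *-monoˡ-≤ B a<c ⟩
      c * B     ∎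
      where open ≤-Reasoning

    code< : ∀ n g → code n g < L ^ n
    code< zero g = s≤s z≤n
    code< (suc n) g = digit-< (toℕ<n (g 0)) (code< n (g ∘ suc))

    code-head : ∀ n {g h} → toℕ (g 0) < toℕ (h 0) → code (suc n) g < code (suc n) h
    code-head n {g} {h} lt = <-≤-trans (digit-< lt (code< n (g ∘ suc))) (m≤m+n (toℕ (h 0) * L ^ n) (code n (h ∘ suc)))

    code-head-≤ : ∀ n {g h} → code (suc n) g ≤ code (suc n) h → toℕ (g 0) ≤ toℕ (h 0)
    code-head-≤ n {g} {h} le = ≮⇒≥ (λ lt → <⇒≱ (code-head n {h} {g} lt) le)

    code-tail-< : ∀ n {g h} → g 0 ≡ h 0 → code (suc n) g < code (suc n) h → code n (g ∘ suc) < code n (h ∘ suc)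
    code-tail-< n {g} {h} e lt rewrite e = +-cancelˡ-< (toℕ (h 0) * L ^ n) _ _ lt

    code-injective : ∀ n {g h} → code n g ≡ code n h → ∀ k → k < n → g k ≡ h k
    code-injective (suc n) {g} {h} e k k<n = lem k k<n
      where
      heads : g 0 ≡ h 0
      heads = toℕ-injective (≤-antisym (code-head-≤ n {g} {h} (≤-reflexive e)) (code-head-≤ n {h} {g} (≤-reflexive (sym e))))
      tails : code n (g ∘ suc) ≡ code n (h ∘ suc)
      tails = +-cancelˡ-≡ (toℕ (h 0) * L ^ n) _ _ (trans (cong (λ z → toℕ z * L ^ n + code n (g ∘ suc)) (sym heads)) e)
      lem : ∀ k → k < suc n → g k ≡ h k
      lem zero _ = heads
      lem (suc k) (s≤s k<n) = code-injective n tails k k<n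

    code-last : ∀ n g → code (suc n) g ≡ code n g * L + toℕ (g n)
    code-last zero g = trans (+-identityʳ _) (*-identityʳ _)
    code-last (suc n) g = begin
      a * L ^ suc n + code (suc n) (g ∘ suc)             ≡⟨ cong (a * L ^ suc n +_) (code-last n (g ∘ suc)) ⟩
      a * (L * L ^ n) + (code n (g ∘ suc) * L + z)       ≡⟨ +-assoc _ (code n (g ∘ suc) * L) z ⟨
      a * (L * L ^ n) + code n (g ∘ suc) * L + z         ≡⟨ cong (λ q → q + code n (g ∘ suc) * L + z) (trans (cong (a *_) (*-comm L (L ^ n))) (sym (*-assoc a (L ^ n) L))) ⟩
      a * L ^ n * L + code n (g ∘ suc) * L + z           ≡⟨ cong (_+ z) (*-distribʳ-+ L (a * L ^ n) (code n (g ∘ suc))) ⟨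
      (a * L ^ n + code n (g ∘ suc)) * L + z             ∎
      where
      open ≡-Reasoning
      a = toℕ (g 0)
      z = toℕ (g (suc n))

    module _ {m : ℕ} .{{_ : NonZero m}} where

      code≡⇒≗ : ∀ {g h} → Periodic m g → Periodic m h → code m g ≡ code m h → ∀ k → g k ≡ h k
      code≡⇒≗ {g} {h} p q e k = trans (sym (periodic-% p k))
        (trans (code-injective m e (k % m) (m%n<n k m)) (periodic-% q k))

      code-first : ∀ {g h} → toℕ (g 0) < toℕ (h 0) → code m g < code m h
      code-first {g} {h} = first m refl
        where
        first : ∀ n → n ≡ m → toℕ (g 0) < toℕ (h 0) → code m g < code m h
        first zero e = ⊥-elim (≢-nonZero⁻¹ m (sym e))
        first (suc n) refl = code-head n {g} {h}

      -- Drop the common first letter and append it at the end: by periodicity the last digits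
      -- agree, and a strict inequality between the remaining digits survives multiplication by `L`.
      code-rotate : ∀ {g h} → Periodic m g → Periodic m h → g 0 ≡ h 0 →
        code m g < code m h → code m (shift 1 g) < code m (shift 1 h)
      code-rotate {g} {h} p q = rotate m refl
        where
        rotate : ∀ n → n ≡ m → g 0 ≡ h 0 → code n g < code n h → code n (shift 1 g) < code n (shift 1 h)
        rotate (suc n) refl e lt = begin-strict
          code (suc n) (g ∘ suc)                     ≡⟨ code-last n (g ∘ suc) ⟩
          code n (g ∘ suc) * L + toℕ (g (suc n))     ≡⟨ cong (λ z → code n (g ∘ suc) * L + toℕ z) wrap ⟩
          code n (g ∘ suc) * L + toℕ (h (suc n))     <⟨ +-monoˡ-< (toℕ (h (suc n))) (*-monoˡ-< L {{L≢0}} (code-tail-< n {g} {h} e lt)) ⟩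
          code n (h ∘ suc) * L + toℕ (h (suc n))     ≡⟨ code-last n (h ∘ suc) ⟨
          code (suc n) (h ∘ suc)                     ∎
          where
          open ≤-Reasoning
          L≢0 : NonZero L
          L≢0 = >-nonZero (≤-<-trans z≤n (toℕ<n (g 0)))
          wrap : g (suc n) ≡ h (suc n)
          wrap = trans (cong g (sym (+-identityʳ (suc n)))) (trans (p 0) (trans e
            (trans (sym (q 0)) (cong h (+-identityʳ (suc n))))))

    Lyndon : ℕ → (ℕ → Fin L) → Set
    Lyndon m g = ∀ k → 0 < k → k < m → code m g < code m (shift k g)

    Primitive : ℕ → (ℕ → Fin L) → Set
    Primitive m g = ∀ k → 0 < k → k < m → ¬ (∀ t → g (k + t) ≡ g t)

    Lyndon-cong : ∀ m {g h} → (∀ k → g k ≡ h k) → Lyndon m g → Lyndon m h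
    Lyndon-cong m e ly k 0<k k<m = subst₂ _<_ (code-cong m e) (code-cong m (e ∘ (k +_))) (ly k 0<k k<m)

    Primitive-cong : ∀ m {g h} → (∀ k → g k ≡ h k) → Primitive m g → Primitive m h
    Primitive-cong m e pr k 0<k k<m per = pr k 0<k k<m (λ t → trans (e (k + t)) (trans (per t) (sym (e t))))

    Lyndon⇒Primitive : ∀ m {g} → Lyndon m g → Primitive m g
    Lyndon⇒Primitive m ly k 0<k k<m e = <-irrefl (sym (code-cong m e)) (ly k 0<k k<m)

    module _ {m : ℕ} .{{_ : NonZero m}} where

      wrap-around : ∀ {g : ℕ → Fin L} → Periodic m g → ∀ {k} → k ≤ m → ∀ t → g (k + (m ∸ k + t)) ≡ g t
      wrap-around {g} p {k} k≤m t = trans (cong g (trans (sym (+-assoc k (m ∸ k) t)) (cong (_+ t) (m+[n∸m]≡n k≤m)))) (p t)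

      Primitive-shift : ∀ {g : ℕ → Fin L} → Periodic m g → ∀ k → k < m → Primitive m g → Primitive m (shift k g)
      Primitive-shift {g} p k k<m pr j 0<j j<m e = pr j 0<j j<m (λ t → begin
        g (j + t)                             ≡⟨ wrap-around p (<⇒≤ k<m) (j + t) ⟨
        g (k + (m ∸ k + (j + t)))             ≡⟨ cong (λ z → g (k + z)) (lem t) ⟩
        g (k + (j + (m ∸ k + t)))             ≡⟨ e (m ∸ k + t) ⟩
        g (k + (m ∸ k + t))                   ≡⟨ wrap-around p (<⇒≤ k<m) t ⟩
        g t                                   ∎)
        where
        open ≡-Reasoning
        lem : ∀ t → m ∸ k + (j + t) ≡ j + (m ∸ k + t)
        lem t = trans (sym (+-assoc (m ∸ k) j t)) (trans (cong (_+ t) (+-comm (m ∸ k) j)) (+-assoc j (m ∸ k) t))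

      private
        -- With k < k′ each of `g` and `h` is a proper rotation of the other, by k′ ∸ k and by m
        -- minus that, so each code would be strictly below the other.
        no-smaller : ∀ {g h : ℕ → Fin L} → Periodic m g → Periodic m h → Lyndon m g → Lyndon m h →
          ∀ {k k′} → k < m → k′ < m → (∀ t → g (k + t) ≡ h (k′ + t)) → ¬ k < k′
        no-smaller {g} {h} p q lg lh {k} {k′} k<m k′<m e k<k′ =
          <-asym (subst (code m h <_) (sym (code-cong m g≗)) (lh e′ 0<e′ e′<m))
                 (subst (code m g <_) (sym (code-cong m h≗)) (lg (m ∸ e′) (m<n⇒0<n∸m e′<m) (∸-monoʳ-< 0<e′ (<⇒≤ e′<m))))
          where
          open ≡-Reasoning
          e′ = k′ ∸ k
          0<e′ : 0 < e′
          0<e′ = m<n⇒0<n∸m k<k′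
          e′<m : e′ < m
          e′<m = ≤-<-trans (m∸n≤m k′ k) k′<m
          lem : ∀ t → k′ + (m ∸ k + t) ≡ m + (e′ + t)
          lem t = begin
            k′ + (m ∸ k + t)             ≡⟨ cong (_+ (m ∸ k + t)) (sym (m+[n∸m]≡n (<⇒≤ k<k′))) ⟩
            (k + e′) + (m ∸ k + t)       ≡⟨ cong (_+ (m ∸ k + t)) (+-comm k e′) ⟩
            (e′ + k) + (m ∸ k + t)       ≡⟨ +-assoc e′ k _ ⟩
            e′ + (k + (m ∸ k + t))       ≡⟨ cong (e′ +_) (+-assoc k (m ∸ k) t) ⟨
            e′ + (k + (m ∸ k) + t)       ≡⟨ cong (λ z → e′ + (z + t)) (m+[n∸m]≡n (<⇒≤ k<m)) ⟩
            e′ + (m + t)                 ≡⟨ +-assoc e′ m t ⟨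
            e′ + m + t                   ≡⟨ cong (_+ t) (+-comm e′ m) ⟩
            m + e′ + t                   ≡⟨ +-assoc m e′ t ⟩
            m + (e′ + t)                 ∎
          g≗ : ∀ t → g t ≡ h (e′ + t)
          g≗ t = begin
            g t                      ≡⟨ wrap-around p (<⇒≤ k<m) t ⟨
            g (k + (m ∸ k + t))      ≡⟨ e (m ∸ k + t) ⟩
            h (k′ + (m ∸ k + t))     ≡⟨ cong h (lem t) ⟩
            h (m + (e′ + t))         ≡⟨ q (e′ + t) ⟩
            h (e′ + t)               ∎
          h≗ : ∀ t → h t ≡ g (m ∸ e′ + t)
          h≗ t = trans (sym (wrap-around q (<⇒≤ e′<m) t)) (sym (g≗ (m ∸ e′ + t)))

      Lyndon-unique : ∀ {g h : ℕ → Fin L} → Periodic m g → Periodic m h → Lyndon m g → Lyndon m h →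
        ∀ {k k′} → k < m → k′ < m → (∀ t → g (k + t) ≡ h (k′ + t)) → k ≡ k′ × (∀ t → g t ≡ h t)
      Lyndon-unique {g} {h} p q lg lh {k} {k′} k<m k′<m e = k≡k′ , λ t → begin
        g t                    ≡⟨ wrap-around p (<⇒≤ k<m) t ⟨
        g (k + (m ∸ k + t))    ≡⟨ e (m ∸ k + t) ⟩
        h (k′ + (m ∸ k + t))   ≡⟨ cong (λ z → h (z + (m ∸ k + t))) k≡k′ ⟨
        h (k + (m ∸ k + t))    ≡⟨ wrap-around q (<⇒≤ k<m) t ⟩
        h t                    ∎
        where
        open ≡-Reasoning
        k≡k′ : k ≡ k′
        k≡k′ = ≤-antisym (≮⇒≥ (no-smaller q p lh lg k′<m k<m (sym ∘ e))) (≮⇒≥ (no-smaller p q lg lh k<m k′<m e))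

      private
        at-top : ∀ {n j} {B : Set} → (j < suc n → B) → (j ≡ suc n → B) → j < suc (suc n) → B
        at-top f g (s≤s j≤) with m≤n⇒m<n∨m≡n j≤
        ... | inj₁ a = f a
        ... | inj₂ b = g b

        argmin : ∀ n (c : ℕ → ℕ) → ∃ λ k → k < suc n × (∀ j → j < suc n → c k ≤ c j)
        argmin zero c = 0 , s≤s z≤n , λ { zero _ → ≤-refl ; (suc _) (s≤s ()) }
        argmin (suc n) c with argmin n c
        ... | k , k< , min with c (suc n) <? c k
        ...   | yes lt = suc n , ≤-refl , λ j → at-top (λ j<′ → ≤-trans (<⇒≤ lt) (min j j<′)) (λ { refl → ≤-refl })
        ...   | no ¬lt = k , m≤n⇒m≤1+n k< , λ j → at-top (min j) (λ { refl → ≮⇒≥ ¬lt })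

      -- The rotation with the least code is Lyndon, since a tie with another rotation would give a
      -- proper period.
      Lyndon-exists : ∀ {g : ℕ → Fin L} → Periodic m g → Primitive m g → ∃ λ k → k < m × Lyndon m (shift k g)
      Lyndon-exists {g} p pr = find m refl
        where
        find : ∀ n → n ≡ m → ∃ λ k → k < m × Lyndon m (shift k g)
        find zero e = ⊥-elim (≢-nonZero⁻¹ m (sym e))
        find (suc n) refl with argmin n (λ k → code m (shift k g))
        ... | k , k<m , min = k , k<m , λ j 0<j j<m → ≤∧≢⇒< (least j) (λ eq →
                Primitive-shift p k k<m pr j 0<j j<m (λ t → sym (code≡⇒≗ (shift-periodic p k)
                  (shift-periodic (shift-periodic p k) j) eq t)))
          where
          least : ∀ j → code m (shift k g) ≤ code m (shift j (shift k g))
          -- `min` covers rotations by less than m only, so k + j is reduced modulo m.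
          least j = ≤-trans (min ((k + j) % m) (m%n<n (k + j) m)) (≤-reflexive (code-cong m (λ t →
            trans (periodic-shift-% p (k + j) t) (cong g (+-assoc k j t)))))

-- Filled permutations and Lyndon families: each determines the other.

module Unfolding where

  open FiniteSums
  open Fillings
  open Periodic
  open import Defs
  open import Data.Bool using (Bool; true; false; _∧_; _∨_; T)
  open import Data.Bool.Properties using (T-∧; T-∨)
  open import Data.Empty using (⊥-elim)
  open import Data.Nat
  open import Data.Nat.Properties
  open import Data.Nat.DivMod
  open import Data.Fin as Fin using (Fin; toℕ; fromℕ<; zero; suc; inject₁; combine; remQuot; punchOut)
  open import Data.Fin.Properties as Finₚ using (toℕ<n; toℕ-injective; toℕ-fromℕ<; toℕ-inject₁; combine-remQuot; any?; punchOut-injective; injective⇒≤)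
  open import Data.List as List using (List; []; _∷_; allFin; length)
  open import Data.List.Properties using (length-tabulate)
  open import Data.List.Membership.Propositional using (_∈_)
  open import Data.List.Membership.Propositional.Properties using (∈-allFin)
  open import Data.List.Relation.Unary.Any as Any using (here; there)
  open import Data.List.Relation.Unary.AllPairs as AllPairs using ([]; _∷_)
  open import Data.Vec as Vec using (Vec; []; _∷_; lookup)
  open import Data.Product using (∃; ∃₂; _×_; _,_; proj₁; proj₂)
  open import Data.Sum using (_⊎_; inj₁; inj₂)
  open import Function using (_∘_; id; Equivalence)
  open import Relation.Nullary using (¬_; yes; no)
  open import Relation.Binary using (tri<; tri≈; tri>)
  open import Relation.Binary.PropositionalEquality

  count-≤ : {A : Set} {p q : A → Bool} (xs : List A) → (∀ x → T (p x) → T (q x)) → count p xs ≤ count q xs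
  count-≤ [] h = z≤n
  count-≤ {p = p} {q} (x ∷ xs) h with p x | q x | h x
  ... | true  | true  | _ = s≤s (count-≤ xs h)
  ... | true  | false | f = ⊥-elim (f _)
  ... | false | true  | _ = m≤n⇒m≤1+n (count-≤ xs h)
  ... | false | false | _ = count-≤ xs h

  count-< : {A : Set} {p q : A → Bool} (xs : List A) → (∀ x → T (p x) → T (q x)) →
    ∀ {y} → y ∈ xs → ¬ T (p y) → T (q y) → count p xs < count q xs
  count-< {p = p} {q} (x ∷ xs) h (here refl) ¬py qy with p x | q x
  ... | true  | _    = ⊥-elim (¬py _)
  ... | false | true = s≤s (count-≤ xs h)
  count-< {p = p} {q} (x ∷ xs) h (there y∈) ¬py qy with p x | q x | h x
  ... | true  | true  | _ = s≤s (count-< xs h y∈ ¬py qy)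
  ... | true  | false | f = ⊥-elim (f _)
  ... | false | true  | _ = m≤n⇒m≤1+n (count-< xs h y∈ ¬py qy)
  ... | false | false | _ = count-< xs h y∈ ¬py qy

  count-true : {A : Set} (xs : List A) → count (λ _ → true) xs ≡ length xs
  count-true [] = refl
  count-true (x ∷ xs) = cong suc (count-true xs)

  module Rank {n : ℕ} (K : Fin n → ℕ) where

    -- Sorting by keys: counting the smaller keys gives the position directly.
    rankℕ : Fin n → ℕ
    rankℕ x = count (λ y → K y <ᵇ K x) (allFin n)

    rankℕ<n : ∀ x → rankℕ x < n
    rankℕ<n x = subst (rankℕ x <_) (trans (count-true (allFin n)) (length-tabulate id))
      (count-< (allFin n) (λ _ _ → _) (∈-allFin x) (λ t → <-irrefl refl (<ᵇ⇒< (K x) (K x) t)) _)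

    rank : Fin n → Fin n
    rank x = fromℕ< (rankℕ<n x)

    rank-mono : ∀ {x y} → K x < K y → rank x Fin.< rank y
    rank-mono {x} {y} lt = subst₂ _<_ (sym (toℕ-fromℕ< _)) (sym (toℕ-fromℕ< _))
      (count-< (allFin n) (λ z t → <⇒<ᵇ (<-trans (<ᵇ⇒< (K z) (K x) t) lt)) (∈-allFin x)
        (λ t → <-irrefl refl (<ᵇ⇒< (K x) (K x) t)) (<⇒<ᵇ lt))

  injective⇒onto : ∀ {n} (f : Fin n → Fin n) → (∀ {i j} → f i ≡ f j → i ≡ j) → ∀ i → ∃ λ x → f x ≡ i
  injective⇒onto {suc n} f inj i with any? (λ x → f x Finₚ.≟ i)
  ... | yes p = p
  ... | no ¬p = ⊥-elim (1+n≰n (injective⇒≤ {f = λ x → punchOut {i = i} {j = f x} (λ e → ¬p (x , sym e))}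
      (λ {x} {y} e → inj (punchOut-injective {i = i} (λ e′ → ¬p (x , sym e′)) (λ e′ → ¬p (y , sym e′)) e))))

  -- Applied to an increasing map and to its increasing inverse, it forces the identity: a finite
  -- chain has no other automorphism.
  mono⇒inflationary : ∀ {n} (e : Fin n → Fin n) → (∀ {i j} → i Fin.< j → e i Fin.< e j) → ∀ i → toℕ i ≤ toℕ (e i)
  mono⇒inflationary e mono i = bounded (toℕ i) i refl
    where
    bounded : ∀ k i → toℕ i ≡ k → k ≤ toℕ (e i)
    bounded zero i eq = z≤n
    bounded (suc k) (suc i) eq = ≤-trans (s≤s (bounded k (inject₁ i) (trans (toℕ-inject₁ i) (suc-injective eq))))
      (mono {inject₁ i} {suc i} (s≤s (≤-reflexive (toℕ-inject₁ i))))

  Lex : {L : ℕ} → Fin L → ℕ → Fin L → ℕ → Set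
  Lex c x d y = toℕ c < toℕ d ⊎ (c ≡ d × x < y)

  Lex-trans : ∀ {L} {c d e : Fin L} {x y z} → Lex c x d y → Lex d y e z → Lex c x e z
  Lex-trans (inj₁ a) (inj₁ b) = inj₁ (<-trans a b)
  Lex-trans (inj₁ a) (inj₂ (refl , _)) = inj₁ a
  Lex-trans (inj₂ (refl , _)) (inj₁ b) = inj₁ b
  Lex-trans (inj₂ (refl , a)) (inj₂ (refl , b)) = inj₂ (refl , <-trans a b)

  lexStep⁻ : ∀ {L} (c : Fin L) x d y → T (lexStep c x d y) → Lex c x d y
  lexStep⁻ c x d y t with Equivalence.to (T-∨ {toℕ c <ᵇ toℕ d}) t
  ... | inj₁ a = inj₁ (<ᵇ⇒< (toℕ c) (toℕ d) a)
  ... | inj₂ b with Equivalence.to (T-∧ {toℕ c ≡ᵇ toℕ d}) b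
  ...   | e , l = inj₂ (toℕ-injective (≡ᵇ⇒≡ (toℕ c) (toℕ d) e) , <ᵇ⇒< x y l)

  lexStep⁺ : ∀ {L} (c : Fin L) x d y → Lex c x d y → T (lexStep c x d y)
  lexStep⁺ c x d y (inj₁ a) = Equivalence.from (T-∨ {toℕ c <ᵇ toℕ d}) (inj₁ (<⇒<ᵇ a))
  lexStep⁺ c x d y (inj₂ (refl , l)) = Equivalence.from (T-∨ {toℕ c <ᵇ toℕ d})
    (inj₂ (Equivalence.from (T-∧ {toℕ c ≡ᵇ toℕ d}) (≡⇒≡ᵇ (toℕ c) (toℕ c) refl , <⇒<ᵇ l)))

  lexInc⁻ : ∀ {L n} (f : Vec (Fin L) n) (w : Vec ℕ n) → T (lexInc f w) →
    ∀ i j → i Fin.< j → Lex (lookup f i) (lookup w i) (lookup f j) (lookup w j)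
  lexInc⁻ (c ∷ []) (x ∷ []) t zero zero ()
  lexInc⁻ (c ∷ d ∷ f) (x ∷ y ∷ w) t i j lt with Equivalence.to (T-∧ {lexStep c x d y}) t
  lexInc⁻ (c ∷ d ∷ f) (x ∷ y ∷ w) t zero (suc zero) lt | s , u = lexStep⁻ c x d y s
  lexInc⁻ (c ∷ d ∷ f) (x ∷ y ∷ w) t zero (suc (suc j)) lt | s , u =
    Lex-trans (lexStep⁻ c x d y s) (lexInc⁻ (d ∷ f) (y ∷ w) u zero (suc j) (s≤s z≤n))
  lexInc⁻ (c ∷ d ∷ f) (x ∷ y ∷ w) t (suc i) (suc j) (s≤s lt) | s , u = lexInc⁻ (d ∷ f) (y ∷ w) u i j lt

  lexInc⁺ : ∀ {L n} (f : Vec (Fin L) n) (w : Vec ℕ n) →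
    (∀ i j → i Fin.< j → Lex (lookup f i) (lookup w i) (lookup f j) (lookup w j)) → T (lexInc f w)
  lexInc⁺ [] [] h = _
  lexInc⁺ (c ∷ []) (x ∷ []) h = _
  lexInc⁺ (c ∷ d ∷ f) (x ∷ y ∷ w) h = Equivalence.from (T-∧ {lexStep c x d y})
    (lexStep⁺ c x d y (h zero (suc zero) (s≤s z≤n)) , lexInc⁺ (d ∷ f) (y ∷ w) (λ i j lt → h (suc i) (suc j) (s≤s lt)))

  iter-+ : ∀ {N} (v : Vec (Fin N) N) a c i → iter v (a + c) i ≡ iter v a (iter v c i)
  iter-+ v zero c i = refl
  iter-+ v (suc a) c i = cong (lookup v) (iter-+ v a c i)

  iter-comm : ∀ {N} (v : Vec (Fin N) N) a c i → iter v a (iter v c i) ≡ iter v c (iter v a i)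
  iter-comm v a c i = trans (sym (iter-+ v a c i)) (trans (cong (λ k → iter v k i) (+-comm a c)) (iter-+ v c a i))

  module _ {L m : ℕ} .{{m≢0 : NonZero m}} where
    open Code {L}

    record FilledCycles {N : ℕ} (v : Vec (Fin N) N) (f : Vec (Fin L) N) : Set where
      field
        cycle : ∀ i → iter v m i ≡ i
        short : ∀ i k → 0 < k → k < m → iter v k i ≢ i
        lex   : ∀ i j → i Fin.< j → Lex (lookup f i) (toℕ (lookup v i)) (lookup f j) (toℕ (lookup v j))

    -- A multiset of `r` primitive necklaces: each necklace by its Lyndon representative, the
    -- multiset by its sorted listing.
    record LyndonFamily {r : ℕ} (w : Fin r → ℕ → Fin L) : Set where
      field
        periodic : ∀ j → Periodic m (w j)
        lyndon   : ∀ j → Lyndon m (w j)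
        sorted   : ∀ {i j} → i Fin.≤ j → code m (w i) ≤ code m (w j)

    -- Elements (k , j) are ordered by the word read off from them, ties being broken by j.
    Before : {r : ℕ} (w : Fin r → ℕ → Fin L) → ℕ → Fin r → ℕ → Fin r → Set
    Before w k j k′ j′ = code m (shift k (w j)) < code m (shift k′ (w j′))
      ⊎ (code m (shift k (w j)) ≡ code m (shift k′ (w j′)) × j Fin.< j′)

    -- `P k j` is the position carrying letter `k` of word `j`, with `k` unbounded so that `step`
    -- has no special case at the end of a word. A relation rather than a map, because the two sides
    -- are built from each other by quite different constructions.
    record Unfolds {N r : ℕ} (v : Vec (Fin N) N) (f : Vec (Fin L) N) (w : Fin r → ℕ → Fin L) : Set where
      field
        P      : ℕ → Fin r → Fin N
        step   : ∀ k j → lookup v (P k j) ≡ P (suc k) j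
        wrap   : ∀ j → P m j ≡ P 0 j
        letter : ∀ k j → lookup f (P k j) ≡ w j k
        onto   : ∀ i → ∃₂ λ k j → k < m × P k j ≡ i
        order  : ∀ k j k′ j′ → k < m → k′ < m → Before w k j k′ j′ → P k j Fin.< P k′ j′

      iter-P : ∀ t k j → iter v t (P k j) ≡ P (t + k) j
      iter-P zero k j = refl
      iter-P (suc t) k j = trans (cong (lookup v) (iter-P t k j)) (step (t + k) j)

    Unfolds-cong : ∀ {N r} {v : Vec (Fin N) N} {f : Vec (Fin L) N} {w w′ : Fin r → ℕ → Fin L} →
      (∀ j k → w j k ≡ w′ j k) → Unfolds v f w → Unfolds v f w′
    Unfolds-cong {w = w} {w′} e u = record
      { P = P ; step = step ; wrap = wrap ; onto = onto
      ; letter = λ k j → trans (letter k j) (e j k)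
      ; order = λ k j k′ j′ k< k′< b → order k j k′ j′ k< k′< (back k j k′ j′ b) }
      where
      open Unfolds u
      c≡ : ∀ k j → code m (shift k (w j)) ≡ code m (shift k (w′ j))
      c≡ k j = code-cong m (λ t → e j (k + t))
      back : ∀ k j k′ j′ → Before w′ k j k′ j′ → Before w k j k′ j′
      back k j k′ j′ (inj₁ lt) = inj₁ (subst₂ _<_ (sym (c≡ k j)) (sym (c≡ k′ j′)) lt)
      back k j k′ j′ (inj₂ (eq , lt)) = inj₂ (trans (c≡ k j) (trans eq (sym (c≡ k′ j′))) , lt)

    module _ {r : ℕ} {w : Fin r → ℕ → Fin L} (W : LyndonFamily w) where
      open LyndonFamily W

      -- By `Lyndon-unique`, ties in `Before` occur only at equal rotations of repeated members of
      -- the multiset.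
      code-tie : ∀ {k j k′ j′} → k < m → k′ < m → code m (shift k (w j)) ≡ code m (shift k′ (w j′)) →
        k ≡ k′ × (∀ t → w j t ≡ w j′ t)
      code-tie {k} {j} {k′} {j′} k<m k′<m e = Lyndon-unique (periodic j) (periodic j′) (lyndon j) (lyndon j′) k<m k′<m
        (code≡⇒≗ (shift-periodic (periodic j) k) (shift-periodic (periodic j′) k′) e)

      before-cmp : ∀ k j k′ j′ → k < m → k′ < m → (k ≡ k′ × j ≡ j′) ⊎ (Before w k j k′ j′ ⊎ Before w k′ j′ k j)
      before-cmp k j k′ j′ k< k′< with <-cmp (code m (shift k (w j))) (code m (shift k′ (w j′)))
      ... | tri< a _ _ = inj₂ (inj₁ (inj₁ a))
      ... | tri> _ _ c = inj₂ (inj₂ (inj₁ c))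
      ... | tri≈ _ e _ with <-cmp (toℕ j) (toℕ j′)
      ...   | tri< a _ _ = inj₂ (inj₁ (inj₂ (e , a)))
      ...   | tri> _ _ c = inj₂ (inj₂ (inj₂ (sym e , c)))
      ...   | tri≈ _ e′ _ = inj₁ (proj₁ (code-tie k< k′< e) , toℕ-injective e′)

      module _ {N : ℕ} {v : Vec (Fin N) N} {f : Vec (Fin L) N} (u : Unfolds v f w) where
        open Unfolds u

        order⁻ : ∀ {k j k′ j′} → k < m → k′ < m → P k j Fin.< P k′ j′ → Before w k j k′ j′
        order⁻ {k} {j} {k′} {j′} k< k′< lt with before-cmp k j k′ j′ k< k′<
        ... | inj₁ (refl , refl) = ⊥-elim (<-irrefl refl lt)
        ... | inj₂ (inj₁ b) = b
        ... | inj₂ (inj₂ b) = ⊥-elim (<-asym lt (order k′ j′ k j k′< k< b))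

        P-injective : ∀ {k j k′ j′} → k < m → k′ < m → P k j ≡ P k′ j′ → k ≡ k′ × j ≡ j′
        P-injective {k} {j} {k′} {j′} k< k′< e with before-cmp k j k′ j′ k< k′<
        ... | inj₁ p = p
        ... | inj₂ (inj₁ b) = ⊥-elim (<-irrefl (cong toℕ e) (order k j k′ j′ k< k′< b))
        ... | inj₂ (inj₂ b) = ⊥-elim (<-irrefl (cong toℕ (sym e)) (order k′ j′ k j k′< k< b))

        -- Pairs (k , j) and positions correspond one to one; injections in both directions compare
        -- the cardinalities.
        size : N ≡ m * r
        size = ≤-antisym (injective⇒≤ {f = g} g-inj) (injective⇒≤ {f = h} h-inj)
          where
          g : Fin N → Fin (m * r)
          g i = let k , j , k<m , _ = onto i in combine (fromℕ< k<m) j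
          g-inj : ∀ {i i′} → g i ≡ g i′ → i ≡ i′
          g-inj {i} {i′} e with onto i | onto i′
          ... | k , j , k< , p | k′ , j′ , k′< , p′ with Finₚ.combine-injective (fromℕ< k<) j (fromℕ< k′<) j′ e
          ...   | e₁ , refl = trans (sym p) (trans (cong (λ z → P z j)
                   (trans (sym (toℕ-fromℕ< k<)) (trans (cong toℕ e₁) (toℕ-fromℕ< k′<)))) p′)
          h : Fin (m * r) → Fin N
          h x = let k , j = remQuot r x in P (toℕ k) j
          h-inj : ∀ {x y} → h x ≡ h y → x ≡ y
          h-inj {x} {y} e with P-injective (toℕ<n (proj₁ (remQuot {m} r x))) (toℕ<n (proj₁ (remQuot {m} r y))) e
          ... | e₁ , e₂ = trans (sym (combine-remQuot {m} r x))
                (trans (cong₂ combine (toℕ-injective e₁) e₂) (combine-remQuot {m} r y))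

    -- The order on the elements (k , j) determines their positions, hence the structure.
    unfolds-injective : ∀ {N r} {v v′ : Vec (Fin N) N} {f f′ : Vec (Fin L) N} {w : Fin r → ℕ → Fin L} →
      LyndonFamily w → Unfolds v f w → Unfolds v′ f′ w → (∀ i → lookup v i ≡ lookup v′ i) × (∀ i → lookup f i ≡ lookup f′ i)
    unfolds-injective {N} {r} {v} {v′} {f} {f′} {w} W u u′ = same-v , same-f
      where
      module U = Unfolds u
      module U′ = Unfolds u′
      e : Fin N → Fin N
      e i = let k , j , _ = U.onto i in U′.P k j
      e′ : Fin N → Fin N
      e′ i = let k , j , _ = U′.onto i in U.P k j
      e-mono : ∀ {i j} → i Fin.< j → e i Fin.< e j
      e-mono {a} {c} lt with U.onto a | U.onto c
      ... | k , j , k< , refl | k′ , j′ , k′< , refl = U′.order k j k′ j′ k< k′< (order⁻ W u k< k′< lt)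
      e′-mono : ∀ {i j} → i Fin.< j → e′ i Fin.< e′ j
      e′-mono {a} {c} lt with U′.onto a | U′.onto c
      ... | k , j , k< , refl | k′ , j′ , k′< , refl = U.order k j k′ j′ k< k′< (order⁻ W u′ k< k′< lt)
      e′∘e : ∀ i → e′ (e i) ≡ i
      e′∘e i with U.onto i
      ... | k , j , k< , p with U′.onto (U′.P k j)
      ...   | k′ , j′ , k′< , p′ with P-injective W u′ k′< k< p′
      ...     | refl , refl = p
      e-id : ∀ i → e i ≡ i
      e-id i = toℕ-injective (≤-antisym (≤-trans (mono⇒inflationary e′ e′-mono (e i)) (≤-reflexive (cong toℕ (e′∘e i))))
        (mono⇒inflationary e e-mono i))
      P≡ : ∀ k j → k < m → U.P k j ≡ U′.P k j
      P≡ k j k< with e-id (U.P k j)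
      ... | q with U.onto (U.P k j)
      ...   | k′ , j′ , k′< , p with P-injective W u k′< k< p
      ...     | refl , refl = sym q
      P≡-suc : ∀ k j → k < m → U.P (suc k) j ≡ U′.P (suc k) j
      P≡-suc k j k< with m≤n⇒m<n∨m≡n k<
      ... | inj₁ lt = P≡ (suc k) j lt
      ... | inj₂ refl = trans (U.wrap j) (trans (P≡ 0 j (≤-<-trans z≤n k<)) (sym (U′.wrap j)))
      same-v : ∀ i → lookup v i ≡ lookup v′ i
      same-v i with U.onto i
      ... | k , j , k< , refl = trans (U.step k j) (trans (P≡-suc k j k<)
            (trans (sym (U′.step k j)) (cong (lookup v′) (sym (P≡ k j k<)))))
      same-f : ∀ i → lookup f i ≡ lookup f′ i
      same-f i with U.onto i
      ... | k , j , k< , refl = trans (U.letter k j) (trans (sym (U′.letter k j)) (cong (lookup f′) (sym (P≡ k j k<))))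

    -- The first elements P 0 j are exactly the elements whose itinerary is a Lyndon word.
    unfolds-deterministic : ∀ {N r} {v : Vec (Fin N) N} {f : Vec (Fin L) N} {w w′ : Fin r → ℕ → Fin L} →
      LyndonFamily w → LyndonFamily w′ → Unfolds v f w → Unfolds v f w′ → ∀ j t → w j t ≡ w′ j t
    unfolds-deterministic {N} {r} {v} {f} {w} {w′} W W′ u u′ j t =
      trans (proj₂ (proj₂ (match W W′ u u′ j)) t) (cong (λ z → w′ z t) e-id)
      where
      0<m : 0 < m
      0<m = >-nonZero⁻¹ m
      match : ∀ {w w′ : Fin r → ℕ → Fin L} → LyndonFamily w → LyndonFamily w′ →
        (u : Unfolds v f w) (u′ : Unfolds v f w′) (j : Fin r) →
        ∃ λ j′ → Unfolds.P u 0 j ≡ Unfolds.P u′ 0 j′ × (∀ t → w j t ≡ w′ j′ t)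
      match {w} {w′} W W′ u u′ j with Unfolds.onto u′ (Unfolds.P u 0 j)
      ... | k , j′ , k< , p = j′ , same-start , proj₂ both
        where
        module U = Unfolds u
        module U′ = Unfolds u′
        both : 0 ≡ k × (∀ t → w j t ≡ w′ j′ t)
        both = Lyndon-unique (LyndonFamily.periodic W j) (LyndonFamily.periodic W′ j′)
          (LyndonFamily.lyndon W j) (LyndonFamily.lyndon W′ j′) 0<m k< (λ t → begin
          w j t                          ≡⟨ U.letter t j ⟨
          lookup f (U.P t j)             ≡⟨ cong (λ z → lookup f (U.P z j)) (+-identityʳ t) ⟨
          lookup f (U.P (t + 0) j)       ≡⟨ cong (lookup f) (U.iter-P t 0 j) ⟨
          lookup f (iter v t (U.P 0 j))  ≡⟨ cong (λ z → lookup f (iter v t z)) p ⟨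
          lookup f (iter v t (U′.P k j′)) ≡⟨ cong (lookup f) (U′.iter-P t k j′) ⟩
          lookup f (U′.P (t + k) j′)     ≡⟨ U′.letter (t + k) j′ ⟩
          w′ j′ (t + k)                  ≡⟨ cong (w′ j′) (+-comm t k) ⟩
          w′ j′ (k + t)                  ∎)
          where open ≡-Reasoning
        same-start : U.P 0 j ≡ U′.P 0 j′
        same-start = trans (sym p) (cong (λ z → U′.P z j′) (sym (proj₁ both)))
      start-mono : ∀ {w : Fin r → ℕ → Fin L} → LyndonFamily w → (u : Unfolds v f w) →
        ∀ {i j} → i Fin.< j → Unfolds.P u 0 i Fin.< Unfolds.P u 0 j
      start-mono W u {i} {j} lt with m≤n⇒m<n∨m≡n (LyndonFamily.sorted W (<⇒≤ lt))
      ... | inj₁ c< = Unfolds.order u 0 i 0 j 0<m 0<m (inj₁ c<)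
      ... | inj₂ c≡ = Unfolds.order u 0 i 0 j 0<m 0<m (inj₂ (c≡ , lt))
      start-mono⁻ : ∀ {w : Fin r → ℕ → Fin L} → LyndonFamily w → (u : Unfolds v f w) →
        ∀ {i j} → Unfolds.P u 0 i Fin.< Unfolds.P u 0 j → i Fin.< j
      start-mono⁻ W u {i} {j} lt with <-cmp (toℕ i) (toℕ j)
      ... | tri< a _ _ = a
      ... | tri≈ _ e _ rewrite toℕ-injective e = ⊥-elim (<-irrefl refl lt)
      ... | tri> _ _ c = ⊥-elim (<-asym lt (start-mono W u c))
      match-mono : ∀ {w w′ : Fin r → ℕ → Fin L} (W : LyndonFamily w) (W′ : LyndonFamily w′)
        (u : Unfolds v f w) (u′ : Unfolds v f w′) {i j : Fin r} → i Fin.< j →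
        proj₁ (match W W′ u u′ i) Fin.< proj₁ (match W W′ u u′ j)
      match-mono W W′ u u′ {i} {j} lt = start-mono⁻ W′ u′ (subst₂ Fin._<_
        (proj₁ (proj₂ (match W W′ u u′ i))) (proj₁ (proj₂ (match W W′ u u′ j))) (start-mono W u lt))
      e e′ : Fin r → Fin r
      e i = proj₁ (match W W′ u u′ i)
      e′ i = proj₁ (match W′ W u′ u i)
      e′∘e : e′ (e j) ≡ j
      e′∘e = proj₂ (P-injective W u 0<m 0<m (sym (trans (proj₁ (proj₂ (match W W′ u u′ j)))
        (proj₁ (proj₂ (match W′ W u′ u (e j)))))))
      e-id : e j ≡ j
      e-id = toℕ-injective (≤-antisym
        (≤-trans (mono⇒inflationary e′ (match-mono W′ W u′ u) (e j)) (≤-reflexive (cong toℕ e′∘e)))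
        (mono⇒inflationary e (match-mono W W′ u u′) j))

-- From itineraries to Lyndon families and back.

module Cycles where

  open FiniteSums
  open Fillings
  open Periodic
  open Unfolding
  open import Defs
  open import Data.Bool using (Bool; _∨_; not; T)
  open import Data.Empty using (⊥; ⊥-elim)
  open import Data.Nat
  open import Data.Nat.Properties
  open import Data.Nat.DivMod
  open import Data.Fin as Fin using (Fin; toℕ; zero; suc; combine; remQuot)
  open import Data.Fin.Properties as Finₚ using (toℕ<n; toℕ-injective; toℕ-fromℕ<; remQuot-combine; combine-remQuot)
  open import Data.List as List using (List; _∷_; upTo; allFin; length; filterᵇ)
  open import Data.List.Membership.Propositional using (_∈_)
  open import Data.List.Membership.Propositional.Properties using (∈-upTo⁺; ∈-upTo⁻; ∈-filter⁺; ∈-filter⁻; ∈-allFin; ∈-lookup)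
  import Data.List.Relation.Unary.Any as Any
  open import Data.List.Relation.Unary.All as All using (All)
  open import Data.List.Relation.Unary.AllPairs as AllPairs using (AllPairs; _∷_)
  import Data.List.Relation.Unary.AllPairs.Properties as AllPairsₚ
  import Data.List.Relation.Unary.Any.Properties as Anyₚ
  open import Data.Vec as Vec using (Vec; _∷_; lookup; tabulate)
  open import Data.Vec.Properties using (lookup∘tabulate)
  open import Data.Product using (∃; ∃₂; _×_; _,_; proj₁; proj₂)
  open import Data.Sum using (inj₁; inj₂)
  open import Function using (_∘_; id)
  open import Relation.Nullary.Decidable using (T?)
  open import Relation.Binary using (tri<; tri≈; tri>)
  open import Relation.Binary.PropositionalEquality

  AllPairs-lookup : {A : Set} {R : A → A → Set} {xs : List A} → AllPairs R xs →
    ∀ {i j} → i Fin.< j → R (List.lookup xs i) (List.lookup xs j)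
  AllPairs-lookup {xs = x ∷ xs} (a ∷ ps) {zero} {suc j} lt = All.lookup a (∈-lookup j)
  AllPairs-lookup (a ∷ ps) {suc i} {suc j} (s≤s lt) = AllPairs-lookup ps lt

  module _ {L : ℕ} where
    open Code {L}

    lyndonᵇ primitiveᵇ : ℕ → (ℕ → Fin L) → Bool
    lyndonᵇ m g = all (λ k → (k ≡ᵇ 0) ∨ (code m g <ᵇ code m (shift k g))) (upTo m)
    primitiveᵇ m g = all (λ k → (k ≡ᵇ 0) ∨ not (code m (shift k g) ≡ᵇ code m g)) (upTo m)

    lyndonᵇ⁻ : ∀ m {g} → T (lyndonᵇ m g) → Lyndon m g
    lyndonᵇ⁻ m {g} t (suc k) 0<k k<m = <ᵇ⇒< (code m g) (code m (shift (suc k) g)) (all⁻ (upTo m) t (∈-upTo⁺ k<m))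

    lyndonᵇ⁺ : ∀ m {g} → Lyndon m g → T (lyndonᵇ m g)
    lyndonᵇ⁺ m {g} ly = all⁺ (upTo m) go
      where
      go : ∀ {k} → k ∈ upTo m → T ((k ≡ᵇ 0) ∨ (code m g <ᵇ code m (shift k g)))
      go {zero} _ = _
      go {suc k} k∈ = <⇒<ᵇ (ly (suc k) (s≤s z≤n) (∈-upTo⁻ k∈))

    primitiveᵇ⁻ : ∀ m .{{_ : NonZero m}} {g} → T (primitiveᵇ m g) → Primitive m g
    primitiveᵇ⁻ m {g} t (suc k) 0<k k<m e = T-not⁻ (all⁻ (upTo m) t (∈-upTo⁺ k<m))
      (≡⇒≡ᵇ (code m (shift (suc k) g)) (code m g) (code-cong m e))

    primitiveᵇ⁺ : ∀ m .{{_ : NonZero m}} {g} → Periodic m g → Primitive m g → T (primitiveᵇ m g)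
    primitiveᵇ⁺ m {g} p pr = all⁺ (upTo m) go
      where
      go : ∀ {k} → k ∈ upTo m → T ((k ≡ᵇ 0) ∨ not (code m (shift k g) ≡ᵇ code m g))
      go {zero} _ = _
      go {suc k} k∈ = T-not⁺ (λ t → pr (suc k) (s≤s z≤n) (∈-upTo⁻ k∈)
        (code≡⇒≗ (shift-periodic p (suc k)) p (≡ᵇ⇒≡ (code m (shift (suc k) g)) (code m g) t)))

  module _ {L m : ℕ} .{{m≢0 : NonZero m}} where
    open Code {L}

    module Itinerary {N : ℕ} {v : Vec (Fin N) N} {f : Vec (Fin L) N} (F : FilledCycles {L} {m} v f) where
      open FilledCycles F

      it : Fin N → ℕ → Fin L
      it i t = lookup f (iter v t i)

      iter-periodic : ∀ i → Periodic m (λ t → iter v t i)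
      iter-periodic i t = trans (iter-+ v m t i) (cycle (iter v t i))

      it-periodic : ∀ i → Periodic m (it i)
      it-periodic i t = cong (lookup f) (iter-periodic i t)

      it-iter : ∀ k i t → it (iter v k i) t ≡ it i (k + t)
      it-iter k i t = cong (lookup f) (trans (sym (iter-+ v t k i)) (cong (λ z → iter v z i) (+-comm t k)))

      -- Further to the right the letter is larger or equal; if equal, the permutation ascends on
      -- it, so the images are in order again and the argument repeats.
      code-monotone : ∀ n {i j} → i Fin.< j → code n (it i) ≤ code n (it j)
      code-monotone zero lt = z≤n
      code-monotone (suc n) {i} {j} lt with lex i j lt
      ... | inj₁ c< = <⇒≤ (code-head n {it i} {it j} c<)
      ... | inj₂ (c≡ , σ<) = +-mono-≤ (≤-reflexive (cong (λ z → toℕ z * L ^ n) c≡))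
          (subst₂ _≤_ (code-cong n (it-iter 1 i)) (code-cong n (it-iter 1 j)) (code-monotone n σ<))

      -- As long as the letters agree, the permutation preserves the order of the two positions.
      tie-monotone : ∀ {i j} → i Fin.< j → (∀ t → it i t ≡ it j t) → ∀ k → iter v k i Fin.< iter v k j
      tie-monotone lt e zero = lt
      tie-monotone {i} {j} lt e (suc k) with lex (iter v k i) (iter v k j) (tie-monotone lt e k)
      ... | inj₁ c< = ⊥-elim (<-irrefl (cong toℕ (e k)) c<)
      ... | inj₂ (_ , σ<) = σ<

      private
        multiples : ∀ k i → iter v (m * k) i ≡ i
        multiples k i = trans (cong (λ z → iter v z i) (trans (*-comm m k) (sym (+-identityʳ (k * m)))))
          (periodic-* {m = m} (iter-periodic i) k 0)

      -- A proper period `k` gives i and σ^k i the same itinerary. If i < σ^k i, then `tie-monotone`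
      -- yields i < σ^k i < σ^(2k) i < ..., and after m steps this chain is back at i; likewise for
      -- the opposite order. Equality is excluded by `short`.
      it-primitive : ∀ i → Primitive m (it i)
      it-primitive i k 0<k k<m e with <-cmp (toℕ i) (toℕ (iter v k i))
      ... | tri≈ _ q _ = short i k 0<k k<m (sym (toℕ-injective q))
      ... | tri< lt _ _ = climb m refl
        where
        up : ∀ j → i Fin.< iter v (suc j * k) i
        up zero = subst (λ z → i Fin.< iter v z i) (sym (+-identityʳ k)) lt
        up (suc j) = <-trans (up j) (subst (iter v (suc j * k) i Fin.<_)
          (trans (sym (iter-+ v (suc j * k) k i)) (cong (λ z → iter v z i) (+-comm (suc j * k) k)))
          (tie-monotone lt (λ t → sym (trans (it-iter k i t) (e t))) (suc j * k)))
        climb : ∀ n → n ≡ m → ⊥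
        climb zero q = ≢-nonZero⁻¹ m (sym q)
        climb (suc n) refl = <-irrefl (cong toℕ (sym (multiples k i))) (up n)
      ... | tri> _ _ gt = climb m refl
        where
        down : ∀ j → iter v (suc j * k) i Fin.< i
        down zero = subst (λ z → iter v z i Fin.< i) (sym (+-identityʳ k)) gt
        down (suc j) = <-trans (subst (Fin._< iter v (suc j * k) i)
          (trans (sym (iter-+ v (suc j * k) k i)) (cong (λ z → iter v z i) (+-comm (suc j * k) k)))
          (tie-monotone gt (λ t → trans (it-iter k i t) (e t)) (suc j * k))) (down j)
        climb : ∀ n → n ≡ m → ⊥
        climb zero q = ≢-nonZero⁻¹ m (sym q)
        climb (suc n) refl = <-irrefl (cong toℕ (multiples k i)) (down n)

      -- One element from each cycle, the one whose itinerary is Lyndon. Taken by position, their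
      -- words come out sorted.
      starts : List (Fin N)
      starts = filterᵇ (lyndonᵇ m ∘ it) (allFin N)

      start : Fin (length starts) → Fin N
      start = List.lookup starts

      start-lyndon : ∀ j → Lyndon m (it (start j))
      start-lyndon j = lyndonᵇ⁻ m (proj₂ (∈-filter⁻ (T? ∘ lyndonᵇ m ∘ it) {xs = allFin N} (∈-lookup j)))

      start-onto : ∀ i → Lyndon m (it i) → ∃ λ j → i ≡ start j
      start-onto i ly = Any.index i∈ , Anyₚ.lookup-index i∈
        where
        i∈ : i ∈ starts
        i∈ = ∈-filter⁺ (T? ∘ lyndonᵇ m ∘ it) (∈-allFin i) (lyndonᵇ⁺ m ly)

      start-mono : ∀ {i j} → i Fin.< j → start i Fin.< start j
      start-mono = AllPairs-lookup {R = Fin._<_} {xs = starts} (AllPairsₚ.filter⁺ (T? ∘ lyndonᵇ m ∘ it) (AllPairsₚ.tabulate⁺-< {f = id} id))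

      family : LyndonFamily {L} {m} (it ∘ start)
      family = record
        { periodic = it-periodic ∘ start
        ; lyndon = start-lyndon
        ; sorted = λ {i} {j} i≤j → sorted i j i≤j }
        where
        sorted : ∀ i j → i Fin.≤ j → code m (it (start i)) ≤ code m (it (start j))
        sorted i j i≤j with m≤n⇒m<n∨m≡n i≤j
        ... | inj₁ lt = code-monotone m (start-mono lt)
        ... | inj₂ e = ≤-reflexive (cong (code m ∘ it ∘ start) (toℕ-injective e))

      unfolds : Unfolds {L} {m} v f (it ∘ start)
      unfolds = record
        { P = λ k j → iter v k (start j)
        ; step = λ _ _ → refl
        ; wrap = λ j → cycle (start j)
        ; letter = λ _ _ → refl
        ; onto = onto
        ; order = order }
        where
        onto : ∀ i → ∃₂ λ k j → k < m × iter v k (start j) ≡ i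
        onto i with Lyndon-exists (it-periodic i) (it-primitive i)
        ... | k , k<m , ly with start-onto (iter v k i) (Lyndon-cong m (λ t → sym (it-iter k i t)) ly)
        ...   | j , e = (m ∸ k) % m , j , m%n<n (m ∸ k) m , (begin
          iter v ((m ∸ k) % m) (start j)   ≡⟨ periodic-% {m = m} (iter-periodic (start j)) (m ∸ k) ⟩
          iter v (m ∸ k) (start j)         ≡⟨ cong (iter v (m ∸ k)) e ⟨
          iter v (m ∸ k) (iter v k i)      ≡⟨ iter-+ v (m ∸ k) k i ⟨
          iter v (m ∸ k + k) i             ≡⟨ cong (λ z → iter v z i) (m∸n+n≡m (<⇒≤ k<m)) ⟩
          iter v m i                       ≡⟨ cycle i ⟩
          i                                ∎)
          where open ≡-Reasoning
        order : ∀ k j k′ j′ → k < m → k′ < m → Before {L} {m} (it ∘ start) k j k′ j′ →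
          iter v k (start j) Fin.< iter v k′ (start j′)
        order k j k′ j′ k< k′< (inj₂ (e , lt)) with code-tie family {k} {j} {k′} {j′} k< k′< e
        ... | refl , e′ = tie-monotone (start-mono lt) e′ k
        order k j k′ j′ k< k′< (inj₁ lt) with <-cmp (toℕ (iter v k (start j))) (toℕ (iter v k′ (start j′)))
        ... | tri< a _ _ = a
        ... | tri≈ _ e _ = ⊥-elim (<-irrefl (trans (sym (code-cong m (it-iter k (start j))))
                (trans (cong (code m ∘ it) (toℕ-injective e)) (code-cong m (it-iter k′ (start j′))))) lt)
        ... | tri> _ _ c = ⊥-elim (<⇒≱ lt (subst₂ _≤_ (code-cong m (it-iter k′ (start j′)))
                (code-cong m (it-iter k (start j))) (code-monotone m c)))

    -- The number of starts is not given in advance; counting positions forces it to be `r`.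
    unfold : ∀ {N r} {v : Vec (Fin N) N} {f : Vec (Fin L) N} → N ≡ m * r → FilledCycles {L} {m} v f →
      ∃ λ (w : Fin r → ℕ → Fin L) → LyndonFamily {L} {m} w × Unfolds {L} {m} v f w
    unfold {N} {r} N≡ F with *-cancelˡ-≡ _ r m (trans (sym (size (Itinerary.family F) (Itinerary.unfolds F))) N≡)
    ... | refl = it ∘ start , family , unfolds
      where open Itinerary F

    module Folding {r : ℕ} {w : Fin r → ℕ → Fin L} (W : LyndonFamily {L} {m} w) where
      open LyndonFamily W

      -- As j < r, a single number encodes the order `Before`: the code first, then `j`.
      pairKey : Fin m × Fin r → ℕ
      pairKey (k , j) = code m (shift (toℕ k) (w j)) * r + toℕ j

      key : Fin (m * r) → ℕ
      key x = pairKey (remQuot r x)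

      open Rank key

      -- Reducing `k` modulo m makes `P` periodic, so `step` also holds across the end of a word.
      pos : ℕ → Fin r → Fin (m * r)
      pos k j = combine (k mod m) j

      P : ℕ → Fin r → Fin (m * r)
      P k j = rank (pos k j)

      private
        toℕ-mod : ∀ k → toℕ (k mod m) ≡ k % m
        toℕ-mod k = toℕ-fromℕ< _

        code-mod : ∀ k j → code m (shift (k % m) (w j)) ≡ code m (shift k (w j))
        code-mod k j = code-cong m (periodic-shift-% (periodic j) k)

        key-pos : ∀ k j → key (pos k j) ≡ code m (shift k (w j)) * r + toℕ j
        key-pos k j = trans (cong pairKey (remQuot-combine {m} {r} (k mod m) j))
          (cong (λ z → z * r + toℕ j) (trans (cong (λ z → code m (shift z (w j))) (toℕ-mod k)) (code-mod k j)))

        pos-cong : ∀ {k k′} j → k % m ≡ k′ % m → pos k j ≡ pos k′ j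
        pos-cong {k} {k′} j e = cong (λ z → combine z j)
          (toℕ-injective (trans (toℕ-mod k) (trans e (sym (toℕ-mod k′)))))

      order-all : ∀ k j k′ j′ → Before {L} {m} w k j k′ j′ → P k j Fin.< P k′ j′
      order-all k j k′ j′ b = rank-mono (subst₂ _<_ (sym (key-pos k j)) (sym (key-pos k′ j′)) (lt b))
        where
        lt : Before {L} {m} w k j k′ j′ → code m (shift k (w j)) * r + toℕ j < code m (shift k′ (w j′)) * r + toℕ j′
        lt (inj₁ c<) = <-≤-trans (digit-< c< (toℕ<n j)) (m≤m+n _ (toℕ j′))
        lt (inj₂ (c≡ , j<)) rewrite c≡ = +-monoʳ-< (code m (shift k′ (w j′)) * r) j<

      pos-onto : ∀ x → ∃₂ λ k j → k < m × pos k j ≡ x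
      pos-onto x = toℕ k , j , toℕ<n k , trans (cong (λ z → combine z j)
          (toℕ-injective (trans (toℕ-mod (toℕ k)) (m<n⇒m%n≡m (toℕ<n k))))) (combine-remQuot {m} r x)
        where
        k = proj₁ (remQuot {m} r x)
        j = proj₂ (remQuot {m} r x)

      rank-injective : ∀ {x y} → rank x ≡ rank y → x ≡ y
      rank-injective {x} {y} e with pos-onto x | pos-onto y
      ... | k , j , k< , refl | k′ , j′ , k′< , refl with before-cmp W k j k′ j′ k< k′<
      ...   | inj₁ (refl , refl) = refl
      ...   | inj₂ (inj₁ b) = ⊥-elim (<-irrefl (cong toℕ e) (order-all k j k′ j′ b))
      ...   | inj₂ (inj₂ b) = ⊥-elim (<-irrefl (cong toℕ (sym e)) (order-all k′ j′ k j b))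

      rank⁻¹ : Fin (m * r) → Fin (m * r)
      rank⁻¹ i = proj₁ (injective⇒onto rank rank-injective i)

      rank-rank⁻¹ : ∀ i → rank (rank⁻¹ i) ≡ i
      rank-rank⁻¹ i = proj₂ (injective⇒onto rank rank-injective i)

      rank⁻¹-rank : ∀ x → rank⁻¹ (rank x) ≡ x
      rank⁻¹-rank x = rank-injective (rank-rank⁻¹ (rank x))

      pairNext : Fin m × Fin r → Fin (m * r)
      pairNext (k , j) = P (suc (toℕ k)) j

      pairLabel : Fin m × Fin r → Fin L
      pairLabel (k , j) = w j (toℕ k)

      successor : Fin (m * r) → Fin (m * r)
      successor i = pairNext (remQuot r (rank⁻¹ i))

      label : Fin (m * r) → Fin L
      label i = pairLabel (remQuot r (rank⁻¹ i))

      v : Vec (Fin (m * r)) (m * r)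
      v = tabulate successor

      f : Vec (Fin L) (m * r)
      f = tabulate label

      private
        suc-mod : ∀ k → suc (k % m) % m ≡ suc k % m
        suc-mod k = begin
          (1 + k % m) % m               ≡⟨ %-distribˡ-+ 1 (k % m) m ⟩
          (1 % m + k % m % m) % m       ≡⟨ cong (λ z → (1 % m + z) % m) (m%n%n≡m%n k m) ⟩
          (1 % m + k % m) % m           ≡⟨ %-distribˡ-+ 1 k m ⟨
          (1 + k) % m                   ∎
          where open ≡-Reasoning

      step : ∀ k j → lookup v (P k j) ≡ P (suc k) j
      step k j = trans (lookup∘tabulate successor (P k j)) lem
        where
        lem : successor (P k j) ≡ P (suc k) j
        lem = trans (cong (pairNext ∘ remQuot r) (rank⁻¹-rank (pos k j)))
          (trans (cong pairNext (remQuot-combine {m} {r} (k mod m) j))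
            (cong rank (pos-cong j (trans (cong (λ z → suc z % m) (toℕ-mod k)) (suc-mod k)))))

      letter : ∀ k j → lookup f (P k j) ≡ w j k
      letter k j = trans (lookup∘tabulate label (P k j)) lem
        where
        lem : label (P k j) ≡ w j k
        lem = trans (cong (pairLabel ∘ remQuot r) (rank⁻¹-rank (pos k j)))
          (trans (cong pairLabel (remQuot-combine {m} {r} (k mod m) j))
            (trans (cong (w j) (toℕ-mod k)) (periodic-% {m = m} (periodic j) k)))

      onto : ∀ i → ∃₂ λ k j → k < m × P k j ≡ i
      onto i with pos-onto (rank⁻¹ i)
      ... | k , j , k< , e = k , j , k< , trans (cong rank e) (rank-rank⁻¹ i)

      P-period : ∀ k j → P (m + k) j ≡ P k j
      P-period k j = cong rank (pos-cong j (trans (cong (_% m) (+-comm m k)) ([m+n]%n≡m%n k m)))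

      unfolds : Unfolds {L} {m} v f w
      unfolds = record
        { P = P ; step = step ; letter = letter ; onto = onto
        ; wrap = λ j → trans (cong (λ z → P z j) (sym (+-identityʳ m))) (P-period 0 j)
        ; order = λ k j k′ j′ _ _ → order-all k j k′ j′ }

      open Unfolds unfolds using (iter-P)

      filled : FilledCycles {L} {m} v f
      filled = record { cycle = cycle ; short = short ; lex = lex }
        where
        Preimage : Fin (m * r) → Set
        Preimage i = ∃₂ λ k j → k < m × P k j ≡ i
        cycle : ∀ i → iter v m i ≡ i
        cycle i = at-preimage i (onto i)
          where
          at-preimage : ∀ i → Preimage i → iter v m i ≡ i
          at-preimage _ (k , j , _ , refl) = trans (iter-P m k j) (P-period k j)
        short : ∀ i t → 0 < t → t < m → iter v t i ≢ i
        short i t 0<t t<m = at-preimage i (onto i)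
          where
          open ≡-Reasoning
          swap : ∀ k t s → k + (t + s) ≡ s + (t + k)
          swap k t s = trans (+-comm k (t + s)) (trans (cong (_+ k) (+-comm t s)) (+-assoc s t k))
          at-preimage : ∀ i → Preimage i → iter v t i ≢ i
          -- An early return would give a rotation of the Lyndon word `w j` the proper period `t`.
          at-preimage _ (k , j , k< , refl) e =
            Primitive-shift {m = m} (periodic j) k k< (Lyndon⇒Primitive m (lyndon j)) t 0<t t<m (λ s → begin
              w j (k + (t + s))                ≡⟨ cong (w j) (swap k t s) ⟩
              w j (s + (t + k))                ≡⟨ letter (s + (t + k)) j ⟨
              lookup f (P (s + (t + k)) j)     ≡⟨ cong (lookup f) (iter-P s (t + k) j) ⟨
              lookup f (iter v s (P (t + k) j)) ≡⟨ cong (λ z → lookup f (iter v s z)) (trans (sym (iter-P t k j)) e) ⟩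
              lookup f (iter v s (P k j))      ≡⟨ cong (lookup f) (iter-P s k j) ⟩
              lookup f (P (s + k) j)           ≡⟨ letter (s + k) j ⟩
              w j (s + k)                      ≡⟨ cong (w j) (+-comm s k) ⟩
              w j (k + s)                      ∎)
        shift-suc : ∀ k j t → shift 1 (shift k (w j)) t ≡ shift (suc k) (w j) t
        shift-suc k j t = cong (w j) (+-suc k t)
        -- How the order passes to the images: equal codes stay equal under rotation; a smaller code
        -- has a smaller first letter, or the same one, and then rotating by one letter keeps the
        -- inequality.
        split : ∀ k j k′ j′ → k < m → k′ < m → Before {L} {m} w k j k′ j′ →
          Lex (w j k) (toℕ (P (suc k) j)) (w j′ k′) (toℕ (P (suc k′) j′))
        split k j k′ j′ k< k′< (inj₂ (c≡ , j<)) with code-tie W {k} {j} {k′} {j′} k< k′< c≡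
        ... | refl , e = inj₂ (e k , order-all (suc k) j (suc k) j′ (inj₂ (code-cong m (λ t → e (suc k + t)) , j<)))
        split k j k′ j′ k< k′< (inj₁ c<) with <-cmp (toℕ (w j k)) (toℕ (w j′ k′))
        ... | tri< a _ _ = inj₁ a
        ... | tri> _ _ c = ⊥-elim (<-asym c< (code-first {m = m} (subst₂ (λ a b → toℕ a < toℕ b)
                (cong (w j′) (sym (+-identityʳ k′))) (cong (w j) (sym (+-identityʳ k))) c)))
        ... | tri≈ _ e _ = inj₂ (toℕ-injective e , order-all (suc k) j (suc k′) j′ (inj₁ (subst₂ _<_
                (code-cong m (shift-suc k j)) (code-cong m (shift-suc k′ j′))
                (code-rotate {m = m} (shift-periodic (periodic j) k) (shift-periodic (periodic j′) k′)
                  (trans (cong (w j) (+-identityʳ k)) (trans (toℕ-injective e) (cong (w j′) (sym (+-identityʳ k′))))) c<))))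
        lex : ∀ i i′ → i Fin.< i′ → Lex (lookup f i) (toℕ (lookup v i)) (lookup f i′) (toℕ (lookup v i′))
        lex i i′ = at-preimages i i′ (onto i) (onto i′)
          where
          at-preimages : ∀ i i′ → Preimage i → Preimage i′ → i Fin.< i′ →
            Lex (lookup f i) (toℕ (lookup v i)) (lookup f i′) (toℕ (lookup v i′))
          at-preimages _ _ (k , j , k< , refl) (k′ , j′ , k′< , refl) lt =
            subst₂ (λ a c → Lex (lookup f (P k j)) (toℕ a) (lookup f (P k′ j′)) (toℕ c)) (sym (step k j)) (sym (step k′ j′))
              (subst₂ (λ a c → Lex a (toℕ (P (suc k) j)) c (toℕ (P (suc k′) j′))) (sym (letter k j)) (sym (letter k′ j′))
                (split k j k′ j′ k< k′< (order⁻ W unfolds k< k′< lt)))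

-- Lists of words and of multisets, and their weights.

module Enumeration where

  open FiniteSums
  open Fillings
  open Periodic
  open import Defs
  open import Data.Empty using (⊥; ⊥-elim)
  open import Data.Nat as ℕ using (ℕ; zero; suc; _<_; _≤_; _^_; z≤n; s≤s; NonZero)
  open import Data.Nat.Properties
  open import Data.Fin as Fin using (Fin; toℕ; zero; suc)
  open import Data.Fin.Properties using (toℕ<n)
  open import Data.Rational as ℚ using (ℚ; 0ℚ; 1ℚ)
  import Data.Rational.Properties as ℚₚ
  open import Data.List as List using (List; []; _∷_; _++_; map; allFin; foldr; cartesianProduct)
  open import Data.List.Membership.Propositional using (_∈_)
  open import Data.List.Membership.Propositional.Properties using (∈-map⁺; ∈-map⁻; ∈-concat⁺′; ∈-allFin; ∈-++⁺ˡ; ∈-++⁺ʳ; ∈-++⁻)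
  open import Data.List.Relation.Unary.Any using (here; there)
  open import Data.List.Relation.Unary.All as All using (All)
  import Data.List.Relation.Unary.All.Properties as Allₚ
  open import Data.List.Relation.Unary.AllPairs as AllPairs using (AllPairs; []; _∷_)
  import Data.List.Relation.Unary.AllPairs.Properties as AllPairsₚ
  open import Data.List.Relation.Unary.Unique.Propositional using (Unique)
  import Data.List.Relation.Unary.Unique.Propositional.Properties as Uniqueₚ
  open import Data.Vec as Vec using (Vec; []; _∷_; lookup)
  open import Data.Vec.Properties using (∷-injectiveʳ)
  open import Data.Product using (_×_; _,_; proj₁)
  open import Data.Sum using (inj₁; inj₂)
  open import Function using (_∘_; id)
  open import Relation.Binary.PropositionalEquality

  ∏-++ : {A : Set} (xs ys : List A) (f : A → ℚ) → ∏ (xs ++ ys) f ≡ ∏ xs f ℚ.* ∏ ys f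
  ∏-++ [] ys f = sym (ℚₚ.*-identityˡ _)
  ∏-++ (x ∷ xs) ys f = trans (cong (f x ℚ.*_) (∏-++ xs ys f)) (sym (ℚₚ.*-assoc (f x) _ _))

  ∏-cartesianProduct : {A B : Set} (xs : List A) (ys : List B) (f : A × B → ℚ) →
    ∏ (cartesianProduct xs ys) f ≡ ∏ xs (λ x → ∏ ys (λ y → f (x , y)))
  ∏-cartesianProduct [] ys f = refl
  ∏-cartesianProduct (x ∷ xs) ys f = trans (∏-++ (map (x ,_) ys) _ f)
    (cong₂ ℚ._*_ (∏-map ys (x ,_) f) (∏-cartesianProduct xs ys f))

  ∑-cartesianProduct : {A B : Set} (xs : List A) (ys : List B) (f : A × B → ℚ) →
    ∑ (cartesianProduct xs ys) f ≡ ∑ xs (λ x → ∑ ys (λ y → f (x , y)))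
  ∑-cartesianProduct [] ys f = refl
  ∑-cartesianProduct (x ∷ xs) ys f = trans (∑-++ (map (x ,_) ys) _ f)
    (cong₂ ℚ._+_ (∑-map ys (x ,_) f) (∑-cartesianProduct xs ys f))

  module _ {L : ℕ} where
    open Code {L}

    vcode : {n : ℕ} → Vec (Fin L) n → ℕ
    vcode []              = 0
    vcode {suc n} (c ∷ f) = toℕ c ℕ.* L ^ n ℕ.+ vcode f

    code-vcode : ∀ {n} (w : Vec (Fin L) n) {g} → (∀ i → g (toℕ i) ≡ lookup w i) → code n g ≡ vcode w
    code-vcode [] e = refl
    code-vcode {suc n} (c ∷ w) e = cong₂ (λ a x → toℕ a ℕ.* L ^ n ℕ.+ x) (e zero) (code-vcode w (e ∘ suc))

    code-at : ∀ {n} .{{_ : NonZero n}} (w : Vec (Fin L) n) → code n (at w) ≡ vcode w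
    code-at w = code-vcode w (at-toℕ w)

    vcode< : ∀ {n} (w : Vec (Fin L) n) → vcode w < L ^ n
    vcode< [] = s≤s z≤n
    vcode< (c ∷ w) = digit-< (toℕ<n c) (vcode< w)

    -- The lexicographic order of the list yields its uniqueness and makes `multisets` produce
    -- sorted families.
    allWords-sorted : ∀ n → AllPairs (λ u w → vcode u < vcode w) (allWords L n)
    allWords-sorted zero = All.[] ∷ []
    allWords-sorted (suc n) = AllPairsₚ.concat⁺ {xss = map block (allFin L)}
      (Allₚ.map⁺ (All.tabulate (λ {c} _ → within c)))
      (AllPairsₚ.map⁺ {xs = allFin L} (AllPairsₚ.tabulate⁺-< {f = id} (λ {c} {d} → across c d)))
      where
      block : Fin L → List (Vec (Fin L) (suc n))
      block c = map (c ∷_) (allWords L n)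
      within : ∀ c → AllPairs (λ u w → vcode u < vcode w) (block c)
      within c = AllPairsₚ.map⁺ {f = c ∷_} (AllPairs.map (+-monoʳ-< (toℕ c ℕ.* L ^ n)) (allWords-sorted n))
      across : ∀ c d → c Fin.< d → All (λ u → All (λ w → vcode u < vcode w) (block d)) (block c)
      across c d c<d = Allₚ.map⁺ {f = c ∷_} (All.tabulate (λ {u} _ → Allₚ.map⁺ {f = d ∷_} (All.tabulate (λ {w} _ →
        <-≤-trans (digit-< c<d (vcode< u)) (m≤m+n (toℕ d ℕ.* L ^ n) (vcode w))))))

    allWords-unique : ∀ n → Unique (allWords L n)
    allWords-unique n = AllPairs.map (λ lt e → <-irrefl (cong vcode e) lt) (allWords-sorted n)

    ∈-allWords : ∀ {n} (w : Vec (Fin L) n) → w ∈ allWords L n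
    ∈-allWords [] = here refl
    ∈-allWords {suc n} (c ∷ w) = ∈-concat⁺′ (∈-map⁺ (c ∷_) (∈-allWords w))
      (∈-map⁺ (λ x → map (x ∷_) (allWords L n)) (∈-allFin c))

  weight-∏< : ∀ {L n} (z : Fin L → ℚ) (w : Vec (Fin L) n) (G : ℕ → ℚ) → (∀ i → G (toℕ i) ≡ z (lookup w i)) →
    weight z w ≡ ∏< n G
  weight-∏< z [] G e = refl
  weight-∏< {n = suc n} z (c ∷ w) G e = trans (cong₂ ℚ._*_ (sym (e zero)) (weight-∏< z w (G ∘ suc) (e ∘ suc))) (sym (∏<-suc n G))

  weight-at : ∀ {L n} .{{_ : NonZero n}} (z : Fin L → ℚ) (w : Vec (Fin L) n) → weight z w ≡ ∏< n (λ k → z (at w k))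
  weight-at z w = weight-∏< z w _ (λ i → cong z (at-toℕ w i))

  ∏-allFin-suc : ∀ n (g : Fin (suc n) → ℚ) → ∏ (allFin (suc n)) g ≡ g zero ℚ.* ∏ (allFin n) (g ∘ suc)
  ∏-allFin-suc n g = cong (λ x → g zero ℚ.* foldr ℚ._*_ 1ℚ x)
    (trans (map-tabulate suc g) (sym (map-tabulate id (g ∘ suc))))
    where open import Data.List.Properties using (map-tabulate)

  weight-allFin : ∀ {L n} (z : Fin L → ℚ) (w : Vec (Fin L) n) → weight z w ≡ ∏ (allFin n) (λ i → z (lookup w i))
  weight-allFin z [] = refl
  weight-allFin {n = suc n} z (c ∷ w) = trans (cong (z c ℚ.*_) (weight-allFin z w)) (sym (∏-allFin-suc n (λ i → z (lookup (c ∷ w) i))))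

  -- Each multiset occurs once, listed in the order of `xs`: the head is taken once more or
  -- discarded for good.
  multisets : {A : Set} → List A → (r : ℕ) → List (Vec A r)
  multisets xs       zero    = [] ∷ []
  multisets []       (suc r) = []
  multisets (x ∷ xs) (suc r) = map (x ∷_) (multisets (x ∷ xs) r) ++ multisets xs (suc r)

  -- The complete homogeneous symmetric polynomial h_r, by the recursion that mirrors `multisets`.
  homogeneous : List ℚ → ℕ → ℚ
  homogeneous xs       zero    = 1ℚ
  homogeneous []       (suc r) = 0ℚ
  homogeneous (x ∷ xs) (suc r) = x ℚ.* homogeneous (x ∷ xs) r ℚ.+ homogeneous xs (suc r)

  vproduct : {A : Set} {r : ℕ} → (A → ℚ) → Vec A r → ℚ
  vproduct g []       = 1ℚ
  vproduct g (x ∷ ws) = g x ℚ.* vproduct g ws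

  vproduct-allFin : {A : Set} {r : ℕ} (g : A → ℚ) (ws : Vec A r) → vproduct g ws ≡ ∏ (allFin r) (λ j → g (lookup ws j))
  vproduct-allFin g [] = refl
  vproduct-allFin {r = suc r} g (x ∷ ws) = trans (cong (g x ℚ.*_) (vproduct-allFin g ws)) (sym (∏-allFin-suc r (λ j → g (lookup (x ∷ ws) j))))

  ∑-multisets : {A : Set} (g : A → ℚ) (xs : List A) (r : ℕ) → ∑ (multisets xs r) (vproduct g) ≡ homogeneous (map g xs) r
  ∑-multisets g xs zero = refl
  ∑-multisets g [] (suc r) = refl
  ∑-multisets g (x ∷ xs) (suc r) = begin
    ∑ (map (x ∷_) (multisets (x ∷ xs) r) ++ multisets xs (suc r)) (vproduct g)
      ≡⟨ ∑-++ (map (x ∷_) (multisets (x ∷ xs) r)) (multisets xs (suc r)) (vproduct g) ⟩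
    ∑ (map (x ∷_) (multisets (x ∷ xs) r)) (vproduct g) ℚ.+ ∑ (multisets xs (suc r)) (vproduct g)
      ≡⟨ cong₂ ℚ._+_ (trans (∑-map (multisets (x ∷ xs) r) (x ∷_) (vproduct g))
            (trans (∑-*ˡ (multisets (x ∷ xs) r) (g x) (vproduct g)) (cong (g x ℚ.*_) (∑-multisets g (x ∷ xs) r))))
          (∑-multisets g xs (suc r)) ⟩
    g x ℚ.* homogeneous (map g (x ∷ xs)) r ℚ.+ homogeneous (map g xs) (suc r) ∎
    where open ≡-Reasoning

  module _ {A : Set} (c : A → ℕ) where

    Sorted : {r : ℕ} → Vec A r → Set
    Sorted ws = ∀ {i j} → i Fin.≤ j → c (lookup ws i) ≤ c (lookup ws j)

    ∈-multisets⁻ : ∀ {xs} → AllPairs (λ x y → c x < c y) xs → ∀ {r} {ws : Vec A r} → ws ∈ multisets xs r →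
      (∀ j → lookup ws j ∈ xs) × Sorted ws
    ∈-multisets⁻ {xs} _ {zero} {[]} _ = (λ ()) , λ {i} → λ { {} }
    ∈-multisets⁻ {x ∷ xs} (x< ∷ s) {suc r} {ws} ws∈ with ∈-++⁻ (map (x ∷_) (multisets (x ∷ xs) r)) ws∈
    ... | inj₂ q with ∈-multisets⁻ s q
    ...   | mem , sorted = there ∘ mem , sorted
    ∈-multisets⁻ {x ∷ xs} (x< ∷ s) {suc r} {ws} ws∈ | inj₁ p with ∈-map⁻ (x ∷_) p
    ... | us , us∈ , refl with ∈-multisets⁻ (x< ∷ s) us∈
    ...   | mem , sorted = mem′ , λ {i} {j} → sorted′ i j
      where
      mem′ : ∀ j → lookup (x ∷ us) j ∈ x ∷ xs
      mem′ zero = here refl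
      mem′ (suc j) = mem j
      least : ∀ {y} → y ∈ x ∷ xs → c x ≤ c y
      least (here refl) = ≤-refl
      least (there y∈) = <⇒≤ (All.lookup x< y∈)
      sorted′ : ∀ i j → i Fin.≤ j → c (lookup (x ∷ us) i) ≤ c (lookup (x ∷ us) j)
      sorted′ zero j _ = least (mem′ j)
      sorted′ (suc i) (suc j) (s≤s le) = sorted le

    ∈-multisets⁺ : ∀ xs → AllPairs (λ x y → c x < c y) xs → ∀ {r} (ws : Vec A r) →
      (∀ j → lookup ws j ∈ xs) → Sorted ws → ws ∈ multisets xs r
    ∈-multisets⁺ xs s [] mem sorted = here refl
    ∈-multisets⁺ [] s (u ∷ ws) mem sorted with mem zero
    ... | ()
    ∈-multisets⁺ (x ∷ xs) xs-sorted@(x< ∷ s) {suc r} (u ∷ ws) mem sorted = split (mem zero)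
      (∈-multisets⁺ (x ∷ xs) xs-sorted ws (mem ∘ suc) (λ le → sorted (s≤s le)))
      (λ rest → ∈-multisets⁺ xs s (u ∷ ws) rest sorted)
      where
      front : List (Vec A (suc r))
      front = map (x ∷_) (multisets (x ∷ xs) r)
      split : u ∈ x ∷ xs → ws ∈ multisets (x ∷ xs) r →
        ((∀ j → lookup (u ∷ ws) j ∈ xs) → u ∷ ws ∈ multisets xs (suc r)) → u ∷ ws ∈ front ++ multisets xs (suc r)
      split (here e) keep skip = ∈-++⁺ˡ (subst (λ y → y ∷ ws ∈ front) (sym e) (∈-map⁺ (x ∷_) keep))
      split (there u∈) keep skip = ∈-++⁺ʳ front (skip tail)
        where
        tail : ∀ j → lookup (u ∷ ws) j ∈ xs
        tail j with mem j
        ... | there q = q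
        -- The head `x` at a later place would come after the strictly larger `u`, against
        -- sortedness.
        ... | here e = ⊥-elim (<⇒≱ (All.lookup x< u∈) (subst (c u ≤_) (cong c e) (sorted {zero} {j} z≤n)))

    multisets-unique : ∀ {xs} → AllPairs (λ x y → c x < c y) xs → ∀ r → Unique (multisets xs r)
    multisets-unique s zero = All.[] ∷ []
    multisets-unique {[]} s (suc r) = []
    multisets-unique {x ∷ xs} (x< ∷ s) (suc r) = Uniqueₚ.++⁺
      (Uniqueₚ.map⁺ ∷-injectiveʳ (multisets-unique (x< ∷ s) r)) (multisets-unique s (suc r)) disjoint
      where
      disjoint : ∀ {ws} → ws ∈ map (x ∷_) (multisets (x ∷ xs) r) × ws ∈ multisets xs (suc r) → ⊥
      disjoint (p , q) with ∈-map⁻ (x ∷_) p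
      ... | us , _ , refl = <-irrefl refl (All.lookup x< (proj₁ (∈-multisets⁻ s q) zero))

-- The weighted Gessel-Reutenauer identity.

module GesselReutenauer where

  open FiniteSums
  open Fillings
  open Periodic
  open Unfolding
  open Cycles
  open Enumeration
  open import Defs
  open import Data.Bool using (Bool; true; false; _∧_; _∨_; not; T)
  open import Data.Bool.Properties using (T-∧)
  open import Data.Empty using (⊥-elim)
  open import Data.Nat
  open import Data.Nat.Properties
  open import Data.Fin as Fin using (Fin; toℕ; zero; suc)
  open import Data.Fin.Properties as Finₚ using (toℕ-injective)
  open import Data.Rational as ℚ using (ℚ)
  import Data.Rational.Properties as ℚₚ
  open import Data.List as List using (List; map; upTo; allFin; filterᵇ; cartesianProduct)
  open import Data.List.Membership.Propositional using (_∈_)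
  open import Data.List.Membership.Propositional.Properties
  open import Data.List.Relation.Unary.AllPairs as AllPairs using (AllPairs)
  import Data.List.Relation.Unary.AllPairs.Properties as AllPairsₚ
  open import Data.List.Relation.Unary.Unique.Propositional using (Unique)
  import Data.List.Relation.Unary.Unique.Propositional.Properties as Uniqueₚ
  open import Data.Vec as Vec using (Vec; lookup; tabulate)
  open import Data.Vec.Properties using (lookup∘tabulate; lookup-map; tabulate∘lookup; tabulate-cong)
  open import Data.Product using (∃; _×_; _,_; proj₁; proj₂)
  open import Function using (_∘_; Equivalence)
  open import Relation.Nullary.Decidable using (T?)
  open import Relation.Binary.PropositionalEquality

  lookup-ext : {A : Set} {n : ℕ} (u w : Vec A n) → (∀ i → lookup u i ≡ lookup w i) → u ≡ w
  lookup-ext u w e = trans (sym (tabulate∘lookup u)) (trans (tabulate-cong e) (tabulate∘lookup w))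

  cyclesᵇ : ℕ → {N : ℕ} → Vec (Fin N) N → Bool
  cyclesᵇ m v = isPermutation v ∧ allCyclesOfLength m v

  validᵇ : ℕ → {L N : ℕ} → Vec (Fin N) N × Vec (Fin L) N → Bool
  validᵇ m (v , f) = cyclesᵇ m v ∧ lexInc f (Vec.map toℕ v)

  module _ {L m : ℕ} .{{m≢0 : NonZero m}} where
    open Code {L}

    validᵇ⁻ : ∀ {N} (v : Vec (Fin N) N) (f : Vec (Fin L) N) → T (validᵇ m (v , f)) → FilledCycles {L} {m} v f
    validᵇ⁻ {N} v f t = record { cycle = cycle ; short = short ; lex = lex }
      where
      parts : T (cyclesᵇ m v) × T (lexInc f (Vec.map toℕ v))
      parts = Equivalence.to (T-∧ {cyclesᵇ m v}) t
      cyc : T (allCyclesOfLength m v)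
      cyc = proj₂ (Equivalence.to (T-∧ {isPermutation v}) (proj₁ parts))
      both : ∀ i → T (iter v m i == i) × T (all (λ j → (j ≡ᵇ 0) ∨ not (iter v j i == i)) (upTo m))
      both i = Equivalence.to (T-∧ {iter v m i == i}) (all⁻ (allFin N) cyc (∈-allFin i))
      cycle : ∀ i → iter v m i ≡ i
      cycle i = toℕ-injective (≡ᵇ⇒≡ (toℕ (iter v m i)) (toℕ i) (proj₁ (both i)))
      short : ∀ i k → 0 < k → k < m → iter v k i ≢ i
      short i (suc k) _ k<m e = T-not⁻ (all⁻ (upTo m) (proj₂ (both i)) (∈-upTo⁺ k<m)) (≡⇒≡ᵇ _ _ (cong toℕ e))
      lex : ∀ i j → i Fin.< j → Lex (lookup f i) (toℕ (lookup v i)) (lookup f j) (toℕ (lookup v j))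
      lex i j lt = subst₂ (λ a c → Lex (lookup f i) a (lookup f j) c) (lookup-map i toℕ v) (lookup-map j toℕ v)
        (lexInc⁻ f (Vec.map toℕ v) (proj₂ parts) i j lt)

    validᵇ⁺ : ∀ {N} (v : Vec (Fin N) N) (f : Vec (Fin L) N) → FilledCycles {L} {m} v f → T (validᵇ m (v , f))
    validᵇ⁺ {N} v f F = Equivalence.from (T-∧ {cyclesᵇ m v})
      (Equivalence.from (T-∧ {isPermutation v}) (perm , cyc) ,
       lexInc⁺ f (Vec.map toℕ v) (λ i j lt → subst₂ (λ a c → Lex (lookup f i) a (lookup f j) c)
         (sym (lookup-map i toℕ v)) (sym (lookup-map j toℕ v)) (lex i j lt)))
      where
      open FilledCycles F
      -- σ^(m-1) inverts σ; this is where injectivity of `v` comes from.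
      pred-iter : ∀ n → n ≡ m → ∀ i → iter v (pred n) (lookup v i) ≡ i
      pred-iter zero e i = ⊥-elim (≢-nonZero⁻¹ m (sym e))
      pred-iter (suc n) refl i = trans (iter-comm v n 1 i) (cycle i)
      injective : ∀ {i j} → lookup v i ≡ lookup v j → i ≡ j
      injective {i} {j} e = trans (sym (pred-iter m refl i)) (trans (cong (iter v (pred m)) e) (pred-iter m refl j))
      distinct : ∀ i j → T ((i == j) ∨ not (lookup v i == lookup v j))
      distinct i j with toℕ i ≡ᵇ toℕ j in eq
      ... | true = _
      ... | false = T-not⁺ (λ t → subst T eq (≡⇒≡ᵇ (toℕ i) (toℕ j)
              (cong toℕ (injective (toℕ-injective (≡ᵇ⇒≡ (toℕ (lookup v i)) (toℕ (lookup v j)) t))))))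
      perm : T (isPermutation v)
      perm = all⁺ (allFin N) (λ {i} _ → all⁺ (allFin N) (λ {j} _ → distinct i j))
      cyc : T (allCyclesOfLength m v)
      cyc = all⁺ (allFin N) (λ {i} _ → Equivalence.from (T-∧ {iter v m i == i})
        (≡⇒≡ᵇ (toℕ (iter v m i)) (toℕ i) (cong toℕ (cycle i)) , all⁺ (upTo m) (λ {j} → apart i j)))
        where
        apart : ∀ i j → j ∈ upTo m → T ((j ≡ᵇ 0) ∨ not (iter v j i == i))
        apart i zero _ = _
        apart i (suc j) j∈ = T-not⁺ (λ t → short i (suc j) (s≤s z≤n) (∈-upTo⁻ j∈)
          (toℕ-injective (≡ᵇ⇒≡ (toℕ (iter v (suc j) i)) (toℕ i) t)))

    lyndonWords : List (Vec (Fin L) m)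
    lyndonWords = filterᵇ (lyndonᵇ m ∘ at) (allWords L m)

    lyndonWords-sorted : AllPairs (λ u w → code m (at u) < code m (at w)) lyndonWords
    lyndonWords-sorted = AllPairsₚ.filter⁺ (T? ∘ lyndonᵇ m ∘ at)
      (AllPairs.map (λ {u} {w} → subst₂ _<_ (sym (code-at u)) (sym (code-at w))) (allWords-sorted m))

    module _ (r : ℕ) where
      private
        N : ℕ
        N = m * r

      structures : List (Vec (Fin N) N × Vec (Fin L) N)
      structures = filterᵇ (validᵇ m) (cartesianProduct (allWords N N) (allWords L N))

      families : List (Vec (Vec (Fin L) m) r)
      families = multisets lyndonWords r

      ∈-structures⁻ : ∀ {v f} → (v , f) ∈ structures → FilledCycles {L} {m} v f
      ∈-structures⁻ {v} {f} p = validᵇ⁻ v f (proj₂ (∈-filter⁻ (T? ∘ validᵇ m) {xs = cartesianProduct (allWords N N) (allWords L N)} p))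

      ∈-structures⁺ : ∀ {v f} → FilledCycles {L} {m} v f → (v , f) ∈ structures
      ∈-structures⁺ {v} {f} F = ∈-filter⁺ (T? ∘ validᵇ m) (∈-cartesianProduct⁺ (∈-allWords v) (∈-allWords f)) (validᵇ⁺ v f F)

      ats : Vec (Vec (Fin L) m) r → Fin r → ℕ → Fin L
      ats ws j = at (lookup ws j)

      ∈-families⁻ : ∀ {ws} → ws ∈ families → LyndonFamily {L} {m} (ats ws)
      ∈-families⁻ {ws} ws∈ = record
        { periodic = λ j → at-periodic (lookup ws j)
        ; lyndon = λ j → lyndonᵇ⁻ m (proj₂ (∈-filter⁻ (T? ∘ lyndonᵇ m ∘ at) {xs = allWords L m} (proj₁ mem j)))
        ; sorted = proj₂ mem }
        where
        mem = ∈-multisets⁻ (code m ∘ at) lyndonWords-sorted ws∈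

      ∈-families⁺ : ∀ {ws} → LyndonFamily {L} {m} (ats ws) → ws ∈ families
      ∈-families⁺ {ws} W = ∈-multisets⁺ (code m ∘ at) lyndonWords lyndonWords-sorted ws
        (λ j → ∈-filter⁺ (T? ∘ lyndonᵇ m ∘ at) (∈-allWords (lookup ws j)) (lyndonᵇ⁺ m (LyndonFamily.lyndon W j)))
        (LyndonFamily.sorted W)

      correspondence : Matching structures families
      correspondence = record
        { R = λ { (v , f) ws → Unfolds {L} {m} v f (ats ws) }
        ; total = λ { {v , f} p → total v f p }
        ; onto = onto
        ; det = λ { {v , f} {ws} {ws′} p q q′ u u′ → lookup-ext ws ws′ (λ j → at-injective (lookup ws j) (lookup ws′ j)
            (unfolds-deterministic (∈-families⁻ q) (∈-families⁻ q′) u u′ j)) }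
        ; inj = λ { {v , f} {v′ , f′} {ws} p p′ q u u′ → inj v f v′ f′ ws q u u′ } }
        where
        total : ∀ v f → (v , f) ∈ structures → ∃ λ ws → ws ∈ families × Unfolds {L} {m} v f (ats ws)
        total v f p = encode (unfold refl (∈-structures⁻ p))
          where
          encode : (∃ λ (w : Fin r → ℕ → Fin L) → LyndonFamily {L} {m} w × Unfolds {L} {m} v f w) →
            ∃ λ ws → ws ∈ families × Unfolds {L} {m} v f (ats ws)
          encode (w , W , u) = ws , ∈-families⁺ {ws} W′ , Unfolds-cong w≗ u
            where
            open LyndonFamily W
            ws : Vec (Vec (Fin L) m) r
            ws = tabulate (λ j → word (w j))
            w≗ : ∀ j k → w j k ≡ ats ws j k
            w≗ j k = sym (trans (cong (λ z → at z k) (lookup∘tabulate (λ j → word (w j)) j)) (at-word (periodic j) k))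
            W′ : LyndonFamily {L} {m} (ats ws)
            W′ = record
              { periodic = λ j → at-periodic (lookup ws j)
              ; lyndon = λ j → Lyndon-cong m (w≗ j) (lyndon j)
              ; sorted = λ {i} {j} le → subst₂ _≤_ (code-cong m (w≗ i)) (code-cong m (w≗ j)) (sorted le) }
        onto : ∀ {ws} → ws ∈ families → ∃ λ x → x ∈ structures × Unfolds {L} {m} (proj₁ x) (proj₂ x) (ats ws)
        onto {ws} q = (v , f) , ∈-structures⁺ filled , unfolds
          where open Folding (∈-families⁻ q)
        inj : ∀ v f v′ f′ ws → ws ∈ families → Unfolds {L} {m} v f (ats ws) → Unfolds {L} {m} v′ f′ (ats ws) →
          (v , f) ≡ (v′ , f′)
        inj v f v′ f′ ws q u u′ with unfolds-injective (∈-families⁻ q) u u′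
        ... | e₁ , e₂ = cong₂ _,_ (lookup-ext v v′ e₁) (lookup-ext f f′ e₂)

      structures-unique : Unique structures
      structures-unique = Uniqueₚ.filter⁺ (T? ∘ validᵇ m) (Uniqueₚ.cartesianProduct⁺ (allWords-unique N) (allWords-unique N))

      -- Through `P`, positions and letters of the words are the same set, so the weight of the
      -- filling factors over the words.
      unfolds-weight : (z : Fin L → ℚ) → ∀ {v f ws} → ws ∈ families → Unfolds {L} {m} v f (ats ws) →
        weight z f ≡ vproduct (weight z) ws
      unfolds-weight z {v} {f} {ws} q u = begin
        weight z f
          ≡⟨ weight-allFin z f ⟩
        ∏ (allFin N) (λ i → z (lookup f i))
          ≡⟨ productℚ-↭ (matching-↭ (allFin N) (cartesianProduct (allFin r) (upTo m)) (Uniqueₚ.allFin⁺ N)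
               (Uniqueₚ.cartesianProduct⁺ (Uniqueₚ.allFin⁺ r) (Uniqueₚ.upTo⁺ m)) positions
               (λ i → z (lookup f i)) (λ { (j , k) → z (ats ws j k) })
               (λ { {_} {j , k} _ _ refl → cong z (letter k j) })) ⟩
        ∏ (cartesianProduct (allFin r) (upTo m)) (λ { (j , k) → z (ats ws j k) })
          ≡⟨ ∏-cartesianProduct (allFin r) (upTo m) _ ⟩
        ∏ (allFin r) (λ j → ∏< m (λ k → z (ats ws j k)))
          ≡⟨ ∏-cong (allFin r) (λ j → weight-at z (lookup ws j)) ⟨
        ∏ (allFin r) (λ j → weight z (lookup ws j))
          ≡⟨ vproduct-allFin (weight z) ws ⟨
        vproduct (weight z) ws ∎
        where
        open ≡-Reasoning
        open Unfolds u
        <m : ∀ {j k} → (j , k) ∈ cartesianProduct (allFin r) (upTo m) → k < m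
        <m p = ∈-upTo⁻ (proj₂ (∈-cartesianProduct⁻ (allFin r) (upTo m) p))
        positions : Matching (allFin N) (cartesianProduct (allFin r) (upTo m))
        positions .Matching.R i (j , k) = P k j ≡ i
        positions .Matching.total {i} _ = let k , j , k<m , e = onto i in
          (j , k) , ∈-cartesianProduct⁺ (∈-allFin j) (∈-upTo⁺ k<m) , e
        positions .Matching.onto {j , k} _ = P k j , ∈-allFin (P k j) , refl
        positions .Matching.det {i} {j , k} {j′ , k′} _ p p′ e e′ with P-injective (∈-families⁻ q) u (<m p) (<m p′) (trans e (sym e′))
        ... | refl , refl = refl
        positions .Matching.inj {i} {i′} {j , k} _ _ _ e e′ = trans (sym e) e′

      -- The bijection read with weights: multisets of necklaces are counted by h_r evaluated at the
      -- necklace weights.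
      gessel-reutenauer : (z : Fin L → ℚ) →
        ∑ (allWords N N) (λ v → ⟦ cyclesᵇ m v ⟧ ℚ.* ∑ (allWords L N) (λ f → ⟦ lexInc f (Vec.map toℕ v) ⟧ ℚ.* weight z f))
          ≡ homogeneous (map (weight z) lyndonWords) r
      gessel-reutenauer z = begin
        ∑ (allWords N N) (λ v → ⟦ cyclesᵇ m v ⟧ ℚ.* ∑ (allWords L N) (λ f → ⟦ lexInc f (Vec.map toℕ v) ⟧ ℚ.* weight z f))
          ≡⟨ ∑-cong (allWords N N) (λ v → trans (sym (∑-*ˡ (allWords L N) ⟦ cyclesᵇ m v ⟧ _))
               (∑-cong (allWords L N) (λ f → trans (sym (ℚₚ.*-assoc ⟦ cyclesᵇ m v ⟧ ⟦ lexInc f (Vec.map toℕ v) ⟧ (weight z f)))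
                 (cong (ℚ._* weight z f) (sym (⟦∧⟧ (cyclesᵇ m v) (lexInc f (Vec.map toℕ v)))))))) ⟩
        ∑ (allWords N N) (λ v → ∑ (allWords L N) (λ f → ⟦ validᵇ m (v , f) ⟧ ℚ.* weight z f))
          ≡⟨ ∑-cartesianProduct (allWords N N) (allWords L N) (λ { (v , f) → ⟦ validᵇ m (v , f) ⟧ ℚ.* weight z f }) ⟨
        ∑ (cartesianProduct (allWords N N) (allWords L N)) (λ { (v , f) → ⟦ validᵇ m (v , f) ⟧ ℚ.* weight z f })
          ≡⟨ ∑-cong (cartesianProduct (allWords N N) (allWords L N)) (λ { (v , f) → refl }) ⟩
        ∑ (cartesianProduct (allWords N N) (allWords L N)) (λ x → ⟦ validᵇ m x ⟧ ℚ.* weight z (proj₂ x))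
          ≡⟨ ∑-filterᵇ (validᵇ m) (cartesianProduct (allWords N N) (allWords L N)) (weight z ∘ proj₂) ⟨
        ∑ structures (weight z ∘ proj₂)
          ≡⟨ ∑-matching structures families structures-unique
               (multisets-unique (code m ∘ at) lyndonWords-sorted r) correspondence (weight z ∘ proj₂) (vproduct (weight z))
               (λ { {v , f} {ws} _ q u → unfolds-weight z {v} {f} {ws} q u }) ⟩
        ∑ families (vproduct (weight z))
          ≡⟨ ∑-multisets (weight z) lyndonWords r ⟩
        homogeneous (map (weight z) lyndonWords) r ∎
        where open ≡-Reasoning

-- The Möbius function and its sums over divisors.

module Moebius where

  open FiniteSums
  open Words
  open Periodic
  open import Defs
  open import Data.Bool using (Bool; true; false; _∧_; _∨_; not; T; if_then_else_)
  open import Data.Bool.Properties using (T-∧; T-≡)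
  open import Data.Empty using (⊥-elim)
  open import Data.Nat
  open import Data.Nat.Properties
  open import Data.Nat.Divisibility
  open import Data.Nat.Divisibility.Core using (hasNonTrivialDivisor)
  open import Data.Nat.Primality using (Prime; prime?; prime; euclidsLemma; prime⇒nonZero; prime⇒nonTrivial; prime[2]; composite; ¬prime⇒composite)
  open import Data.Nat.Induction using (<-rec)
  import Data.Integer as ℤ
  open import Data.Rational as ℚ using (ℚ; 0ℚ; 1ℚ)
  import Data.Rational.Properties as ℚₚ
  open import Data.List as List using (List; []; _∷_; map; upTo; filterᵇ; _∷ʳ_; [_])
  open import Data.List.Properties using (upTo-∷ʳ)
  open import Data.List.Membership.Propositional using (_∈_)
  open import Data.List.Membership.Propositional.Properties
  open import Data.List.Relation.Unary.Unique.Propositional using (Unique)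
  import Data.List.Relation.Unary.Unique.Propositional.Properties as Uniqueₚ
  open import Data.Product using (∃; _×_; _,_; proj₁; proj₂)
  open import Data.Sum using (_⊎_; inj₁; inj₂)
  open import Function using (_∘_; Equivalence)
  open import Relation.Nullary using (¬_; yes; no; Dec)
  open import Relation.Nullary.Decidable using (⌊_⌋; toWitness; fromWitness; T?)
  open import Relation.Binary.PropositionalEquality
  open import Tactic.RingSolver using (solve-∀)

  ind : Bool → ℕ
  ind true  = 1
  ind false = 0

  count-∷ʳ : {A : Set} (p : A → Bool) (xs : List A) (x : A) → count p (xs ∷ʳ x) ≡ count p xs + ind (p x)
  count-∷ʳ p [] x with p x
  ... | true = refl
  ... | false = refl
  count-∷ʳ p (y ∷ xs) x with p y
  ... | true = cong suc (count-∷ʳ p xs x)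
  ... | false = count-∷ʳ p xs x

  count-upTo : ∀ p n → count p (upTo (suc n)) ≡ count p (upTo n) + ind (p n)
  count-upTo p n = trans (cong (count p) (sym (upTo-∷ʳ n))) (count-∷ʳ p (upTo n) n)

  T-ext : ∀ {a c} → (T a → T c) → (T c → T a) → a ≡ c
  T-ext {true} {true} f g = refl
  T-ext {true} {false} f g = ⊥-elim (f _)
  T-ext {false} {true} f g = ⊥-elim (g _)
  T-ext {false} {false} f g = refl

  ind-false : ∀ {a} → ¬ T a → ind a ≡ 0
  ind-false {true} n = ⊥-elim (n _)
  ind-false {false} n = refl

  ind-true : ∀ {a} → T a → ind a ≡ 1
  ind-true {true} _ = refl

  count-upTo-cong : ∀ {p q} n → (∀ k → k < n → p k ≡ q k) → count p (upTo n) ≡ count q (upTo n)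
  count-upTo-cong zero e = refl
  count-upTo-cong {p} {q} (suc n) e = trans (count-upTo p n) (trans
    (cong₂ (λ a c → a + ind c) (count-upTo-cong n (λ k k< → e k (m≤n⇒m≤1+n k<))) (e n ≤-refl)) (sym (count-upTo q n)))

  count-upTo-extend : ∀ {p} a c → (∀ k → a ≤ k → ¬ T (p k)) → count p (upTo (c + a)) ≡ count p (upTo a)
  count-upTo-extend a zero e = refl
  count-upTo-extend {p} a (suc c) e = trans (count-upTo p (c + a))
    (trans (cong₂ _+_ (count-upTo-extend a c e) (ind-false (e (c + a) (m≤n+m a c)))) (+-identityʳ _))

  count-upTo-insert : ∀ {p q} x n → x < n → ¬ T (p x) → T (q x) → (∀ k → k ≢ x → p k ≡ q k) →
    count q (upTo n) ≡ suc (count p (upTo n))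
  count-upTo-insert {p} {q} x (suc n) (s≤s x≤n) ¬px qx e with m≤n⇒m<n∨m≡n x≤n
  ... | inj₁ x<n = trans (count-upTo q n) (trans
      (cong₂ (λ a c → a + ind c) (count-upTo-insert x n x<n ¬px qx e) (sym (e n (≢-sym (<⇒≢ x<n)))))
      (sym (cong suc (count-upTo p n))))
  ... | inj₂ refl = trans (count-upTo q n) (trans (cong₂ _+_ (count-upTo-cong n (λ k k< → sym (e k (<⇒≢ k<)))) (ind-true qx))
      (trans (+-comm (count p (upTo n)) 1) (cong suc (trans (sym (+-identityʳ _))
        (trans (cong (count p (upTo n) +_) (sym (ind-false ¬px))) (sym (count-upTo p n)))))))

  -- The metavariable is solved to the parity function local to μ, which has no
  -- name outside Defs.
  mutual
    ωEven : ℕ → ℕ → Bool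
    ωEven = _

    μ-unfold : ∀ n → μ n ≡ (if squarefree n then (if ωEven n (ω n) then ℤ.+ 1 else ℤ.- (ℤ.+ 1)) else ℤ.+ 0)
    μ-unfold n with ω n
    ... | j = refl

  ωEven-sgn : ∀ n k → ℤ→ℚ (if ωEven n k then ℤ.+ 1 else ℤ.- (ℤ.+ 1)) ≡ sgn k
  ωEven-sgn n zero = refl
  ωEven-sgn n (suc zero) = refl
  ωEven-sgn n (suc (suc k)) = trans (ωEven-sgn n k) (lem (sgn k))
    where
    lem : ∀ a → a ≡ ℚ.- (ℚ.- a)
    lem = solve-∀ ℚ-ring

  μℚ : ℕ → ℚ
  μℚ n = ℤ→ℚ (μ n)

  if-true : {A : Set} {x y : A} (c : Bool) → T c → (if c then x else y) ≡ x
  if-true true _ = refl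

  if-false : {A : Set} {x y : A} (c : Bool) → ¬ T c → (if c then x else y) ≡ y
  if-false true n = ⊥-elim (n _)
  if-false false _ = refl

  μ-squarefree : ∀ n → T (squarefree n) → μℚ n ≡ sgn (ω n)
  μ-squarefree n s = trans (cong ℤ→ℚ (trans (μ-unfold n) (if-true (squarefree n) s))) (ωEven-sgn n (ω n))

  μ-square : ∀ n → ¬ T (squarefree n) → μℚ n ≡ 0ℚ
  μ-square n s = cong ℤ→ℚ (trans (μ-unfold n) (if-false (squarefree n) s))

  SquareFree : ℕ → Set
  SquareFree n = ∀ q → Prime q → ¬ q * q ∣ n

  squarefree⁻ : ∀ n .{{_ : NonZero n}} → T (squarefree n) → SquareFree n
  squarefree⁻ n s q pq q²∣n = T-not⁻ (all⁻ {p = λ p → not (⌊ prime? p ⌋ ∧ ⌊ p * p ∣? n ⌋)} (upTo (suc n)) s (∈-upTo⁺ (s≤s q≤n)))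
    (Equivalence.from (T-∧ {⌊ prime? q ⌋}) (fromWitness pq , fromWitness q²∣n))
    where
    q≤n : q ≤ n
    q≤n = ≤-trans (m≤m*n q q {{prime⇒nonZero pq}}) (∣⇒≤ q²∣n)

  squarefree⁺ : ∀ n → SquareFree n → T (squarefree n)
  squarefree⁺ n s = all⁺ (upTo (suc n)) (λ {q} _ → T-not⁺ (λ t →
    let a , c = Equivalence.to (T-∧ {⌊ prime? q ⌋}) t in s q (toWitness a) (toWitness c)))

  isPrimeFactor : ℕ → ℕ → Bool
  isPrimeFactor n p = ⌊ prime? p ⌋ ∧ ⌊ p ∣? n ⌋

  primeFactor⁻ : ∀ n p → T (isPrimeFactor n p) → Prime p × p ∣ n
  primeFactor⁻ n p t = let a , c = Equivalence.to (T-∧ {⌊ prime? p ⌋}) t in toWitness a , toWitness c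

  primeFactor⁺ : ∀ n p → Prime p → p ∣ n → T (isPrimeFactor n p)
  primeFactor⁺ n p a c = Equivalence.from (T-∧ {⌊ prime? p ⌋}) (fromWitness a , fromWitness c)

  prime-∣-prime : ∀ {p q} → Prime p → Prime q → q ∣ p → q ≡ p
  prime-∣-prime {p} {q} pp@(prime nc) pq q∣p with m≤n⇒m<n∨m≡n (∣⇒≤ {{prime⇒nonZero pp}} q∣p)
  ... | inj₂ e = e
  ... | inj₁ lt = ⊥-elim (nc (hasNonTrivialDivisor {{prime⇒nonTrivial pq}} lt q∣p))

  module _ {p : ℕ} (pp : Prime p) (d : ℕ) .{{d≢0 : NonZero d}} (p∤d : ¬ p ∣ d) where
    private instance
      p≢0 : NonZero p
      p≢0 = prime⇒nonZero pp

    -- `ω` searches only up to its argument, so the range for `d` is widened to that for `p * d`;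
    -- there the two tests differ at `p` alone.
    ω-prime-* : ω (p * d) ≡ suc (ω d)
    ω-prime-* = begin
      count (isPrimeFactor (p * d)) (upTo (suc (p * d)))
        ≡⟨ count-upTo-insert p (suc (p * d)) (s≤s (m≤m*n p d)) (p∤d ∘ proj₂ ∘ primeFactor⁻ d p)
             (primeFactor⁺ (p * d) p pp (m∣m*n d)) agree ⟩
      suc (count (isPrimeFactor d) (upTo (suc (p * d))))
        ≡⟨ cong (λ k → suc (count (isPrimeFactor d) (upTo k))) (sym (trans (+-suc _ d) (cong suc (m∸n+n≡m (m≤n*m d p))))) ⟩
      suc (count (isPrimeFactor d) (upTo (p * d ∸ d + suc d)))
        ≡⟨ cong suc (count-upTo-extend (suc d) (p * d ∸ d) (λ k d<k t → <⇒≱ d<k (∣⇒≤ (proj₂ (primeFactor⁻ d k t))))) ⟩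
      suc (count (isPrimeFactor d) (upTo (suc d))) ∎
      where
      open ≡-Reasoning
      agree : ∀ k → k ≢ p → isPrimeFactor d k ≡ isPrimeFactor (p * d) k
      agree k k≢p = T-ext
        (λ t → let a , c = primeFactor⁻ d k t in primeFactor⁺ (p * d) k a (∣n⇒∣m*n p c))
        (λ t → let a , c = primeFactor⁻ (p * d) k t in primeFactor⁺ d k a (other a (euclidsLemma p d a c)))
        where
        other : Prime k → k ∣ p ⊎ k ∣ d → k ∣ d
        other pk (inj₁ k∣p) = ⊥-elim (k≢p (prime-∣-prime pp pk k∣p))
        other pk (inj₂ k∣d) = k∣d

    -- If q² ∣ p d with q ≠ p, both factors q already lie in d; if q = p, cancelling one factor
    -- leaves p ∣ d.
    squarefree-prime-* : SquareFree d → SquareFree (p * d)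
    squarefree-prime-* s q pq q²∣ with q ≟ p
    ... | yes refl = p∤d (*-cancelˡ-∣ p q²∣)
    ... | no q≢p with euclidsLemma p d pq (∣-trans (m∣m*n q) q²∣)
    ...   | inj₁ q∣p = q≢p (prime-∣-prime pp pq q∣p)
    ...   | inj₂ (divides c refl) with euclidsLemma p c pq (*-cancelʳ-∣ q {{prime⇒nonZero pq}} (subst (q * q ∣_) (sym (*-assoc p c q)) q²∣))
    ...     | inj₁ q∣p = q≢p (prime-∣-prime pp pq q∣p)
    ...     | inj₂ q∣c = s q pq (*-monoˡ-∣ q q∣c)

    μ-prime-* : SquareFree d → μℚ d ≡ ℚ.- μℚ (p * d)
    μ-prime-* s = begin
      μℚ d                       ≡⟨ μ-squarefree d (squarefree⁺ d s) ⟩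
      sgn (ω d)                  ≡⟨ lem (sgn (ω d)) ⟩
      ℚ.- sgn (suc (ω d))        ≡⟨ cong (λ k → ℚ.- sgn k) ω-prime-* ⟨
      ℚ.- sgn (ω (p * d))        ≡⟨ cong ℚ.-_ (μ-squarefree (p * d) (squarefree⁺ (p * d) (squarefree-prime-* s))) ⟨
      ℚ.- μℚ (p * d)             ∎
      where
      open ≡-Reasoning
      lem : ∀ a → a ≡ ℚ.- (ℚ.- a)
      lem = solve-∀ ℚ-ring

  prime-factor : ∀ n .{{_ : NonTrivial n}} → ∃ λ p → Prime p × p ∣ n
  prime-factor = <-rec (λ n → .{{_ : NonTrivial n}} → ∃ λ p → Prime p × p ∣ n) step
    where
    step : ∀ n → (∀ {k} → k < n → .{{_ : NonTrivial k}} → ∃ λ p → Prime p × p ∣ k) → .{{_ : NonTrivial n}} → ∃ λ p → Prime p × p ∣ n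
    step n rec with prime? n
    ... | yes pn = n , pn , ∣-refl
    ... | no ¬pn with ¬prime⇒composite ¬pn
    ...   | composite {d} d<n d∣n with rec d<n
    ...     | p , pp , p∣d = p , pp , ∣-trans p∣d d∣n

  ∑-divisors : ℕ → (ℕ → ℚ) → ℚ
  ∑-divisors n g = ∑< n (λ e → ⟦ ⌊ suc e ∣? n ⌋ ⟧ ℚ.* g (suc e))

  module _ (n : ℕ) .{{n≢0 : NonZero n}} {p : ℕ} (pp : Prime p) (p∣n : p ∣ n) where
    private
      instance
        p≢0 : NonZero p
        p≢0 = prime⇒nonZero pp

      good with-p without-p : ℕ → Bool
      good d = ⌊ d ∣? n ⌋ ∧ squarefree d
      with-p d = good d ∧ ⌊ p ∣? d ⌋
      without-p d = good d ∧ not ⌊ p ∣? d ⌋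

      ds A B : List ℕ
      ds = map suc (upTo n)
      A = filterᵇ without-p ds
      B = filterᵇ with-p ds

      ds-unique : Unique ds
      ds-unique = Uniqueₚ.map⁺ suc-injective (Uniqueₚ.upTo⁺ n)

      ∈-ds⁻ : ∀ {d} → d ∈ ds → NonZero d
      ∈-ds⁻ d∈ with ∈-map⁻ suc d∈
      ... | e , _ , refl = _

      ∈-ds⁺ : ∀ {d} → .{{NonZero d}} → d ∣ n → d ∈ ds
      ∈-ds⁺ {suc d} d∣n = ∈-map⁺ suc (∈-upTo⁺ (∣⇒≤ d∣n))

      good⁻ : ∀ d .{{_ : NonZero d}} → T (good d) → d ∣ n × SquareFree d
      good⁻ d t = let a , c = Equivalence.to (T-∧ {⌊ d ∣? n ⌋}) t in toWitness a , squarefree⁻ d c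

      good⁺ : ∀ d → d ∣ n → SquareFree d → T (good d)
      good⁺ d a c = Equivalence.from (T-∧ {⌊ d ∣? n ⌋}) (fromWitness a , squarefree⁺ d c)

      ∈A⁻ : ∀ {d} → d ∈ A → NonZero d × d ∣ n × SquareFree d × ¬ p ∣ d
      ∈A⁻ {d} d∈ with ∈-filter⁻ (T? ∘ without-p) {xs = ds} d∈
      ... | d∈ds , t with Equivalence.to (T-∧ {good d}) t
      ...   | g , ¬p∣d = d≢0 , proj₁ gd , proj₂ gd , (λ p∣d → T-not⁻ ¬p∣d (fromWitness p∣d))
        where
        d≢0 = ∈-ds⁻ d∈ds
        gd = good⁻ d {{d≢0}} g

      ∈A⁺ : ∀ {d} → .{{NonZero d}} → d ∣ n → SquareFree d → ¬ p ∣ d → d ∈ A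
      ∈A⁺ {d} d∣n s p∤d = ∈-filter⁺ (T? ∘ without-p) (∈-ds⁺ d∣n)
        (Equivalence.from (T-∧ {good d}) (good⁺ d d∣n s , T-not⁺ (p∤d ∘ toWitness)))

      ∈B⁻ : ∀ {d} → d ∈ B → NonZero d × d ∣ n × SquareFree d × p ∣ d
      ∈B⁻ {d} d∈ with ∈-filter⁻ (T? ∘ with-p) {xs = ds} d∈
      ... | d∈ds , t with Equivalence.to (T-∧ {good d}) t
      ...   | g , p∣d = d≢0 , proj₁ gd , proj₂ gd , toWitness p∣d
        where
        d≢0 = ∈-ds⁻ d∈ds
        gd = good⁻ d {{d≢0}} g

      ∈B⁺ : ∀ {d} → .{{NonZero d}} → d ∣ n → SquareFree d → p ∣ d → d ∈ B
      ∈B⁺ {d} d∣n s p∣d = ∈-filter⁺ (T? ∘ with-p) (∈-ds⁺ d∣n)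
        (Equivalence.from (T-∧ {good d}) (good⁺ d d∣n s , fromWitness p∣d))

      multiply : Matching A B
      multiply .Matching.R d d′ = d′ ≡ p * d
      multiply .Matching.total {d} d∈ with ∈A⁻ d∈
      ... | d≢0 , divides q n≡ , s , p∤d with euclidsLemma q d pp (subst (p ∣_) n≡ p∣n)
      ...   | inj₂ p∣d = ⊥-elim (p∤d p∣d)
      ...   | inj₁ p∣q = p * d , ∈B⁺ {{m*n≢0 p d {{p≢0}} {{d≢0}}}} (subst (p * d ∣_) (sym n≡) (*-monoˡ-∣ d p∣q))
                (squarefree-prime-* pp d {{d≢0}} p∤d s) (m∣m*n d) , refl
      multiply .Matching.onto {d′} d′∈ with ∈B⁻ d′∈
      ... | d′≢0 , d′∣n , s , divides q refl = q , ∈A⁺ {{m*n≢0⇒m≢0 q {{d′≢0}}}} (∣-trans (m∣m*n p) d′∣n)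
              (λ t pt t² → s t pt (∣m⇒∣m*n p t²)) (λ p∣q → s p pp (*-monoˡ-∣ p p∣q)) , *-comm q p
      multiply .Matching.det _ _ _ e e′ = trans e (sym e′)
      multiply .Matching.inj _ _ _ e e′ = *-cancelˡ-≡ _ _ p (trans (sym e) e′)

      split-μ : ∀ d .{{_ : NonZero d}} → ⟦ ⌊ d ∣? n ⌋ ⟧ ℚ.* μℚ d ≡ ⟦ without-p d ⟧ ℚ.* μℚ d ℚ.+ ⟦ with-p d ⟧ ℚ.* μℚ d
      split-μ d = case (T? (squarefree d))
        where
        a = ⌊ d ∣? n ⌋
        s = squarefree d
        c = ⌊ p ∣? d ⌋
        expand : ∀ y → ⟦ (a ∧ s) ∧ y ⟧ ≡ ⟦ a ⟧ ℚ.* ⟦ s ⟧ ℚ.* ⟦ y ⟧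
        expand y = trans (⟦∧⟧ (a ∧ s) y) (cong (ℚ._* ⟦ y ⟧) (⟦∧⟧ a s))
        lem : ∀ a s c x → a ℚ.* s ℚ.* (1ℚ ℚ.- c) ℚ.* x ℚ.+ a ℚ.* s ℚ.* c ℚ.* x ≡ a ℚ.* (s ℚ.* x)
        lem = solve-∀ ℚ-ring
        sμ : Dec (T s) → ⟦ s ⟧ ℚ.* μℚ d ≡ μℚ d
        sμ (yes t) = trans (cong (λ b → ⟦ b ⟧ ℚ.* μℚ d) (Equivalence.to T-≡ t)) (ℚₚ.*-identityˡ (μℚ d))
        sμ (no ¬t) = trans (cong (⟦ s ⟧ ℚ.*_) (μ-square d ¬t)) (trans (ℚₚ.*-zeroʳ ⟦ s ⟧) (sym (μ-square d ¬t)))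
        case : Dec (T s) → ⟦ a ⟧ ℚ.* μℚ d ≡ ⟦ without-p d ⟧ ℚ.* μℚ d ℚ.+ ⟦ with-p d ⟧ ℚ.* μℚ d
        case t = sym (trans (cong₂ (λ x y → x ℚ.* μℚ d ℚ.+ y ℚ.* μℚ d)
            (trans (expand (not c)) (cong (⟦ a ⟧ ℚ.* ⟦ s ⟧ ℚ.*_) (⟦not⟧ c))) (expand c))
          (trans (lem ⟦ a ⟧ ⟦ s ⟧ ⟦ c ⟧ (μℚ d)) (cong (⟦ a ⟧ ℚ.*_) (sμ t))))

    -- d ↦ p d pairs the squarefree divisors prime to p with those divisible by p.
    ∑-μ-cancels : ∑-divisors n μℚ ≡ 0ℚ
    ∑-μ-cancels = begin
      ∑ (upTo n) (λ e → ⟦ ⌊ suc e ∣? n ⌋ ⟧ ℚ.* μℚ (suc e))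
        ≡⟨ ∑-cong (upTo n) (λ e → split-μ (suc e)) ⟩
      ∑ (upTo n) (λ e → ⟦ without-p (suc e) ⟧ ℚ.* μℚ (suc e) ℚ.+ ⟦ with-p (suc e) ⟧ ℚ.* μℚ (suc e))
        ≡⟨ ∑-+ (upTo n) _ _ ⟩
      ∑ (upTo n) (λ e → ⟦ without-p (suc e) ⟧ ℚ.* μℚ (suc e)) ℚ.+ ∑ (upTo n) (λ e → ⟦ with-p (suc e) ⟧ ℚ.* μℚ (suc e))
        ≡⟨ cong₂ ℚ._+_ (back without-p) (back with-p) ⟩
      ∑ A μℚ ℚ.+ ∑ B μℚ
        ≡⟨ cong (ℚ._+ ∑ B μℚ) (trans (∑-matching A B (Uniqueₚ.filter⁺ (T? ∘ without-p) ds-unique)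
             (Uniqueₚ.filter⁺ (T? ∘ with-p) ds-unique) multiply μℚ (λ d → ℚ.- μℚ d) opposite) (∑-neg B μℚ)) ⟩
      ℚ.- ∑ B μℚ ℚ.+ ∑ B μℚ
        ≡⟨ ℚₚ.+-inverseˡ (∑ B μℚ) ⟩
      0ℚ ∎
      where
      open ≡-Reasoning
      back : ∀ q → ∑ (upTo n) (λ e → ⟦ q (suc e) ⟧ ℚ.* μℚ (suc e)) ≡ ∑ (filterᵇ q ds) μℚ
      back q = trans (sym (∑-map (upTo n) suc (λ d → ⟦ q d ⟧ ℚ.* μℚ d))) (sym (∑-filterᵇ q ds μℚ))
      opposite : ∀ {d d′} → d ∈ A → d′ ∈ B → d′ ≡ p * d → μℚ d ≡ ℚ.- μℚ d′
      opposite {d} d∈ _ refl = let d≢0 , _ , s , p∤d = ∈A⁻ d∈ in μ-prime-* pp d {{d≢0}} p∤d s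

  ∑-μ-nontrivial : ∀ n .{{_ : NonTrivial n}} → ∑-divisors n μℚ ≡ 0ℚ
  ∑-μ-nontrivial n = let p , pp , p∣n = prime-factor n in ∑-μ-cancels n {{nonTrivial⇒nonZero n}} pp p∣n

  μ-4∣ : ∀ d .{{_ : NonZero d}} → 4 ∣ d → μℚ d ≡ 0ℚ
  μ-4∣ d 4∣d = μ-square d (λ t → squarefree⁻ d t 2 prime[2] 4∣d)

-- The weighted count of Lyndon words.

module Necklaces where

  open FiniteSums
  open Words
  open Fillings
  open Periodic
  open Cycles
  open Enumeration
  open GesselReutenauer
  open Moebius
  open import Defs
  open import Data.Bool using (Bool; true; false; _∧_; T)
  open import Data.Bool.Properties using (T-∧; T-≡)
  open import Data.Empty using (⊥-elim)
  open import Data.Nat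
  open import Data.Nat.Properties
  open import Data.Nat.Divisibility
  open import Data.Nat.DivMod
  open import Data.Fin using (Fin)
  open import Data.Rational as ℚ using (ℚ; 0ℚ; 1ℚ)
  import Data.Rational.Properties as ℚₚ
  open import Data.List as List using (List; []; _∷_; upTo; allFin; filterᵇ; cartesianProduct; length)
  open import Data.List.Properties using (length-upTo)
  open import Data.List.Membership.Propositional using (_∈_)
  open import Data.List.Membership.Propositional.Properties
  import Data.List.Relation.Unary.Unique.Propositional.Properties as Uniqueₚ
  open import Data.Vec as Vec using (Vec; []; _∷_)
  open import Data.Product using (∃; _×_; _,_; proj₂)
  open import Data.Sum using (_⊎_; inj₁; inj₂)
  open import Function using (_∘_; Equivalence)
  open import Relation.Nullary using (¬_; yes; no)
  open import Relation.Nullary.Decidable using (⌊_⌋; toWitness; fromWitness; T?)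
  open import Relation.Unary using (Decidable)
  open import Relation.Binary.PropositionalEquality
  open import Tactic.RingSolver using (solve-∀)

  infixl 7 _÷_
  -- Total, so that a summand can be a function of every `d`; `∑-divisors` evaluates it at positive
  -- `d` only.
  _÷_ : ℕ → ℕ → ℕ
  n ÷ zero  = 0
  n ÷ suc d = n / suc d

  ∑-const : {A : Set} (xs : List A) (c : ℚ) → ∑ xs (λ _ → c) ≡ ℕ→ℚ (length xs) ℚ.* c
  ∑-const xs c = trans (∑-cong xs (λ _ → sym (ℚₚ.*-identityˡ c)))
    (trans (∑-*ʳ xs c (λ _ → 1ℚ)) (cong (ℚ._* c) (∑-one xs)))

  ∏<-rotate : ∀ n .{{_ : NonZero n}} {G : ℕ → ℚ} → Periodic n G → ∏< n (G ∘ suc) ≡ ∏< n G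
  ∏<-rotate (suc n) {G} p = begin
    ∏< (suc n) (G ∘ suc)               ≡⟨ ∏<-last n (G ∘ suc) ⟩
    ∏< n (G ∘ suc) ℚ.* G (suc n)       ≡⟨ cong (∏< n (G ∘ suc) ℚ.*_) (trans (cong G (sym (+-identityʳ (suc n)))) (p 0)) ⟩
    ∏< n (G ∘ suc) ℚ.* G 0             ≡⟨ ℚₚ.*-comm _ (G 0) ⟩
    G 0 ℚ.* ∏< n (G ∘ suc)             ≡⟨ ∏<-suc n G ⟨
    ∏< (suc n) G                       ∎
    where open ≡-Reasoning

  ∏<-shift : ∀ n .{{_ : NonZero n}} {G : ℕ → ℚ} → Periodic n G → ∀ k → ∏< n (shift k G) ≡ ∏< n G
  ∏<-shift n p zero = refl
  ∏<-shift n {G} p (suc k) = trans (∏<-shift n {G ∘ suc} (λ t → trans (cong G (sym (+-suc n t))) (p (suc t))) k) (∏<-rotate n p)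

  ∏<-+ : ∀ a c G → ∏< (a + c) G ≡ ∏< a G ℚ.* ∏< c (shift a G)
  ∏<-+ zero c G = sym (ℚₚ.*-identityˡ _)
  ∏<-+ (suc a) c G = begin
    ∏< (suc (a + c)) G                                       ≡⟨ ∏<-suc (a + c) G ⟩
    G 0 ℚ.* ∏< (a + c) (G ∘ suc)                             ≡⟨ cong (G 0 ℚ.*_) (∏<-+ a c (G ∘ suc)) ⟩
    G 0 ℚ.* (∏< a (G ∘ suc) ℚ.* ∏< c (shift (suc a) G))      ≡⟨ ℚₚ.*-assoc (G 0) _ _ ⟨
    G 0 ℚ.* ∏< a (G ∘ suc) ℚ.* ∏< c (shift (suc a) G)        ≡⟨ cong (ℚ._* ∏< c (shift (suc a) G)) (∏<-suc a G) ⟨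
    ∏< (suc a) G ℚ.* ∏< c (shift (suc a) G)                  ∎
    where open ≡-Reasoning

  ∏<-power : ∀ e d {G : ℕ → ℚ} → Periodic e G → ∏< (d * e) G ≡ pow (∏< e G) d
  ∏<-power e zero p = refl
  ∏<-power e (suc d) {G} p = trans (∏<-+ e (d * e) G) (cong (∏< e G ℚ.*_)
    (trans (∏-cong (upTo (d * e)) p) (∏<-power e d p)))

  pow-* : ∀ a c n → pow (a ℚ.* c) n ≡ pow a n ℚ.* pow c n
  pow-* a c zero = refl
  pow-* a c (suc n) = trans (cong (a ℚ.* c ℚ.*_) (pow-* a c n)) (lem a c (pow a n) (pow c n))
    where
    lem : ∀ a c x y → a ℚ.* c ℚ.* (x ℚ.* y) ≡ (a ℚ.* x) ℚ.* (c ℚ.* y)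
    lem = solve-∀ ℚ-ring

  pow-weight : ∀ {L n} (z : Fin L → ℚ) d (w : Vec (Fin L) n) → pow (weight z w) d ≡ weight (λ c → pow (z c) d) w
  pow-weight z d [] = pow-one d
  pow-weight z d (c ∷ w) = trans (pow-* (z c) (weight z w) d) (cong (pow (z c) d ℚ.*_) (pow-weight z d w))

  ∑-weight : ∀ {L} (z : Fin L → ℚ) n → ∑ (allWords L n) (weight z) ≡ pow (∑ (allFin L) z) n
  ∑-weight z zero = refl
  ∑-weight {L} z (suc n) = begin
    ∑ (allWords L (suc n)) (weight z)                                       ≡⟨ ∑-allWords-suc L n (weight z) ⟩
    ∑ (allFin L) (λ c → ∑ (allWords L n) (λ w → z c ℚ.* weight z w))        ≡⟨ ∑-cong (allFin L) (λ c → ∑-*ˡ (allWords L n) (z c) (weight z)) ⟩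
    ∑ (allFin L) (λ c → z c ℚ.* ∑ (allWords L n) (weight z))                ≡⟨ ∑-*ʳ (allFin L) (∑ (allWords L n) (weight z)) z ⟩
    ∑ (allFin L) z ℚ.* ∑ (allWords L n) (weight z)                          ≡⟨ cong (∑ (allFin L) z ℚ.*_) (∑-weight z n) ⟩
    ∑ (allFin L) z ℚ.* pow (∑ (allFin L) z) n                               ∎
    where open ≡-Reasoning

  ∑<-extend : ∀ a c {f : ℕ → ℚ} → (∀ k → a ≤ k → f k ≡ 0ℚ) → ∑< (c + a) f ≡ ∑< a f
  ∑<-extend a zero e = refl
  ∑<-extend a (suc c) {f} e = trans (∑<-last (c + a) f)
    (trans (cong₂ ℚ._+_ (∑<-extend a c e) (e (c + a) (m≤n+m a c))) (ℚₚ.+-identityʳ _))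

  ⟦⟧-false : ∀ {c} → ¬ T c → ⟦ c ⟧ ≡ 0ℚ
  ⟦⟧-false {true} n = ⊥-elim (n _)
  ⟦⟧-false {false} _ = refl

  ⟦⟧-true : ∀ {c} → T c → ⟦ c ⟧ ≡ 1ℚ
  ⟦⟧-true {true} _ = refl

  ∑-divisors-cong : ∀ n {f g : ℕ → ℚ} → (∀ d .{{_ : NonZero d}} → d ∣ n → f d ≡ g d) → ∑-divisors n f ≡ ∑-divisors n g
  ∑-divisors-cong n e = ∑-cong (upTo n) (λ k → guard ⌊ suc k ∣? n ⌋ (λ t → e (suc k) (toWitness (Equivalence.from T-≡ t))))

  -- For tests that cut the divisors of `m` down to those of some `n`: compatibility with a period,
  -- and later oddness.
  ∑-divisors-restrict : ∀ m n .{{_ : NonZero n}} → n ≤ m → (q : ℕ → Bool) {g : ℕ → ℚ} →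
    (∀ d .{{_ : NonZero d}} → ⌊ d ∣? m ⌋ ∧ q d ≡ ⌊ d ∣? n ⌋) → ∑-divisors m (λ d → ⟦ q d ⟧ ℚ.* g d) ≡ ∑-divisors n g
  ∑-divisors-restrict m n n≤m q {g} e = begin
    ∑< m (λ k → ⟦ ⌊ suc k ∣? m ⌋ ⟧ ℚ.* (⟦ q (suc k) ⟧ ℚ.* g (suc k)))
      ≡⟨ ∑-cong (upTo m) (λ k → trans (sym (ℚₚ.*-assoc ⟦ ⌊ suc k ∣? m ⌋ ⟧ ⟦ q (suc k) ⟧ (g (suc k))))
           (cong (ℚ._* g (suc k)) (trans (sym (⟦∧⟧ ⌊ suc k ∣? m ⌋ (q (suc k)))) (cong ⟦_⟧ (e (suc k)))))) ⟩
    ∑< m F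
      ≡⟨ cong (λ k → ∑< k F) (sym (m∸n+n≡m n≤m)) ⟩
    ∑< (m ∸ n + n) F
      ≡⟨ ∑<-extend n (m ∸ n) (λ k n≤k → trans (cong (ℚ._* g (suc k)) (⟦⟧-false {⌊ suc k ∣? n ⌋} (λ t → <⇒≱ (s≤s n≤k) (∣⇒≤ (toWitness {a? = suc k ∣? n} t)))))
           (ℚₚ.*-zeroˡ (g (suc k)))) ⟩
    ∑< n F ∎
    where
    open ≡-Reasoning
    F : ℕ → ℚ
    F k = ⟦ ⌊ suc k ∣? n ⌋ ⟧ ℚ.* g (suc k)

  least : ∀ {P : ℕ → Set} → Decidable P → ∀ n → P n → ∃ λ k → P k × k ≤ n × (∀ j → j < k → ¬ P j)
  least {P} P? n pn with search (suc n)
    where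
    search : ∀ b → (∃ λ k → P k × k < b × (∀ j → j < k → ¬ P j)) ⊎ (∀ j → j < b → ¬ P j)
    search zero = inj₂ (λ _ ())
    search (suc b) with search b
    ... | inj₁ (k , pk , k<b , min) = inj₁ (k , pk , m≤n⇒m≤1+n k<b , min)
    ... | inj₂ none with P? b
    ...   | yes pb = inj₁ (b , pb , ≤-refl , none)
    ...   | no ¬pb = inj₂ λ { j (s≤s j≤b) pj → [ (λ j<b → none j j<b pj) , (λ { refl → ¬pb pj }) ]′ (m≤n⇒m<n∨m≡n j≤b) }
      where open import Data.Sum using ([_,_]′)
  ... | inj₁ (k , pk , s≤s k≤n , min) = k , pk , k≤n , min
  ... | inj₂ none = ⊥-elim (none n ≤-refl pn)

  module _ {L m : ℕ} .{{m≢0 : NonZero m}} where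
    open Code {L}

    primitiveWords : List (Vec (Fin L) m)
    primitiveWords = filterᵇ (primitiveᵇ m ∘ at) (allWords L m)

    ∈-primitiveWords⁻ : ∀ {w} → w ∈ primitiveWords → Primitive m (at w)
    ∈-primitiveWords⁻ w∈ = primitiveᵇ⁻ m (proj₂ (∈-filter⁻ (T? ∘ primitiveᵇ m ∘ at) {xs = allWords L m} w∈))

    ∈-primitiveWords⁺ : ∀ {w} → Primitive m (at w) → w ∈ primitiveWords
    ∈-primitiveWords⁺ {w} pr = ∈-filter⁺ (T? ∘ primitiveᵇ m ∘ at) (∈-allWords w) (primitiveᵇ⁺ m (at-periodic w) pr)

    ∈-lyndonWords⁻ : ∀ {w} → w ∈ lyndonWords {L} {m} → Lyndon m (at w)
    ∈-lyndonWords⁻ w∈ = lyndonᵇ⁻ m (proj₂ (∈-filter⁻ (T? ∘ lyndonᵇ m ∘ at) {xs = allWords L m} w∈))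

    ∈-lyndonWords⁺ : ∀ {w} → Lyndon m (at w) → w ∈ lyndonWords {L} {m}
    ∈-lyndonWords⁺ {w} ly = ∈-filter⁺ (T? ∘ lyndonᵇ m ∘ at) (∈-allWords w) (lyndonᵇ⁺ m ly)

    private
      rotations : List (ℕ × Vec (Fin L) m)
      rotations = cartesianProduct (upTo m) (lyndonWords {L} {m})

      split : ∀ {k ν} → (k , ν) ∈ rotations → k < m × Lyndon m (at ν)
      split p = let a , c = ∈-cartesianProduct⁻ (upTo m) (lyndonWords {L} {m}) p in ∈-upTo⁻ a , ∈-lyndonWords⁻ c

      rotate : Matching rotations primitiveWords
      rotate .Matching.R (k , ν) w = ∀ t → at w t ≡ at ν (k + t)
      rotate .Matching.total {k , ν} p = let k<m , ly = split p
                                             at≗ = at-word (shift-periodic (at-periodic ν) k) in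
        word (shift k (at ν)) ,
        ∈-primitiveWords⁺ (Primitive-cong m (sym ∘ at≗) (Primitive-shift (at-periodic ν) k k<m (Lyndon⇒Primitive m ly))) ,
        at≗
      rotate .Matching.onto {w} p with Lyndon-exists (at-periodic w) (∈-primitiveWords⁻ p)
      ... | k , k<m , ly = ((m ∸ k) % m , ν) ,
          ∈-cartesianProduct⁺ (∈-upTo⁺ (m%n<n (m ∸ k) m)) (∈-lyndonWords⁺ (Lyndon-cong m (sym ∘ at≗) ly)) ,
          λ t → sym (trans (periodic-shift-% (at-periodic ν) (m ∸ k) t)
            (trans (at≗ (m ∸ k + t)) (wrap-around (at-periodic w) (<⇒≤ k<m) t)))
        where
        ν = word (shift k (at w))
        at≗ = at-word (shift-periodic (at-periodic w) k)
      rotate .Matching.det {k , ν} {w} {w′} _ _ _ e e′ = at-injective w w′ (λ t → trans (e t) (sym (e′ t)))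
      rotate .Matching.inj {k , ν} {k′ , ν′} p p′ _ e e′ with split p | split p′
      ... | k< , ly | k′< , ly′ with Lyndon-unique (at-periodic ν) (at-periodic ν′) ly ly′ k< k′< (λ t → trans (sym (e t)) (e′ t))
      ...   | refl , ν≗ = cong (k ,_) (at-injective ν ν′ ν≗)

    -- A primitive word is exactly one of the `m` rotations of exactly one Lyndon word, and rotation
    -- preserves the weight.
    ∑-lyndon : (z : Fin L → ℚ) → ℕ→ℚ m ℚ.* ∑ lyndonWords (weight z) ≡ ∑ primitiveWords (weight z)
    ∑-lyndon z = begin
      ℕ→ℚ m ℚ.* ∑ lyndonWords (weight z)
        ≡⟨ cong (λ k → ℕ→ℚ k ℚ.* ∑ lyndonWords (weight z)) (length-upTo m) ⟨
      ℕ→ℚ (length (upTo m)) ℚ.* ∑ lyndonWords (weight z)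
        ≡⟨ ∑-const (upTo m) (∑ lyndonWords (weight z)) ⟨
      ∑ (upTo m) (λ _ → ∑ lyndonWords (weight z))
        ≡⟨ ∑-cartesianProduct (upTo m) lyndonWords (weight z ∘ proj₂) ⟨
      ∑ rotations (weight z ∘ proj₂)
        ≡⟨ ∑-matching rotations primitiveWords
             (Uniqueₚ.cartesianProduct⁺ (Uniqueₚ.upTo⁺ m) (Uniqueₚ.filter⁺ (T? ∘ lyndonᵇ m ∘ at) (allWords-unique m)))
             (Uniqueₚ.filter⁺ (T? ∘ primitiveᵇ m ∘ at) (allWords-unique m)) rotate (weight z ∘ proj₂) (weight z) same-weight ⟩
      ∑ primitiveWords (weight z) ∎
      where
      open ≡-Reasoning
      same-weight : ∀ {x w} → x ∈ rotations → w ∈ primitiveWords → Matching.R rotate x w → weight z (proj₂ x) ≡ weight z w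
      same-weight {k , ν} {w} _ _ e = begin
        weight z ν                              ≡⟨ weight-at z ν ⟩
        ∏< m (λ t → z (at ν t))                 ≡⟨ ∏<-shift m (λ t → cong z (at-periodic ν t)) k ⟨
        ∏< m (λ t → z (at ν (k + t)))           ≡⟨ ∏-cong (upTo m) (λ t → cong z (e t)) ⟨
        ∏< m (λ t → z (at w t))                 ≡⟨ weight-at z w ⟨
        weight z w                              ∎

    periodᵇ : ℕ → (ℕ → Fin L) → Bool
    periodᵇ e g = code m (shift e g) ≡ᵇ code m g

    module _ {g : ℕ → Fin L} (per : Periodic m g) where

      periodᵇ⁻ : ∀ {e} → T (periodᵇ e g) → Periodic e g
      periodᵇ⁻ {e} t = code≡⇒≗ (shift-periodic per e) per (≡ᵇ⇒≡ (code m (shift e g)) (code m g) t)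

      periodᵇ⁺ : ∀ {e} → Periodic e g → T (periodᵇ e g)
      periodᵇ⁺ {e} p = ≡⇒≡ᵇ (code m (shift e g)) (code m g) (code-cong m p)

      least-period : ∃ λ e → NonZero e × Periodic e g × e ≤ m × (∀ j → 0 < j → j < e → ¬ Periodic j g)
      least-period with least {λ e → T ((0 <ᵇ e) ∧ periodᵇ e g)} (λ e → T? ((0 <ᵇ e) ∧ periodᵇ e g)) m
                          (Equivalence.from (T-∧ {0 <ᵇ m}) (<⇒<ᵇ (>-nonZero⁻¹ m) , periodᵇ⁺ per))
      ... | e , t , e≤m , min with Equivalence.to (T-∧ {0 <ᵇ e}) t
      ...   | 0<e , p = e , >-nonZero (<ᵇ⇒< 0 e 0<e) , periodᵇ⁻ p , e≤m ,
              λ j 0<j j<e pj → min j j<e (Equivalence.from (T-∧ {0 <ᵇ j}) (<⇒<ᵇ 0<j , periodᵇ⁺ pj))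

      -- The periods of g are the multiples of its least period e₀, so the d ∣ m
      -- with period m / d are the divisors of m / e₀.
      primitive-μ : ⟦ primitiveᵇ m g ⟧ ≡ ∑-divisors m (λ d → ⟦ periodᵇ (m ÷ d) g ⟧ ℚ.* μℚ d)
      primitive-μ with least-period
      ... | e₀ , e₀≢0 , p₀ , e₀≤m , min = sym (trans (∑-divisors-restrict m D {{D≢0}} D≤m (λ d → periodᵇ (m ÷ d) g) {μℚ} agree) value)
        where
        instance
          e₀-nonZero : NonZero e₀
          e₀-nonZero = e₀≢0
        multiple : ∀ {e} → Periodic e g → e₀ ∣ e
        multiple {e} p with e % e₀ in eq
        ... | zero = m%n≡0⇒n∣m e e₀ eq
        ... | suc j = ⊥-elim (min (suc j) (s≤s z≤n) (subst (_< e₀) eq (m%n<n e e₀)) (λ t → begin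
          g (suc j + t)                         ≡⟨ cong (λ k → g (k + t)) eq ⟨
          g (e % e₀ + t)                        ≡⟨ periodic-shift-% p₀ e t ⟩
          g (e + t)                             ≡⟨ p t ⟩
          g t                                   ∎))
          where open ≡-Reasoning
        multiple⁻ : ∀ {e} → e₀ ∣ e → Periodic e g
        multiple⁻ (divides q refl) t = periodic-* p₀ q t
        D = quotient (multiple per)
        m≡ : m ≡ D * e₀
        m≡ = _∣_.equality (multiple per)
        D≢0 : NonZero D
        D≢0 = m*n≢0⇒m≢0 D {{subst NonZero m≡ m≢0}}
        D≤m : D ≤ m
        D≤m = subst (D ≤_) (sym m≡) (m≤m*n D e₀)
        agree : ∀ d .{{_ : NonZero d}} → ⌊ d ∣? m ⌋ ∧ periodᵇ (m ÷ d) g ≡ ⌊ d ∣? D ⌋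
        agree d@(suc _) = T-ext to from
          where
          to : T (⌊ d ∣? m ⌋ ∧ periodᵇ (m / d) g) → T ⌊ d ∣? D ⌋
          to t with Equivalence.to (T-∧ {⌊ d ∣? m ⌋}) t
          ... | a , c with multiple (periodᵇ⁻ c)
          ...   | divides q q≡ = fromWitness (divides q (*-cancelʳ-≡ D (q * d) e₀ (begin
                    D * e₀               ≡⟨ m≡ ⟨
                    m                    ≡⟨ m/n*n≡m (toWitness a) ⟨
                    m / d * d            ≡⟨ cong (_* d) q≡ ⟩
                    q * e₀ * d           ≡⟨ *-assoc q e₀ d ⟩
                    q * (e₀ * d)         ≡⟨ cong (q *_) (*-comm e₀ d) ⟩
                    q * (d * e₀)         ≡⟨ *-assoc q d e₀ ⟨
                    q * d * e₀           ∎)))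
            where open ≡-Reasoning
          from : T ⌊ d ∣? D ⌋ → T (⌊ d ∣? m ⌋ ∧ periodᵇ (m / d) g)
          from t with toWitness t
          ... | divides q D≡ = Equivalence.from (T-∧ {⌊ d ∣? m ⌋})
                (fromWitness (divides (q * e₀) m≡′) , periodᵇ⁺ (multiple⁻ (divides q (trans (cong (_/ d) m≡′) (m*n/n≡m (q * e₀) d)))))
            where
            m≡′ : m ≡ q * e₀ * d
            m≡′ = trans m≡ (trans (cong (_* e₀) D≡) (trans (*-assoc q d e₀) (trans (cong (q *_) (*-comm d e₀)) (sym (*-assoc q e₀ d)))))
        value : ∑-divisors D μℚ ≡ ⟦ primitiveᵇ m g ⟧
        value = cases D refl
          where
          cases : ∀ k → k ≡ D → ∑-divisors D μℚ ≡ ⟦ primitiveᵇ m g ⟧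
          cases zero e = ⊥-elim (≢-nonZero⁻¹ D {{D≢0}} (sym e))
          cases (suc zero) e = trans (cong (λ k → ∑-divisors k μℚ) (sym e)) (sym (⟦⟧-true (primitiveᵇ⁺ m per
            (λ k 0<k k<m → min k 0<k (subst (k <_) (trans m≡ (trans (cong (_* e₀) (sym e)) (+-identityʳ e₀))) k<m)))))
          cases (suc (suc k)) e = trans (∑-μ-nontrivial D {{subst NonTrivial e _}})
            (sym (⟦⟧-false (λ t → primitiveᵇ⁻ m t e₀ (>-nonZero⁻¹ e₀) e₀<m p₀)))
            where
            e₀<m : e₀ < m
            e₀<m = subst (e₀ <_) (sym (trans m≡ (cong (_* e₀) (sym e)))) (m<m+n e₀ (≤-trans (>-nonZero⁻¹ e₀) (m≤m+n e₀ (k * e₀))))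

    module _ (z : Fin L → ℚ) (d : ℕ) .{{d≢0 : NonZero d}} (e : ℕ) (m≡ : m ≡ d * e) where
      private
        instance
          e≢0 : NonZero e
          e≢0 = m*n≢0⇒n≢0 d {{subst NonZero m≡ m≢0}}

        repetitions : List (Vec (Fin L) m)
        repetitions = filterᵇ (periodᵇ e ∘ at) (allWords L m)

        ∈-repetitions⁻ : ∀ {w} → w ∈ repetitions → Periodic e (at w)
        ∈-repetitions⁻ {w} w∈ = periodᵇ⁻ (at-periodic w) (proj₂ (∈-filter⁻ (T? ∘ periodᵇ e ∘ at) {xs = allWords L m} w∈))

        at-periodic′ : (u : Vec (Fin L) e) → Periodic m (at u)
        at-periodic′ u t = trans (cong (λ k → at u (k + t)) m≡) (periodic-* (at-periodic u) d t)

        root : Matching repetitions (allWords L e)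
        root .Matching.R w u = ∀ t → at w t ≡ at u t
        root .Matching.total {w} w∈ = word (at w) , ∈-allWords _ , λ t → sym (at-word (∈-repetitions⁻ w∈) t)
        root .Matching.onto {u} _ = word (at u) ,
          ∈-filter⁺ (T? ∘ periodᵇ e ∘ at) (∈-allWords _) (periodᵇ⁺ (at-periodic (word (at u)))
            (λ t → trans (at≗ (e + t)) (trans (at-periodic u t) (sym (at≗ t))))) , at≗
          where
          at≗ : ∀ t → at (word {n = m} (at u)) t ≡ at u t
          at≗ = at-word (at-periodic′ u)
        root .Matching.det {w} {u} {u′} _ _ _ p p′ = at-injective u u′ (λ t → trans (sym (p t)) (p′ t))
        root .Matching.inj {w} {w′} _ _ _ p p′ = at-injective w w′ (λ t → trans (p t) (sym (p′ t)))

      -- A word of period `e` is the `d`-th power of its first `e` letters, so each letter weight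
      -- enters to the power `d`; here power sums arise.
      ∑-repetitions : ∑ (allWords L m) (λ w → ⟦ periodᵇ e (at w) ⟧ ℚ.* weight z w) ≡ pow (∑ (allFin L) (λ c → pow (z c) d)) e
      ∑-repetitions = begin
        ∑ (allWords L m) (λ w → ⟦ periodᵇ e (at w) ⟧ ℚ.* weight z w)
          ≡⟨ ∑-filterᵇ (periodᵇ e ∘ at) (allWords L m) (weight z) ⟨
        ∑ repetitions (weight z)
          ≡⟨ ∑-matching repetitions (allWords L e) (Uniqueₚ.filter⁺ (T? ∘ periodᵇ e ∘ at) (allWords-unique m))
               (allWords-unique e) root (weight z) (weight (λ c → pow (z c) d)) same-weight ⟩
        ∑ (allWords L e) (weight (λ c → pow (z c) d))
          ≡⟨ ∑-weight (λ c → pow (z c) d) e ⟩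
        pow (∑ (allFin L) (λ c → pow (z c) d)) e ∎
        where
        open ≡-Reasoning
        same-weight : ∀ {w u} → w ∈ repetitions → u ∈ allWords L e → (∀ t → at w t ≡ at u t) →
          weight z w ≡ weight (λ c → pow (z c) d) u
        same-weight {w} {u} _ _ p = begin
          weight z w                              ≡⟨ weight-at z w ⟩
          ∏< m (λ t → z (at w t))                 ≡⟨ ∏-cong (upTo m) (λ t → cong z (p t)) ⟩
          ∏< m (λ t → z (at u t))                 ≡⟨ cong (λ k → ∏< k (λ t → z (at u t))) m≡ ⟩
          ∏< (d * e) (λ t → z (at u t))           ≡⟨ ∏<-power e d (λ t → cong z (at-periodic u t)) ⟩
          pow (∏< e (λ t → z (at u t))) d         ≡⟨ cong (λ x → pow x d) (weight-at z u) ⟨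
          pow (weight z u) d                      ≡⟨ pow-weight z d u ⟩
          weight (λ c → pow (z c) d) u            ∎

    -- Witt's formula with weights, from Möbius inversion over the periods of each word.
    lyndon-count : (z : Fin L → ℚ) → ℕ→ℚ m ℚ.* ∑ (lyndonWords {L} {m}) (weight z)
      ≡ ∑-divisors m (λ d → μℚ d ℚ.* pow (∑ (allFin L) (λ c → pow (z c) d)) (m ÷ d))
    lyndon-count z = begin
      ℕ→ℚ m ℚ.* ∑ lyndonWords (weight z)
        ≡⟨ ∑-lyndon z ⟩
      ∑ primitiveWords (weight z)
        ≡⟨ ∑-filterᵇ (primitiveᵇ m ∘ at) (allWords L m) (weight z) ⟩
      ∑ (allWords L m) (λ w → ⟦ primitiveᵇ m (at w) ⟧ ℚ.* weight z w)
        ≡⟨ ∑-cong (allWords L m) (λ w → trans (cong (ℚ._* weight z w) (primitive-μ (at-periodic w))) (sym (∑-*ʳ (upTo m) (weight z w) _))) ⟩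
      ∑ (allWords L m) (λ w → ∑ (upTo m) (λ k → ⟦ ⌊ suc k ∣? m ⌋ ⟧ ℚ.* (⟦ periodᵇ (m / suc k) (at w) ⟧ ℚ.* μℚ (suc k)) ℚ.* weight z w))
        ≡⟨ ∑-swap (allWords L m) (upTo m) _ ⟩
      ∑ (upTo m) (λ k → ∑ (allWords L m) (λ w → ⟦ ⌊ suc k ∣? m ⌋ ⟧ ℚ.* (⟦ periodᵇ (m / suc k) (at w) ⟧ ℚ.* μℚ (suc k)) ℚ.* weight z w))
        ≡⟨ ∑-cong (upTo m) (λ k → trans
             (∑-cong (allWords L m) (λ w → lem ⟦ ⌊ suc k ∣? m ⌋ ⟧ ⟦ periodᵇ (m / suc k) (at w) ⟧ (μℚ (suc k)) (weight z w)))
             (∑-*ˡ (allWords L m) (⟦ ⌊ suc k ∣? m ⌋ ⟧ ℚ.* μℚ (suc k)) _)) ⟩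
      ∑ (upTo m) (λ k → ⟦ ⌊ suc k ∣? m ⌋ ⟧ ℚ.* μℚ (suc k) ℚ.* ∑ (allWords L m) (λ w → ⟦ periodᵇ (m / suc k) (at w) ⟧ ℚ.* weight z w))
        ≡⟨ ∑-cong (upTo m) (λ k → ℚₚ.*-assoc ⟦ ⌊ suc k ∣? m ⌋ ⟧ (μℚ (suc k)) _) ⟩
      ∑-divisors m (λ d → μℚ d ℚ.* ∑ (allWords L m) (λ w → ⟦ periodᵇ (m ÷ d) (at w) ⟧ ℚ.* weight z w))
        ≡⟨ ∑-divisors-cong m term ⟩
      ∑-divisors m (λ d → μℚ d ℚ.* pow (∑ (allFin L) (λ c → pow (z c) d)) (m ÷ d)) ∎
      where
      open ≡-Reasoning
      lem : ∀ a p u w → a ℚ.* (p ℚ.* u) ℚ.* w ≡ a ℚ.* u ℚ.* (p ℚ.* w)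
      lem = solve-∀ ℚ-ring
      term : ∀ d .{{_ : NonZero d}} → d ∣ m → μℚ d ℚ.* ∑ (allWords L m) (λ w → ⟦ periodᵇ (m ÷ d) (at w) ⟧ ℚ.* weight z w)
        ≡ μℚ d ℚ.* pow (∑ (allFin L) (λ c → pow (z c) d)) (m ÷ d)
      term d@(suc _) d∣m = cong (μℚ d ℚ.*_) (∑-repetitions z d (m / d) (trans (sym (m/n*n≡m d∣m)) (*-comm (m / d) d)))

-- Formal power series, exponentials and Newton's identities.

module PowerSeries where

  open FiniteSums
  open Words
  open Enumeration
  open import Defs
  open import Data.Nat as ℕ using (ℕ; zero; suc; _∸_; z≤n; s≤s; _!; NonZero)
  import Data.Nat.Properties as ℕₚ
  open import Data.Rational as ℚ using (ℚ; 0ℚ; 1ℚ; _+_; _*_; _-_; -_)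
  open import Data.Rational.Properties
  open import Data.List using (List; []; _∷_; upTo)
  open import Data.Sum using (inj₁; inj₂)
  open import Function using (_∘_)
  open import Relation.Binary.PropositionalEquality
  open import Tactic.RingSolver using (solve-∀)
  open ≡-Reasoning

  ⋆-suc : ∀ a c n → (a ⋆ c) (suc n) ≡ a 0 * c (suc n) + ((a ∘ suc) ⋆ c) n
  ⋆-suc a c n = ∑<-suc (suc n) (λ k → a k * c (suc n ∸ k))

  ⋆-cong : ∀ {a a′ c c′} n → (∀ k → k ℕ.≤ n → a k ≡ a′ k) → (∀ k → k ℕ.≤ n → c k ≡ c′ k) → (a ⋆ c) n ≡ (a′ ⋆ c′) n
  ⋆-cong n p q = ∑<-cong (suc n) (λ { k (s≤s k≤n) → cong₂ _*_ (p k k≤n) (q (n ∸ k) (ℕₚ.m∸n≤m n k)) })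

  ⋆-congˡ : ∀ {a a′} c n → (∀ k → a k ≡ a′ k) → (a ⋆ c) n ≡ (a′ ⋆ c) n
  ⋆-congˡ c n e = ∑-cong (upTo (suc n)) (λ k → cong (_* c (n ∸ k)) (e k))

  ⋆-congʳ : ∀ a {c c′} n → (∀ k → c k ≡ c′ k) → (a ⋆ c) n ≡ (a ⋆ c′) n
  ⋆-congʳ a n e = ∑-cong (upTo (suc n)) (λ k → cong (a k *_) (e (n ∸ k)))

  ⋆-comm : ∀ a c n → (a ⋆ c) n ≡ (c ⋆ a) n
  ⋆-comm a c n = trans (∑<-reverse n (λ k → a k * c (n ∸ k))) (∑<-cong (suc n) (λ { k (s≤s k≤n) →
    trans (cong (λ j → a (n ∸ k) * c j) (ℕₚ.m∸[m∸n]≡n k≤n)) (*-comm (a (n ∸ k)) (c k)) }))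

  ⋆-scaleˡ : ∀ x a c n → ((λ k → x * a k) ⋆ c) n ≡ x * (a ⋆ c) n
  ⋆-scaleˡ x a c n = trans (∑-cong (upTo (suc n)) (λ k → *-assoc x (a k) (c (n ∸ k)))) (∑-*ˡ (upTo (suc n)) x (λ k → a k * c (n ∸ k)))

  ⋆-scaleʳ : ∀ x a c n → (a ⋆ (λ k → x * c k)) n ≡ x * (a ⋆ c) n
  ⋆-scaleʳ x a c n = trans (⋆-comm a (λ k → x * c k) n) (trans (⋆-scaleˡ x c a n) (cong (x *_) (⋆-comm c a n)))

  ⋆-+ˡ : ∀ a a′ c n → ((λ k → a k + a′ k) ⋆ c) n ≡ (a ⋆ c) n + (a′ ⋆ c) n
  ⋆-+ˡ a a′ c n = trans (∑-cong (upTo (suc n)) (λ k → *-distribʳ-+ (c (n ∸ k)) (a k) (a′ k)))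
    (∑-+ (upTo (suc n)) (λ k → a k * c (n ∸ k)) (λ k → a′ k * c (n ∸ k)))

  ⋆-assoc : ∀ a b c n → ((a ⋆ b) ⋆ c) n ≡ (a ⋆ (b ⋆ c)) n
  ⋆-assoc a b c zero = lem (a 0) (b 0) (c 0)
    where
    lem : ∀ x y z → (x * y + 0ℚ) * z + 0ℚ ≡ x * (y * z + 0ℚ) + 0ℚ
    lem = solve-∀ ℚ-ring
  ⋆-assoc a b c (suc n) = begin
    ((a ⋆ b) ⋆ c) (suc n)
      ≡⟨ ⋆-suc (a ⋆ b) c n ⟩
    (a 0 * b 0 + 0ℚ) * c (suc n) + (((a ⋆ b) ∘ suc) ⋆ c) n
      ≡⟨ cong ((a 0 * b 0 + 0ℚ) * c (suc n) +_) (trans (⋆-congˡ c n (⋆-suc a b))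
           (⋆-+ˡ (λ k → a 0 * b (suc k)) ((a ∘ suc) ⋆ b) c n)) ⟩
    (a 0 * b 0 + 0ℚ) * c (suc n) + (((λ k → a 0 * b (suc k)) ⋆ c) n + (((a ∘ suc) ⋆ b) ⋆ c) n)
      ≡⟨ cong₂ (λ x y → (a 0 * b 0 + 0ℚ) * c (suc n) + (x + y)) (⋆-scaleˡ (a 0) (b ∘ suc) c n) (⋆-assoc (a ∘ suc) b c n) ⟩
    (a 0 * b 0 + 0ℚ) * c (suc n) + (a 0 * ((b ∘ suc) ⋆ c) n + ((a ∘ suc) ⋆ (b ⋆ c)) n)
      ≡⟨ lem (a 0) (b 0) (c (suc n)) (((b ∘ suc) ⋆ c) n) (((a ∘ suc) ⋆ (b ⋆ c)) n) ⟩
    a 0 * (b 0 * c (suc n) + ((b ∘ suc) ⋆ c) n) + ((a ∘ suc) ⋆ (b ⋆ c)) n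
      ≡⟨ cong (λ x → a 0 * x + ((a ∘ suc) ⋆ (b ⋆ c)) n) (⋆-suc b c n) ⟨
    a 0 * (b ⋆ c) (suc n) + ((a ∘ suc) ⋆ (b ⋆ c)) n
      ≡⟨ ⋆-suc a (b ⋆ c) n ⟨
    (a ⋆ (b ⋆ c)) (suc n) ∎
    where
    lem : ∀ x y z u w → (x * y + 0ℚ) * z + (x * u + w) ≡ x * (y * z + u) + w
    lem = solve-∀ ℚ-ring

  ⋆-left-comm : ∀ a b c n → (a ⋆ (b ⋆ c)) n ≡ (b ⋆ (a ⋆ c)) n
  ⋆-left-comm a b c n = trans (sym (⋆-assoc a b c n)) (trans (⋆-congˡ c n (⋆-comm a b)) (⋆-assoc b a c n))

  ⋆-zeroˡ : ∀ a c n → (∀ k → a k ≡ 0ℚ) → (a ⋆ c) n ≡ 0ℚ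
  ⋆-zeroˡ a c n e = ∑-zero (upTo (suc n)) (λ {k} _ → trans (cong (_* c (n ∸ k)) (e k)) (*-zeroˡ (c (n ∸ k))))

  ⋆-identityˡ : ∀ c n → (oneS ⋆ c) n ≡ c n
  ⋆-identityˡ c zero = lem (c 0)
    where
    lem : ∀ x → 1ℚ * x + 0ℚ ≡ x
    lem = solve-∀ ℚ-ring
  ⋆-identityˡ c (suc n) = trans (⋆-suc oneS c n) (trans (cong (1ℚ * c (suc n) +_) (⋆-zeroˡ (oneS ∘ suc) c n (λ _ → refl))) (lem (c (suc n))))
    where
    lem : ∀ x → 1ℚ * x + 0ℚ ≡ x
    lem = solve-∀ ℚ-ring

  ⋆-identityʳ : ∀ c n → (c ⋆ oneS) n ≡ c n
  ⋆-identityʳ c n = trans (⋆-comm c oneS n) (⋆-identityˡ c n)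

  -- t d/dt
  θ : Series → Series
  θ a n = ℕ→ℚ n * a n

  θ-⋆ : ∀ a c n → θ (a ⋆ c) n ≡ (θ a ⋆ c) n + (a ⋆ θ c) n
  θ-⋆ a c n = begin
    ℕ→ℚ n * ∑< (suc n) (λ k → a k * c (n ∸ k))
      ≡⟨ ∑-*ˡ (upTo (suc n)) (ℕ→ℚ n) (λ k → a k * c (n ∸ k)) ⟨
    ∑< (suc n) (λ k → ℕ→ℚ n * (a k * c (n ∸ k)))
      ≡⟨ ∑<-cong (suc n) (λ { k (s≤s k≤n) → trans
           (cong (_* (a k * c (n ∸ k))) (trans (cong ℕ→ℚ (sym (ℕₚ.m+[n∸m]≡n k≤n))) (ℕ→ℚ-+ k (n ∸ k))))
           (lem (ℕ→ℚ k) (ℕ→ℚ (n ∸ k)) (a k) (c (n ∸ k))) }) ⟩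
    ∑< (suc n) (λ k → ℕ→ℚ k * a k * c (n ∸ k) + a k * (ℕ→ℚ (n ∸ k) * c (n ∸ k)))
      ≡⟨ ∑-+ (upTo (suc n)) (λ k → ℕ→ℚ k * a k * c (n ∸ k)) (λ k → a k * (ℕ→ℚ (n ∸ k) * c (n ∸ k))) ⟩
    (θ a ⋆ c) n + (a ⋆ θ c) n ∎
    where
    lem : ∀ x y u w → (x + y) * (u * w) ≡ x * u * w + u * (y * w)
    lem = solve-∀ ℚ-ring

  cancel-suc : ∀ n {x y} → ℕ→ℚ (suc n) * x ≡ ℕ→ℚ (suc n) * y → x ≡ y
  cancel-suc n {x} {y} e = trans (undo x) (trans (cong (recip (suc n) *_) e) (sym (undo y)))
    where
    undo : ∀ x → x ≡ recip (suc n) * (ℕ→ℚ (suc n) * x)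
    undo x = trans (sym (*-identityˡ x)) (trans (cong (_* x) (trans (sym (recip-inverse n)) (*-comm (ℕ→ℚ (suc n)) (recip (suc n)))))
      (*-assoc (recip (suc n)) (ℕ→ℚ (suc n)) x))

  -- The equation t f′ = P f with P(0) = 0 determines each coefficient from the lower ones, because
  -- n + 1 is invertible. It replaces manipulation of binomial series.
  θ-unique : ∀ {P f g} → P 0 ≡ 0ℚ → (∀ n → θ f n ≡ (P ⋆ f) n) → (∀ n → θ g n ≡ (P ⋆ g) n) → f 0 ≡ g 0 → ∀ n → f n ≡ g n
  θ-unique {P} {f} {g} P0 θf θg e₀ n = below n n ℕₚ.≤-refl
    where
    unfold : ∀ {f} → (∀ n → θ f n ≡ (P ⋆ f) n) → ∀ n → ℕ→ℚ (suc n) * f (suc n) ≡ ((P ∘ suc) ⋆ f) n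
    unfold {f} θf n = trans (θf (suc n)) (trans (⋆-suc P f n)
      (trans (cong (λ x → x * f (suc n) + ((P ∘ suc) ⋆ f) n) P0) (lem (f (suc n)) (((P ∘ suc) ⋆ f) n))))
      where
      lem : ∀ x y → 0ℚ * x + y ≡ y
      lem = solve-∀ ℚ-ring
    below : ∀ b n → n ℕ.≤ b → f n ≡ g n
    below b zero _ = e₀
    below (suc b) (suc n) (s≤s n≤b) = cancel-suc n (trans (unfold θf n)
      (trans (⋆-cong {P ∘ suc} {P ∘ suc} {f} {g} n (λ _ _ → refl) (λ k k≤n → below b k (ℕₚ.≤-trans k≤n n≤b))) (sym (unfold θg n))))

  expCoeff : ℕ → ℚ → ℚ
  expCoeff k a = recip (k !) * pow a k

  recip-* : ∀ m n .{{_ : NonZero m}} .{{_ : NonZero n}} → recip (m ℕ.* n) ≡ recip m * recip n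
  recip-* (suc m) (suc n) = begin
    recip (suc m ℕ.* suc n)
      ≡⟨ lem₁ (recip (suc m ℕ.* suc n)) (ℕ→ℚ (suc m)) (recip (suc m)) (ℕ→ℚ (suc n)) (recip (suc n)) (recip-inverse m) (recip-inverse n) ⟩
    (ℕ→ℚ (suc m) * ℕ→ℚ (suc n)) * recip (suc m ℕ.* suc n) * (recip (suc m) * recip (suc n))
      ≡⟨ cong (λ x → x * recip (suc m ℕ.* suc n) * (recip (suc m) * recip (suc n))) (ℕ→ℚ-* (suc m) (suc n)) ⟨
    ℕ→ℚ (suc m ℕ.* suc n) * recip (suc m ℕ.* suc n) * (recip (suc m) * recip (suc n))
      ≡⟨ cong (_* (recip (suc m) * recip (suc n))) (recip-inverse (n ℕ.+ m ℕ.* suc n)) ⟩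
    1ℚ * (recip (suc m) * recip (suc n))
      ≡⟨ *-identityˡ _ ⟩
    recip (suc m) * recip (suc n) ∎
    where
    lem₁ : ∀ x a a′ b b′ → a * a′ ≡ 1ℚ → b * b′ ≡ 1ℚ → x ≡ (a * b) * x * (a′ * b′)
    lem₁ x a a′ b b′ p q = begin
      x                          ≡⟨ lem₂ x ⟩
      1ℚ * 1ℚ * x                ≡⟨ cong₂ (λ u w → u * w * x) p q ⟨
      (a * a′) * (b * b′) * x    ≡⟨ lem₃ x a a′ b b′ ⟩
      (a * b) * x * (a′ * b′)    ∎
      where
      lem₂ : ∀ x → x ≡ 1ℚ * 1ℚ * x
      lem₂ = solve-∀ ℚ-ring
      lem₃ : ∀ x a a′ b b′ → (a * a′) * (b * b′) * x ≡ (a * b) * x * (a′ * b′)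
      lem₃ = solve-∀ ℚ-ring

  recip-suc! : ∀ k → recip (suc k !) ≡ recip (suc k) * recip (k !)
  recip-suc! k = recip-* (suc k) (k !) {{_}} {{ℕₚ._!≢0 k}}

  expCoeff-suc : ∀ k a → expCoeff (suc k) a * ℕ→ℚ (suc k) ≡ a * expCoeff k a
  expCoeff-suc k a = begin
    recip (suc k !) * (a * pow a k) * ℕ→ℚ (suc k)
      ≡⟨ cong (λ x → x * (a * pow a k) * ℕ→ℚ (suc k)) (recip-suc! k) ⟩
    recip (suc k) * recip (k !) * (a * pow a k) * ℕ→ℚ (suc k)
      ≡⟨ lem (recip (suc k)) (recip (k !)) a (pow a k) (ℕ→ℚ (suc k)) ⟩
    ℕ→ℚ (suc k) * recip (suc k) * (a * (recip (k !) * pow a k))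
      ≡⟨ cong (_* (a * (recip (k !) * pow a k))) (recip-inverse k) ⟩
    1ℚ * (a * (recip (k !) * pow a k))
      ≡⟨ *-identityˡ _ ⟩
    a * (recip (k !) * pow a k) ∎
    where
    lem : ∀ r f a p n → r * f * (a * p) * n ≡ n * r * (a * (f * p))
    lem = solve-∀ ℚ-ring

  -- exp(a L(t)) for a series L without constant term
  expS : Series → ℚ → Series
  expS L a n = ∑< (suc n) (λ k → expCoeff k a * powS L k n)

  module _ {L : Series} (L0 : L 0 ≡ 0ℚ) where

    powS-vanish : ∀ k n → n ℕ.< k → powS L k n ≡ 0ℚ
    powS-vanish (suc k) n (s≤s n≤k) = ∑<-zero (suc n) (λ { j (s≤s j≤n) → term j j≤n })
      where
      term : ∀ j → j ℕ.≤ n → L j * powS L k (n ∸ j) ≡ 0ℚ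
      term zero _ = trans (cong (_* powS L k n) L0) (*-zeroˡ (powS L k n))
      term (suc j) j<n = trans (cong (L (suc j) *_) (powS-vanish k (n ∸ suc j)
        (ℕₚ.<-≤-trans (ℕₚ.∸-monoʳ-< {n} {suc j} {0} (s≤s z≤n) j<n) n≤k))) (*-zeroʳ (L (suc j)))

    -- The k-th power of a series without constant term starts at t^k, so the exponential sum may be
    -- cut anywhere beyond `n`.
    expS-extend : ∀ a n K → n ℕ.< K → ∑< K (λ k → expCoeff k a * powS L k n) ≡ expS L a n
    expS-extend a n (suc K) (s≤s n≤K) with ℕₚ.m≤n⇒m<n∨m≡n n≤K
    ... | inj₂ refl = refl
    ... | inj₁ n<K = begin
      ∑< (suc K) F                      ≡⟨ ∑<-last K F ⟩
      ∑< K F + expCoeff K a * powS L K n  ≡⟨ cong₂ (λ x y → x + expCoeff K a * y) (expS-extend a n K n<K) (powS-vanish K n n<K) ⟩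
      expS L a n + expCoeff K a * 0ℚ    ≡⟨ lem (expS L a n) (expCoeff K a) ⟩
      expS L a n                        ∎
      where
      F : ℕ → ℚ
      F k = expCoeff k a * powS L k n
      lem : ∀ x y → x + y * 0ℚ ≡ x
      lem = solve-∀ ℚ-ring

    θ-powS : ∀ k n → θ (powS L (suc k)) n ≡ ℕ→ℚ (suc k) * (θ L ⋆ powS L k) n
    θ-powS zero n = begin
      θ (L ⋆ oneS) n            ≡⟨ cong (ℕ→ℚ n *_) (⋆-identityʳ L n) ⟩
      θ L n                     ≡⟨ ⋆-identityʳ (θ L) n ⟨
      (θ L ⋆ oneS) n            ≡⟨ *-identityˡ _ ⟨
      1ℚ * (θ L ⋆ oneS) n       ∎
    θ-powS (suc k) n = begin
      θ (L ⋆ powS L (suc k)) n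
        ≡⟨ θ-⋆ L (powS L (suc k)) n ⟩
      (θ L ⋆ powS L (suc k)) n + (L ⋆ θ (powS L (suc k))) n
        ≡⟨ cong ((θ L ⋆ powS L (suc k)) n +_) (trans (⋆-congʳ L n (θ-powS k))
             (trans (⋆-scaleʳ (ℕ→ℚ (suc k)) L (θ L ⋆ powS L k) n) (cong (ℕ→ℚ (suc k) *_) (⋆-left-comm L (θ L) (powS L k) n)))) ⟩
      (θ L ⋆ powS L (suc k)) n + ℕ→ℚ (suc k) * (θ L ⋆ powS L (suc k)) n
        ≡⟨ lem (ℕ→ℚ (suc k)) ((θ L ⋆ powS L (suc k)) n) ⟩
      (1ℚ + ℕ→ℚ (suc k)) * (θ L ⋆ powS L (suc k)) n
        ≡⟨ cong (_* (θ L ⋆ powS L (suc k)) n) (ℕ→ℚ-suc (suc k)) ⟨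
      ℕ→ℚ (suc (suc k)) * (θ L ⋆ powS L (suc k)) n ∎
      where
      lem : ∀ c x → x + c * x ≡ (1ℚ + c) * x
      lem = solve-∀ ℚ-ring

    -- Chain rule: term k + 1 of the exponential yields term k on the right, the factor k + 1
    -- cancelling against the factorial.
    θ-expS : ∀ a n → θ (expS L a) n ≡ ((λ k → a * θ L k) ⋆ expS L a) n
    θ-expS a zero = trans (*-zeroˡ (expS L a 0)) (sym (trans (cong (λ x → a * x * expS L a 0 + 0ℚ) (*-zeroˡ (L 0))) (lem a (expS L a 0))))
      where
      lem : ∀ a x → a * 0ℚ * x + 0ℚ ≡ 0ℚ
      lem = solve-∀ ℚ-ring
    θ-expS a (suc n) = begin
      ℕ→ℚ (suc n) * ∑< (suc (suc n)) (λ k → expCoeff k a * powS L k (suc n))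
        ≡⟨ ∑-*ˡ (upTo (suc (suc n))) (ℕ→ℚ (suc n)) (λ k → expCoeff k a * powS L k (suc n)) ⟨
      ∑< (suc (suc n)) (λ k → ℕ→ℚ (suc n) * (expCoeff k a * powS L k (suc n)))
        ≡⟨ ∑<-suc (suc n) (λ k → ℕ→ℚ (suc n) * (expCoeff k a * powS L k (suc n))) ⟩
      ℕ→ℚ (suc n) * (expCoeff 0 a * 0ℚ) + ∑< (suc n) (λ k → ℕ→ℚ (suc n) * (expCoeff (suc k) a * powS L (suc k) (suc n)))
        ≡⟨ cong₂ _+_ (lem₀ (ℕ→ℚ (suc n)) (expCoeff 0 a)) (∑-cong (upTo (suc n)) term) ⟩
      0ℚ + ∑< (suc n) (λ k → ∑< (suc n) (λ j → a * θ L (suc j) * (expCoeff k a * powS L k (n ∸ j))))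
        ≡⟨ trans (+-identityˡ _) (∑-swap (upTo (suc n)) (upTo (suc n)) (λ k j → a * θ L (suc j) * (expCoeff k a * powS L k (n ∸ j)))) ⟩
      ∑< (suc n) (λ j → ∑< (suc n) (λ k → a * θ L (suc j) * (expCoeff k a * powS L k (n ∸ j))))
        ≡⟨ ∑-cong (upTo (suc n)) (λ j → trans (∑-*ˡ (upTo (suc n)) (a * θ L (suc j)) (λ k → expCoeff k a * powS L k (n ∸ j)))
             (cong (a * θ L (suc j) *_) (expS-extend a (n ∸ j) (suc n) (s≤s (ℕₚ.m∸n≤m n j))))) ⟩
      ((λ j → a * θ L (suc j)) ⋆ expS L a) n
        ≡⟨ lem₁ (a * θ L 0) (expS L a (suc n)) (((λ j → a * θ L (suc j)) ⋆ expS L a) n) (trans (cong (a *_) (*-zeroˡ (L 0))) (*-zeroʳ a)) ⟩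
      a * θ L 0 * expS L a (suc n) + ((λ j → a * θ L (suc j)) ⋆ expS L a) n
        ≡⟨ ⋆-suc (λ k → a * θ L k) (expS L a) n ⟨
      ((λ k → a * θ L k) ⋆ expS L a) (suc n) ∎
      where
      lem₀ : ∀ x y → x * (y * 0ℚ) ≡ 0ℚ
      lem₀ = solve-∀ ℚ-ring
      lem₁ : ∀ x y z → x ≡ 0ℚ → z ≡ x * y + z
      lem₁ x y z e = trans (lem y z) (cong (λ u → u * y + z) (sym e))
        where
        lem : ∀ y z → z ≡ 0ℚ * y + z
        lem = solve-∀ ℚ-ring
      lem₂ : ∀ c n x → n * (c * x) ≡ c * (n * x)
      lem₂ = solve-∀ ℚ-ring
      lem₃ : ∀ c k x → c * (k * x) ≡ c * k * x
      lem₃ = solve-∀ ℚ-ring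
      lem₄ : ∀ a c x y → a * c * (x * y) ≡ a * x * (c * y)
      lem₄ = solve-∀ ℚ-ring
      lem₅ : ∀ x y z → x ≡ 0ℚ → x * y + z ≡ z
      lem₅ x y z e = sym (lem₁ x y z e)
      term : ∀ k → ℕ→ℚ (suc n) * (expCoeff (suc k) a * powS L (suc k) (suc n))
        ≡ ∑< (suc n) (λ j → a * θ L (suc j) * (expCoeff k a * powS L k (n ∸ j)))
      term k = begin
        ℕ→ℚ (suc n) * (expCoeff (suc k) a * powS L (suc k) (suc n))
          ≡⟨ lem₂ (expCoeff (suc k) a) (ℕ→ℚ (suc n)) (powS L (suc k) (suc n)) ⟩
        expCoeff (suc k) a * θ (powS L (suc k)) (suc n)
          ≡⟨ cong (expCoeff (suc k) a *_) (θ-powS k (suc n)) ⟩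
        expCoeff (suc k) a * (ℕ→ℚ (suc k) * (θ L ⋆ powS L k) (suc n))
          ≡⟨ lem₃ (expCoeff (suc k) a) (ℕ→ℚ (suc k)) ((θ L ⋆ powS L k) (suc n)) ⟩
        expCoeff (suc k) a * ℕ→ℚ (suc k) * (θ L ⋆ powS L k) (suc n)
          ≡⟨ cong₂ _*_ (expCoeff-suc k a) (trans (⋆-suc (θ L) (powS L k) n)
               (lem₅ (θ L 0) (powS L k (suc n)) (((θ L ∘ suc) ⋆ powS L k) n) (*-zeroˡ (L 0)))) ⟩
        a * expCoeff k a * ∑< (suc n) (λ j → θ L (suc j) * powS L k (n ∸ j))
          ≡⟨ ∑-*ˡ (upTo (suc n)) (a * expCoeff k a) (λ j → θ L (suc j) * powS L k (n ∸ j)) ⟨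
        ∑< (suc n) (λ j → a * expCoeff k a * (θ L (suc j) * powS L k (n ∸ j)))
          ≡⟨ ∑-cong (upTo (suc n)) (λ j → lem₄ a (expCoeff k a) (θ L (suc j)) (powS L k (n ∸ j))) ⟩
        ∑< (suc n) (λ j → a * θ L (suc j) * (expCoeff k a * powS L k (n ∸ j))) ∎

  -- The entry at 0 is 0 and not the number of terms: for H the series of the h_n, this is the
  -- series t H′/H.
  powerSum : List ℚ → ℕ → ℚ
  powerSum xs zero    = 0ℚ
  powerSum xs (suc j) = ∑ xs (λ x → pow x (suc j))

  -- Newton's identities by induction on the list: if H and K are the series without and with `x`,
  -- then K = H + x t K.
  newton : ∀ xs n → θ (homogeneous xs) n ≡ (powerSum xs ⋆ homogeneous xs) n
  newton xs zero = refl
  newton xs (suc n) = trans (step xs n) (sym (trans (⋆-suc (powerSum xs) (homogeneous xs) n)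
    (lem₀ (homogeneous xs (suc n)) (((powerSum xs ∘ suc) ⋆ homogeneous xs) n))))
    where
    lem₀ : ∀ x y → 0ℚ * x + y ≡ y
    lem₀ = solve-∀ ℚ-ring
    geometric : ∀ x h n → ((λ j → pow x (suc (suc j))) ⋆ h) n ≡ x * ((λ j → pow x (suc j)) ⋆ h) n
    geometric x h n = ⋆-scaleˡ x (λ j → pow x (suc j)) h n
    step : ∀ xs n → ℕ→ℚ (suc n) * homogeneous xs (suc n) ≡ ((powerSum xs ∘ suc) ⋆ homogeneous xs) n
    step [] n = trans (*-zeroʳ (ℕ→ℚ (suc n))) (sym (⋆-zeroˡ (λ _ → 0ℚ) (homogeneous []) n (λ _ → refl)))
    step (x ∷ xs) n = begin
      ℕ→ℚ (suc n) * (x * h′ n + h (suc n))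
        ≡⟨ both n ⟩
      G n + R n
        ≡⟨ ⋆-+ˡ (λ j → pow x (suc j)) (powerSum xs ∘ suc) h′ n ⟨
      ((λ j → pow x (suc j) + powerSum xs (suc j)) ⋆ h′) n ∎
      where
      h h′ G R : Series
      h = homogeneous xs
      h′ = homogeneous (x ∷ xs)
      G = (λ j → pow x (suc j)) ⋆ h′
      R = (powerSum xs ∘ suc) ⋆ h′
      R-suc : ∀ n → R (suc n) ≡ x * R n + ((powerSum xs ∘ suc) ⋆ h) (suc n)
      R-suc n = begin
        R (suc n)
          ≡⟨ ⋆-comm (powerSum xs ∘ suc) h′ (suc n) ⟩
        (h′ ⋆ p) (suc n)
          ≡⟨ ⋆-suc h′ p n ⟩
        1ℚ * p (suc n) + ((λ k → x * h′ k + h (suc k)) ⋆ p) n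
          ≡⟨ cong (1ℚ * p (suc n) +_) (trans (⋆-+ˡ (λ k → x * h′ k) (h ∘ suc) p n)
               (cong (_+ ((h ∘ suc) ⋆ p) n) (trans (⋆-scaleˡ x h′ p n) (cong (x *_) (⋆-comm h′ p n))))) ⟩
        1ℚ * p (suc n) + (x * R n + ((h ∘ suc) ⋆ p) n)
          ≡⟨ lem (1ℚ * p (suc n)) (x * R n) (((h ∘ suc) ⋆ p) n) ⟩
        x * R n + (1ℚ * p (suc n) + ((h ∘ suc) ⋆ p) n)
          ≡⟨ cong (x * R n +_) (trans (sym (⋆-suc h p n)) (⋆-comm h p (suc n))) ⟩
        x * R n + (p ⋆ h) (suc n) ∎
        where
        p = powerSum xs ∘ suc
        lem : ∀ a b c → a + (b + c) ≡ b + (a + c)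
        lem = solve-∀ ℚ-ring
      G-suc : ∀ n → G (suc n) ≡ x * h′ (suc n) + x * G n
      G-suc n = trans (⋆-suc (λ j → pow x (suc j)) h′ n)
        (cong₂ (λ a c → a * h′ (suc n) + c) (*-identityʳ x) (geometric x h′ n))
      both : ∀ n → ℕ→ℚ (suc n) * (x * h′ n + h (suc n)) ≡ G n + R n
      both zero = trans (cong (λ z → 1ℚ * (x * 1ℚ + z)) (trans (sym (*-identityˡ (h 1))) (step xs 0))) (lem x (powerSum xs 1))
        where
        lem : ∀ x p → 1ℚ * (x * 1ℚ + (p * 1ℚ + 0ℚ)) ≡ (x * 1ℚ * 1ℚ + 0ℚ) + (p * 1ℚ + 0ℚ)
        lem = solve-∀ ℚ-ring
      both (suc n) = begin
        ℕ→ℚ (suc (suc n)) * (x * h′ (suc n) + h (suc (suc n)))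
          ≡⟨ *-distribˡ-+ (ℕ→ℚ (suc (suc n))) (x * h′ (suc n)) (h (suc (suc n))) ⟩
        ℕ→ℚ (suc (suc n)) * (x * h′ (suc n)) + ℕ→ℚ (suc (suc n)) * h (suc (suc n))
          ≡⟨ cong₂ (λ a c → a * (x * h′ (suc n)) + c) (ℕ→ℚ-suc (suc n)) (step xs (suc n)) ⟩
        (1ℚ + ℕ→ℚ (suc n)) * (x * h′ (suc n)) + S
          ≡⟨ lem₁ (ℕ→ℚ (suc n)) x (h′ (suc n)) S ⟩
        x * h′ (suc n) + x * (ℕ→ℚ (suc n) * h′ (suc n)) + S
          ≡⟨ cong (λ z → x * h′ (suc n) + x * z + S) (both n) ⟩
        x * h′ (suc n) + x * (G n + R n) + S
          ≡⟨ lem₂ x (h′ (suc n)) (G n) (R n) S ⟩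
        (x * h′ (suc n) + x * G n) + (x * R n + S)
          ≡⟨ cong₂ _+_ (G-suc n) (R-suc n) ⟨
        G (suc n) + R (suc n) ∎
        where
        S = ((powerSum xs ∘ suc) ⋆ h) (suc n)
        lem₁ : ∀ n x y s → (1ℚ + n) * (x * y) + s ≡ x * y + x * (n * y) + s
        lem₁ = solve-∀ ℚ-ring
        lem₂ : ∀ x y g r s → x * y + x * (g + r) + s ≡ (x * y + x * g) + (x * r + s)
        lem₂ = solve-∀ ℚ-ring

-- Necklace counts for letters of weight 1 and -1.

module SignedLetters where

  open FiniteSums
  open Words
  open Fillings
  open Enumeration
  open GesselReutenauer
  open Moebius
  open Necklaces
  open PowerSeries
  open import Defs
  open import Data.Bool using (Bool; true; false; not; if_then_else_)
  open import Data.Nat as ℕ using (ℕ; zero; suc; NonZero)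
  open import Data.Nat.Divisibility using (_∣?_)
  open import Data.Fin using (Fin; toℕ; zero; suc)
  open import Data.Rational as ℚ using (ℚ; 0ℚ; 1ℚ; ½; _+_; _*_; _-_; -_)
  open import Data.Rational.Properties
  open import Data.List as List using (List; []; _∷_; map; upTo; allFin; length)
  open import Data.List.Properties using (length-tabulate)
  open import Data.List.Relation.Unary.All as All using (All; []; _∷_)
  open import Data.Vec as Vec using (Vec; toList)
  open import Data.Vec.Properties using (toList-map)
  open import Function using (id)
  open import Relation.Nullary.Decidable using (⌊_⌋)
  open import Relation.Binary.PropositionalEquality
  open import Tactic.RingSolver using (solve-∀)
  open ≡-Reasoning

  sgn-square : ∀ n → sgn n * sgn n ≡ 1ℚ
  sgn-square zero = refl
  sgn-square (suc n) = trans (lem (sgn n)) (sgn-square n)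
    where
    lem : ∀ a → - a * - a ≡ a * a
    lem = solve-∀ ℚ-ring

  -- The derivative of log((1+t)/(1-t)) is 2/(1-t²).
  θ-logRatio : ∀ j → θ logRatio (suc j) ≡ evenℚ j + evenℚ j
  θ-logRatio j = begin
    ℕ→ℚ (suc j) * (sgn j * recip (suc j) - - sgn j * (sgn j * recip (suc j)))
      ≡⟨ lem₁ (ℕ→ℚ (suc j)) (recip (suc j)) (sgn j) ⟩
    ℕ→ℚ (suc j) * recip (suc j) * (sgn j + sgn j * sgn j)
      ≡⟨ cong₂ (λ x y → x * (sgn j + y)) (recip-inverse j) (sgn-square j) ⟩
    1ℚ * (sgn j + 1ℚ)
      ≡⟨ cong₂ (λ x y → 1ℚ * (x + y)) (even-odd j) (even+odd j) ⟨
    1ℚ * ((evenℚ j - oddℚ j) + (evenℚ j + oddℚ j))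
      ≡⟨ lem₂ (evenℚ j) (oddℚ j) ⟩
    evenℚ j + evenℚ j ∎
    where
    lem₁ : ∀ n r s → n * (s * r - - s * (s * r)) ≡ n * r * (s + s * s)
    lem₁ = solve-∀ ℚ-ring
    lem₂ : ∀ e o → 1ℚ * ((e - o) + (e + o)) ≡ e + e
    lem₂ = solve-∀ ℚ-ring

  -- Power sums of a multiset of signs: a in odd degrees, c in even degrees.
  signSum : ℚ → ℚ → Series
  signSum a c zero    = 0ℚ
  signSum a c (suc j) = evenℚ j * a + oddℚ j * c

  -- For p signs 1 and n signs -1, with a = p - n and c = p + n, this is (1-t)^(-p) (1+t)^(-n). The
  -- second factor is (1-t)^(-c), since `recip` is the coefficient sequence of -log(1-t).
  signSeries : ℚ → ℚ → Series
  signSeries a c = expS logRatio (½ * (a - c)) ⋆ expS recip c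

  θ-signSeries : ∀ a c n → θ (signSeries a c) n ≡ (signSum a c ⋆ signSeries a c) n
  θ-signSeries a c n = begin
    θ (f ⋆ g) n
      ≡⟨ θ-⋆ f g n ⟩
    (θ f ⋆ g) n + (f ⋆ θ g) n
      ≡⟨ cong₂ _+_ (⋆-congˡ g n (θ-expS {logRatio} refl α)) (⋆-congʳ f n (θ-expS {recip} refl c)) ⟩
    ((A ⋆ f) ⋆ g) n + (f ⋆ (B ⋆ g)) n
      ≡⟨ cong₂ _+_ (⋆-assoc A f g n) (⋆-left-comm f B g n) ⟩
    (A ⋆ (f ⋆ g)) n + (B ⋆ (f ⋆ g)) n
      ≡⟨ ⋆-+ˡ A B (f ⋆ g) n ⟨
    ((λ k → A k + B k) ⋆ (f ⋆ g)) n
      ≡⟨ ⋆-congˡ (f ⋆ g) n total ⟩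
    (signSum a c ⋆ (f ⋆ g)) n ∎
    where
    α = ½ * (a - c)
    f g A B : Series
    f = expS logRatio α
    g = expS recip c
    A k = α * θ logRatio k
    B k = c * θ recip k
    total : ∀ k → A k + B k ≡ signSum a c k
    total zero = lem α c
      where
      lem : ∀ a c → a * (0ℚ * 0ℚ) + c * (0ℚ * 0ℚ) ≡ 0ℚ
      lem = solve-∀ ℚ-ring
    total (suc j) = begin
      α * θ logRatio (suc j) + c * (ℕ→ℚ (suc j) * recip (suc j))
        ≡⟨ cong₂ (λ x y → α * x + c * y) (θ-logRatio j) (trans (recip-inverse j) (sym (even+odd j))) ⟩
      ½ * (a - c) * (evenℚ j + evenℚ j) + c * (evenℚ j + oddℚ j)
        ≡⟨ lem a c (evenℚ j) (oddℚ j) ⟩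
      evenℚ j * a + oddℚ j * c ∎
      where
      lem : ∀ a c e o → ½ * (a - c) * (e + e) + c * (e + o) ≡ e * a + o * c
      lem = solve-∀ ℚ-ring

  pow-sign : ∀ {x} → x * x ≡ 1ℚ → ∀ n → pow x n ≡ evenℚ n * 1ℚ + oddℚ n * x
  pow-sign {x} e zero = lem x
    where
    lem : ∀ x → 1ℚ ≡ 1ℚ * 1ℚ + 0ℚ * x
    lem = solve-∀ ℚ-ring
  pow-sign {x} e (suc zero) = lem x
    where
    lem : ∀ x → x * 1ℚ ≡ 0ℚ * 1ℚ + 1ℚ * x
    lem = solve-∀ ℚ-ring
  pow-sign {x} e (suc (suc n)) = trans (sym (*-assoc x x (pow x n))) (trans (cong (_* pow x n) e)
    (trans (*-identityˡ (pow x n)) (pow-sign e n)))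

  ∑-pow-signs : ∀ {A : Set} (xs : List A) (f : A → ℚ) → (∀ x → f x * f x ≡ 1ℚ) → ∀ n →
    ∑ xs (λ x → pow (f x) n) ≡ evenℚ n * ℕ→ℚ (length xs) + oddℚ n * ∑ xs f
  ∑-pow-signs xs f e n = begin
    ∑ xs (λ x → pow (f x) n)
      ≡⟨ ∑-cong xs (λ x → pow-sign (e x) n) ⟩
    ∑ xs (λ x → evenℚ n * 1ℚ + oddℚ n * f x)
      ≡⟨ ∑-+ xs (λ _ → evenℚ n * 1ℚ) (λ x → oddℚ n * f x) ⟩
    ∑ xs (λ _ → evenℚ n * 1ℚ) + ∑ xs (λ x → oddℚ n * f x)
      ≡⟨ cong₂ _+_ (trans (∑-*ˡ xs (evenℚ n) (λ _ → 1ℚ)) (cong (evenℚ n *_) (∑-one xs))) (∑-*ˡ xs (oddℚ n) f) ⟩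
    evenℚ n * ℕ→ℚ (length xs) + oddℚ n * ∑ xs f ∎

  -- Both sides have constant term 1 and the same logarithmic derivative, the series of power sums.
  homogeneous-signs : {A : Set} (xs : List A) (f : A → ℚ) → (∀ x → f x * f x ≡ 1ℚ) → ∀ r →
    homogeneous (map f xs) r ≡ signSeries (∑ xs f) (ℕ→ℚ (length xs)) r
  homogeneous-signs xs f e = θ-unique {signSum a c} {homogeneous (map f xs)} {signSeries a c} refl newton′ (θ-signSeries a c) refl
    where
    a = ∑ xs f
    c = ℕ→ℚ (length xs)
    sums : ∀ k → powerSum (map f xs) k ≡ signSum a c k
    sums zero = refl
    sums (suc j) = trans (∑-map xs f (λ x → pow x (suc j))) (trans (∑-pow-signs xs f e (suc j)) (lem j))
      where
      flip : ∀ j → evenℚ (suc j) ≡ oddℚ j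
      flip zero = refl
      flip (suc zero) = refl
      flip (suc (suc j)) = flip j
      flop : ∀ j → oddℚ (suc j) ≡ evenℚ j
      flop zero = refl
      flop (suc zero) = refl
      flop (suc (suc j)) = flop j
      lem : ∀ j → evenℚ (suc j) * c + oddℚ (suc j) * a ≡ evenℚ j * a + oddℚ j * c
      lem j = trans (cong₂ (λ x y → x * c + y * a) (flip j) (flop j)) (+-comm (oddℚ j * c) (evenℚ j * a))
    newton′ : ∀ n → θ (homogeneous (map f xs)) n ≡ (signSum a c ⋆ homogeneous (map f xs)) n
    newton′ n = trans (newton (map f xs) n) (⋆-congˡ (homogeneous (map f xs)) n sums)

  recip-cancel : ∀ m .{{_ : NonZero m}} x → recip m * (ℕ→ℚ m * x) ≡ x
  recip-cancel (suc n) x = trans (sym (*-assoc (recip (suc n)) (ℕ→ℚ (suc n)) x)) (trans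
    (cong (_* x) (trans (*-comm (recip (suc n)) (ℕ→ℚ (suc n))) (recip-inverse n))) (*-identityˡ x))

  Signs : List ℚ → Set
  Signs = All (λ y → y * y ≡ 1ℚ)

  sign-lookup : ∀ {ys} → Signs ys → ∀ c → List.lookup ys c * List.lookup ys c ≡ 1ℚ
  sign-lookup (e ∷ es) zero = e
  sign-lookup (e ∷ es) (suc c) = sign-lookup es c

  ∑-lookup : ∀ ys → ∑ (allFin (length ys)) (List.lookup ys) ≡ sumℚ ys
  ∑-lookup [] = refl
  ∑-lookup (y ∷ ys) = trans (∑-allFin-suc (length ys) (List.lookup (y ∷ ys))) (cong (y +_) (∑-lookup ys))

  weight-one : ∀ {L n} (w : Vec (Fin L) n) → weight (λ _ → 1ℚ) w ≡ 1ℚ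
  weight-one Vec.[] = refl
  weight-one (c Vec.∷ w) = trans (*-identityˡ _) (weight-one w)

  oneLine : {N n : ℕ} → Vec (Fin N) n → List ℕ
  oneLine v = map toℕ (toList v)

  odd? : ℕ → Bool
  odd? zero          = false
  odd? (suc zero)    = true
  odd? (suc (suc n)) = odd? n

  module _ (m : ℕ) .{{m≢0 : NonZero m}} where

    -- The contributions of the odd and of the even divisors to m times the signed number of necklaces.
    oddDivisors : (ℕ → ℚ) → ℚ
    oddDivisors s = ∑-divisors m (λ d → ⟦ odd? d ⟧ * (μℚ d * s (m ÷ d)))

    evenDivisors : ℚ → ℚ
    evenDivisors q = ∑-divisors m (λ d → ⟦ not (odd? d) ⟧ * (μℚ d * pow q (m ÷ d)))

    necklaces : ℚ → ℚ
    necklaces q = recip m * ∑-divisors m (λ d → μℚ d * pow q (m ÷ d))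

    -- Witt's formula with d-th power sum `x` for odd `d` and `q`, the number of letters, for even
    -- `d`.
    signedNecklaces : ℚ → ℚ → ℚ
    signedNecklaces x q = recip m * (oddDivisors (pow x) + evenDivisors q)

    module _ {L : ℕ} (z : Fin L → ℚ) (sign : ∀ c → z c * z c ≡ 1ℚ) where

      letter-sum : ∀ d → ∑ (allFin L) (λ c → pow (z c) d) ≡ (if odd? d then ∑ (allFin L) z else ℕ→ℚ L)
      letter-sum d = trans (∑-pow-signs (allFin L) z sign d)
        (trans (cong (λ l → evenℚ d * ℕ→ℚ l + oddℚ d * ∑ (allFin L) z) (length-tabulate {n = L} id)) (choose d))
        where
        q = ℕ→ℚ L
        X = ∑ (allFin L) z
        choose : ∀ d → evenℚ d * q + oddℚ d * X ≡ (if odd? d then X else q)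
        choose zero = lem q X
          where
          lem : ∀ q x → 1ℚ * q + 0ℚ * x ≡ q
          lem = solve-∀ ℚ-ring
        choose (suc zero) = lem q X
          where
          lem : ∀ q x → 0ℚ * q + 1ℚ * x ≡ x
          lem = solve-∀ ℚ-ring
        choose (suc (suc d)) = choose d

      signed-count : ∑ (lyndonWords {L} {m}) (weight z) ≡ signedNecklaces (∑ (allFin L) z) (ℕ→ℚ L)
      signed-count = begin
        ∑ lyndonWords (weight z)
          ≡⟨ recip-cancel m (∑ lyndonWords (weight z)) ⟨
        recip m * (ℕ→ℚ m * ∑ lyndonWords (weight z))
          ≡⟨ cong (recip m *_) (lyndon-count {L} {m} z) ⟩
        recip m * ∑-divisors m (λ d → μℚ d * pow (∑ (allFin L) (λ c → pow (z c) d)) (m ÷ d))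
          ≡⟨ cong (recip m *_) (∑-cong (upTo m) (λ k → cong (⟦ ⌊ suc k ∣? m ⌋ ⟧ *_) (trans
               (cong (λ x → μℚ (suc k) * pow x (m ÷ suc k)) (letter-sum (suc k)))
               (split (odd? (suc k)) (μℚ (suc k)) (m ÷ suc k))))) ⟩
        recip m * ∑-divisors m (λ d → ⟦ odd? d ⟧ * (μℚ d * pow X (m ÷ d)) + ⟦ not (odd? d) ⟧ * (μℚ d * pow q (m ÷ d)))
          ≡⟨ cong (recip m *_) (trans (∑-cong (upTo m) (λ k → *-distribˡ-+ ⟦ ⌊ suc k ∣? m ⌋ ⟧
               (⟦ odd? (suc k) ⟧ * (μℚ (suc k) * pow X (m ÷ suc k))) (⟦ not (odd? (suc k)) ⟧ * (μℚ (suc k) * pow q (m ÷ suc k)))))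
               (∑-+ (upTo m) (λ k → ⟦ ⌊ suc k ∣? m ⌋ ⟧ * (⟦ odd? (suc k) ⟧ * (μℚ (suc k) * pow X (m ÷ suc k))))
                 (λ k → ⟦ ⌊ suc k ∣? m ⌋ ⟧ * (⟦ not (odd? (suc k)) ⟧ * (μℚ (suc k) * pow q (m ÷ suc k)))))) ⟩
        recip m * (oddDivisors (pow X) + evenDivisors q) ∎
        where
        q = ℕ→ℚ L
        X = ∑ (allFin L) z
        split : ∀ o u e → u * pow (if o then X else q) e ≡ ⟦ o ⟧ * (u * pow X e) + ⟦ not o ⟧ * (u * pow q e)
        split true u e = lem (u * pow X e) (u * pow q e)
          where
          lem : ∀ x y → x ≡ 1ℚ * x + 0ℚ * y
          lem = solve-∀ ℚ-ring
        split false u e = lem (u * pow X e) (u * pow q e)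
          where
          lem : ∀ x y → y ≡ 0ℚ * x + 1ℚ * y
          lem = solve-∀ ℚ-ring

      weight-sign : ∀ {n} (w : Vec (Fin L) n) → weight z w * weight z w ≡ 1ℚ
      weight-sign Vec.[] = refl
      weight-sign (c Vec.∷ w) = trans (lem (z c) (weight z w)) (trans (cong₂ _*_ (sign c) (weight-sign w)) refl)
        where
        lem : ∀ a x → a * x * (a * x) ≡ a * a * (x * x)
        lem = solve-∀ ℚ-ring

    count-lyndon : ∀ L → ℕ→ℚ (length (lyndonWords {L} {m})) ≡ necklaces (ℕ→ℚ L)
    count-lyndon L = begin
      ℕ→ℚ (length (lyndonWords {L} {m}))
        ≡⟨ ∑-one lyndonWords ⟨
      ∑ lyndonWords (λ _ → 1ℚ)
        ≡⟨ ∑-cong lyndonWords (λ w → sym (weight-one w)) ⟩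
      ∑ lyndonWords (weight (λ _ → 1ℚ))
        ≡⟨ recip-cancel m (∑ lyndonWords (weight (λ _ → 1ℚ))) ⟨
      recip m * (ℕ→ℚ m * ∑ lyndonWords (weight (λ _ → 1ℚ)))
        ≡⟨ cong (recip m *_) (lyndon-count {L} {m} (λ _ → 1ℚ)) ⟩
      recip m * ∑-divisors m (λ d → μℚ d * pow (∑ (allFin L) (λ c → pow 1ℚ d)) (m ÷ d))
        ≡⟨ cong (recip m *_) (∑-cong (upTo m) (λ k → cong (λ x → ⟦ ⌊ suc k ∣? m ⌋ ⟧ * (μℚ (suc k) * pow x (m ÷ suc k))) (ones (suc k)))) ⟩
      recip m * ∑-divisors m (λ d → μℚ d * pow (ℕ→ℚ L) (m ÷ d)) ∎
      where
      ones : ∀ d → ∑ (allFin L) (λ c → pow 1ℚ d) ≡ ℕ→ℚ L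
      ones d = trans (∑-cong (allFin L) (λ _ → pow-one d)) (trans (∑-one (allFin L)) (cong ℕ→ℚ (length-tabulate {n = L} id)))

    ∑-fillings : ∀ r ys → Signs ys →
      ∑ (allWords (m ℕ.* r) (m ℕ.* r)) (λ v → ⟦ cyclesᵇ m v ⟧ * fillings ys (oneLine v))
        ≡ signSeries (signedNecklaces (sumℚ ys) (ℕ→ℚ (length ys))) (necklaces (ℕ→ℚ (length ys))) r
    ∑-fillings r ys signs = begin
      ∑ (allWords N N) (λ v → ⟦ cyclesᵇ m v ⟧ * fillings ys (oneLine v))
        ≡⟨ ∑-cong (allWords N N) (λ v → cong (⟦ cyclesᵇ m v ⟧ *_)
             (trans (cong (fillings ys) (sym (toList-map toℕ v))) (fillings-lexSum ys (Vec.map toℕ v)))) ⟩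
      ∑ (allWords N N) (λ v → ⟦ cyclesᵇ m v ⟧ * lexSum ys (Vec.map toℕ v))
        ≡⟨ gessel-reutenauer {length ys} {m} r z ⟩
      homogeneous (map (weight z) lyndonWords) r
        ≡⟨ homogeneous-signs lyndonWords (weight z) (weight-sign z sign) r ⟩
      signSeries (∑ lyndonWords (weight z)) (ℕ→ℚ (length (lyndonWords {length ys} {m}))) r
        ≡⟨ cong₂ (λ a c → signSeries a c r)
             (trans (signed-count z sign) (cong (λ x → signedNecklaces x (ℕ→ℚ (length ys))) (∑-lookup ys)))
             (count-lyndon (length ys)) ⟩
      signSeries (signedNecklaces (sumℚ ys) (ℕ→ℚ (length ys))) (necklaces (ℕ→ℚ (length ys))) r ∎
      where
      N = m ℕ.* r
      z = List.lookup ys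
      sign = sign-lookup signs

-- Moments of sums of signs, continued to sech, and operators on moment sequences.

module Moments where

  open FiniteSums
  open Words
  open Moebius
  open Necklaces
  open PowerSeries
  open SignedLetters
  open import Defs
  open import Data.Nat as ℕ using (ℕ; zero; suc; _∸_; _!; NonZero; z≤n; s≤s)
  import Data.Nat.Properties as ℕₚ
  open import Data.Nat.Divisibility using (_∣?_)
  open import Data.Rational as ℚ using (ℚ; 0ℚ; 1ℚ; ½; _+_; _*_; _-_; -_)
  open import Data.Rational.Properties
  open import Data.List as List using (List; []; _∷_; map; upTo; zipWith)
  open import Data.List.Relation.Unary.All using ([]; _∷_)
  open import Function using (_∘_; id)
  open import Relation.Nullary.Decidable using (⌊_⌋)
  open import Relation.Binary.PropositionalEquality
  open import Tactic.RingSolver using (solve-∀)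
  open ≡-Reasoning

  invRev-map : ∀ a n → invRev a n ≡ map (λ k → invSeries1 a (n ∸ k)) (upTo (suc n))
  invRev-map a zero = refl
  invRev-map a (suc n) = cong (invSeries1 a (suc n) ∷_) (trans (invRev-map a n)
    (sym (map-upTo-suc (suc n) (λ k → invSeries1 a (suc n ∸ k)) id)))

  zipWith-map : {A B C : Set} (f : B → B → C) (g h : A → B) (xs : List A) →
    zipWith f (map g xs) (map h xs) ≡ map (λ x → f (g x) (h x)) xs
  zipWith-map f g h [] = refl
  zipWith-map f g h (x ∷ xs) = cong (f (g x) (h x) ∷_) (zipWith-map f g h xs)

  invSeries1-suc : ∀ a n → invSeries1 a (suc n) ≡ - ((a ∘ suc) ⋆ invSeries1 a) n
  invSeries1-suc a n = cong (λ l → - sumℚ l) (trans (cong (zipWith _*_ (map (a ∘ suc) (upTo (suc n)))) (invRev-map a n))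
    (zipWith-map _*_ (a ∘ suc) (λ k → invSeries1 a (n ∸ k)) (upTo (suc n))))

  ⋆-inverse : ∀ a → a 0 ≡ 1ℚ → ∀ n → (a ⋆ invSeries1 a) n ≡ oneS n
  ⋆-inverse a e zero = cong (λ x → x * 1ℚ + 0ℚ) e
  ⋆-inverse a e (suc n) = trans (⋆-suc a (invSeries1 a) n)
    (trans (cong₂ (λ x y → x * y + ((a ∘ suc) ⋆ invSeries1 a) n) e (invSeries1-suc a n)) (lem (((a ∘ suc) ⋆ invSeries1 a) n)))
    where
    lem : ∀ x → 1ℚ * - x + x ≡ 0ℚ
    lem = solve-∀ ℚ-ring

  -- The metavariable is solved to the function local to cosS.
  mutual
    cosAux : ℕ → ℕ → ℚ
    cosAux = _

    cosS-unfold : ∀ k → cosS (suc (suc k)) ≡ ℚ.- (cosAux (suc (suc k)) k ℚ.* recip (suc k ℕ.* suc (suc k)))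
    cosS-unfold k with ℚ._*_ | suc (suc k)
    ... | _·_ | n = refl

  recip-2+! : ∀ k → recip (suc (suc k) !) ≡ recip (suc k ℕ.* suc (suc k)) * recip (k !)
  recip-2+! k = begin
    recip (suc (suc k) !)                                  ≡⟨ recip-suc! (suc k) ⟩
    recip (suc (suc k)) * recip (suc k !)                  ≡⟨ cong (recip (suc (suc k)) *_) (recip-suc! k) ⟩
    recip (suc (suc k)) * (recip (suc k) * recip (k !))    ≡⟨ lem (recip (suc (suc k))) (recip (suc k)) (recip (k !)) ⟩
    recip (suc k) * recip (suc (suc k)) * recip (k !)      ≡⟨ cong (_* recip (k !)) (recip-* (suc k) (suc (suc k))) ⟨
    recip (suc k ℕ.* suc (suc k)) * recip (k !)            ∎
    where
    lem : ∀ a b c → a * (b * c) ≡ b * a * c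
    lem = solve-∀ ℚ-ring

  cosAux-ρ : ∀ n k → cosAux n k ≡ ρ k * recip (k !)
  cosAux-ρ n zero = refl
  cosAux-ρ n (suc zero) = refl
  cosAux-ρ n (suc (suc k)) = begin
    - (cosAux n k * c)               ≡⟨ cong (λ x → - (x * c)) (cosAux-ρ n k) ⟩
    - (ρ k * recip (k !) * c)        ≡⟨ lem (ρ k) (recip (k !)) c ⟩
    - ρ k * (c * recip (k !))        ≡⟨ cong (- ρ k *_) (recip-2+! k) ⟨
    - ρ k * recip (suc (suc k) !)    ∎
    where
    c = recip (suc k ℕ.* suc (suc k))
    lem : ∀ r f c → - (r * f * c) ≡ - r * (c * f)
    lem = solve-∀ ℚ-ring

  cosS-ρ : ∀ k → cosS k ≡ ρ k * recip (k !)
  cosS-ρ k = cosAux-ρ k k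

  coshS : Series
  coshS k = evenℚ k * recip (k !)

  -- Both sides vanish for odd `k`; for even `k`, ρ k is a sign and ρ (k + j) = ρ k · ρ j.
  ρ-shift : ∀ k j → evenℚ k * ρ j ≡ ρ (k ℕ.+ j) * ρ k
  ρ-shift zero j = *-comm 1ℚ (ρ j)
  ρ-shift (suc zero) j = trans (*-zeroˡ (ρ j)) (sym (*-zeroʳ (ρ (suc j))))
  ρ-shift (suc (suc k)) j = trans (ρ-shift k j) (lem (ρ (k ℕ.+ j)) (ρ k))
    where
    lem : ∀ a b → a * b ≡ - a * - b
    lem = solve-∀ ℚ-ring

  -- cosh · sech = 1
  coshS-sech : ∀ n → (coshS ⋆ (λ k → ρ k * secS k)) n ≡ oneS n
  coshS-sech n = begin
    ∑< (suc n) (λ k → evenℚ k * recip (k !) * (ρ (n ∸ k) * secS (n ∸ k)))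
      ≡⟨ ∑<-cong (suc n) (λ { k (s≤s k≤n) → term k k≤n }) ⟩
    ∑< (suc n) (λ k → ρ n * (cosS k * secS (n ∸ k)))
      ≡⟨ ∑-*ˡ (upTo (suc n)) (ρ n) (λ k → cosS k * secS (n ∸ k)) ⟩
    ρ n * (cosS ⋆ secS) n
      ≡⟨ cong (ρ n *_) (⋆-inverse cosS refl n) ⟩
    ρ n * oneS n
      ≡⟨ last n ⟩
    oneS n ∎
    where
    last : ∀ n → ρ n * oneS n ≡ oneS n
    last zero = refl
    last (suc n) = *-zeroʳ (ρ (suc n))
    lem₁ : ∀ e f r s → e * f * (r * s) ≡ e * r * f * s
    lem₁ = solve-∀ ℚ-ring
    lem₂ : ∀ a r f s → a * r * f * s ≡ a * (r * f * s)
    lem₂ = solve-∀ ℚ-ring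
    term : ∀ k → k ℕ.≤ n → evenℚ k * recip (k !) * (ρ (n ∸ k) * secS (n ∸ k)) ≡ ρ n * (cosS k * secS (n ∸ k))
    term k k≤n = begin
      evenℚ k * recip (k !) * (ρ (n ∸ k) * secS (n ∸ k))
        ≡⟨ lem₁ (evenℚ k) (recip (k !)) (ρ (n ∸ k)) (secS (n ∸ k)) ⟩
      evenℚ k * ρ (n ∸ k) * recip (k !) * secS (n ∸ k)
        ≡⟨ cong (λ x → x * recip (k !) * secS (n ∸ k)) (trans (ρ-shift k (n ∸ k)) (cong (λ j → ρ j * ρ k) (ℕₚ.m+[n∸m]≡n k≤n))) ⟩
      ρ n * ρ k * recip (k !) * secS (n ∸ k)
        ≡⟨ lem₂ (ρ n) (ρ k) (recip (k !)) (secS (n ∸ k)) ⟩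
      ρ n * (ρ k * recip (k !) * secS (n ∸ k))
        ≡⟨ cong (λ x → ρ n * (x * secS (n ∸ k))) (cosS-ρ k) ⟨
      ρ n * (cosS k * secS (n ∸ k)) ∎

  tS : Series
  tS zero          = 0ℚ
  tS (suc zero)    = 1ℚ
  tS (suc (suc _)) = 0ℚ

  expX : ℚ → Series
  expX x n = expCoeff n x

  θ-expX : ∀ x n → θ (expX x) n ≡ ((λ k → x * tS k) ⋆ expX x) n
  θ-expX x zero = lem x (expX x 0)
    where
    lem : ∀ x y → 0ℚ * y ≡ x * 0ℚ * y + 0ℚ
    lem = solve-∀ ℚ-ring
  θ-expX x (suc n) = begin
    ℕ→ℚ (suc n) * expCoeff (suc n) x
      ≡⟨ trans (*-comm (ℕ→ℚ (suc n)) (expCoeff (suc n) x)) (expCoeff-suc n x) ⟩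
    x * expX x n
      ≡⟨ cong (x *_) (⋆-identityˡ (expX x) n) ⟨
    x * (oneS ⋆ expX x) n
      ≡⟨ cong (x *_) (⋆-congˡ (expX x) n oneS-tS) ⟩
    x * ((tS ∘ suc) ⋆ expX x) n
      ≡⟨ ⋆-scaleˡ x (tS ∘ suc) (expX x) n ⟨
    ((λ k → x * tS (suc k)) ⋆ expX x) n
      ≡⟨ lem x (expX x (suc n)) (((λ k → x * tS (suc k)) ⋆ expX x) n) ⟩
    x * 0ℚ * expX x (suc n) + ((λ k → x * tS (suc k)) ⋆ expX x) n
      ≡⟨ ⋆-suc (λ k → x * tS k) (expX x) n ⟨
    ((λ k → x * tS k) ⋆ expX x) (suc n) ∎
    where
    oneS-tS : ∀ k → oneS k ≡ tS (suc k)
    oneS-tS zero = refl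
    oneS-tS (suc k) = refl
    lem : ∀ x y z → z ≡ x * 0ℚ * y + z
    lem = solve-∀ ℚ-ring

  expX-+ : ∀ x y n → expX (x + y) n ≡ (expX x ⋆ expX y) n
  expX-+ x y = θ-unique {λ k → (x + y) * tS k} {expX (x + y)} {expX x ⋆ expX y} (*-zeroʳ (x + y)) (θ-expX (x + y)) product refl
    where
    product : ∀ n → θ (expX x ⋆ expX y) n ≡ ((λ k → (x + y) * tS k) ⋆ (expX x ⋆ expX y)) n
    product n = begin
      θ (expX x ⋆ expX y) n
        ≡⟨ θ-⋆ (expX x) (expX y) n ⟩
      (θ (expX x) ⋆ expX y) n + (expX x ⋆ θ (expX y)) n
        ≡⟨ cong₂ _+_ (trans (⋆-congˡ (expX y) n (θ-expX x)) (⋆-assoc (λ k → x * tS k) (expX x) (expX y) n))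
             (trans (⋆-congʳ (expX x) n (θ-expX y)) (⋆-left-comm (expX x) (λ k → y * tS k) (expX y) n)) ⟩
      ((λ k → x * tS k) ⋆ (expX x ⋆ expX y)) n + ((λ k → y * tS k) ⋆ (expX x ⋆ expX y)) n
        ≡⟨ ⋆-+ˡ (λ k → x * tS k) (λ k → y * tS k) (expX x ⋆ expX y) n ⟨
      ((λ k → x * tS k + y * tS k) ⋆ (expX x ⋆ expX y)) n
        ≡⟨ ⋆-congˡ (expX x ⋆ expX y) n (λ k → sym (*-distribʳ-+ (tS k) x y)) ⟩
      ((λ k → (x + y) * tS k) ⋆ (expX x ⋆ expX y)) n ∎

  coshS-average : ∀ k → ½ * expX 1ℚ k + ½ * expX (- 1ℚ) k ≡ coshS k
  coshS-average k = begin
    ½ * (recip (k !) * pow 1ℚ k) + ½ * (recip (k !) * pow (- 1ℚ) k)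
      ≡⟨ cong₂ (λ x y → ½ * (recip (k !) * x) + ½ * (recip (k !) * y)) (trans (pow-one k) (sym (even+odd k)))
           (trans (pow-minus-one k) (sym (even-odd k))) ⟩
    ½ * (recip (k !) * (evenℚ k + oddℚ k)) + ½ * (recip (k !) * (evenℚ k - oddℚ k))
      ≡⟨ lem (recip (k !)) (evenℚ k) (oddℚ k) ⟩
    evenℚ k * recip (k !) ∎
    where
    lem : ∀ f e o → ½ * (f * (e + o)) + ½ * (f * (e - o)) ≡ e * f
    lem = solve-∀ ℚ-ring

  -- Normalised moments of a sum of l independent signs, indexed by l + 1;
  -- index 0 continues them to l = -1.
  moment : ℕ → Series
  moment zero    n = ρ n * secS n
  moment (suc l) n = mean l (λ ys → expX (sumℚ ys) n)

  mean-⋆ : ∀ l a (F : List ℚ → Series) n → mean l (λ ys → (a ⋆ F ys) n) ≡ (a ⋆ (λ k → mean l (λ ys → F ys k))) n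
  mean-⋆ l a F n = trans (mean-∑ l (upTo (suc n)) (λ k ys → a k * F ys (n ∸ k)))
    (∑-cong (upTo (suc n)) (λ k → mean-*ˡ l (a k) (λ ys → F ys (n ∸ k))))

  -- A further independent sign multiplies the exponential generating function by cosh; the step
  -- from index 0 is cosh · sech = 1.
  moment-suc : ∀ i n → moment (suc i) n ≡ (coshS ⋆ moment i) n
  moment-suc zero n = trans (zero-power n) (sym (coshS-sech n))
    where
    zero-power : ∀ n → expX 0ℚ n ≡ oneS n
    zero-power zero = refl
    zero-power (suc n) = trans (cong (recip (suc n !) *_) (*-zeroˡ (pow 0ℚ n))) (*-zeroʳ (recip (suc n !)))
  moment-suc (suc l) n = begin
    ½ * mean l (λ ys → expX (1ℚ + sumℚ ys) n) + ½ * mean l (λ ys → expX (- 1ℚ + sumℚ ys) n)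
      ≡⟨ cong₂ (λ x y → ½ * x + ½ * y) (half 1ℚ) (half (- 1ℚ)) ⟩
    ½ * (expX 1ℚ ⋆ moment (suc l)) n + ½ * (expX (- 1ℚ) ⋆ moment (suc l)) n
      ≡⟨ cong₂ _+_ (⋆-scaleˡ ½ (expX 1ℚ) (moment (suc l)) n) (⋆-scaleˡ ½ (expX (- 1ℚ)) (moment (suc l)) n) ⟨
    ((λ k → ½ * expX 1ℚ k) ⋆ moment (suc l)) n + ((λ k → ½ * expX (- 1ℚ) k) ⋆ moment (suc l)) n
      ≡⟨ ⋆-+ˡ (λ k → ½ * expX 1ℚ k) (λ k → ½ * expX (- 1ℚ) k) (moment (suc l)) n ⟨
    ((λ k → ½ * expX 1ℚ k + ½ * expX (- 1ℚ) k) ⋆ moment (suc l)) n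
      ≡⟨ ⋆-congˡ (moment (suc l)) n coshS-average ⟩
    (coshS ⋆ moment (suc l)) n ∎
    where
    half : ∀ x → mean l (λ ys → expX (x + sumℚ ys) n) ≡ (expX x ⋆ moment (suc l)) n
    half x = trans (mean-cong l (λ ys → expX-+ x (sumℚ ys) n)) (mean-⋆ l (expX x) (λ ys → expX (sumℚ ys)) n)

  isPoly-⋆ : ∀ a (F : ℕ → Series) n → (∀ k → k ℕ.≤ n → IsPoly (λ i → F i k)) → IsPoly (λ i → (a ⋆ F i) n)
  isPoly-⋆ a F zero p = isPoly-+ (isPoly-* (isPoly-const (a 0)) (p 0 z≤n)) (isPoly-const 0ℚ)
  isPoly-⋆ a F (suc n) p = isPoly-cong (λ i → sym (⋆-suc a (F i) n))
    (isPoly-+ (isPoly-* (isPoly-const (a 0)) (p (suc n) ℕₚ.≤-refl)) (isPoly-⋆ (a ∘ suc) F n (λ k k≤n → p k (ℕₚ.m≤n⇒m≤1+n k≤n))))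

  -- As for `conv-power`: cosh has constant term 1, so one difference in the index lowers the degree
  -- of the moment.
  isPoly-moment : ∀ n → IsPoly (λ i → moment i n)
  isPoly-moment n = bounded n n ℕₚ.≤-refl
    where
    lem₀ : ∀ x → 0ℚ ≡ 1ℚ * x + 0ℚ - x
    lem₀ = solve-∀ ℚ-ring
    lem : ∀ x y → y ≡ 1ℚ * x + y - x
    lem = solve-∀ ℚ-ring
    bounded : ∀ b n → n ℕ.≤ b → IsPoly (λ i → moment i n)
    bounded b zero _ = isPoly-Δ (isPoly-cong (λ i → trans (lem₀ (moment i 0)) (cong (_- moment i 0) (sym (moment-suc i 0)))) (isPoly-const 0ℚ))
    bounded (suc b) (suc n) (s≤s n≤b) = isPoly-Δ (isPoly-cong
      (λ i → trans (lem (moment i (suc n)) (((coshS ∘ suc) ⋆ moment i) n))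
        (cong (_- moment i (suc n)) (trans (sym (⋆-suc coshS (moment i) n)) (sym (moment-suc i (suc n))))))
      (isPoly-⋆ (coshS ∘ suc) moment n (λ k k≤n → bounded b k (ℕₚ.≤-trans k≤n n≤b))))

  fact-recip : ∀ n → ℕ→ℚ (n !) * recip (n !) ≡ 1ℚ
  fact-recip n = inverse (n !) {{ℕₚ._!≢0 n}}
    where
    inverse : ∀ k .{{_ : NonZero k}} → ℕ→ℚ k * recip k ≡ 1ℚ
    inverse (suc k) = recip-inverse k

  rawMoment : ℕ → ℕ → ℚ
  rawMoment i n = ℕ→ℚ (n !) * moment i n

  rawMoment-suc : ∀ l n → rawMoment (suc l) n ≡ mean l (λ ys → pow (sumℚ ys) n)
  rawMoment-suc l n = trans (sym (mean-*ˡ l (ℕ→ℚ (n !)) (λ ys → expX (sumℚ ys) n)))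
    (mean-cong l (λ ys → trans (sym (*-assoc (ℕ→ℚ (n !)) (recip (n !)) (pow (sumℚ ys) n)))
      (trans (cong (_* pow (sumℚ ys) n) (fact-recip n)) (*-identityˡ (pow (sumℚ ys) n)))))

  pow-+ : ∀ x a c → pow x (a ℕ.+ c) ≡ pow x a * pow x c
  pow-+ x zero c = sym (*-identityˡ (pow x c))
  pow-+ x (suc a) c = trans (cong (x *_) (pow-+ x a c)) (sym (*-assoc x (pow x a) (pow x c)))

  module Operator (m : ℕ) .{{m≢0 : NonZero m}} where

    -- Multiplication by (signedNecklaces − c)/2 on moment sequences, powers of the
    -- variable acting by shifts; κ is the contribution of the even divisors.
    operator : ℚ → ℚ → (ℕ → ℚ) → ℕ → ℚ
    operator κ c s n = ½ * (recip m * (oddDivisors m (λ e → s (n ℕ.+ e)) + κ * s n) - c * s n)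

    iterate : ℚ → ℚ → ℕ → (ℕ → ℚ) → ℕ → ℚ
    iterate κ c zero    s = s
    iterate κ c (suc k) s = operator κ c (iterate κ c k s)

    oddDivisors-cong : ∀ {s t} → (∀ e → s e ≡ t e) → oddDivisors m s ≡ oddDivisors m t
    oddDivisors-cong e = ∑-cong (upTo m) (λ k → cong (λ x → ⟦ ⌊ suc k ∣? m ⌋ ⟧ * (⟦ odd? (suc k) ⟧ * (μℚ (suc k) * x))) (e (m ÷ suc k)))

    oddDivisors-scale : ∀ x s → oddDivisors m (λ e → x * s e) ≡ x * oddDivisors m s
    oddDivisors-scale x s = trans (∑-cong (upTo m) (λ k → lem x ⟦ ⌊ suc k ∣? m ⌋ ⟧ ⟦ odd? (suc k) ⟧ (μℚ (suc k)) (s (m ÷ suc k))))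
      (∑-*ˡ (upTo m) x (λ k → ⟦ ⌊ suc k ∣? m ⌋ ⟧ * (⟦ odd? (suc k) ⟧ * (μℚ (suc k) * s (m ÷ suc k)))))
      where
      lem : ∀ x a b c s → a * (b * (c * (x * s))) ≡ x * (a * (b * (c * s)))
      lem = solve-∀ ℚ-ring

    operator-cong : ∀ κ c {s t} → (∀ n → s n ≡ t n) → ∀ n → operator κ c s n ≡ operator κ c t n
    operator-cong κ c {s} {t} e n = cong₂ (λ x y → ½ * (recip m * (x + κ * y) - c * y)) (oddDivisors-cong (λ d → e (n ℕ.+ d))) (e n)

    iterate-cong : ∀ κ c k {s t} → (∀ n → s n ≡ t n) → ∀ n → iterate κ c k s n ≡ iterate κ c k t n
    iterate-cong κ c zero e = e
    iterate-cong κ c (suc k) e = operator-cong κ c (iterate-cong κ c k e)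

    isPoly-oddDivisors : {s : ℕ → ℕ → ℚ} → (∀ e → IsPoly (λ i → s i e)) → IsPoly (λ i → oddDivisors m (s i))
    isPoly-oddDivisors p = isPoly-∑ (upTo m) (λ k → isPoly-* (isPoly-const ⟦ ⌊ suc k ∣? m ⌋ ⟧)
      (isPoly-* (isPoly-const ⟦ odd? (suc k) ⟧) (isPoly-* (isPoly-const (μℚ (suc k))) (p (m ÷ suc k)))))

    module _ {κ c : ℕ → ℚ} {s : ℕ → ℕ → ℚ} (pκ : IsPoly κ) (pc : IsPoly c) (ps : ∀ n → IsPoly (λ i → s i n)) where

      isPoly-iterate : ∀ k n → IsPoly (λ i → iterate (κ i) (c i) k (s i) n)
      isPoly-iterate zero n = ps n
      isPoly-iterate (suc k) n = isPoly-* (isPoly-const ½) (isPoly-+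
        (isPoly-* (isPoly-const (recip m)) (isPoly-+ (isPoly-oddDivisors (λ e → isPoly-iterate k (n ℕ.+ e))) (isPoly-* pκ (isPoly-iterate k n))))
        (isPoly-cong (λ i → lem (c i) (iterate (κ i) (c i) k (s i) n)) (isPoly-* (isPoly-const (- 1ℚ)) (isPoly-* pc (isPoly-iterate k n)))))
        where
        lem : ∀ c x → - 1ℚ * (c * x) ≡ - (c * x)
        lem = solve-∀ ℚ-ring

    mean-oddDivisors : ∀ l (F : List ℚ → ℕ → ℚ) → mean l (λ ys → oddDivisors m (F ys)) ≡ oddDivisors m (λ e → mean l (λ ys → F ys e))
    mean-oddDivisors l F = trans (mean-∑ l (upTo m) (λ k ys → ⟦ ⌊ suc k ∣? m ⌋ ⟧ * (⟦ odd? (suc k) ⟧ * (μℚ (suc k) * F ys (m ÷ suc k)))))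
      (∑-cong (upTo m) (λ k → trans (mean-*ˡ l ⟦ ⌊ suc k ∣? m ⌋ ⟧ _) (cong (⟦ ⌊ suc k ∣? m ⌋ ⟧ *_)
        (trans (mean-*ˡ l ⟦ odd? (suc k) ⟧ _) (cong (⟦ odd? (suc k) ⟧ *_) (mean-*ˡ l (μℚ (suc k)) (λ ys → F ys (m ÷ suc k))))))))

    -- The exponent of `signSeries` as a number, for a given value `x` of the sum of signs.
    multiplier : ℚ → ℚ → ℚ → ℚ
    multiplier κ c x = ½ * (recip m * (oddDivisors m (pow x) + κ) - c)

    -- For l ≥ 0 the iterates are genuine expectations of X^n g(X)^k. The operator form is what
    -- still makes sense at l = -1, where there is no X.
    iterate-mean : ∀ κ c l k n → iterate κ c k (rawMoment (suc l)) n ≡ mean l (λ ys → pow (sumℚ ys) n * pow (multiplier κ c (sumℚ ys)) k)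
    iterate-mean κ c l zero n = trans (rawMoment-suc l n) (mean-cong l (λ ys → sym (*-identityʳ (pow (sumℚ ys) n))))
    iterate-mean κ c l (suc k) n = begin
      operator κ c (iterate κ c k (rawMoment (suc l))) n
        ≡⟨ operator-cong κ c (iterate-mean κ c l k) n ⟩
      ½ * (recip m * (oddDivisors m (λ e → mean l (λ ys → F ys (n ℕ.+ e))) + κ * mean l (λ ys → F ys n)) - c * mean l (λ ys → F ys n))
        ≡⟨ cong₂ (λ x y → ½ * (recip m * (x + κ * mean l (λ ys → F ys n)) - y))
             (mean-oddDivisors l (λ ys e → F ys (n ℕ.+ e))) (mean-*ˡ l c (λ ys → F ys n)) ⟨
      ½ * (recip m * (mean l (λ ys → O ys) + κ * mean l (λ ys → F ys n)) - mean l (λ ys → c * F ys n))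
        ≡⟨ lem₁ (recip m) (mean l (λ ys → O ys)) κ (mean l (λ ys → F ys n)) (mean l (λ ys → c * F ys n)) ⟩
      ½ * recip m * mean l O + (½ * recip m * κ * mean l (λ ys → F ys n) + - ½ * mean l (λ ys → c * F ys n))
        ≡⟨ cong₂ _+_ (mean-*ˡ l (½ * recip m) O) (cong₂ _+_ (mean-*ˡ l (½ * recip m * κ) (λ ys → F ys n)) (mean-*ˡ l (- ½) (λ ys → c * F ys n))) ⟨
      mean l (λ ys → ½ * recip m * O ys) + (mean l (λ ys → ½ * recip m * κ * F ys n) + mean l (λ ys → - ½ * (c * F ys n)))
        ≡⟨ trans (mean-+ l (λ ys → ½ * recip m * O ys) (λ ys → ½ * recip m * κ * F ys n + - ½ * (c * F ys n)))
             (cong (mean l (λ ys → ½ * recip m * O ys) +_) (mean-+ l (λ ys → ½ * recip m * κ * F ys n) (λ ys → - ½ * (c * F ys n)))) ⟨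
      mean l (λ ys → ½ * recip m * O ys + (½ * recip m * κ * F ys n + - ½ * (c * F ys n)))
        ≡⟨ mean-cong l pointwise ⟩
      mean l (λ ys → pow (sumℚ ys) n * pow (multiplier κ c (sumℚ ys)) (suc k)) ∎
      where
      F : List ℚ → ℕ → ℚ
      F ys e = pow (sumℚ ys) e * pow (multiplier κ c (sumℚ ys)) k
      O : List ℚ → ℚ
      O ys = oddDivisors m (λ e → F ys (n ℕ.+ e))
      lem₁ : ∀ r o κ f g → ½ * (r * (o + κ * f) - g) ≡ ½ * r * o + (½ * r * κ * f + - ½ * g)
      lem₁ = solve-∀ ℚ-ring
      lem₂ : ∀ r p x o κ c → ½ * r * (p * x * o) + (½ * r * κ * (p * x) + - ½ * (c * (p * x))) ≡ p * (½ * (r * (o + κ) - c) * x)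
      lem₂ = solve-∀ ℚ-ring
      lem₃ : ∀ a b c → a * b * c ≡ a * c * b
      lem₃ = solve-∀ ℚ-ring
      pointwise : ∀ ys → ½ * recip m * O ys + (½ * recip m * κ * F ys n + - ½ * (c * F ys n))
        ≡ pow (sumℚ ys) n * pow (multiplier κ c (sumℚ ys)) (suc k)
      pointwise ys = trans (cong (λ o → ½ * recip m * o + (½ * recip m * κ * F ys n + - ½ * (c * F ys n)))
          (trans (oddDivisors-cong (λ e → trans (cong (_* G) (pow-+ X n e)) (lem₃ (pow X n) (pow X e) G)))
            (oddDivisors-scale (pow X n * G) (pow X))))
        (lem₂ (recip m) (pow X n) G (oddDivisors m (pow X)) κ c)
        where
        X = sumℚ ys
        G = pow (multiplier κ c X) k

    -- The umbral counterpart of signSeries.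
    umbralSeries : ℚ → ℚ → (ℕ → ℚ) → Series
    umbralSeries κ c s r = ∑< (suc r) (λ u →
      ∑< (suc u) (λ k → recip (k !) * powS logRatio k u * iterate κ c k s 0) * expS recip c (r ∸ u))

    mean-signSeries : ∀ q c l r →
      mean l (λ ys → signSeries (signedNecklaces m (sumℚ ys) q) c r) ≡ umbralSeries (evenDivisors m q) c (rawMoment (suc l)) r
    mean-signSeries q c l r = begin
      mean l (λ ys → ∑< (suc r) (λ u → expS logRatio (g ys) u * expS recip c (r ∸ u)))
        ≡⟨ mean-∑ l (upTo (suc r)) (λ u ys → expS logRatio (g ys) u * expS recip c (r ∸ u)) ⟩
      ∑< (suc r) (λ u → mean l (λ ys → expS logRatio (g ys) u * expS recip c (r ∸ u)))
        ≡⟨ ∑-cong (upTo (suc r)) (λ u → trans (mean-cong l (λ ys → *-comm (expS logRatio (g ys) u) (expS recip c (r ∸ u))))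
             (trans (mean-*ˡ l (expS recip c (r ∸ u)) (λ ys → expS logRatio (g ys) u))
               (trans (*-comm (expS recip c (r ∸ u)) _) (cong (_* expS recip c (r ∸ u)) (inner u))))) ⟩
      umbralSeries (evenDivisors m q) c (rawMoment (suc l)) r ∎
      where
      g : List ℚ → ℚ
      g ys = multiplier (evenDivisors m q) c (sumℚ ys)
      lem : ∀ f p w → f * p * w ≡ f * w * (1ℚ * p)
      lem = solve-∀ ℚ-ring
      inner : ∀ u → mean l (λ ys → expS logRatio (g ys) u)
        ≡ ∑< (suc u) (λ k → recip (k !) * powS logRatio k u * iterate (evenDivisors m q) c k (rawMoment (suc l)) 0)
      inner u = trans (mean-∑ l (upTo (suc u)) (λ k ys → expCoeff k (g ys) * powS logRatio k u))
        (∑-cong (upTo (suc u)) (λ k → trans (mean-cong l (λ ys → lem (recip (k !)) (pow (g ys) k) (powS logRatio k u)))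
          (trans (mean-*ˡ l (recip (k !) * powS logRatio k u) (λ ys → 1ℚ * pow (g ys) k))
            (cong (recip (k !) * powS logRatio k u *_) (sym (iterate-mean (evenDivisors m q) c l k 0))))))

    -- `κ` and `c` move with the index as well, because both depend on the number of letters.
    isPoly-umbralSeries : ∀ {κ c : ℕ → ℚ} → IsPoly κ → IsPoly c → ∀ r → IsPoly (λ i → umbralSeries (κ i) (c i) (rawMoment i) r)
    isPoly-umbralSeries {κ} {c} pκ pc r = isPoly-∑ (upTo (suc r)) (λ u → isPoly-*
      (isPoly-∑ (upTo (suc u)) (λ k → isPoly-* (isPoly-const (recip (k !) * powS logRatio k u))
        (isPoly-iterate pκ pc (λ n → isPoly-* (isPoly-const (ℕ→ℚ (n !))) (isPoly-moment n)) k 0)))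
      (isPoly-∑ (upTo (suc (r ∸ u))) (λ k → isPoly-* (isPoly-* (isPoly-const (recip (k !))) (isPoly-pow k pc))
        (isPoly-const (powS recip k (r ∸ u))))))

-- Comparison of the two sides at l = -1.

module Reduction where

  open FiniteSums
  open Words
  open GesselReutenauer
  open Moebius
  open Necklaces
  open PowerSeries
  open SignedLetters
  open Moments
  open Periodic
  open import Defs
  open import Data.Bool using (Bool; true; false; not; _∧_; T)
  open import Data.Bool.Properties using (T-∨)
  open import Data.Empty using (⊥; ⊥-elim)
  open import Data.Nat as ℕ using (ℕ; zero; suc; _<ᵇ_; NonZero)
  import Data.Nat.Properties as ℕₚ
  open import Data.Nat.Divisibility using (_∣?_)
  open import Data.Fin using (Fin; toℕ; zero; suc)
  import Data.Fin.Properties as Finₚ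
  open import Data.Rational as ℚ using (ℚ; 0ℚ; 1ℚ; ½; _+_; _*_; _-_; -_)
  open import Data.Rational.Properties
  open import Data.List as List using (List; []; _∷_; upTo; length; _++_; [_]; allFin)
  open import Data.List.Properties using (length-map; length-++; ++-identityʳ)
  open import Data.List.Membership.Propositional.Properties using (∈-allFin)
  open import Data.List.Relation.Unary.All as All using (All; []; _∷_)
  import Data.List.Relation.Unary.All.Properties as Allₚ
  open import Data.List.Relation.Unary.AllPairs as AllPairs using (AllPairs; []; _∷_)
  open import Data.List.Relation.Unary.Unique.Propositional using (Unique)
  import Data.List.Relation.Unary.Unique.Propositional.Properties as Uniqueₚ
  open import Data.Vec as Vec using (Vec; []; _∷_; lookup; toList)
  open import Data.Vec.Properties using (length-toList)
  open import Data.Sum using (inj₁; inj₂)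
  open import Function using (_∘_; Equivalence)
  open import Relation.Nullary using (¬_; yes; no; Dec)
  open import Relation.Nullary.Decidable using (⌊_⌋; T?)
  open import Relation.Binary.PropositionalEquality hiding ([_])
  open import Tactic.RingSolver using (solve-∀)


  open ≡-Reasoning

  mean-cong-signs : ∀ l {F G} → (∀ ys → Signs ys → length ys ≡ l → F ys ≡ G ys) → mean l F ≡ mean l G
  mean-cong-signs zero e = e [] [] refl
  mean-cong-signs (suc l) e = cong₂ (λ x y → ½ * x + ½ * y)
    (mean-cong-signs l (λ ys s len → e (1ℚ ∷ ys) (refl ∷ s) (cong suc len)))
    (mean-cong-signs l (λ ys s len → e (- 1ℚ ∷ ys) (refl ∷ s) (cong suc len)))

  module _ (m : ℕ) .{{m≢0 : NonZero m}} (r : ℕ) where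
    open Operator m

    private
      N : ℕ
      N = m ℕ.* r

    isPoly-evenDivisors : ∀ {q} → IsPoly q → IsPoly (λ i → evenDivisors m (q i))
    isPoly-evenDivisors p = isPoly-∑ (upTo m) (λ k → isPoly-* (isPoly-const ⟦ ⌊ suc k ∣? m ⌋ ⟧)
      (isPoly-* (isPoly-const ⟦ not (odd? (suc k)) ⟧) (isPoly-* (isPoly-const (μℚ (suc k))) (isPoly-pow (m ÷ suc k) p))))

    isPoly-necklaces : ∀ {q} → IsPoly q → IsPoly (λ i → necklaces m (q i))
    isPoly-necklaces p = isPoly-* (isPoly-const (recip m)) (isPoly-∑ (upTo m) (λ k → isPoly-* (isPoly-const ⟦ ⌊ suc k ∣? m ⌋ ⟧)
      (isPoly-* (isPoly-const (μℚ (suc k))) (isPoly-pow (m ÷ suc k) p))))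

    -- An identity between polynomials in the number l of sign letters, known for all l ≥ 0, evaluated at l = -1.
    continue : (W : ℕ → Functional) (alphabet : List ℚ → List ℚ) (q : ℕ → ℚ) → (∀ w → IsPoly (λ i → W i w)) → IsPoly q →
      (∀ ys → Signs ys → Signs (alphabet ys)) → (∀ ys → sumℚ (alphabet ys) ≡ sumℚ ys) →
      (∀ ys → ℕ→ℚ (length (alphabet ys)) ≡ q (suc (length ys))) →
      (∀ l w → mean l (λ ys → fillings (alphabet ys) w) ≡ W (suc l) w) →
      ∑ (allWords N N) (λ v → ⟦ cyclesᵇ m v ⟧ * W 0 (oneLine v)) ≡ umbralSeries (evenDivisors m (q 0)) (necklaces m (q 0)) (rawMoment 0) r
    continue W alphabet q pW pq signs sums lengths means = agree-at-0
      (isPoly-∑ (allWords N N) (λ v → isPoly-* (isPoly-const ⟦ cyclesᵇ m v ⟧) (pW (oneLine v))))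
      (isPoly-umbralSeries (isPoly-evenDivisors pq) (isPoly-necklaces pq) r) agree
      where
      agree : ∀ l → ∑ (allWords N N) (λ v → ⟦ cyclesᵇ m v ⟧ * W (suc l) (oneLine v))
        ≡ umbralSeries (evenDivisors m (q (suc l))) (necklaces m (q (suc l))) (rawMoment (suc l)) r
      agree l = begin
        ∑ (allWords N N) (λ v → ⟦ cyclesᵇ m v ⟧ * W (suc l) (oneLine v))
          ≡⟨ ∑-cong (allWords N N) (λ v → trans (cong (⟦ cyclesᵇ m v ⟧ *_) (sym (means l (oneLine v))))
               (sym (mean-*ˡ l ⟦ cyclesᵇ m v ⟧ (λ ys → fillings (alphabet ys) (oneLine v))))) ⟩
        ∑ (allWords N N) (λ v → mean l (λ ys → ⟦ cyclesᵇ m v ⟧ * fillings (alphabet ys) (oneLine v)))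
          ≡⟨ mean-∑ l (allWords N N) (λ v ys → ⟦ cyclesᵇ m v ⟧ * fillings (alphabet ys) (oneLine v)) ⟨
        mean l (λ ys → ∑ (allWords N N) (λ v → ⟦ cyclesᵇ m v ⟧ * fillings (alphabet ys) (oneLine v)))
          ≡⟨ mean-cong-signs l (λ ys s len → trans (∑-fillings m r (alphabet ys) (signs ys s))
               (cong₂ (λ x p → signSeries (signedNecklaces m x p) (necklaces m p) r) (sums ys)
                 (trans (lengths ys) (cong (q ∘ suc) len)))) ⟩
        mean l (λ ys → signSeries (signedNecklaces m (sumℚ ys) (q (suc l))) (necklaces m (q (suc l))) r)
          ≡⟨ mean-signSeries (q (suc l)) (necklaces m (q (suc l))) l r ⟩
        umbralSeries (evenDivisors m (q (suc l))) (necklaces m (q (suc l))) (rawMoment (suc l)) r ∎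

  isPoly-ℕ→ℚ : IsPoly ℕ→ℚ
  isPoly-ℕ→ℚ = isPoly-Δ (isPoly-cong (λ i → sym (trans (cong (_- ℕ→ℚ i) (ℕ→ℚ-suc i)) (lem (ℕ→ℚ i)))) (isPoly-const 1ℚ))
    where
    lem : ∀ x → 1ℚ + x - x ≡ 1ℚ
    lem = solve-∀ ℚ-ring

  signedCount : Bool → (m r : ℕ) → ℚ
  signedCount d m r = ∑ (allWords (m ℕ.* r) (m ℕ.* r)) (λ v → ⟦ cyclesᵇ m v ⟧ * ⟦ zigzag≥ d (oneLine v) ⟧)

  length-oneLine : ∀ {n} (v : Vec (Fin n) n) → length (oneLine v) ≡ n
  length-oneLine v = trans (length-map toℕ (toList v)) (length-toList v)

  ascending-start : ∀ m .{{_ : NonZero m}} r →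
    ρ (m ℕ.* r) * signedCount false m r
      ≡ Operator.umbralSeries m (evenDivisors m (- 1ℚ)) (necklaces m (- 1ℚ)) (rawMoment 0) r
  ascending-start m r = trans (trans (sym (∑-*ˡ (allWords N N) (ρ N) _)) (∑-cong (allWords N N) term))
    -- Index i stands for l = i - 1 sign letters and no others, so the number of letters is i - 1,
    -- with value -1 at i = 0.
    (continue m r (conv-power (Zig 1ℚ 0ℚ)) (_++ []) (λ i → ℕ→ℚ i - 1ℚ)
      (isPoly-conv-power (Zig 1ℚ 0ℚ)) (isPoly-+ isPoly-ℕ→ℚ (isPoly-const (- 1ℚ)))
      (λ ys s → subst (Signs) (sym (++-identityʳ ys)) s) (λ ys → cong sumℚ (++-identityʳ ys))
      (λ ys → trans (cong (ℕ→ℚ ∘ length) (++-identityʳ ys)) (sym (trans (cong (_- 1ℚ) (ℕ→ℚ-suc (length ys))) (lem (ℕ→ℚ (length ys))))))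
      (mean-fillings (Zig 1ℚ 0ℚ) [] (λ w → trans (conv-Cos-Zig 1ℚ 0ℚ w) (lem′ (δ w) (Sin w)))))
    where
    N = m ℕ.* r
    lem : ∀ x → 1ℚ + x - 1ℚ ≡ x
    lem = solve-∀ ℚ-ring
    lem′ : ∀ x y → 1ℚ * x + 0ℚ * y ≡ x
    lem′ = solve-∀ ℚ-ring
    left-comm : ∀ x y z → x * (y * z) ≡ y * (x * z)
    left-comm = solve-∀ ℚ-ring
    term : ∀ v → ρ N * (⟦ cyclesᵇ m v ⟧ * ⟦ zigzag≥ false (oneLine v) ⟧) ≡ ⟦ cyclesᵇ m v ⟧ * Zig 1ℚ 0ℚ (oneLine v)
    term v = trans (left-comm (ρ N) ⟦ cyclesᵇ m v ⟧ ⟦ zigzag≥ false (oneLine v) ⟧)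
      (cong (λ k → ⟦ cyclesᵇ m v ⟧ * (ρ k * ⟦ zigzag≥ false (oneLine v) ⟧)) (sym (length-oneLine v)))

  descending-start : ∀ m .{{_ : NonZero m}} r → evenℚ (m ℕ.* r) ≡ 1ℚ →
    ρ (m ℕ.* r) * signedCount true m r
      ≡ Operator.umbralSeries m (evenDivisors m 1ℚ) (necklaces m 1ℚ) (rawMoment 0) r
  descending-start m r even = trans (trans (sym (∑-*ˡ (allWords N N) (ρ N) _)) (∑-cong (allWords N N) term))
    -- The two fixed letters leave the sum of weights unchanged and raise the number of letters to l
    -- + 2 = i + 1, with value 1 at i = 0.
    (continue m r (λ i → conv (Hom 1ℚ) (conv-power Zag i)) (λ ys → 1ℚ ∷ (ys ++ [ - 1ℚ ])) (λ i → ℕ→ℚ i + 1ℚ)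
      (λ w → isPoly-conv (Hom 1ℚ) (conv-power Zag) w (λ v _ → isPoly-conv-power Zag v)) (isPoly-+ isPoly-ℕ→ℚ (isPoly-const 1ℚ))
      (λ ys s → refl ∷ Allₚ.++⁺ s (refl ∷ [])) sums lengths means)
    where
    N = m ℕ.* r
    sum-++ : ∀ xs → sumℚ (xs ++ [ - 1ℚ ]) ≡ sumℚ xs - 1ℚ
    sum-++ [] = refl
    sum-++ (x ∷ xs) = trans (cong (x +_) (sum-++ xs)) (sym (+-assoc x (sumℚ xs) (- 1ℚ)))
    sums : ∀ ys → 1ℚ + sumℚ (ys ++ [ - 1ℚ ]) ≡ sumℚ ys
    sums ys = trans (cong (1ℚ +_) (sum-++ ys)) (lem (sumℚ ys))
      where
      lem : ∀ x → 1ℚ + (x - 1ℚ) ≡ x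
      lem = solve-∀ ℚ-ring
    lengths : ∀ ys → ℕ→ℚ (suc (length (ys ++ [ - 1ℚ ]))) ≡ ℕ→ℚ (suc (length ys)) + 1ℚ
    lengths ys = trans (cong (ℕ→ℚ ∘ suc) (length-++ ys)) (ℕ→ℚ-+ (suc (length ys)) 1)
    means : ∀ l w → mean l (λ ys → conv (Hom 1ℚ) (fillings (ys ++ [ - 1ℚ ])) w) ≡ conv (Hom 1ℚ) (conv-power Zag (suc l)) w
    means l w = trans (mean-conv l (Hom 1ℚ) (λ ys → fillings (ys ++ [ - 1ℚ ])) w)
      (conv-cong {φ = Hom 1ℚ} (λ _ → refl) (mean-fillings Zag [ - 1ℚ ]
        (λ u → trans (conv-Cos-Zag u) (sym (conv-δ (Hom (- 1ℚ)) u))) l) w)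
    left-comm : ∀ x y z → x * (y * z) ≡ y * (x * z)
    left-comm = solve-∀ ℚ-ring
    term : ∀ v → ρ N * (⟦ cyclesᵇ m v ⟧ * ⟦ zigzag≥ true (oneLine v) ⟧) ≡ ⟦ cyclesᵇ m v ⟧ * conv (Hom 1ℚ) Zag (oneLine v)
    term v = trans (left-comm (ρ N) ⟦ cyclesᵇ m v ⟧ ⟦ zigzag≥ true (oneLine v) ⟧)
      (cong (⟦ cyclesᵇ m v ⟧ *_) (trans (cong (λ k → ρ k * ⟦ zigzag≥ true (oneLine v) ⟧) (sym (length-oneLine v)))
        (sym (conv-Hom-Zag (oneLine v) (trans (cong evenℚ (length-oneLine v)) even)))))

  zigzag-distinct : ∀ d w → AllPairs _≢_ w → zigzag d w ≡ zigzag≥ d w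
  zigzag-distinct d [] _ = refl
  zigzag-distinct d (x ∷ []) _ = refl
  zigzag-distinct false (x ∷ y ∷ w) (_ ∷ ps) = cong ((x <ᵇ y) ∧_) (zigzag-distinct true (y ∷ w) ps)
  zigzag-distinct true (x ∷ y ∷ w) ((x≢y ∷ _) ∷ ps) = cong₂ _∧_ flip (zigzag-distinct false (y ∷ w) ps)
    where
    flip : (y <ᵇ x) ≡ not (x <ᵇ y)
    flip = T-ext
      (λ t → T-not⁺ (λ s → ℕₚ.<-asym (ℕₚ.<ᵇ⇒< y x t) (ℕₚ.<ᵇ⇒< x y s)))
      (λ t → ℕₚ.<⇒<ᵇ (ℕₚ.≤∧≢⇒< (ℕₚ.≮⇒≥ (λ lt → T-not⁻ t (ℕₚ.<⇒<ᵇ lt))) (x≢y ∘ sym)))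

  toList-unique : {A : Set} {n : ℕ} (v : Vec A n) → (∀ {i j} → lookup v i ≡ lookup v j → i ≡ j) → Unique (toList v)
  toList-unique [] inj = []
  toList-unique (x ∷ v) inj = fresh v (λ i e → case (inj {zero} {suc i} e)) ∷ toList-unique v (λ {i} {j} e → Finₚ.suc-injective (inj {suc i} {suc j} e))
    where
    case : ∀ {n} {i : Fin n} → zero ≡ suc i → ⊥
    case ()
    fresh : ∀ {n} (u : Vec _ n) → (∀ i → x ≢ lookup u i) → All (x ≢_) (toList u)
    fresh [] h = []
    fresh (y ∷ u) h = h zero ∷ fresh u (h ∘ suc)

  permutation-unique : ∀ {N} (v : Vec (Fin N) N) → T (isPermutation v) → Unique (oneLine v)
  permutation-unique {N} v t = Uniqueₚ.map⁺ Finₚ.toℕ-injective (toList-unique v injective)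
    where
    injective : ∀ {i j} → lookup v i ≡ lookup v j → i ≡ j
    injective {i} {j} e with Equivalence.to (T-∨ {i == j}) (all⁻ (allFin N) (all⁻ (allFin N) t (∈-allFin i)) (∈-allFin j))
    ... | inj₁ p = Finₚ.toℕ-injective (ℕₚ.≡ᵇ⇒≡ (toℕ i) (toℕ j) p)
    ... | inj₂ q = ⊥-elim (T-not⁻ q (ℕₚ.≡⇒≡ᵇ (toℕ (lookup v i)) (toℕ (lookup v j)) (cong toℕ e)))

  count-signedCount : ∀ d m r →
    ℕ→ℚ (count (λ v → isPermutation v ∧ zigzag d (oneLine v) ∧ allCyclesOfLength m v) (allWords (m ℕ.* r) (m ℕ.* r)))
      ≡ signedCount d m r
  count-signedCount d m r = trans (count-∑ _ (allWords (m ℕ.* r) (m ℕ.* r))) (∑-cong (allWords (m ℕ.* r) (m ℕ.* r)) (λ v →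
    trans (cong ⟦_⟧ (rearrange v (T? (isPermutation v)))) (⟦∧⟧ (cyclesᵇ m v) (zigzag≥ d (oneLine v)))))
    where
    swap : ∀ p z c → p ∧ z ∧ c ≡ (p ∧ c) ∧ z
    swap true true true = refl
    swap true true false = refl
    swap true false true = refl
    swap true false false = refl
    swap false z c = refl
    rearrange : ∀ v → Dec (T (isPermutation v)) →
      isPermutation v ∧ zigzag d (oneLine v) ∧ allCyclesOfLength m v ≡ cyclesᵇ m v ∧ zigzag≥ d (oneLine v)
    rearrange v (yes t) = trans (swap (isPermutation v) _ _)
      (cong (cyclesᵇ m v ∧_) (zigzag-distinct d (oneLine v) (permutation-unique v t)))
    rearrange v (no ¬t) = trans (absorb (isPermutation v) ¬t) (sym (trans (cong (_∧ zigzag≥ d (oneLine v))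
        (absorb (isPermutation v) ¬t)) refl))
      where
      absorb : ∀ p → ¬ T p → ∀ {x} → p ∧ x ≡ false
      absorb true n = ⊥-elim (n _)
      absorb false n = refl

-- Parity, Euler numbers and umbral evaluation.

module Evaluation where

  open FiniteSums
  open Words
  open Moebius
  open Necklaces
  open PowerSeries
  open SignedLetters
  open Moments
  open Reduction
  open import Defs
  open import Data.Bool using (true; false; not; _∧_; _xor_; T; if_then_else_)
  open import Data.Bool.Properties using (T-≡; T-∧; ∧-identityʳ; not-involutive)
  open import Data.Nat as ℕ using (ℕ; zero; suc; _∸_; _^_; _!; NonZero; NonTrivial; s≤s)
  import Data.Nat.Properties as ℕₚ
  open import Data.Nat.Divisibility
  open import Data.Nat.DivMod using (m/n*n≡m; n/1≡n; m≡m%n+[m/n]*n)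
  import Data.Integer as ℤ
  open import Data.Rational as ℚ using (ℚ; 0ℚ; 1ℚ; ½; _+_; _*_; _-_; -_)
  open import Data.Rational.Properties
  open import Data.List as List using (List; []; _∷_; map; upTo)
  open import Data.List.Properties using (length-upTo)
  open import Data.Product using (∃; _×_; _,_)
  open import Data.Sum using (_⊎_; inj₁; inj₂)
  open import Function using (_∘_; Equivalence)
  open import Relation.Nullary.Decidable using (⌊_⌋; toWitness; fromWitness)
  open import Relation.Binary.PropositionalEquality
  open import Tactic.RingSolver using (solve-∀)
  open ≡-Reasoning

  odd-suc : ∀ n → odd? (suc n) ≡ not (odd? n)
  odd-suc zero = refl
  odd-suc (suc zero) = refl
  odd-suc (suc (suc n)) = odd-suc n

  odd-+ : ∀ a c → odd? (a ℕ.+ c) ≡ odd? a xor odd? c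
  odd-+ zero c = refl
  odd-+ (suc zero) c = odd-suc c
  odd-+ (suc (suc a)) c = odd-+ a c

  odd-* : ∀ a c → odd? (a ℕ.* c) ≡ odd? a ∧ odd? c
  odd-* zero c = refl
  odd-* (suc a) c = trans (odd-+ c (a ℕ.* c)) (trans (cong (odd? c xor_) (odd-* a c))
    (trans (table (odd? a) (odd? c)) (cong (_∧ odd? c) (sym (odd-suc a)))))
    where
    table : ∀ p q → q xor (p ∧ q) ≡ not p ∧ q
    table true true = refl
    table true false = refl
    table false true = refl
    table false false = refl

  halve : ∀ n → odd? n ≡ false → ∃ λ k → n ≡ 2 ℕ.* k
  halve zero _ = 0 , refl
  halve (suc (suc n)) e with halve n e
  ... | k , refl = suc k , cong suc (sym (ℕₚ.+-suc k (k ℕ.+ 0)))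

  odd-double : ∀ k → odd? (2 ℕ.* k) ≡ false
  odd-double k = odd-* 2 k

  even-evenℚ : ∀ n → odd? n ≡ false → evenℚ n ≡ 1ℚ
  even-evenℚ zero _ = refl
  even-evenℚ (suc (suc n)) e = even-evenℚ n e

  odd-oddℚ : ∀ n → odd? n ≡ true → oddℚ n ≡ 1ℚ
  odd-oddℚ (suc zero) _ = refl
  odd-oddℚ (suc (suc n)) e = odd-oddℚ n e

  odd-evenℚ : ∀ n → odd? n ≡ true → evenℚ n ≡ 0ℚ
  odd-evenℚ (suc zero) _ = refl
  odd-evenℚ (suc (suc n)) e = odd-evenℚ n e

  sgn-even : ∀ n → odd? n ≡ false → sgn n ≡ 1ℚ
  sgn-even zero _ = refl
  sgn-even (suc (suc n)) e = cong (λ x → - (- x)) (sgn-even n e)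

  sgn-odd : ∀ n → odd? n ≡ true → sgn n ≡ - 1ℚ
  sgn-odd (suc zero) _ = refl
  sgn-odd (suc (suc n)) e = cong (λ x → - (- x)) (sgn-odd n e)

  ρ-odd : ∀ n → odd? n ≡ true → ρ n ≡ 0ℚ
  ρ-odd (suc zero) _ = refl
  ρ-odd (suc (suc n)) e = cong -_ (ρ-odd n e)

  ρ-square : ∀ n → odd? n ≡ false → ρ n * ρ n ≡ 1ℚ
  ρ-square zero _ = refl
  ρ-square (suc (suc n)) e = trans (lem (ρ n)) (ρ-square n e)
    where
    lem : ∀ x → - x * - x ≡ x * x
    lem = solve-∀ ℚ-ring

  ρ-+ : ∀ a c → odd? a ≡ false → ρ (a ℕ.+ c) ≡ ρ a * ρ c
  ρ-+ zero c _ = sym (*-identityˡ (ρ c))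
  ρ-+ (suc (suc a)) c e = trans (cong -_ (ρ-+ a c e)) (neg-distribˡ-* (ρ a) (ρ c))

  ρ-* : ∀ r m → odd? m ≡ false → ρ (r ℕ.* m) ≡ pow (ρ m) r
  ρ-* zero m _ = refl
  ρ-* (suc r) m e = trans (ρ-+ m (r ℕ.* m) e) (cong (ρ m *_) (ρ-* r m e))

  cosS-odd : ∀ n → odd? n ≡ true → cosS n ≡ 0ℚ
  cosS-odd n e = trans (cosS-ρ n) (trans (cong (_* recip (n !)) (ρ-odd n e)) (*-zeroˡ (recip (n !))))

  ⋆-vanish : ∀ a c n → (∀ k j → k ℕ.+ j ≡ n → a k ≡ 0ℚ ⊎ c j ≡ 0ℚ) → (a ⋆ c) n ≡ 0ℚ
  ⋆-vanish a c n h = ∑<-zero (suc n) (λ { k (s≤s k≤n) → term k (h k (n ∸ k) (ℕₚ.m+[n∸m]≡n k≤n)) })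
    where
    term : ∀ k → a k ≡ 0ℚ ⊎ c (n ∸ k) ≡ 0ℚ → a k * c (n ∸ k) ≡ 0ℚ
    term k (inj₁ e) = trans (cong (_* c (n ∸ k)) e) (*-zeroˡ (c (n ∸ k)))
    term k (inj₂ e) = trans (cong (a k *_) e) (*-zeroʳ (a k))

  secS-odd : ∀ n → odd? n ≡ true → secS n ≡ 0ℚ
  secS-odd n = below n n ℕₚ.≤-refl
    where
    below : ∀ b n → n ℕ.≤ b → odd? n ≡ true → secS n ≡ 0ℚ
    below (suc b) (suc n) (s≤s n≤b) e = trans (invSeries1-suc cosS n) (cong -_ (⋆-vanish (cosS ∘ suc) secS n cases))
      where
      cases : ∀ k j → k ℕ.+ j ≡ n → cosS (suc k) ≡ 0ℚ ⊎ secS j ≡ 0ℚ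
      cases k j k+j≡n with odd? j in eq
      ... | true = inj₂ (below b j (ℕₚ.≤-trans (subst (j ℕ.≤_) k+j≡n (ℕₚ.m≤n+m j k)) n≤b) eq)
      ... | false = inj₁ (cosS-odd (suc k) (trans (sym (trans (odd-+ (suc k) j) (trans (cong (odd? (suc k) xor_) eq) (xor-false (odd? (suc k))))))
              (trans (cong (odd? ∘ suc) k+j≡n) e)))
        where
        xor-false : ∀ p → p xor false ≡ p
        xor-false true = refl
        xor-false false = refl

  -- The metavariable is solved to the function local to sinS.
  mutual
    sinAux : ℕ → ℕ → ℚ
    sinAux = _

    sinS-unfold : ∀ k → sinS (suc (suc k)) ≡ ℚ.- (sinAux (suc (suc k)) k ℚ.* recip (suc k ℕ.* suc (suc k)))
    sinS-unfold k with ℚ._*_ | suc (suc k)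
    ... | _·_ | n = refl

  sinS-even : ∀ n → odd? n ≡ false → sinS n ≡ 0ℚ
  sinS-even n = aux n n
    where
    aux : ∀ n k → odd? k ≡ false → sinAux n k ≡ 0ℚ
    aux n zero _ = refl
    aux n (suc (suc k)) e = trans (cong (λ x → - (x * recip (suc k ℕ.* suc (suc k)))) (aux n k e))
      (cong -_ (*-zeroˡ (recip (suc k ℕ.* suc (suc k)))))

  tanS-even : ∀ n → odd? n ≡ false → tanS n ≡ 0ℚ
  tanS-even n e = ⋆-vanish sinS secS n cases
    where
    cases : ∀ k j → k ℕ.+ j ≡ n → sinS k ≡ 0ℚ ⊎ secS j ≡ 0ℚ
    cases k j k+j≡n with odd? k in eq
    ... | false = inj₁ (sinS-even k eq)
    ... | true = inj₂ (secS-odd j (trans (sym (not-involutive (odd? j)))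
            (cong not (trans (sym (cong (_xor odd? j) eq)) (trans (sym (odd-+ k j)) (trans (cong odd? k+j≡n) e))))))

  -- For odd n both sides contain ρ n = 0; for even n the tangent part of `EulerNum` vanishes,
  -- leaving the secant number with the sign it has in sech.
  rawMoment-Euler : ∀ n → rawMoment 0 n ≡ ρ n * EulerNum n
  rawMoment-Euler n = cases (odd? n) refl
    where
    cases : ∀ p → odd? n ≡ p → rawMoment 0 n ≡ ρ n * EulerNum n
    cases true e = trans (trans (cong (λ x → ℕ→ℚ (n !) * (x * secS n)) (ρ-odd n e)) (lem (ℕ→ℚ (n !)) (secS n) (EulerNum n)))
      (cong (_* EulerNum n) (sym (ρ-odd n e)))
      where
      lem : ∀ f s y → f * (0ℚ * s) ≡ 0ℚ * y
      lem = solve-∀ ℚ-ring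
    cases false e = trans (lem (ℕ→ℚ (n !)) (ρ n) (secS n)) (cong (λ t → ρ n * (ℕ→ℚ (n !) * (secS n + t))) (sym (tanS-even n e)))
      where
      lem : ∀ f r s → f * (r * s) ≡ r * (f * (s + 0ℚ))
      lem = solve-∀ ℚ-ring

  -- A polynomial in E acts on sequences, E being the shift.
  act : Poly → (ℕ → ℚ) → ℕ → ℚ
  act []      s n = 0ℚ
  act (c ∷ p) s n = c * s n + act p s (suc n)

  -- The metavariable is solved to the function local to umbral.
  mutual
    umbralFrom : ℕ → Poly → ℚ
    umbralFrom = _

    umbral-from : ∀ p → umbral p ≡ umbralFrom 0 p
    umbral-from p with zero
    ... | k = refl

  umbral-act : ∀ p → umbral p ≡ act p EulerNum 0
  umbral-act p = from 0 p
    where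
    from : ∀ k p → umbralFrom k p ≡ act p EulerNum k
    from k [] = refl
    from k (c ∷ p) = cong (c * EulerNum k +_) (from (suc k) p)

  act-+ₚ : ∀ p q s n → act (p +ₚ q) s n ≡ act p s n + act q s n
  act-+ₚ [] q s n = sym (+-identityˡ (act q s n))
  act-+ₚ (a ∷ p) [] s n = sym (+-identityʳ (act (a ∷ p) s n))
  act-+ₚ (a ∷ p) (c ∷ q) s n = trans (cong ((a + c) * s n +_) (act-+ₚ p q s (suc n))) (lem a c (s n) (act p s (suc n)) (act q s (suc n)))
    where
    lem : ∀ a c x y z → (a + c) * x + (y + z) ≡ (a * x + y) + (c * x + z)
    lem = solve-∀ ℚ-ring

  act-scaleₚ : ∀ a p s n → act (scaleₚ a p) s n ≡ a * act p s n
  act-scaleₚ a [] s n = sym (*-zeroʳ a)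
  act-scaleₚ a (c ∷ p) s n = trans (cong (a * c * s n +_) (act-scaleₚ a p s (suc n))) (lem a c (s n) (act p s (suc n)))
    where
    lem : ∀ a c x y → a * c * x + a * y ≡ a * (c * x + y)
    lem = solve-∀ ℚ-ring

  -- Products of polynomials become compositions of operators, so powers of the exponent are
  -- complete before any E^k turns into a number.
  act-*ₚ : ∀ p q s n → act (p *ₚ q) s n ≡ act p (act q s) n
  act-*ₚ [] q s n = refl
  act-*ₚ (a ∷ p) q s n = begin
    act (scaleₚ a q +ₚ (0ℚ ∷ (p *ₚ q))) s n
      ≡⟨ act-+ₚ (scaleₚ a q) (0ℚ ∷ (p *ₚ q)) s n ⟩
    act (scaleₚ a q) s n + (0ℚ * s n + act (p *ₚ q) s (suc n))
      ≡⟨ cong₂ (λ x y → x + (0ℚ * s n + y)) (act-scaleₚ a q s n) (act-*ₚ p q s (suc n)) ⟩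
    a * act q s n + (0ℚ * s n + act p (act q s) (suc n))
      ≡⟨ lem (a * act q s n) (s n) (act p (act q s) (suc n)) ⟩
    a * act q s n + act p (act q s) (suc n) ∎
    where
    lem : ∀ x y z → x + (0ℚ * y + z) ≡ x + z
    lem = solve-∀ ℚ-ring

  act-constₚ : ∀ c s n → act (constₚ c) s n ≡ c * s n
  act-constₚ c s n = +-identityʳ (c * s n)

  act-Epow : ∀ k s n → act (Epow k) s n ≡ s (n ℕ.+ k)
  act-Epow zero s n = trans (lem (s n)) (cong s (sym (ℕₚ.+-identityʳ n)))
    where
    lem : ∀ x → 1ℚ * x + 0ℚ ≡ x
    lem = solve-∀ ℚ-ring
  act-Epow (suc k) s n = trans (trans (cong (_+ act (Epow k) s (suc n)) (*-zeroˡ (s n))) (+-identityˡ _))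
    (trans (act-Epow k s (suc n)) (cong s (sym (ℕₚ.+-suc n k))))

  act-sumₚ : {A : Set} (f : A → Poly) (xs : List A) → ∀ s n → act (sumₚ (map f xs)) s n ≡ ∑ xs (λ x → act (f x) s n)
  act-sumₚ f [] s n = refl
  act-sumₚ f (x ∷ xs) s n = trans (act-+ₚ (f x) (sumₚ (map f xs)) s n) (cong (act (f x) s n +_) (act-sumₚ f xs s n))

  recip-nonZero : ∀ n .{{_ : NonZero n}} → (ℤ.+ 1 ℚ./ n) ≡ recip n
  recip-nonZero (suc n) = refl

  umbralPower-act : ∀ g r → umbralPower g r ≡ ∑< (suc r) (λ k → recip (k !) * powS logRatio k r * act (g ^ₚ k) EulerNum 0)
  umbralPower-act g r = trans (umbral-act (powerCoeff g r)) (trans (act-sumₚ (λ k → scaleₚ ((ℤ.+ 1 ℚ./ (k !)) {{ℕₚ._!≢0 k}} * powS logRatio k r) (g ^ₚ k)) (upTo (suc r)) EulerNum 0)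
    (∑-cong (upTo (suc r)) (λ k → trans (act-scaleₚ ((ℤ.+ 1 ℚ./ (k !)) {{ℕₚ._!≢0 k}} * powS logRatio k r) (g ^ₚ k) EulerNum 0)
      (cong (λ x → x * powS logRatio k r * act (g ^ₚ k) EulerNum 0) (recip-nonZero (k !) {{ℕₚ._!≢0 k}})))))

  logRatio-twist : ∀ n → sgn n * logRatio n ≡ - logRatio n
  logRatio-twist zero = refl
  logRatio-twist (suc n) = begin
    - s * (s * x - - s * (s * x))      ≡⟨ lem₁ s x ⟩
    - (s * x * (s * s)) - s * (s * x)  ≡⟨ cong (λ y → - (s * x * y) - s * (s * x)) (sgn-square n) ⟩
    - (s * x * 1ℚ) - s * (s * x)       ≡⟨ lem₂ s x ⟩
    - (s * x - - s * (s * x))          ∎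
    where
    s = sgn n
    x = recip (suc n)
    lem₁ : ∀ s r → - s * (s * r - - s * (s * r)) ≡ - (s * r * (s * s)) - s * (s * r)
    lem₁ = solve-∀ ℚ-ring
    lem₂ : ∀ s r → - (s * r * 1ℚ) - s * (s * r) ≡ - (s * r - - s * (s * r))
    lem₂ = solve-∀ ℚ-ring

  sgn-+ : ∀ a c → sgn (a ℕ.+ c) ≡ sgn a * sgn c
  sgn-+ zero c = sym (*-identityˡ (sgn c))
  sgn-+ (suc a) c = trans (cong -_ (sgn-+ a c)) (neg-distribˡ-* (sgn a) (sgn c))

  ⋆-twist : ∀ a c n → sgn n * (a ⋆ c) n ≡ ((λ k → sgn k * a k) ⋆ (λ k → sgn k * c k)) n
  ⋆-twist a c n = trans (sym (∑-*ˡ (upTo (suc n)) (sgn n) (λ k → a k * c (n ∸ k)))) (∑<-cong (suc n) (λ { k (s≤s k≤n) →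
    trans (cong (_* (a k * c (n ∸ k))) (trans (cong sgn (sym (ℕₚ.m+[n∸m]≡n k≤n))) (sgn-+ k (n ∸ k))))
      (lem (sgn k) (sgn (n ∸ k)) (a k) (c (n ∸ k))) }))
    where
    lem : ∀ s t a c → s * t * (a * c) ≡ s * a * (t * c)
    lem = solve-∀ ℚ-ring

  -- log((1+t)/(1-t)) is odd in t, so its k-th power has the parity of k.
  powS-twist : ∀ k n → sgn n * powS logRatio k n ≡ sgn k * powS logRatio k n
  powS-twist zero zero = refl
  powS-twist zero (suc n) = *-zeroʳ (- sgn n)
  powS-twist (suc k) n = begin
    sgn n * (logRatio ⋆ powS logRatio k) n
      ≡⟨ ⋆-twist logRatio (powS logRatio k) n ⟩
    ((λ j → sgn j * logRatio j) ⋆ (λ j → sgn j * powS logRatio k j)) n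
      ≡⟨ trans (⋆-congˡ (λ j → sgn j * powS logRatio k j) n (λ j → trans (logRatio-twist j) (neg (logRatio j)))) (⋆-congʳ (λ j → - 1ℚ * logRatio j) n (powS-twist k)) ⟩
    ((λ j → - 1ℚ * logRatio j) ⋆ (λ j → sgn k * powS logRatio k j)) n
      ≡⟨ trans (⋆-scaleˡ (- 1ℚ) logRatio (λ j → sgn k * powS logRatio k j) n) (cong (- 1ℚ *_) (⋆-scaleʳ (sgn k) logRatio (powS logRatio k) n)) ⟩
    - 1ℚ * (sgn k * (logRatio ⋆ powS logRatio k) n)
      ≡⟨ lem (sgn k) ((logRatio ⋆ powS logRatio k) n) ⟩
    - sgn k * (logRatio ⋆ powS logRatio k) n ∎
    where
    neg : ∀ x → - x ≡ - 1ℚ * x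
    neg = solve-∀ ℚ-ring
    lem : ∀ s x → - 1ℚ * (s * x) ≡ - s * x
    lem = solve-∀ ℚ-ring

  IsSign : ℚ → Set
  IsSign ς = ς ≡ 1ℚ ⊎ ς ≡ - 1ℚ

  ρ-sign : ∀ n → odd? n ≡ false → IsSign (ρ n)
  ρ-sign zero _ = inj₁ refl
  ρ-sign (suc (suc n)) e with ρ-sign n e
  ... | inj₁ p = inj₂ (cong -_ p)
  ... | inj₂ p = inj₁ (cong -_ p)

  -- Replacing t by ςt and the exponent by ς times itself has no net effect on the power of
  -- (1+t)/(1-t).
  sign-powS : ∀ {ς} → IsSign ς → ∀ k u → pow ς u * (pow ς k * powS logRatio k u) ≡ powS logRatio k u
  sign-powS (inj₁ refl) k u = trans (cong₂ (λ x y → x * (y * powS logRatio k u)) (pow-one u) (pow-one k)) (lem (powS logRatio k u))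
    where
    lem : ∀ x → 1ℚ * (1ℚ * x) ≡ x
    lem = solve-∀ ℚ-ring
  sign-powS (inj₂ refl) k u = begin
    pow (- 1ℚ) u * (pow (- 1ℚ) k * P)   ≡⟨ cong₂ (λ x y → x * (y * P)) (pow-minus-one u) (pow-minus-one k) ⟩
    sgn u * (sgn k * P)                 ≡⟨ lem₁ (sgn u) (sgn k) P ⟩
    sgn k * (sgn u * P)                 ≡⟨ cong (sgn k *_) (powS-twist k u) ⟩
    sgn k * (sgn k * P)                 ≡⟨ *-assoc (sgn k) (sgn k) P ⟨
    sgn k * sgn k * P                   ≡⟨ cong (_* P) (sgn-square k) ⟩
    1ℚ * P                              ≡⟨ *-identityˡ P ⟩
    P                                   ∎
    where
    P = powS logRatio k u
    lem₁ : ∀ a b c → a * (b * c) ≡ b * (a * c)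
    lem₁ = solve-∀ ℚ-ring

  module _ (m : ℕ) .{{m≢0 : NonZero m}} (κ c ς : ℚ) (sign : IsSign ς) (g : Poly)
    (acts : ∀ f n → Operator.operator m κ c (λ j → ρ j * f j) n ≡ ς * (ρ n * act g f n)) where
    open Operator m

    operator-scale : ∀ x s n → operator κ c (λ j → x * s j) n ≡ x * operator κ c s n
    operator-scale x s n = trans (cong (λ o → ½ * (recip m * (o + κ * (x * s n)) - c * (x * s n))) (oddDivisors-scale x (λ e → s (n ℕ.+ e))))
      (lem (recip m) x (oddDivisors m (λ e → s (n ℕ.+ e))) κ (s n) c)
      where
      lem : ∀ r x o κ s c → ½ * (r * (x * o + κ * (x * s)) - c * (x * s)) ≡ x * (½ * (r * (o + κ * s) - c * s))
      lem = solve-∀ ℚ-ring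

    -- The signs `ρ` of the moments pass through each application of the operator at the price of
    -- one `ς`, and the operator turns into the polynomial `g`.
    iterate-act : ∀ k n → iterate κ c k (λ j → ρ j * EulerNum j) n ≡ pow ς k * (ρ n * act (g ^ₚ k) EulerNum n)
    iterate-act zero n = trans (cong (ρ n *_) (sym (trans (act-constₚ 1ℚ EulerNum n) (*-identityˡ (EulerNum n))))) (sym (*-identityˡ _))
    iterate-act (suc k) n = begin
      operator κ c (iterate κ c k (λ j → ρ j * EulerNum j)) n
        ≡⟨ operator-cong κ c (iterate-act k) n ⟩
      operator κ c (λ j → pow ς k * (ρ j * act (g ^ₚ k) EulerNum j)) n
        ≡⟨ operator-scale (pow ς k) (λ j → ρ j * act (g ^ₚ k) EulerNum j) n ⟩
      pow ς k * operator κ c (λ j → ρ j * act (g ^ₚ k) EulerNum j) n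
        ≡⟨ cong (pow ς k *_) (acts (act (g ^ₚ k) EulerNum) n) ⟩
      pow ς k * (ς * (ρ n * act g (act (g ^ₚ k) EulerNum) n))
        ≡⟨ cong (λ x → pow ς k * (ς * (ρ n * x))) (act-*ₚ g (g ^ₚ k) EulerNum n) ⟨
      pow ς k * (ς * (ρ n * act (g ^ₚ suc k) EulerNum n))
        ≡⟨ lem (pow ς k) ς (ρ n * act (g ^ₚ suc k) EulerNum n) ⟩
      ς * pow ς k * (ρ n * act (g ^ₚ suc k) EulerNum n) ∎
      where
      lem : ∀ a b x → a * (b * x) ≡ b * a * x
      lem = solve-∀ ℚ-ring

    -- The factor ς^r is shared between the two series; in the first it cancels against the ς^k of
    -- the iterates by `sign-powS`.
    umbralSeries-power : ∀ r → pow ς r * umbralSeries κ c (rawMoment 0) r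
      ≡ (umbralPower g ⋆ (λ n → pow ς n * expS recip c n)) r
    umbralSeries-power r = begin
      pow ς r * ∑< (suc r) (λ u → S u * expS recip c (r ∸ u))
        ≡⟨ ∑-*ˡ (upTo (suc r)) (pow ς r) (λ u → S u * expS recip c (r ∸ u)) ⟨
      ∑< (suc r) (λ u → pow ς r * (S u * expS recip c (r ∸ u)))
        ≡⟨ ∑<-cong (suc r) (λ { u (s≤s u≤r) → trans (cong (_* (S u * expS recip c (r ∸ u)))
             (trans (cong (pow ς) (sym (ℕₚ.m+[n∸m]≡n u≤r))) (pow-+ ς u (r ∸ u))))
             (trans (lem₁ (pow ς u) (pow ς (r ∸ u)) (S u) (expS recip c (r ∸ u))) (cong (_* (pow ς (r ∸ u) * expS recip c (r ∸ u))) (inner u))) }) ⟩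
      (umbralPower g ⋆ (λ n → pow ς n * expS recip c n)) r ∎
      where
      S : ℕ → ℚ
      S u = ∑< (suc u) (λ k → recip (k !) * powS logRatio k u * iterate κ c k (rawMoment 0) 0)
      lem₁ : ∀ a b s x → a * b * (s * x) ≡ a * s * (b * x)
      lem₁ = solve-∀ ℚ-ring
      lem₂ : ∀ p f w q z → p * (f * w * (q * (1ℚ * z))) ≡ f * (p * (q * w)) * z
      lem₂ = solve-∀ ℚ-ring
      inner : ∀ u → pow ς u * S u ≡ umbralPower g u
      inner u = trans (sym (∑-*ˡ (upTo (suc u)) (pow ς u) _)) (trans (∑-cong (upTo (suc u)) (λ k → begin
        pow ς u * (recip (k !) * powS logRatio k u * iterate κ c k (rawMoment 0) 0)
          ≡⟨ cong (λ x → pow ς u * (recip (k !) * powS logRatio k u * x)) (trans (iterate-cong κ c k rawMoment-Euler 0) (iterate-act k 0)) ⟩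
        pow ς u * (recip (k !) * powS logRatio k u * (pow ς k * (1ℚ * act (g ^ₚ k) EulerNum 0)))
          ≡⟨ lem₂ (pow ς u) (recip (k !)) (powS logRatio k u) (pow ς k) (act (g ^ₚ k) EulerNum 0) ⟩
        recip (k !) * (pow ς u * (pow ς k * powS logRatio k u)) * act (g ^ₚ k) EulerNum 0
          ≡⟨ cong (λ x → recip (k !) * x * act (g ^ₚ k) EulerNum 0) (sign-powS sign k u) ⟩
        recip (k !) * powS logRatio k u * act (g ^ₚ k) EulerNum 0 ∎)) (sym (umbralPower-act g u)))

  -- Divisor sums for even m, split into odd and even divisors.

  module _ (m h k : ℕ) .{{m≢0 : NonZero m}} .{{h≢0 : NonZero h}} (m≡ : m ≡ 2 ^ suc k ℕ.* h) (h-odd : odd? h ≡ true) where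

    private
      m-half : m ≡ 2 ℕ.* (2 ^ k ℕ.* h)
      m-half = trans m≡ (ℕₚ.*-assoc 2 (2 ^ k) h)

      ÷-* : ∀ d .{{_ : NonZero d}} → d ∣ m → m ≡ (m ÷ d) ℕ.* d
      ÷-* (suc d) d∣m = sym (m/n*n≡m d∣m)

      h∣m : h ∣ m
      h∣m = divides (2 ^ suc k) m≡

      odd-∣-2* : ∀ d x → odd? d ≡ true → d ∣ 2 ℕ.* x → d ∣ x
      odd-∣-2* d x d-odd (divides q eq) with halve q (trans (sym (trans (odd-* q d) (trans (cong (odd? q ∧_) d-odd) (∧-identityʳ (odd? q)))))
                                                       (trans (cong odd? (sym eq)) (odd-double x)))
      ... | q′ , refl = divides q′ (ℕₚ.*-cancelˡ-≡ x (q′ ℕ.* d) 2 (trans eq (ℕₚ.*-assoc 2 q′ d)))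

      odd-∣-2^* : ∀ d j x → odd? d ≡ true → d ∣ 2 ^ j ℕ.* x → d ∣ x
      odd-∣-2^* d zero x d-odd p = subst (d ∣_) (ℕₚ.*-identityˡ x) p
      odd-∣-2^* d (suc j) x d-odd p = odd-∣-2^* d j x d-odd (odd-∣-2* d (2 ^ j ℕ.* x) d-odd (subst (d ∣_) (ℕₚ.*-assoc 2 (2 ^ j) x) p))

      odd-divisors : ∀ d .{{_ : NonZero d}} → ⌊ d ∣? m ⌋ ∧ odd? d ≡ ⌊ d ∣? h ⌋
      odd-divisors d = T-ext to from
        where
        to : T (⌊ d ∣? m ⌋ ∧ odd? d) → T ⌊ d ∣? h ⌋
        to t = let a , o = Equivalence.to (T-∧ {⌊ d ∣? m ⌋}) t in
          fromWitness (odd-∣-2^* d (suc k) h (Equivalence.to T-≡ o) (subst (d ∣_) m≡ (toWitness a)))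
        from : T ⌊ d ∣? h ⌋ → T (⌊ d ∣? m ⌋ ∧ odd? d)
        from t = Equivalence.from (T-∧ {⌊ d ∣? m ⌋}) (fromWitness (∣-trans (toWitness t) h∣m) , Equivalence.from T-≡ (factor (toWitness t)))
          where
          factor : d ∣ h → odd? d ≡ true
          factor (divides q refl) = right (odd? q) (odd? d) (trans (sym (odd-* q d)) h-odd)
            where
            right : ∀ p q → p ∧ q ≡ true → q ≡ true
            right true q e = e

      ∧-split : ∀ p q → p ∧ q ≡ false → q ≡ true → p ≡ false
      ∧-split true true () _
      ∧-split false q _ _ = refl

    m-even : odd? m ≡ false
    m-even = trans (cong odd? m-half) (odd-double (2 ^ k ℕ.* h))

    cofactor-even : ∀ d .{{_ : NonZero d}} → d ∣ m → odd? d ≡ true → odd? (m ÷ d) ≡ false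
    cofactor-even d d∣m d-odd = ∧-split (odd? (m ÷ d)) (odd? d) (trans (sym (odd-* (m ÷ d) d)) (trans (cong odd? (sym (÷-* d d∣m))) m-even)) d-odd

    oddDivisors-h : ∀ s → oddDivisors m s ≡ ∑-divisors h (λ d → μℚ d * s (m ÷ d))
    oddDivisors-h s = ∑-divisors-restrict m h (∣⇒≤ h∣m) odd? {λ d → μℚ d * s (m ÷ d)} odd-divisors

    -- m / d ≡ m (mod 4) for every odd divisor d
    ρ-cofactor : ∀ d .{{_ : NonZero d}} → d ∣ m → odd? d ≡ true → ρ (m ÷ d) ≡ ρ m
    ρ-cofactor d d∣m d-odd = sym (begin
      ρ m                              ≡⟨ cong ρ (trans (÷-* d d∣m) (ℕₚ.*-comm (m ÷ d) d)) ⟩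
      ρ (d ℕ.* e)                      ≡⟨ ρ-* d e e-even ⟩
      pow (ρ e) d                      ≡⟨ pow-sign (ρ-square e e-even) d ⟩
      evenℚ d * 1ℚ + oddℚ d * ρ e      ≡⟨ cong₂ (λ x y → x * 1ℚ + y * ρ e) (odd-evenℚ d d-odd) (odd-oddℚ d d-odd) ⟩
      0ℚ * 1ℚ + 1ℚ * ρ e               ≡⟨ lem (ρ e) ⟩
      ρ e                              ∎)
      where
      e = m ÷ d
      e-even = cofactor-even d d∣m d-odd
      lem : ∀ x → 0ℚ * 1ℚ + 1ℚ * x ≡ x
      lem = solve-∀ ℚ-ring

    oddDivisors-ρ : ∀ (f : ℕ → ℚ) n → oddDivisors m (λ e → ρ (n ℕ.+ e) * f (n ℕ.+ e)) ≡ ρ m * ρ n * oddDivisors m (λ e → f (n ℕ.+ e))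
    oddDivisors-ρ f n = trans (∑-divisors-cong m (λ d d∣m → guard (odd? d) (λ o →
        cong (λ x → μℚ d * (x * f (n ℕ.+ m ÷ d))) (trans (cong ρ (ℕₚ.+-comm n (m ÷ d)))
          (trans (ρ-+ (m ÷ d) n (cofactor-even d d∣m o)) (cong (_* ρ n) (ρ-cofactor d d∣m o)))))))
      (Operator.oddDivisors-scale m (ρ m * ρ n) (λ e → f (n ℕ.+ e)))

    recip-2m : recip (2 ℕ.* m) ≡ ½ * recip m
    recip-2m = recip-* 2 m

    -- Even divisors and the subtracted necklace count both act as constants; together, with the
    -- sign ρ m taken out, they form the constant term `c′` of the exponent.
    operator-acts : ∀ κ c c′ G → κ - ℕ→ℚ m * c ≡ ρ m * c′ →
      (∀ (f : ℕ → ℚ) n → act G f n ≡ oddDivisors m (λ e → f (n ℕ.+ e)) + c′ * f n) →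
      ∀ (f : ℕ → ℚ) n → Operator.operator m κ c (λ j → ρ j * f j) n ≡ ρ m * (ρ n * act (scaleₚ (recip (2 ℕ.* m)) G) f n)
    operator-acts κ c c′ G const acts f n = begin
      ½ * (recip m * (oddDivisors m (λ e → ρ (n ℕ.+ e) * f (n ℕ.+ e)) + κ * (ρ n * f n)) - c * (ρ n * f n))
        ≡⟨ cong (λ o → ½ * (recip m * (o + κ * (ρ n * f n)) - c * (ρ n * f n))) (oddDivisors-ρ f n) ⟩
      ½ * (recip m * (ρ m * ρ n * O + κ * (ρ n * f n)) - c * (ρ n * f n))
        ≡⟨ cong (λ y → ½ * (recip m * (ρ m * ρ n * O + κ * (ρ n * f n)) - y)) (sym (recip-cancel m (c * (ρ n * f n)))) ⟩
      ½ * (recip m * (ρ m * ρ n * O + κ * (ρ n * f n)) - recip m * (ℕ→ℚ m * (c * (ρ n * f n))))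
        ≡⟨ lem₁ (recip m) (ρ m * ρ n * O) κ (ρ n * f n) (ℕ→ℚ m) c ⟩
      ½ * recip m * (ρ m * ρ n * O + (κ - ℕ→ℚ m * c) * (ρ n * f n))
        ≡⟨ cong (λ x → ½ * recip m * (ρ m * ρ n * O + x * (ρ n * f n))) const ⟩
      ½ * recip m * (ρ m * ρ n * O + ρ m * c′ * (ρ n * f n))
        ≡⟨ lem₂ (½ * recip m) (ρ m) (ρ n) O c′ (f n) ⟩
      ρ m * (ρ n * (½ * recip m * (O + c′ * f n)))
        ≡⟨ cong (λ x → ρ m * (ρ n * x)) (sym (trans (act-scaleₚ (recip (2 ℕ.* m)) G f n) (cong₂ _*_ recip-2m (acts f n)))) ⟩
      ρ m * (ρ n * act (scaleₚ (recip (2 ℕ.* m)) G) f n) ∎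
      where
      O = oddDivisors m (λ e → f (n ℕ.+ e))
      lem₁ : ∀ r o κ x m c → ½ * (r * (o + κ * x) - r * (m * (c * x))) ≡ ½ * r * (o + (κ - m * c) * x)
      lem₁ = solve-∀ ℚ-ring
      lem₂ : ∀ r a b o c f → r * (a * b * o + a * c * (b * f)) ≡ a * (b * (r * (o + c * f)))
      lem₂ = solve-∀ ℚ-ring

    -- It is 1 for h = 1 and 0 for larger h, which separates powers of two from the other even m.
    η : ℚ
    η = ∑-divisors h μℚ

    odd-part : ∀ q → (∀ d .{{_ : NonZero d}} → d ∣ m → odd? d ≡ true → pow q (m ÷ d) ≡ 1ℚ) → oddDivisors m (pow q) ≡ η
    odd-part q e = trans (∑-divisors-cong m (λ d d∣m → guard (odd? d) (λ o → cong (μℚ d *_) (e d d∣m o))))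
      (trans (oddDivisors-h (λ _ → 1ℚ)) (∑-divisors-cong h (λ d _ → *-identityʳ (μℚ d))))

    parts : ∀ q → ∑-divisors m (λ d → μℚ d * pow q (m ÷ d)) ≡ oddDivisors m (pow q) + evenDivisors m q
    parts q = trans (∑-cong (upTo m) (λ j → trans (cong (⟦ ⌊ suc j ∣? m ⌋ ⟧ *_) (split (odd? (suc j)) (μℚ (suc j) * pow q (m ÷ suc j))))
        (*-distribˡ-+ ⟦ ⌊ suc j ∣? m ⌋ ⟧ (⟦ odd? (suc j) ⟧ * (μℚ (suc j) * pow q (m ÷ suc j))) (⟦ not (odd? (suc j)) ⟧ * (μℚ (suc j) * pow q (m ÷ suc j))))))
      (∑-+ (upTo m) (λ j → ⟦ ⌊ suc j ∣? m ⌋ ⟧ * (⟦ odd? (suc j) ⟧ * (μℚ (suc j) * pow q (m ÷ suc j))))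
        (λ j → ⟦ ⌊ suc j ∣? m ⌋ ⟧ * (⟦ not (odd? (suc j)) ⟧ * (μℚ (suc j) * pow q (m ÷ suc j)))))
      where
      split : ∀ p x → x ≡ ⟦ p ⟧ * x + ⟦ not p ⟧ * x
      split true = lem
        where
        lem : ∀ x → x ≡ 1ℚ * x + 0ℚ * x
        lem = solve-∀ ℚ-ring
      split false = lem
        where
        lem : ∀ x → x ≡ 0ℚ * x + 1ℚ * x
        lem = solve-∀ ℚ-ring

    private
      m-nontrivial : NonTrivial m
      m-nontrivial = ℕ.n>1⇒nonTrivial (subst (1 ℕ.<_) (sym m-half)
        (ℕₚ.m≤m*n 2 (2 ^ k ℕ.* h) {{ℕₚ.m*n≢0 (2 ^ k) h {{ℕₚ.m^n≢0 2 k}}}}))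

      all-one : ∑-divisors m (λ d → μℚ d * pow 1ℚ (m ÷ d)) ≡ 0ℚ
      all-one = trans (∑-divisors-cong m (λ d _ → trans (cong (μℚ d *_) (pow-one (m ÷ d))) (*-identityʳ (μℚ d)))) (∑-μ-nontrivial m {{m-nontrivial}})

      pow-minus-even : ∀ n → odd? n ≡ false → pow (- 1ℚ) n ≡ 1ℚ
      pow-minus-even n e = trans (pow-minus-one n) (sgn-even n e)

    necklaces-one : necklaces m 1ℚ ≡ 0ℚ
    necklaces-one = trans (cong (recip m *_) all-one) (*-zeroʳ (recip m))

    -- At q = 1 the Möbius sum over all divisors of m > 1 is zero, and its odd part is `η`.
    evenDivisors-one : evenDivisors m 1ℚ ≡ - η
    evenDivisors-one = trans (lem η (evenDivisors m 1ℚ)) (trans (cong (λ x → x - η)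
      (trans (cong (_+ evenDivisors m 1ℚ) (sym (odd-part 1ℚ (λ d _ _ → pow-one (m ÷ d))))) (trans (sym (parts 1ℚ)) all-one))) (+-identityˡ (- η)))
      where
      lem : ∀ a b → b ≡ a + b - a
      lem = solve-∀ ℚ-ring

    necklaces-minus-one : necklaces m (- 1ℚ) ≡ recip m * (η + evenDivisors m (- 1ℚ))
    necklaces-minus-one = cong (recip m *_) (trans (parts (- 1ℚ)) (cong (_+ evenDivisors m (- 1ℚ))
      (odd-part (- 1ℚ) (λ d d∣m o → pow-minus-even (m ÷ d) (cofactor-even d d∣m o)))))

    private
      even-terms : ∀ {x : ℕ → ℚ} {y : ℕ → ℚ} → (∀ d .{{_ : NonZero d}} → d ∣ m → odd? d ≡ false → μℚ d * x d ≡ μℚ d * y d) →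
        ∑-divisors m (λ d → ⟦ not (odd? d) ⟧ * (μℚ d * x d)) ≡ ∑-divisors m (λ d → ⟦ not (odd? d) ⟧ * (μℚ d * y d))
      even-terms e = ∑-divisors-cong m (λ d d∣m → guard (not (odd? d)) (λ o →
        e d d∣m (trans (sym (not-involutive (odd? d))) (cong not o))))

      odd-cofactor-4∣ : ∀ q d → odd? q ≡ true → odd? d ≡ false → 4 ∣ q ℕ.* d → 4 ∣ d
      odd-cofactor-4∣ q d q-odd d-even (divides x eq) with halve d d-even
      ... | d′ , refl with halve d′ (trans (sym (trans (odd-* q d′) (cong (_∧ odd? d′) q-odd))) (trans (cong odd? q*d′) (odd-double x)))
        where
        q*d′ : q ℕ.* d′ ≡ 2 ℕ.* x
        q*d′ = ℕₚ.*-cancelˡ-≡ (q ℕ.* d′) (2 ℕ.* x) 2 (begin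
          2 ℕ.* (q ℕ.* d′)         ≡⟨ ℕₚ.*-assoc 2 q d′ ⟨
          2 ℕ.* q ℕ.* d′           ≡⟨ cong (ℕ._* d′) (ℕₚ.*-comm 2 q) ⟩
          q ℕ.* 2 ℕ.* d′           ≡⟨ ℕₚ.*-assoc q 2 d′ ⟩
          q ℕ.* (2 ℕ.* d′)         ≡⟨ eq ⟩
          x ℕ.* 4                  ≡⟨ ℕₚ.*-comm x 4 ⟩
          4 ℕ.* x                  ≡⟨ ℕₚ.*-assoc 2 2 x ⟩
          2 ℕ.* (2 ℕ.* x)          ∎)
      ...   | z , refl = divides z (trans (sym (ℕₚ.*-assoc 2 2 z)) (ℕₚ.*-comm 4 z))

    -- The sign (-1)^(m/d) differs from 1 only for odd m/d, and then 4 ∣ d and μ(d) = 0. So q = -1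
    -- gives the same value as q = 1.
    evenDivisors-4∣ : 4 ∣ m → evenDivisors m (- 1ℚ) ≡ - η
    evenDivisors-4∣ 4∣m = trans (even-terms (λ d d∣m e → cases d d∣m e (odd? (m ÷ d)) refl)) evenDivisors-one
      where
      cases : ∀ d .{{_ : NonZero d}} → d ∣ m → odd? d ≡ false → ∀ p → odd? (m ÷ d) ≡ p →
        μℚ d * pow (- 1ℚ) (m ÷ d) ≡ μℚ d * pow 1ℚ (m ÷ d)
      cases d d∣m e false o = cong (μℚ d *_) (trans (pow-minus-even (m ÷ d) o) (sym (pow-one (m ÷ d))))
      cases d d∣m e true o = trans (cong (_* pow (- 1ℚ) (m ÷ d)) μ0)
          (trans (lem (pow (- 1ℚ) (m ÷ d)) (pow 1ℚ (m ÷ d))) (cong (_* pow 1ℚ (m ÷ d)) (sym μ0)))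
        where
        lem : ∀ x y → 0ℚ * x ≡ 0ℚ * y
        lem = solve-∀ ℚ-ring
        4∣d : 4 ∣ d
        4∣d = odd-cofactor-4∣ (m ÷ d) d o e (subst (4 ∣_) (÷-* d d∣m) 4∣m)
        μ0 : μℚ d ≡ 0ℚ
        μ0 = μ-4∣ d 4∣d

    -- Now m = 2h, every even divisor has an odd cofactor, and passing from q = 1 to q = -1 reverses
    -- the sign of every term.
    evenDivisors-2∥ : k ≡ 0 → evenDivisors m (- 1ℚ) ≡ η
    evenDivisors-2∥ refl = begin
      evenDivisors m (- 1ℚ)
        ≡⟨ even-terms {y = λ d → - 1ℚ * pow 1ℚ (m ÷ d)} term ⟩
      ∑-divisors m (λ d → ⟦ not (odd? d) ⟧ * (μℚ d * (- 1ℚ * pow 1ℚ (m ÷ d))))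
        ≡⟨ ∑-cong (upTo m) (λ j → pull ⟦ ⌊ suc j ∣? m ⌋ ⟧ ⟦ not (odd? (suc j)) ⟧ (μℚ (suc j)) (pow 1ℚ (m ÷ suc j))) ⟩
      ∑ (upTo m) (λ j → - (⟦ ⌊ suc j ∣? m ⌋ ⟧ * (⟦ not (odd? (suc j)) ⟧ * (μℚ (suc j) * pow 1ℚ (m ÷ suc j)))))
        ≡⟨ ∑-neg (upTo m) (λ j → ⟦ ⌊ suc j ∣? m ⌋ ⟧ * (⟦ not (odd? (suc j)) ⟧ * (μℚ (suc j) * pow 1ℚ (m ÷ suc j)))) ⟩
      - evenDivisors m 1ℚ
        ≡⟨ cong -_ evenDivisors-one ⟩
      - (- η)
        ≡⟨ double-neg η ⟩
      η ∎
      where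
      pull : ∀ a b c p → a * (b * (c * (- 1ℚ * p))) ≡ - (a * (b * (c * p)))
      pull = solve-∀ ℚ-ring
      double-neg : ∀ x → - (- x) ≡ x
      double-neg = solve-∀ ℚ-ring
      cofactor-odd : ∀ q d → odd? d ≡ false → q ℕ.* d ≡ 2 ℕ.* h → odd? q ≡ true
      cofactor-odd q d d-even eq with halve d d-even
      ... | d′ , refl = left (odd? q) (odd? d′) (trans (sym (odd-* q d′)) (trans (cong odd? q*d′) h-odd))
        where
        left : ∀ p q → p ∧ q ≡ true → p ≡ true
        left true q e = refl
        q*d′ : q ℕ.* d′ ≡ h
        q*d′ = ℕₚ.*-cancelˡ-≡ (q ℕ.* d′) h 2 (begin
          2 ℕ.* (q ℕ.* d′)         ≡⟨ ℕₚ.*-assoc 2 q d′ ⟨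
          2 ℕ.* q ℕ.* d′           ≡⟨ cong (ℕ._* d′) (ℕₚ.*-comm 2 q) ⟩
          q ℕ.* 2 ℕ.* d′           ≡⟨ ℕₚ.*-assoc q 2 d′ ⟩
          q ℕ.* (2 ℕ.* d′)         ≡⟨ eq ⟩
          2 ℕ.* h                  ∎)
      term : ∀ d .{{_ : NonZero d}} → d ∣ m → odd? d ≡ false → μℚ d * pow (- 1ℚ) (m ÷ d) ≡ μℚ d * (- 1ℚ * pow 1ℚ (m ÷ d))
      term d d∣m e = cong (μℚ d *_) (trans (trans (pow-minus-one (m ÷ d)) (sgn-odd (m ÷ d)
          (cofactor-odd (m ÷ d) d e (trans (sym (÷-* d d∣m)) (trans m-half (cong (2 ℕ.*_) (ℕₚ.*-identityˡ h)))))))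
        (cong (- 1ℚ *_) (sym (pow-one (m ÷ d)))))

    -- ρ m is a sign, so its 2r-th power can be inserted. One half combines with the count to ρ (m
    -- r); the other is absorbed by `umbralSeries-power`.
    power-count : ∀ d κ c c′ G r → ρ (m ℕ.* r) * signedCount d m r ≡ Operator.umbralSeries m κ c (rawMoment 0) r →
      κ - ℕ→ℚ m * c ≡ ρ m * c′ → (∀ (f : ℕ → ℚ) n → act G f n ≡ oddDivisors m (λ e → f (n ℕ.+ e)) + c′ * f n) →
      signedCount d m r ≡ (umbralPower (scaleₚ (recip (2 ℕ.* m)) G) ⋆ (λ n → pow (ρ m) n * expS recip c n)) r
    power-count d κ c c′ G r count const acts = begin
      C
        ≡⟨ *-identityˡ C ⟨
      1ℚ * C
        ≡⟨ cong (_* C) (trans (sym (pow-one r)) (trans (cong (λ x → pow x r) (sym (ρ-square m m-even))) (pow-* (ρ m) (ρ m) r))) ⟩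
      pow (ρ m) r * pow (ρ m) r * C
        ≡⟨ *-assoc (pow (ρ m) r) (pow (ρ m) r) C ⟩
      pow (ρ m) r * (pow (ρ m) r * C)
        ≡⟨ cong (λ x → pow (ρ m) r * (x * C)) (trans (sym (ρ-* r m m-even)) (cong ρ (ℕₚ.*-comm r m))) ⟩
      pow (ρ m) r * (ρ (m ℕ.* r) * C)
        ≡⟨ cong (pow (ρ m) r *_) count ⟩
      pow (ρ m) r * Operator.umbralSeries m κ c (rawMoment 0) r
        ≡⟨ umbralSeries-power m κ c (ρ m) (ρ-sign m m-even) (scaleₚ (recip (2 ℕ.* m)) G) (operator-acts κ c c′ G const acts) r ⟩
      (umbralPower (scaleₚ (recip (2 ℕ.* m)) G) ⋆ (λ n → pow (ρ m) n * expS recip c n)) r ∎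
      where
      C = signedCount d m r

    power-count₀ : ∀ d κ c c′ G r → ρ (m ℕ.* r) * signedCount d m r ≡ Operator.umbralSeries m κ c (rawMoment 0) r →
      c ≡ 0ℚ → κ ≡ ρ m * c′ → (∀ (f : ℕ → ℚ) n → act G f n ≡ oddDivisors m (λ e → f (n ℕ.+ e)) + c′ * f n) →
      signedCount d m r ≡ umbralPower (scaleₚ (recip (2 ℕ.* m)) G) r
    power-count₀ d κ .0ℚ c′ G r count refl const acts = trans
      (power-count d κ 0ℚ c′ G r count (trans (lem₁ κ (ℕ→ℚ m)) const) acts)
      (trans (⋆-congʳ (umbralPower (scaleₚ (recip (2 ℕ.* m)) G)) r trivial) (⋆-identityʳ (umbralPower (scaleₚ (recip (2 ℕ.* m)) G)) r))
      where
      lem₁ : ∀ x y → x - y * 0ℚ ≡ x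
      lem₁ = solve-∀ ℚ-ring
      lem₂ : ∀ x y z → x * (0ℚ * y) * z ≡ 0ℚ
      lem₂ = solve-∀ ℚ-ring
      lem₃ : ∀ x → 1ℚ * 1ℚ * x + 0ℚ ≡ x
      lem₃ = solve-∀ ℚ-ring
      expS-zero : ∀ n → expS recip 0ℚ n ≡ oneS n
      expS-zero n = trans (∑<-suc n (λ j → expCoeff j 0ℚ * powS recip j n)) (trans
        (cong (1ℚ * 1ℚ * oneS n +_) (∑<-zero n (λ j _ → lem₂ (recip (suc j !)) (pow 0ℚ j) (powS recip (suc j) n)))) (lem₃ (oneS n)))
      trivial : ∀ n → pow (ρ m) n * expS recip 0ℚ n ≡ oneS n
      trivial n = trans (cong (pow (ρ m) n *_) (expS-zero n)) (unit n)
        where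
        unit : ∀ n → pow (ρ m) n * oneS n ≡ oneS n
        unit zero = refl
        unit (suc n) = *-zeroʳ (pow (ρ m) (suc n))

  -- The three cases.

  -- exp(-log(1-t)) = 1/(1-t), since both satisfy the same equation in `θ`.
  expS-recip-one : ∀ n → expS recip 1ℚ n ≡ 1ℚ
  expS-recip-one = θ-unique {λ k → 1ℚ * θ recip k} {expS recip 1ℚ} {λ _ → 1ℚ} refl (θ-expS {recip} refl 1ℚ) ones refl
    where
    ones : ∀ n → θ (λ _ → 1ℚ) n ≡ ((λ k → 1ℚ * θ recip k) ⋆ (λ _ → 1ℚ)) n
    ones n = trans (*-identityʳ (ℕ→ℚ n)) (sym (trans (∑<-suc n (λ k → 1ℚ * θ recip k * 1ℚ))
      (trans (cong (0ℚ +_) (trans (∑-cong (upTo n) (λ k → trans (lem (θ recip (suc k))) (recip-inverse k)))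
        (trans (∑-one (upTo n)) (cong ℕ→ℚ (length-upTo n))))) (+-identityˡ (ℕ→ℚ n)))))
      where
      lem : ∀ x → 1ℚ * x * 1ℚ ≡ x
      lem = solve-∀ ℚ-ring

  inverse-onePlusT : ∀ n → invSeries1 onePlusT n ≡ sgn n
  inverse-onePlusT zero = refl
  inverse-onePlusT (suc n) = trans (invSeries1-suc onePlusT n) (cong -_ (trans
    (⋆-congˡ (invSeries1 onePlusT) n tail) (trans (⋆-identityˡ (invSeries1 onePlusT) n) (inverse-onePlusT n))))
    where
    tail : ∀ k → onePlusT (suc k) ≡ oneS k
    tail zero = refl
    tail (suc k) = refl

  %2⇒odd : ∀ h → h ℕ.% 2 ≡ 1 → odd? h ≡ true
  %2⇒odd h e = trans (cong odd? (trans (m≡m%n+[m/n]*n h 2) (cong (ℕ._+ h ℕ./ 2 ℕ.* 2) e)))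
    (trans (odd-suc (h ℕ./ 2 ℕ.* 2)) (cong not (trans (cong odd? (ℕₚ.*-comm (h ℕ./ 2) 2)) (odd-double (h ℕ./ 2)))))

  -- The divisors of h are the odd divisors of m, and the constant term of the exponent is 0.
  act-gA : ∀ m h k .{{_ : NonZero m}} .{{_ : NonZero h}} → m ≡ 2 ^ suc k ℕ.* h → odd? h ≡ true → ∀ (f : ℕ → ℚ) n →
    act (sumₚ (map (λ e → if ⌊ suc e ∣? h ⌋ then scaleₚ (ℤ→ℚ (μ (suc e))) (Epow (m ℕ./ suc e)) else []) (upTo h))) f n
      ≡ oddDivisors m (λ e → f (n ℕ.+ e)) + 0ℚ * f n
  act-gA m h k m≡ h-odd f n = begin
    act (sumₚ (map poly (upTo h))) f n
      ≡⟨ act-sumₚ poly (upTo h) f n ⟩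
    ∑ (upTo h) (λ e → act (poly e) f n)
      ≡⟨ ∑-cong (upTo h) (λ e → trans (choose ⌊ suc e ∣? h ⌋ (scaleₚ (ℤ→ℚ (μ (suc e))) (Epow (m ℕ./ suc e))))
           (cong (⟦ ⌊ suc e ∣? h ⌋ ⟧ *_) (trans (act-scaleₚ (μℚ (suc e)) (Epow (m ℕ./ suc e)) f n) (cong (μℚ (suc e) *_) (act-Epow (m ℕ./ suc e) f n))))) ⟩
    ∑-divisors h (λ d → μℚ d * f (n ℕ.+ m ÷ d))
      ≡⟨ oddDivisors-h m h k m≡ h-odd (λ e → f (n ℕ.+ e)) ⟨
    oddDivisors m (λ e → f (n ℕ.+ e))
      ≡⟨ lem (oddDivisors m (λ e → f (n ℕ.+ e))) (f n) ⟩
    oddDivisors m (λ e → f (n ℕ.+ e)) + 0ℚ * f n ∎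
    where
    poly : ℕ → Poly
    poly e = if ⌊ suc e ∣? h ⌋ then scaleₚ (ℤ→ℚ (μ (suc e))) (Epow (m ℕ./ suc e)) else []
    choose : ∀ b p → act (if b then p else []) f n ≡ ⟦ b ⟧ * act p f n
    choose true p = sym (*-identityˡ (act p f n))
    choose false p = sym (*-zeroˡ (act p f n))
    lem : ∀ x y → x ≡ x + 0ℚ * y
    lem = solve-∀ ℚ-ring

  act-gB : ∀ m k .{{_ : NonZero m}} → m ≡ 2 ^ suc k ℕ.* 1 → ∀ c (f : ℕ → ℚ) n →
    act (Epow m +ₚ constₚ c) f n ≡ oddDivisors m (λ e → f (n ℕ.+ e)) + c * f n
  act-gB m k m≡ c f n = trans (act-+ₚ (Epow m) (constₚ c) f n) (cong₂ _+_
    (trans (act-Epow m f n) (sym (trans (oddDivisors-h m 1 k m≡ refl (λ e → f (n ℕ.+ e)))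
      (trans (lem (f (n ℕ.+ m ℕ./ 1))) (cong (λ e → f (n ℕ.+ e)) (n/1≡n m)))))) (act-constₚ c f n))
    where
    lem : ∀ x → 1ℚ * (1ℚ * x) + 0ℚ ≡ x
    lem = solve-∀ ℚ-ring

  module _ (m h k : ℕ) .{{m≢0 : NonZero m}} .{{h≢0 : NonZero h}} (m≡ : m ≡ 2 ^ suc k ℕ.* h) (h-odd : odd? h ≡ true) (r : ℕ) where

    private
      N-even : evenℚ (m ℕ.* r) ≡ 1ℚ
      N-even = even-evenℚ (m ℕ.* r) (trans (odd-* m r) (cong (_∧ odd? r) (m-even m h k m≡ h-odd)))

    alternating : ρ (m ℕ.* r) * signedCount true m r ≡ Operator.umbralSeries m (- η m h k m≡ h-odd) 0ℚ (rawMoment 0) r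
    alternating = trans (descending-start m r N-even) (cong₂ (λ κ c → Operator.umbralSeries m κ c (rawMoment 0) r)
      (evenDivisors-one m h k m≡ h-odd) (necklaces-one m h k m≡ h-odd))

    reverseAlternating : ∀ κ → evenDivisors m (- 1ℚ) ≡ κ →
      ρ (m ℕ.* r) * signedCount false m r ≡ Operator.umbralSeries m κ (recip m * (η m h k m≡ h-odd + κ)) (rawMoment 0) r
    reverseAlternating κ e = trans (ascending-start m r) (cong₂ (λ κ c → Operator.umbralSeries m κ c (rawMoment 0) r)
      e (trans (necklaces-minus-one m h k m≡ h-odd) (cong (λ x → recip m * (η m h k m≡ h-odd + x)) e)))

  4∣2^ : ∀ k h → 4 ∣ 2 ^ suc (suc k) ℕ.* h
  4∣2^ k h = ∣m⇒∣m*n h (divides (2 ^ k) (trans (sym (ℕₚ.*-assoc 2 2 (2 ^ k))) (ℕₚ.*-comm 4 (2 ^ k))))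

  case-a : ∀ k h → 1 ℕ.≤ k → 3 ℕ.≤ h → h ℕ.% 2 ≡ 1 → ∀ r →
    (ℕ→ℚ (b (2 ^ k ℕ.* h) r) ≡ umbralPower (gA (2 ^ k ℕ.* h) h) r) × (ℕ→ℚ (b* (2 ^ k ℕ.* h) r) ≡ umbralPower (gA (2 ^ k ℕ.* h) h) r)
  case-a (suc k) h@(suc (suc _)) _ (s≤s (s≤s _)) h%2 r =
    trans (count-signedCount true m r) (power-count₀ m h k refl h-odd true 0ℚ 0ℚ 0ℚ G r
      (trans (alternating m h k refl h-odd r) (cong (λ x → Operator.umbralSeries m (- x) 0ℚ (rawMoment 0) r) η≡0))
      refl (sym (*-zeroʳ (ρ m))) acts) ,
    trans (count-signedCount false m r) (power-count₀ m h k refl h-odd false 0ℚ 0ℚ 0ℚ G r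
      (trans (reverseAlternating m h k refl h-odd r 0ℚ (κ≡0 k)) (cong (λ x → Operator.umbralSeries m 0ℚ x (rawMoment 0) r)
        (trans (cong (λ x → recip m * (x + 0ℚ)) η≡0) (*-zeroʳ (recip m)))))
      refl (sym (*-zeroʳ (ρ m))) acts)
    where
    m = 2 ^ suc k ℕ.* h
    instance
      m≢0 : NonZero m
      m≢0 = ℕₚ.m*n≢0 (2 ^ suc k) h {{ℕₚ.m^n≢0 2 (suc k)}}
    h-odd = %2⇒odd h h%2
    G = sumₚ (map (λ e → if ⌊ suc e ∣? h ⌋ then scaleₚ (ℤ→ℚ (μ (suc e))) (Epow (m ℕ./ suc e)) else []) (upTo h))
    acts = act-gA m h k refl h-odd
    -- As h > 1 the Möbius sum vanishes, and with it κ, c and the constant term, for both kinds of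
    -- permutations.
    η≡0 : ∑-divisors h μℚ ≡ 0ℚ
    η≡0 = ∑-μ-nontrivial h
    κ≡0 : ∀ j → evenDivisors (2 ^ suc j ℕ.* h) {{ℕₚ.m*n≢0 (2 ^ suc j) h {{ℕₚ.m^n≢0 2 (suc j)}}}} (- 1ℚ) ≡ 0ℚ
    κ≡0 zero = trans (evenDivisors-2∥ (2 ^ 1 ℕ.* h) h 0 refl h-odd refl) η≡0
    κ≡0 (suc j) = trans (evenDivisors-4∣ (2 ^ suc (suc j) ℕ.* h) h (suc j) {{ℕₚ.m*n≢0 (2 ^ suc (suc j)) h {{ℕₚ.m^n≢0 2 (suc (suc j))}}}} refl h-odd (4∣2^ j h)) (cong -_ η≡0)

  case-b : ∀ k → 2 ℕ.≤ k → ∀ r →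
    (ℕ→ℚ (b (2 ^ k) r) ≡ umbralPower (gB (2 ^ k)) r) × (ℕ→ℚ (b* (2 ^ k) r) ≡ umbralPower (gB (2 ^ k)) r)
  case-b (suc (suc k)) (s≤s (s≤s _)) r =
    trans (count-signedCount true m r) (power-count₀ m 1 (suc k) m≡ refl true (- 1ℚ) 0ℚ (- 1ℚ) G r
      (alternating m 1 (suc k) m≡ refl r) refl const acts) ,
    -- Here η = 1 and κ = -1, so the continued necklace count is (1 - 1)/m, written `recip m * 0ℚ`.
    trans (count-signedCount false m r) (power-count₀ m 1 (suc k) m≡ refl false (- 1ℚ) (recip m * 0ℚ) (- 1ℚ) G r
      (reverseAlternating m 1 (suc k) m≡ refl r (- 1ℚ) (evenDivisors-4∣ m 1 (suc k) m≡ refl (subst (4 ∣_) (sym m≡) (4∣2^ k 1))))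
      (*-zeroʳ (recip m)) const acts)
    where
    m = 2 ^ suc (suc k)
    instance
      m≢0 : NonZero m
      m≢0 = ℕₚ.m^n≢0 2 (suc (suc k))
    m≡ : m ≡ 2 ^ suc (suc k) ℕ.* 1
    m≡ = sym (ℕₚ.*-identityʳ m)
    G = Epow m +ₚ constₚ (- 1ℚ)
    acts = act-gB m (suc k) m≡ (- 1ℚ)
    ρm : ρ m ≡ 1ℚ
    ρm = trans (cong ρ (trans (sym (ℕₚ.*-assoc 2 2 (2 ^ k))) (ℕₚ.*-comm 4 (2 ^ k)))) (trans (ρ-* (2 ^ k) 4 refl) (pow-one (2 ^ k)))
    const : - 1ℚ ≡ ρ m * - 1ℚ
    const = cong (_* - 1ℚ) (sym ρm)

  case-c : ∀ r → (ℕ→ℚ (b 2 r) ≡ umbralPower gC r) × (ℕ→ℚ (b* 2 r) ≡ (umbralPower gC ⋆ invSeries1 onePlusT) r)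
  case-c r =
    -- κ = -1 as for the higher powers of two, but ρ 2 = -1 whereas ρ m = 1 for 4 ∣ m: hence E² + 1
    -- in place of a constant -1.
    trans (count-signedCount true 2 r) (power-count₀ 2 1 0 refl refl true (- 1ℚ) 0ℚ 1ℚ G r
      (alternating 2 1 0 refl refl r) refl refl acts) ,
    -- Here κ = 1 and c = (1 + 1)/2 = 1, so κ - 2c = -1 = ρ 2 · 1 and the exponent is the same as
    -- before. The extra factor (1-t)^(-1) is taken at -t and becomes 1/(1+t).
    trans (count-signedCount false 2 r) (trans (power-count 2 1 0 refl refl false 1ℚ 1ℚ 1ℚ G r
      (reverseAlternating 2 1 0 refl refl r 1ℚ (evenDivisors-2∥ 2 1 0 refl refl refl)) refl acts)
      (⋆-congʳ (umbralPower gC) r (λ n → trans (cong₂ _*_ (pow-minus-one n) (expS-recip-one n))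
        (trans (*-identityʳ (sgn n)) (sym (inverse-onePlusT n))))))
    where
    G = Epow 2 +ₚ constₚ 1ℚ
    acts = act-gB 2 0 refl 1ℚ

open Evaluation using (case-a; case-b; case-c)
open import Defs
open import Data.Nat using (ℕ; _≤_; _^_; _*_; _%_)
open import Data.Product using (_×_; _,_)
open import Relation.Binary.PropositionalEquality using (_≡_)

theorem5p5 : ((k h : ℕ) → 1 ≤ k → 3 ≤ h → h % 2 ≡ 1 → (r : ℕ) →
    (ℕ→ℚ (b (2 ^ k * h) r) ≡ umbralPower (gA (2 ^ k * h) h) r)
    × (ℕ→ℚ (b* (2 ^ k * h) r) ≡ umbralPower (gA (2 ^ k * h) h) r))
    × ((k : ℕ) → 2 ≤ k → (r : ℕ) →
    (ℕ→ℚ (b (2 ^ k) r) ≡ umbralPower (gB (2 ^ k)) r)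
    × (ℕ→ℚ (b* (2 ^ k) r) ≡ umbralPower (gB (2 ^ k)) r))
    × ((r : ℕ) →
    (ℕ→ℚ (b 2 r) ≡ umbralPower gC r)
    × (ℕ→ℚ (b* 2 r) ≡ (umbralPower gC ⋆ invSeries1 onePlusT) r))
theorem5p5 = case-a , case-b , case-c
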